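{- Let $\mathcal{C}$ be a class of functions from $\mathbb{R}^3$ to $\mathbb{R}$ that peacefully approximates the class of polytime computable integer functions, and such that every function in $\mathcal{C}$ has a polytime computable integer approximation. Then for every function $f:\mathbb{R}\to\mathbb{R}$ the following are equivalent: (1) $f$ is polytime computable; (2) there exists a positive integer $k$ such that (a) $f$ is $n^k$-$\mathcal{C}$-definable and (b) $f$ is $n^k$-smooth.
   Context: Dyadic numbers: $\mathbb{D}=\{a/2^b : a\in\mathbb{Z}, b\in\mathbb{N}\}$. For $x\in\mathbb{R}$, $CF_x$ is the set of functions $\varphi:\mathbb{N}\to\mathbb{D}$ with $|x-\varphi(n)|\le 2^{ -n}$ for all $n\in\mathbb{N}$. A function $f:\mathbb{R}\to\mathbb{R}$ is computable if there is an oracle Turing machine $M$ such that for all $x\in\mathbb{R}$, all $\varphi\in CF_x$ and all $n\in\mathbb{N}$, $|M^{\varphi}(n)-f(x)|\le 2^{ -n}$. It is polytime computable if moreover there is a polynomial $p$ such that the running time of $M^{\varphi}(n)$ is at most $p(k,n)$, where $k=\min\{j\in\mathbb{N} : x\in[-2^j,2^j]\}$. An integer function $h:\mathbb{Z}^d\to\mathbb{Z}$ is polytime computable if it is computable by a Turing machine in time polynomial in the lengths of the binary representations of its arguments. For $a,b\in\mathbb{R}$, $[a,b]$ denotes the closed interval with endpoints $a$ and $b$ in whichever order. A function $g:\mathbb{R}^3\to\mathbb{R}$ is peaceful if $g(x,y,z)\in[g(\lfloor x\rfloor,y,z),g(\lceil x\rceil,y,z)]$ for all $x\in\mathbb{R}$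 and all integers $y,z\ge 1$. A class $\mathcal{C}$ of functions $\mathbb{R}^3\to\mathbb{R}$ approximates a class $\mathcal{D}$ of functions $\mathbb{Z}^3\to\mathbb{Z}$ if for every $g\in\mathcal{D}$ there is $\tilde g\in\mathcal{C}$ with $|\tilde g(x,y,z)-g(x,y,z)|\le 1/4$ for all $x,y,z\in\mathbb{Z}$. $\mathcal{C}$ peacefully approximates $\mathcal{D}$ if the subclass of peaceful functions of $\mathcal{C}$ approximates $\mathcal{D}$. Here $\mathcal{D}$ is the class of polytime computable functions $\mathbb{Z}^3\to\mathbb{Z}$. A function $g:\mathbb{R}^d\to\mathbb{R}$ has a polytime computable integer approximation if there is a polytime computable $h:\mathbb{Z}^d\to\mathbb{Z}$ with $|h(\bar x)-g(\bar x)|\le 1$ for all $\bar x\in\mathbb{Z}^d$. For $T:\mathbb{N}\to\mathbb{N}$ and real $x\ge 1$, put $\#_T[x]=2^{T(\lfloor\log_2 x\rfloor)}$. The prefix $n^k$ stands for $T(n)=n^k$. $f$ is $T$-$\mathcal{C}$-definable if there is a peaceful function $g\in\mathcal{C}$ such that for all $x\in\mathbb{Z}$ and all integers $y,z\ge 1$ with $z>\frac{4|x|}{\#_T[yz]}$, $\left|g(x,y,z)-y f\!\left(\frac{x}{\#_T[yz]}\right)\right|\le 2$. $f$ is $T$-smooth if there is an integer $M$ such that for all $x_1,x_2\in\mathbb{R}$ and all real $y,z\ge 1$ with $z>\frac{4|x_1|}{\#_T[yz]}$: if $|x_1-x_2|\le 1$ then $y\left|f\!\left(\frac{x_1}{\#_T[yz]}\right)-f\!\left(\frac{x_2}{\#_T[yz]}\right)\right|\le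 M$. -}

module Defs where

open import Data.Digit using (toDigits)
open import Data.Fin.Base using (Fin; zero; suc)
open import Data.Integer.Base as ℤ using (ℤ; +_; -[1+_])
open import Data.List.Base as List using (List; []; _∷_; _++_)
open import Data.Nat.Base as ℕ using (ℕ; zero; suc)
import Data.Nat.DivMod as ℕ
import Data.Nat.Properties as ℕ
open import Data.Product.Base using (∃-syntax; _×_; _,_; proj₁; proj₂)
open import Data.Rational.Base as ℚ using (ℚ; 0ℚ; 1ℚ; ½)
import Data.Rational.Properties as ℚ
open import Data.Rational.Solver using (module +-*-Solver)
open import Data.Sum.Base using (_⊎_; inj₁; inj₂)
open import Data.Unit.Base using (⊤)
open import Data.Vec.Base as Vec using (Vec; []; _∷_)
import Data.Vec.Relation.Binary.Equality.Setoid as VecSetoid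
open import Function.Base using (_∘_)
open import Function.Bundles using (Func; _⟨$⟩_)
open import Level using (Level; 0ℓ; _⊔_)
open import Relation.Binary.Bundles using (Setoid)
open import Relation.Binary.PropositionalEquality using (_≡_; refl; sym; trans; cong; cong₂; subst)
open import Relation.Binary.Structures using (IsEquivalence)
open import Relation.Unary using (Pred)

private variable
  ℓ ℓ′ : Level

private
  halve : ∀ ε → ½ ℚ.* ε ℚ.+ ½ ℚ.* ε ≡ ε
  halve ε = trans (sym (ℚ.*-distribʳ-+ ε ½ ½)) (ℚ.*-identityˡ ε)

  half-pos : ∀ {ε} → 0ℚ ℚ.< ε → 0ℚ ℚ.< ½ ℚ.* ε
  half-pos {ε} 0<ε =
    ℚ.positive⁻¹ (½ ℚ.* ε) {{ℚ.pos*pos⇒pos ½ ε {{ℚ.positive 0<ε}}}}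

  add-halves : ∀ {p q ε} → p ℚ.≤ ½ ℚ.* ε → q ℚ.≤ ½ ℚ.* ε → p ℚ.+ q ℚ.≤ ε
  add-halves {ε = ε} p≤ q≤ =
    ℚ.≤-trans (ℚ.+-mono-≤ p≤ q≤) (ℚ.≤-reflexive (halve ε))

  ∣p-q∣≡∣q-p∣ : ∀ p q → ℚ.∣ p ℚ.- q ∣ ≡ ℚ.∣ q ℚ.- p ∣
  ∣p-q∣≡∣q-p∣ p q = trans
    (cong ℚ.∣_∣ (solve 2 (λ a b → a :- b := :- (b :- a)) refl p q))
    (ℚ.∣-p∣≡∣p∣ (q ℚ.- p))
    where open +-*-Solver

  triangle : ∀ p q r → ℚ.∣ p ℚ.- r ∣ ℚ.≤ ℚ.∣ p ℚ.- q ∣ ℚ.+ ℚ.∣ q ℚ.- r ∣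
  triangle p q r = subst (λ s → ℚ.∣ s ∣ ℚ.≤ ℚ.∣ p ℚ.- q ∣ ℚ.+ ℚ.∣ q ℚ.- r ∣)
    (solve 3 (λ a b c → (a :- b) :+ (b :- c) := a :- c) refl p q r)
    (ℚ.∣p+q∣≤∣p∣+∣q∣ (p ℚ.- q) (q ℚ.- r))
    where open +-*-Solver

  ∣p∣≤∣q∣+∣p-q∣ : ∀ p q → ℚ.∣ p ∣ ℚ.≤ ℚ.∣ q ∣ ℚ.+ ℚ.∣ p ℚ.- q ∣
  ∣p∣≤∣q∣+∣p-q∣ p q = subst (λ s → ℚ.∣ s ∣ ℚ.≤ ℚ.∣ q ∣ ℚ.+ ℚ.∣ p ℚ.- q ∣)
    (solve 2 (λ a b → b :+ (a :- b) := a) refl p q)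
    (ℚ.∣p+q∣≤∣p∣+∣q∣ q (p ℚ.- q))
    where open +-*-Solver

  ∣p∣-∣q∣≤∣p-q∣ : ∀ p q → ℚ.∣ p ∣ ℚ.- ℚ.∣ q ∣ ℚ.≤ ℚ.∣ p ℚ.- q ∣
  ∣p∣-∣q∣≤∣p-q∣ p q = ℚ.≤-trans
    (ℚ.+-monoˡ-≤ (ℚ.- ℚ.∣ q ∣) (∣p∣≤∣q∣+∣p-q∣ p q))
    (ℚ.≤-reflexive (solve 2 (λ a b → (a :+ b) :- a := b) refl ℚ.∣ q ∣ ℚ.∣ p ℚ.- q ∣))
    where open +-*-Solver

  ∣∣p∣-∣q∣∣≤∣p-q∣ : ∀ p q → ℚ.∣ ℚ.∣ p ∣ ℚ.- ℚ.∣ q ∣ ∣ ℚ.≤ ℚ.∣ p ℚ.- q ∣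
  ∣∣p∣-∣q∣∣≤∣p-q∣ p q with ℚ.∣p∣≡p∨∣p∣≡-p (ℚ.∣ p ∣ ℚ.- ℚ.∣ q ∣)
  ... | inj₁ eq = ℚ.≤-trans (ℚ.≤-reflexive eq) (∣p∣-∣q∣≤∣p-q∣ p q)
  ... | inj₂ eq = ℚ.≤-trans
    (ℚ.≤-reflexive (trans eq
      (solve 2 (λ a b → :- (a :- b) := b :- a) refl ℚ.∣ p ∣ ℚ.∣ q ∣)))
    (ℚ.≤-trans (∣p∣-∣q∣≤∣p-q∣ q p) (ℚ.≤-reflexive (∣p-q∣≡∣q-p∣ q p)))
    where open +-*-Solver

  scaled : ∀ {K ε} → 0ℚ ℚ.< K → 0ℚ ℚ.< ε →
           ∃[ δ ] (0ℚ ℚ.< δ) × (∀ {p q} → 0ℚ ℚ.≤ q → p ℚ.≤ K → q ℚ.≤ δ → p ℚ.* q ℚ.≤ ε)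
  scaled {K} {ε} 0<K 0<ε = δ , ℚ.positive⁻¹ δ , bound
    where
    instance
      K⁺ : ℚ.Positive K
      K⁺ = ℚ.positive 0<K
      ε⁺ : ℚ.Positive ε
      ε⁺ = ℚ.positive 0<ε
      K≢0 : ℚ.NonZero K
      K≢0 = ℚ.pos⇒nonZero K
      1/K⁺ : ℚ.Positive (ℚ.1/ K)
      1/K⁺ = ℚ.1/pos⇒pos K
      K⁰ : ℚ.NonNegative K
      K⁰ = ℚ.pos⇒nonNeg K
    δ : ℚ
    δ = ℚ.1/ K ℚ.* ε
    instance
      δ⁺ : ℚ.Positive δ
      δ⁺ = ℚ.pos*pos⇒pos (ℚ.1/ K) ε
    Kδ≡ε : K ℚ.* δ ≡ ε
    Kδ≡ε = trans (sym (ℚ.*-assoc K (ℚ.1/ K) ε))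
      (trans (cong (ℚ._* ε) (ℚ.*-inverseʳ K)) (ℚ.*-identityˡ ε))
    bound : ∀ {p q} → 0ℚ ℚ.≤ q → p ℚ.≤ K → q ℚ.≤ δ → p ℚ.* q ℚ.≤ ε
    bound {p} {q} 0≤q p≤K q≤δ = ℚ.≤-trans
      (ℚ.*-monoʳ-≤-nonNeg q {{ℚ.nonNegative 0≤q}} p≤K)
      (ℚ.≤-trans (ℚ.*-monoˡ-≤-nonNeg K q≤δ) (ℚ.≤-reflexive Kδ≡ε))

-- A real number is a Cauchy sequence of rationals up to _≃_, and a
-- function on the reals is a setoid function.
record ℝ : Set where
  constructor mkℝ
  field
    seq    : ℕ → ℚ
    cauchy : ∀ ε → 0ℚ ℚ.< ε →
             ∃[ N ] ∀ m n → N ℕ.≤ m → N ℕ.≤ n → ℚ.∣ seq m ℚ.- seq n ∣ ℚ.≤ ε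

open ℝ public

infix  4 _≃_ _≤_ _<_ _∈[_,_]
infixl 6 _+_ _-_
infixl 7 _*_

_≃_ : ℝ → ℝ → Set
x ≃ y = ∀ ε → 0ℚ ℚ.< ε →
        ∃[ N ] ∀ n → N ℕ.≤ n → ℚ.∣ seq x n ℚ.- seq y n ∣ ℚ.≤ ε

_≤_ : ℝ → ℝ → Set
x ≤ y = ∀ ε → 0ℚ ℚ.< ε → ∃[ N ] ∀ n → N ℕ.≤ n → seq x n ℚ.≤ seq y n ℚ.+ ε

_<_ : ℝ → ℝ → Set
x < y = ∃[ ε ] (0ℚ ℚ.< ε) × (∃[ N ] ∀ n → N ℕ.≤ n → seq x n ℚ.+ ε ℚ.≤ seq y n)

≃-isEquivalence : IsEquivalence _≃_
≃-isEquivalence = record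
  { refl  = λ {x} ε 0<ε → 0 , λ n _ → ℚ.≤-trans
      (ℚ.≤-reflexive (cong ℚ.∣_∣ (ℚ.+-inverseʳ (seq x n)))) (ℚ.<⇒≤ 0<ε)
  ; sym   = λ {x} {y} x≃y ε 0<ε → let (N , h) = x≃y ε 0<ε in
      N , λ n N≤n → ℚ.≤-trans (ℚ.≤-reflexive (∣p-q∣≡∣q-p∣ (seq y n) (seq x n))) (h n N≤n)
  ; trans = λ {x} {y} {z} x≃y y≃z ε 0<ε →
      let (N₁ , h₁) = x≃y (½ ℚ.* ε) (half-pos 0<ε)
          (N₂ , h₂) = y≃z (½ ℚ.* ε) (half-pos 0<ε)
      in N₁ ℕ.⊔ N₂ , λ n N≤n → ℚ.≤-trans (triangle (seq x n) (seq y n) (seq z n))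
           (add-halves (h₁ n (ℕ.m⊔n≤o⇒m≤o N₁ N₂ N≤n)) (h₂ n (ℕ.m⊔n≤o⇒n≤o N₁ N₂ N≤n)))
  }

ℝ-setoid : Setoid 0ℓ 0ℓ
ℝ-setoid = record { isEquivalence = ≃-isEquivalence }

fromℚ : ℚ → ℝ
fromℚ q = mkℝ (λ _ → q) λ ε 0<ε → 0 , λ _ _ _ _ →
  ℚ.≤-trans (ℚ.≤-reflexive (cong ℚ.∣_∣ (ℚ.+-inverseʳ q))) (ℚ.<⇒≤ 0<ε)

fromℤ : ℤ → ℝ
fromℤ i = fromℚ (i ℚ./ 1)

_+_ : ℝ → ℝ → ℝ
x + y = mkℝ (λ n → seq x n ℚ.+ seq y n) λ ε 0<ε →
  let (N₁ , h₁) = cauchy x (½ ℚ.* ε) (half-pos 0<ε)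
      (N₂ , h₂) = cauchy y (½ ℚ.* ε) (half-pos 0<ε)
  in N₁ ℕ.⊔ N₂ , λ m n N≤m N≤n → ℚ.≤-trans
       (split (seq x m) (seq x n) (seq y m) (seq y n))
       (add-halves (h₁ m n (ℕ.m⊔n≤o⇒m≤o N₁ N₂ N≤m) (ℕ.m⊔n≤o⇒m≤o N₁ N₂ N≤n))
                   (h₂ m n (ℕ.m⊔n≤o⇒n≤o N₁ N₂ N≤m) (ℕ.m⊔n≤o⇒n≤o N₁ N₂ N≤n)))
  where
  open +-*-Solver
  split : ∀ a b c d → ℚ.∣ (a ℚ.+ c) ℚ.- (b ℚ.+ d) ∣ ℚ.≤ ℚ.∣ a ℚ.- b ∣ ℚ.+ ℚ.∣ c ℚ.- d ∣
  split a b c d = subst (λ s → ℚ.∣ s ∣ ℚ.≤ ℚ.∣ a ℚ.- b ∣ ℚ.+ ℚ.∣ c ℚ.- d ∣)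
    (solve 4 (λ a b c d → (a :- b) :+ (c :- d) := (a :+ c) :- (b :+ d)) refl a b c d)
    (ℚ.∣p+q∣≤∣p∣+∣q∣ (a ℚ.- b) (c ℚ.- d))

-_ : ℝ → ℝ
- x = mkℝ (λ n → ℚ.- seq x n) λ ε 0<ε →
  let (N , h) = cauchy x ε 0<ε
  in N , λ m n N≤m N≤n → ℚ.≤-trans
       (ℚ.≤-reflexive (trans
         (cong ℚ.∣_∣ (solve 2 (λ a b → (:- a) :- (:- b) := b :- a) refl (seq x m) (seq x n)))
         (∣p-q∣≡∣q-p∣ (seq x n) (seq x m))))
       (h m n N≤m N≤n)
  where open +-*-Solver

_-_ : ℝ → ℝ → ℝ
x - y = x + (- y)

∣_∣ : ℝ → ℝ
∣ x ∣ = mkℝ (λ n → ℚ.∣ seq x n ∣) λ ε 0<ε →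
  let (N , h) = cauchy x ε 0<ε
  in N , λ m n N≤m N≤n → ℚ.≤-trans (∣∣p∣-∣q∣∣≤∣p-q∣ (seq x m) (seq x n)) (h m n N≤m N≤n)

private
  eventually-bounded : ∀ x → ∃[ K ] (0ℚ ℚ.< K) × (∃[ N ] ∀ n → N ℕ.≤ n → ℚ.∣ seq x n ∣ ℚ.≤ K)
  eventually-bounded x =
    let (N , h) = cauchy x 1ℚ (ℚ.positive⁻¹ 1ℚ)
    in ℚ.∣ seq x N ∣ ℚ.+ 1ℚ
     , ℚ.+-mono-≤-< (ℚ.0≤∣p∣ (seq x N)) (ℚ.positive⁻¹ 1ℚ)
     , N
     , λ n N≤n → ℚ.≤-trans (∣p∣≤∣q∣+∣p-q∣ (seq x n) (seq x N))
         (ℚ.+-monoʳ-≤ ℚ.∣ seq x N ∣ (h n N N≤n ℕ.≤-refl))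

_*_ : ℝ → ℝ → ℝ
x * y = mkℝ (λ n → seq x n ℚ.* seq y n) λ ε 0<ε →
  let (K , 0<K , N₁ , h₁) = eventually-bounded x
      (L , 0<L , N₂ , h₂) = eventually-bounded y
      (δ , 0<δ , small₁)  = scaled 0<K (half-pos 0<ε)
      (η , 0<η , small₂)  = scaled 0<L (half-pos 0<ε)
      (N₃ , h₃) = cauchy y δ 0<δ
      (N₄ , h₄) = cauchy x η 0<η
      N₁₂ = N₁ ℕ.⊔ N₂
      N₃₄ = N₃ ℕ.⊔ N₄
      ≤₁₂ : ∀ {n} → N₁₂ ℕ.⊔ N₃₄ ℕ.≤ n → N₁₂ ℕ.≤ n
      ≤₁₂ = ℕ.m⊔n≤o⇒m≤o N₁₂ N₃₄
      ≤₃₄ : ∀ {n} → N₁₂ ℕ.⊔ N₃₄ ℕ.≤ n → N₃₄ ℕ.≤ n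
      ≤₃₄ = ℕ.m⊔n≤o⇒n≤o N₁₂ N₃₄
  in N₁₂ ℕ.⊔ N₃₄ , λ m n N≤m N≤n → ℚ.≤-trans
       (split (seq x m) (seq x n) (seq y m) (seq y n))
       (add-halves
         (small₁ (ℚ.0≤∣p∣ (seq y m ℚ.- seq y n))
           (h₁ m (ℕ.m⊔n≤o⇒m≤o N₁ N₂ (≤₁₂ N≤m)))
           (h₃ m n (ℕ.m⊔n≤o⇒m≤o N₃ N₄ (≤₃₄ N≤m)) (ℕ.m⊔n≤o⇒m≤o N₃ N₄ (≤₃₄ N≤n))))
         (small₂ (ℚ.0≤∣p∣ (seq x m ℚ.- seq x n))
           (h₂ n (ℕ.m⊔n≤o⇒n≤o N₁ N₂ (≤₁₂ N≤n)))
           (h₄ m n (ℕ.m⊔n≤o⇒n≤o N₃ N₄ (≤₃₄ N≤m)) (ℕ.m⊔n≤o⇒n≤o N₃ N₄ (≤₃₄ N≤n)))))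
  where
  open +-*-Solver
  split : ∀ a b c d → ℚ.∣ a ℚ.* c ℚ.- b ℚ.* d ∣
            ℚ.≤ ℚ.∣ a ∣ ℚ.* ℚ.∣ c ℚ.- d ∣ ℚ.+ ℚ.∣ d ∣ ℚ.* ℚ.∣ a ℚ.- b ∣
  split a b c d = ℚ.≤-trans
    (ℚ.≤-reflexive (cong ℚ.∣_∣
      (solve 4 (λ a b c d → a :* c :- b :* d := a :* (c :- d) :+ d :* (a :- b)) refl a b c d)))
    (ℚ.≤-trans (ℚ.∣p+q∣≤∣p∣+∣q∣ (a ℚ.* (c ℚ.- d)) (d ℚ.* (a ℚ.- b)))
      (ℚ.≤-reflexive (cong₂ ℚ._+_ (ℚ.∣p*q∣≡∣p∣*∣q∣ a (c ℚ.- d)) (ℚ.∣p*q∣≡∣p∣*∣q∣ d (a ℚ.- b)))))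

½^_ : ℕ → ℚ
½^ zero    = 1ℚ
½^ (suc n) = ½ ℚ.* ½^ n

2^ 2^- : ℕ → ℝ
2^  n = fromℤ (+ (2 ℕ.^ n))
2^- n = fromℚ (½^ n)

_∈[_,_] : ℝ → ℝ → ℝ → Set
v ∈[ a , b ] = (a ≤ v × v ≤ b) ⊎ (b ≤ v × v ≤ a)

-- Floor, ceiling and integer logarithm cannot be computed from a Cauchy
-- sequence, so they are given by their graphs.
IsFloor IsCeiling : ℝ → ℤ → Set
IsFloor   x i = fromℤ i ≤ x × x < fromℤ (ℤ.suc i)
IsCeiling x i = fromℤ (ℤ.pred i) < x × x ≤ fromℤ i

-- m = ⌊log₂ x⌋, for real x ≥ 1
IsFloorLog₂ : ℝ → ℕ → Set
IsFloorLog₂ x m = 2^ m ≤ x × x < 2^ (suc m)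

-- k = min { j ∈ ℕ : x ∈ [-2^j , 2^j] }
IsMagnitude : ℝ → ℕ → Set
IsMagnitude x k = ∣ x ∣ ≤ 2^ k × (∀ j → ∣ x ∣ ≤ 2^ j → k ℕ.≤ j)

ℝ→ℝ : Set
ℝ→ℝ = Func ℝ-setoid ℝ-setoid

ℝ^_→ℝ : ℕ → Set
ℝ^ d →ℝ = Func (VecSetoid.≋-setoid ℝ-setoid d) ℝ-setoid

infix 7 _/2^_

record 𝔻 : Set where
  constructor _/2^_
  field
    num : ℤ
    exp : ℕ

from𝔻 : 𝔻 → ℝ
from𝔻 (a /2^ b) = fromℚ ((a ℚ./ 1) ℚ.* ½^ b)

CF : ℝ → Pred (ℕ → 𝔻) 0ℓ
CF x φ = ∀ n → ∣ x - from𝔻 (φ n) ∣ ≤ 2^- n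

data Glyph : Set where
  𝟎 𝟏 minus point comma : Glyph

unary : ℕ → List Glyph
unary n = List.replicate n 𝟏

-- Most significant digit first, without leading zeros (zero is "0").
binary : ℕ → List Glyph
binary n = List.map digit (List.reverse (proj₁ (toDigits 2 n)))
  where
  digit : Fin 2 → Glyph
  digit zero       = 𝟎
  digit (suc zero) = 𝟏

sign : ℤ → List Glyph
sign (+ _)    = []
sign -[1+ _ ] = minus ∷ []

wordℤ : ℤ → List Glyph
wordℤ i = sign i ++ binary ℤ.∣ i ∣

wordsℤ : ∀ {d} → Vec ℤ d → List Glyph
wordsℤ []       = []
wordsℤ (i ∷ is) = wordℤ i ++ comma ∷ wordsℤ is

dropTrailing𝟎 : List Glyph → List Glyph
dropTrailing𝟎 = List.reverse ∘ dropLeading𝟎 ∘ List.reverse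
  where
  dropLeading𝟎 : List Glyph → List Glyph
  dropLeading𝟎 (𝟎 ∷ w) = dropLeading𝟎 w
  dropLeading𝟎 w       = w

-- The finite binary expansion of a / 2^b in the form ±101.0011; the
-- fractional part has no trailing zeros, so the word depends only on the
-- number and not on the pair a, b.  Since the integer part comes first, a
-- machine can use a leading segment of an oracle answer, whose length is
-- not bounded in terms of the query.
word𝔻 : 𝔻 → List Glyph
word𝔻 (a /2^ b) =
  sign a ++ binary (shift b) ++ point ∷ dropTrailing𝟎 (List.applyDownFrom (bit ∘ shift) b)
  where
  shift : ℕ → ℕ
  shift i = (ℤ.∣ a ∣ ℕ./ (2 ℕ.^ i)) {{ℕ.m^n≢0 2 i}}
  bit : ℕ → Glyph
  bit n with n ℕ.% 2
  ... | zero  = 𝟎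
  ... | suc _ = 𝟏

data Kind : Set where
  plain oracle : Kind

data Move : Set where
  left stay right : Move

data Symbol (aux : ℕ) : Set where
  blank   : Symbol aux
  glyph   : Glyph → Symbol aux
  special : Fin aux → Symbol aux

data Instruction (aux states tapes : ℕ) : Kind → Set where
  halt  : ∀ {κ} → Instruction aux states tapes κ
  act   : ∀ {κ} → Fin states → Vec (Symbol aux × Move) tapes → Instruction aux states tapes κ
  query : Fin states → Instruction aux states tapes oracle

-- The first three tapes are the input, output and query tape.
record Machine (κ : Kind) : Set where
  field
    aux states work : ℕ
    start           : Fin states
    δ               : Fin states → Vec (Symbol aux) (3 ℕ.+ work) →
                      Instruction aux states (3 ℕ.+ work) κ

Oracle : Kind → Set
Oracle plain  = ⊤
Oracle oracle = ℕ → List Glyph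

-- A two-way infinite tape.  The cells to the left of the head are listed
-- from the head outwards; unlisted cells are blank.
record Tape (aux : ℕ) : Set where
  constructor tape
  field
    before : List (Symbol aux)
    head   : Symbol aux
    after  : List (Symbol aux)

module _ {aux : ℕ} where

  write : Symbol aux → Tape aux → Tape aux
  write s (tape ls _ rs) = tape ls s rs

  move : Move → Tape aux → Tape aux
  move left  (tape []       s rs)       = tape [] blank (s ∷ rs)
  move left  (tape (l ∷ ls) s rs)       = tape ls l (s ∷ rs)
  move stay  t                          = t
  move right (tape ls       s [])       = tape (s ∷ ls) blank []
  move right (tape ls       s (r ∷ rs)) = tape (s ∷ ls) r rs

  loaded : List Glyph → Tape aux
  loaded []      = tape [] blank []
  loaded (c ∷ w) = tape [] (glyph c) (List.map glyph w)

  glyphs : List (Symbol aux) → List Glyph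
  glyphs (glyph c ∷ ss) = c ∷ glyphs ss
  glyphs _              = []

  -- The word from the head rightwards to the first cell without a glyph.
  contents : Tape aux → List Glyph
  contents (tape _ s rs) = glyphs (s ∷ rs)

leading𝟏s : List Glyph → ℕ
leading𝟏s (𝟏 ∷ w) = suc (leading𝟏s w)
leading𝟏s _       = 0

module _ {κ : Kind} (M : Machine κ) (O : Oracle κ) where
  open Machine M

  record Config : Set where
    constructor config
    field
      state : Fin states
      tapes : Vec (Tape aux) (3 ℕ.+ work)

  initial : List Glyph → Config
  initial w = config start (loaded w ∷ Vec.replicate (2 ℕ.+ work) (loaded []))

  instruction : Config → Instruction aux states (3 ℕ.+ work) κ
  instruction (config q ts) = δ q (Vec.map Tape.head ts)

  -- A query 𝟏ᵐ on the query tape is replaced by the oracle's answer to m,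
  -- with the head on its first symbol, in a single step.
  execute : ∀ {κ′} → Oracle κ′ → Instruction aux states (3 ℕ.+ work) κ′ → Config → Config
  execute _ halt       c             = c
  execute _ (act q as) (config _ ts) =
    config q (Vec.zipWith (λ a t → move (proj₂ a) (write (proj₁ a) t)) as ts)
  execute A (query q)  (config _ (tᵢ ∷ tₒ ∷ t ∷ ts)) =
    config q (tᵢ ∷ tₒ ∷ loaded (A (leading𝟏s (contents t))) ∷ ts)

  run : ℕ → Config → Config
  run zero    c = c
  run (suc t) c = run t (execute O (instruction c) c)

  HaltsWithin : List Glyph → ℕ → Set
  HaltsWithin w t = instruction (run t (initial w)) ≡ halt

  output : Config → List Glyph
  output (config _ (_ ∷ tₒ ∷ _)) = contents tₒ

  Outputs : List Glyph → List Glyph → Set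
  Outputs w v = ∃[ t ] HaltsWithin w t × output (run t (initial w)) ≡ v

data Poly (d : ℕ) : Set where
  con       : ℕ → Poly d
  var       : Fin d → Poly d
  _:+_ _:*_ : Poly d → Poly d → Poly d

⟦_⟧ : ∀ {d} → Poly d → Vec ℕ d → ℕ
⟦ con c  ⟧ ρ = c
⟦ var i  ⟧ ρ = Vec.lookup ρ i
⟦ p :+ q ⟧ ρ = ⟦ p ⟧ ρ ℕ.+ ⟦ q ⟧ ρ
⟦ p :* q ⟧ ρ = ⟦ p ⟧ ρ ℕ.* ⟦ q ⟧ ρ

Computes : Machine oracle → ℝ→ℝ → Set
Computes M f = ∀ x φ → CF x φ → ∀ n →
  ∃[ d ] Outputs M (word𝔻 ∘ φ) (unary n) (word𝔻 d) × ∣ from𝔻 d - (f ⟨$⟩ x) ∣ ≤ 2^- n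

RunsInTime : Machine oracle → Poly 2 → Set
RunsInTime M p = ∀ x φ → CF x φ → ∀ n k → IsMagnitude x k →
  HaltsWithin M (word𝔻 ∘ φ) (unary n) (⟦ p ⟧ (k ∷ n ∷ []))

PolytimeComputable : ℝ→ℝ → Set
PolytimeComputable f = ∃[ M ] Computes M f × (∃[ p ] RunsInTime M p)

PolytimeComputableℤ : ∀ {d} → Pred (Vec ℤ d → ℤ) 0ℓ
PolytimeComputableℤ {d} h = ∃[ M ]
  (∀ is → Outputs {plain} M _ (wordsℤ is) (wordℤ (h is))) ×
  (∃[ p ] ∀ (is : Vec ℤ d) → HaltsWithin M _ (wordsℤ is) (⟦ p ⟧ (Vec.map (List.length ∘ wordℤ) is)))

Peaceful : Pred (ℝ^ 3 →ℝ) 0ℓ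
Peaceful g = ∀ x (y z : ℤ) → ℤ.1ℤ ℤ.≤ y → ℤ.1ℤ ℤ.≤ z →
  ∀ i j → IsFloor x i → IsCeiling x j →
  at x y z ∈[ at (fromℤ i) y z , at (fromℤ j) y z ]
  where
  at : ℝ → ℤ → ℤ → ℝ
  at x y z = g ⟨$⟩ (x ∷ fromℤ y ∷ fromℤ z ∷ [])

Approximates : Pred (ℝ^ 3 →ℝ) ℓ → Pred (Vec ℤ 3 → ℤ) ℓ′ → Set (ℓ ⊔ ℓ′)
Approximates C D = ∀ g → D g → ∃[ g̃ ] C g̃ ×
  (∀ is → ∣ (g̃ ⟨$⟩ Vec.map fromℤ is) - fromℤ (g is) ∣ ≤ fromℚ (+ 1 ℚ./ 4))

PeacefullyApproximates : Pred (ℝ^ 3 →ℝ) ℓ → Pred (Vec ℤ 3 → ℤ) ℓ′ → Set (ℓ ⊔ ℓ′)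
PeacefullyApproximates C D = Approximates (λ g → C g × Peaceful g) D

HasPolytimeIntegerApproximation : ∀ {d} → Pred (ℝ^ d →ℝ) 0ℓ
HasPolytimeIntegerApproximation g = ∃[ h ] PolytimeComputableℤ h ×
  (∀ is → ∣ fromℤ (h is) - (g ⟨$⟩ Vec.map fromℤ is) ∣ ≤ fromℤ (+ 1))

-- When m = ⌊log₂ x⌋ we have #_T[x] = 2^(T m), and dividing by #_T[x] is
-- multiplying by 2^- (T m).

Definable : (ℕ → ℕ) → Pred (ℝ^ 3 →ℝ) ℓ → ℝ→ℝ → Set ℓ
Definable T C f = ∃[ g ] C g × Peaceful g ×
  (∀ (x y z : ℤ) → ℤ.1ℤ ℤ.≤ y → ℤ.1ℤ ℤ.≤ z →
   ∀ m → IsFloorLog₂ (fromℤ y * fromℤ z) m →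
   fromℤ (+ 4) * ∣ fromℤ x ∣ * 2^- (T m) < fromℤ z →
   ∣ (g ⟨$⟩ (fromℤ x ∷ fromℤ y ∷ fromℤ z ∷ [])) - fromℤ y * (f ⟨$⟩ (fromℤ x * 2^- (T m))) ∣
     ≤ fromℤ (+ 2))

Smooth : (ℕ → ℕ) → ℝ→ℝ → Set
Smooth T f = ∃[ M ] ∀ x₁ x₂ y z → fromℤ (+ 1) ≤ y → fromℤ (+ 1) ≤ z →
  ∀ m → IsFloorLog₂ (y * z) m →
  fromℤ (+ 4) * ∣ x₁ ∣ * 2^- (T m) < z →
  ∣ x₁ - x₂ ∣ ≤ fromℤ (+ 1) →
  y * ∣ (f ⟨$⟩ (x₁ * 2^- (T m))) - (f ⟨$⟩ (x₂ * 2^- (T m))) ∣ ≤ fromℤ M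

{-# OPTIONS --safe #-}
-- (1) ⇒ (2).  Let M compute f in polynomial time.  The integer function
-- g(x, y, z) ≈ y f(x / 2^(m^k)), with m = ⌊log₂ yz⌋, is polytime: run M with the
-- constant oracle answering x / 2^(m^k) to every query, at a precision of the
-- length of the input, and multiply the result by y.  For smoothness, a run
-- of M sees only polynomially many digits of its oracle and asks only for
-- polynomial precision (every step lengthens the query tape by a bounded
-- amount), so for large k the runs at two points at distance 2^-(m^k) can be
-- given oracles that agree on everything the machine sees.  For m ≤ 1,
-- where m^k does not grow with k, f is bounded by the length of the output.
--
-- (2) ⇒ (1).  Ask for x to precision 1 to choose z = 2^a large enough, put
-- y = 2^b with b slightly larger than the required precision, ask for x to
-- precision (a + b)^k, truncate, and evaluate the integer approximation h of
-- g; the answer is h / y, and smoothness controls the error of truncation.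
--
-- The machines are programs over finitely many stacks, compiled to Turing
-- machines with one tape per stack.  A simulated machine keeps each tape on
-- two stacks and is run for as many steps as a unary clock (c + N)^e, an
-- upper bound for the given polynomial, has entries.
module Submission where

-- The time bound of `M` refers to the least j with |x| ≤ 2^j, which a Cauchy sequence does not
-- reveal. Any upper bound `B` can replace it: the polynomial is monotone, and halting within a
-- given time is decidable, so an argument by contradiction is enough.
--
-- Oracle words may be arbitrarily long, which would spoil the count of query lengths. The
-- continuity argument therefore picks its own oracle `sample`, with words of length j plus a
-- constant and half the permitted error; the spare half allows its answers for one point to serve
-- for a nearby one.
--
-- The side condition 4|x|/2^(m^k) < z, with z ≤ yz < 2^(m+1), bounds the argument of f by 2^m. So
-- magnitude, precision and query lengths are all polynomial in m, and a single exponent k exceeds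
-- them once m ≥ 2.
--
-- Running time is kept in the derivations themselves: a program comes with one derivation `Run` for
-- its intended store, whose cost is definitionally a polynomial in finitely many lengths, and those
-- lengths are then bounded one by one.

module Halting where

  open import Defs using (Kind; Oracle; Machine; initial; instruction; run; halt; HaltsWithin; Outputs; output)
  open import Data.Nat.Base
  open import Data.Nat.Properties
  open import Data.Product.Base using (_,_)
  open import Data.Sum.Base using (inj₁; inj₂)
  open import Relation.Binary.PropositionalEquality

  module _ {κ : Kind} (M : Machine κ) (O : Oracle κ) where

    run-+ : ∀ a b c → run M O (a + b) c ≡ run M O b (run M O a c)
    run-+ zero    b c = refl
    run-+ (suc a) b c = run-+ a b _

    -- `halt` is executed as the identity, so a halting configuration is a fixed point of `run` and
    -- every time bound may be enlarged.
    halted-run : ∀ t c → instruction M O c ≡ halt → run M O t c ≡ c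
    halted-run zero    c h = refl
    halted-run (suc t) c h rewrite h = halted-run t c h

    run-halted : ∀ {t u c} → t ≤ u → instruction M O (run M O t c) ≡ halt → run M O u c ≡ run M O t c
    run-halted {t} {u} {c} t≤u h = trans (cong (λ k → run M O k c) (sym (m+[n∸m]≡n t≤u)))
      (trans (run-+ t (u ∸ t) c) (halted-run (u ∸ t) (run M O t c) h))

    halts-later : ∀ {w t u} → t ≤ u → HaltsWithin M O w t → HaltsWithin M O w u
    halts-later t≤u h = trans (cong (instruction M O) (run-halted t≤u h)) h

    -- `Outputs` conceals its number of steps. Of two runs that have both halted, the longer one
    -- stays in the final configuration of the shorter, so the output can be read at the known bound
    -- `t`.
    halted-output : ∀ {w v t} → Outputs M O w v → HaltsWithin M O w t → output M O (run M O t (initial M O w)) ≡ v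
    halted-output {w} {v} {t} (u , h , e) h′ with ≤-total t u
    ... | inj₁ t≤u = trans (cong (output M O) (sym (run-halted t≤u h′))) e
    ... | inj₂ u≤t = trans (cong (output M O) (run-halted u≤t h)) e

-- Stack programs, their timed semantics, and their compilation to Turing machines.

module StackPrograms where

  open import Defs using (Kind; oracle; Oracle; Glyph; 𝟎; 𝟏; minus; point; comma; Move; left; stay; right; Symbol; blank; glyph; special; Instruction; halt; act; query; Machine; Tape; tape; write; move; loaded; glyphs; contents; leading𝟏s; Config; config; initial; instruction; execute; run; HaltsWithin; output; Outputs)
  open Halting
  open import Data.Bool.Base using (Bool; true; false; if_then_else_)
  open import Data.Empty using (⊥)
  open import Data.Fin.Base using (Fin; zero; suc)
  open import Data.Fin.Properties using (_≟_)
  open import Data.List.Base as List using (List; []; _∷_; _++_; length; drop)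
  open import Data.List.Membership.Propositional using (_∈_)
  open import Data.List.Membership.Propositional.Properties using (∈-++⁺ˡ; ∈-++⁺ʳ; ∈-map⁺; ∈-concatMap⁺; ∈-allFin)
  open import Data.List.Relation.Unary.Any using (here; there; index)
  import Data.List.Relation.Unary.Any as Any
  open import Data.List.Relation.Unary.Any.Properties using (lookup-index)
  open import Data.Maybe.Base as Maybe using (Maybe; just; nothing)
  open import Data.Nat.Base
  open import Data.Nat.Properties hiding (_≟_)
  open import Data.Product.Base using (Σ; ∃-syntax; _×_; _,_; proj₁; proj₂; map₂)
  open import Data.Sum.Base using (_⊎_; inj₁; inj₂)
  open import Data.Unit.Base using (⊤; tt)
  open import Data.Vec.Base as Vec using (Vec; []; _∷_; lookup; updateAt; _[_]≔_)
  open import Data.Vec.Properties using (lookup-zipWith; lookup-map; lookup∘updateAt; lookup∘updateAt′; lookup-replicate)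
  open import Function.Base using (_∘_; id; const)
  open import Relation.Binary.PropositionalEquality
  open import Relation.Nullary.Decidable using (yes; no)

  -- Repetitions in the list are harmless: coding needs `decode` to be a left inverse of `encode`,
  -- nothing more.
  record Finite (A : Set) : Set where
    field
      elements : List A
      complete : ∀ a → a ∈ elements

    size : ℕ
    size = length elements

    encode : A → Fin size
    encode a = index (complete a)

    decode : Fin size → A
    decode = List.lookup elements

    decode-encode : ∀ a → decode (encode a) ≡ a
    decode-encode a = sym (lookup-index (complete a))

  open Finite

  finite-⊥ : Finite ⊥
  finite-⊥ = record { elements = [] ; complete = λ () }

  finite-⊤ : Finite ⊤
  finite-⊤ = record { elements = tt ∷ [] ; complete = λ _ → here refl }

  finite-Bool : Finite Bool
  finite-Bool = record { elements = false ∷ true ∷ [] ; complete = λ { false → here refl ; true → there (here refl) } }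

  finite-Maybe : ∀ {A} → Finite A → Finite (Maybe A)
  finite-Maybe F = record
    { elements = nothing ∷ List.map just (elements F)
    ; complete = λ { nothing → here refl ; (just a) → there (∈-map⁺ just (complete F a)) } }

  finite-⊎ : ∀ {A B} → Finite A → Finite B → Finite (A ⊎ B)
  finite-⊎ F G = record
    { elements = List.map inj₁ (elements F) ++ List.map inj₂ (elements G)
    ; complete = λ { (inj₁ a) → ∈-++⁺ˡ (∈-map⁺ inj₁ (complete F a))
                   ; (inj₂ b) → ∈-++⁺ʳ (List.map inj₁ (elements F)) (∈-map⁺ inj₂ (complete G b)) } }

  finite-Σ : ∀ {A} {B : A → Set} → Finite A → (∀ a → Finite (B a)) → Finite (Σ A B)
  finite-Σ {A} {B} F G = record
    { elements = List.concatMap row (elements F)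
    ; complete = λ { (a , b) → ∈-concatMap⁺ row (Any.map (λ { refl → ∈-map⁺ (a ,_) (complete (G a) b) })
        (complete F a)) } }
    where
    row : A → List (Σ A B)
    row a = List.map (a ,_) (elements (G a))

  finite-Fin : ∀ n → Finite (Fin n)
  finite-Fin n = record { elements = List.allFin n ; complete = ∈-allFin }

  finite-Glyph : Finite Glyph
  finite-Glyph = record
    { elements = 𝟎 ∷ 𝟏 ∷ minus ∷ point ∷ comma ∷ []
    ; complete = λ { 𝟎 → here refl ; 𝟏 → there (here refl) ; minus → there (there (here refl))
                   ; point → there (there (there (here refl))) ; comma → there (there (there (there (here refl)))) } }

  -- Marks are for the blanks, auxiliary symbols and states of a simulated machine.
  data Letter (X : Set) : Set where
    gl   : Glyph → Letter X
    mark : X → Letter X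

  finite-Letter : ∀ {X} → Finite X → Finite (Letter X)
  finite-Letter F = record
    { elements = List.map gl (elements finite-Glyph) ++ List.map mark (elements F)
    ; complete = λ { (gl c)   → ∈-++⁺ˡ (∈-map⁺ gl (complete finite-Glyph c))
                   ; (mark x) → ∈-++⁺ʳ (List.map gl (elements finite-Glyph)) (∈-map⁺ mark (complete F x)) } }

  -- Programs on finitely many stacks; `case` and `while` inspect the top of a
  -- stack without popping it.
  infixr 5 _⨾_

  data Prog (X : Set) : Kind → ℕ → Set where
    skip  : ∀ {κ n} → Prog X κ n
    push  : ∀ {κ n} → Fin n → Letter X → Prog X κ n
    pop   : ∀ {κ n} → Fin n → Prog X κ n
    case  : ∀ {κ n} → Fin n → (Maybe (Letter X) → Prog X κ n) → Prog X κ n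
    _⨾_   : ∀ {κ n} → Prog X κ n → Prog X κ n → Prog X κ n
    while : ∀ {κ n} → Fin n → (Maybe (Letter X) → Bool) → (Maybe (Letter X) → Prog X κ n) → Prog X κ n
    ask   : ∀ {w} → Prog X oracle (3 + w)

  Stack : Set → Set
  Stack X = List (Letter X)

  Store : Set → ℕ → Set
  Store X n = Vec (Stack X) n

  word : ∀ {X} → List Glyph → Stack X
  word = List.map gl

  prefix : ∀ {X} → Stack X → List Glyph
  prefix (gl c ∷ cs) = c ∷ prefix cs
  prefix _           = []

  peek : ∀ {X n} → Store X n → Fin n → Maybe (Letter X)
  peek s i = List.head (lookup s i)

  -- A big-step semantics whose last index bounds the steps of the compiled machine. `push` costs
  -- two because the head moves left before it writes. `weaken` makes the index an upper bound, so
  -- that cases of unequal cost can share one.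
  data Run {X : Set} : ∀ {κ n} → Oracle κ → Prog X κ n → Store X n → Store X n → ℕ → Set where
    skip  : ∀ {κ n} {O : Oracle κ} {s : Store X n} → Run O skip s s 0
    push  : ∀ {κ n} {O : Oracle κ} {s : Store X n} {i c} →
            Run O (push i c) s (updateAt s i (c ∷_)) 2
    pop   : ∀ {κ n} {O : Oracle κ} {s : Store X n} {i} →
            Run O (pop i) s (updateAt s i (drop 1)) 1
    case  : ∀ {κ n} {O : Oracle κ} {s s′ : Store X n} {i f t} →
            Run O (f (peek s i)) s s′ t → Run O (case i f) s s′ (suc t)
    _⨾_   : ∀ {κ n} {O : Oracle κ} {s s′ s″ : Store X n} {p q t t′} →
            Run O p s s′ t → Run O q s′ s″ t′ → Run O (p ⨾ q) s s″ (t + t′)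
    done  : ∀ {κ n} {O : Oracle κ} {s : Store X n} {i g f} →
            g (peek s i) ≡ false → Run O (while i g f) s s 1
    loop  : ∀ {κ n} {O : Oracle κ} {s s′ s″ : Store X n} {i g f t t′} →
            g (peek s i) ≡ true → Run O (f (peek s i)) s s′ t →
            Run O (while i g f) s′ s″ t′ → Run O (while i g f) s s″ (suc (t + t′))
    ask   : ∀ {w} {A : ℕ → List Glyph} {a b q} {s : Store X w} →
            Run {κ = oracle} A ask (a ∷ b ∷ q ∷ s) (a ∷ b ∷ word (A (leading𝟏s (prefix q))) ∷ s) 1
    weaken : ∀ {κ n} {O : Oracle κ} {s s′ : Store X n} {p t t′} → t ≤ t′ →
            Run O p s s′ t → Run O p s s′ t′

  -- Control states, one for each point of the program at which a step is taken; `skip` takes none.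
  -- A state inside a branch remembers the symbol that selected the branch, since the body depends
  -- on it.
  St : ∀ {X κ n} → Prog X κ n → Set
  St skip          = ⊥
  St (push _ _)    = Bool
  St (pop _)       = ⊤
  St {X} (case _ f)    = Maybe (Σ (Maybe (Letter X)) λ c → St (f c))
  St (p ⨾ q)       = St p ⊎ St q
  St {X} (while _ _ f) = Maybe (Σ (Maybe (Letter X)) λ c → St (f c))
  St ask           = ⊤

  finite-St : ∀ {X κ n} → Finite X → (p : Prog X κ n) → Finite (St p)
  finite-St F skip          = finite-⊥
  finite-St F (push _ _)    = finite-Bool
  finite-St F (pop _)       = finite-⊤
  finite-St F (case _ f)    = finite-Maybe (finite-Σ (finite-Maybe (finite-Letter F)) λ c → finite-St F (f c))
  finite-St F (p ⨾ q)       = finite-⊎ (finite-St F p) (finite-St F q)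
  finite-St F (while _ _ f) = finite-Maybe (finite-Σ (finite-Maybe (finite-Letter F)) λ c → finite-St F (f c))
  finite-St F ask           = finite-⊤

  data Effect (X : Set) : Kind → ℕ → Set where
    put : ∀ {κ n} → Fin n → Letter X → Effect X κ n
    go  : ∀ {κ n} → Fin n → Move → Effect X κ n
    ask : ∀ {w} → Effect X oracle (3 + w)

  -- `nothing` stands for the exit of a program.
  link : ∀ {A B : Set} → (A → B) → Maybe B → Maybe A → Maybe B
  link f e (just a) = just (f a)
  link f e nothing  = e

  entry : ∀ {X κ n} (p : Prog X κ n) → Maybe (St p)
  entry skip          = nothing
  entry (push _ _)    = just false
  entry (pop _)       = just tt
  entry (case _ _)    = just nothing
  entry (p ⨾ q)       = link inj₁ (Maybe.map inj₂ (entry q)) (entry p)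
  entry (while _ _ _) = just nothing
  entry ask           = just tt

  step : ∀ {X κ n} (p : Prog X κ n) → St p → Vec (Maybe (Letter X)) n → Effect X κ n × Maybe (St p)
  step (push i c)    false              hs = go i left , just true
  step (push i c)    true               hs = put i c , nothing
  -- An empty stack shows a blank under the head; moving right would expose whatever lies beyond it,
  -- so the head stays.
  step (pop i)       _                  hs with lookup hs i
  ... | nothing = go i stay , nothing
  ... | just _  = go i right , nothing
  step (case i f)    nothing            hs =
    go i stay , link (λ σ → just (lookup hs i , σ)) nothing (entry (f (lookup hs i)))
  step (case i f)    (just (c , σ))     hs =
    map₂ (link (λ σ → just (c , σ)) nothing) (step (f c) σ hs)
  step (p ⨾ q)       (inj₁ σ)           hs = map₂ (link inj₁ (Maybe.map inj₂ (entry q))) (step p σ hs)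
  step (p ⨾ q)       (inj₂ σ)           hs = map₂ (Maybe.map inj₂) (step q σ hs)
  step (while i g f) nothing            hs = go i stay ,
    (if g (lookup hs i) then link (λ σ → just (lookup hs i , σ)) (just nothing) (entry (f (lookup hs i))) else
        nothing)
  -- The exit of the body is linked to the test `just nothing`, not to the exit of the loop.
  step (while i g f) (just (c , σ))     hs =
    map₂ (link (λ σ → just (c , σ)) (just nothing)) (step (f c) σ hs)
  step ask           _                  hs = ask , nothing

  module Compile {X : Set} (F : Finite X) {κ : Kind} {w : ℕ} (P : Prog X κ (3 + w)) where

    Sym : Set
    Sym = Symbol (size F)

    symbol : Letter X → Sym
    symbol (gl c)   = glyph c
    symbol (mark x) = special (encode F x)

    letter : Sym → Maybe (Letter X)
    letter blank       = nothing
    letter (glyph c)   = just (gl c)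
    letter (special k) = just (mark (decode F k))

    letter-symbol : ∀ c → letter (symbol c) ≡ just c
    letter-symbol (gl c)   = refl
    letter-symbol (mark x) = cong (just ∘ mark) (decode-encode F x)

    states : Finite (Maybe (St P))
    states = finite-Maybe (finite-St F P)

    keep : Sym → Sym × Move
    keep h = h , stay

    realise : ∀ {κ} → Effect X κ (3 + w) → Fin (size states) → Vec Sym (3 + w) →
              Instruction (size F) (size states) (3 + w) κ
    realise (put i c) q hs = act q (Vec.map keep hs [ i ]≔ (symbol c , stay))
    realise (go i m)  q hs = act q (Vec.map keep hs [ i ]≔ (lookup hs i , m))
    realise ask       q hs = query q

    control : Maybe (St P) → Vec (Maybe (Letter X)) (3 + w) → Maybe (Effect X κ (3 + w) × Maybe (St P))
    control nothing  hs = nothing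
    control (just σ) hs = just (step P σ hs)

    react : Maybe (Effect X κ (3 + w) × Maybe (St P)) → Vec Sym (3 + w) →
            Instruction (size F) (size states) (3 + w) κ
    react nothing        hs = halt
    react (just (e , σ)) hs = realise e (encode states σ) hs

    machine : Machine κ
    machine = record
      { aux = size F ; states = size states ; work = w
      ; start = encode states (entry P)
      ; δ = λ q hs → react (control (decode states q) (Vec.map letter hs)) hs }

    -- The stack occupies the cells from the head rightwards up to the first blank or the end of the
    -- listed cells. Popped symbols stay behind to the left of the head, where the next push
    -- overwrites them.
    data Cells : List Sym → Stack X → Set where
      void : Cells [] []
      end  : ∀ {cs} → Cells (blank ∷ cs) []
      cell : ∀ {c cs xs} → Cells cs xs → Cells (symbol c ∷ cs) (c ∷ xs)

    Holds : Tape (size F) → Stack X → Set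
    Holds (tape _ h rs) xs = Cells (h ∷ rs) xs

    Tapes : Set
    Tapes = Vec (Tape (size F)) (3 + w)

    Represents : Tapes → Store X (3 + w) → Set
    Represents ts s = ∀ i → Holds (lookup ts i) (lookup s i)

    holds-head : ∀ t xs → Holds t xs → letter (Tape.head t) ≡ List.head xs
    holds-head (tape _ _ _) _ end               = refl
    holds-head (tape _ _ _) _ (cell {c = c} cs) = letter-symbol c

    represents-peek : ∀ {ts s} → Represents ts s → ∀ i →
                      lookup (Vec.map letter (Vec.map Tape.head ts)) i ≡ peek s i
    represents-peek {ts} {s} R i = trans (lookup-map i letter (Vec.map Tape.head ts))
      (trans (cong letter (lookup-map i Tape.head ts)) (holds-head (lookup ts i) (lookup s i) (R i)))

    perform : Sym × Move → Tape (size F) → Tape (size F)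
    perform a t = move (proj₂ a) (write (proj₁ a) t)

    -- An instruction acts on every tape at once; on the tapes not concerned it rewrites the scanned
    -- symbol and stays, which changes nothing definitionally.
    lookup-perform : (ts : Tapes) (i : Fin (3 + w)) (a : Sym × Move) → ∀ j →
      lookup (Vec.zipWith perform (Vec.map keep (Vec.map Tape.head ts) [ i ]≔ a) ts) j
        ≡ lookup (updateAt ts i (perform a)) j
    lookup-perform ts i a j with i ≟ j
    ... | yes refl = trans (lookup-zipWith perform i (Vec.map keep (Vec.map Tape.head ts) [ i ]≔ a) ts)
        (trans (cong (λ b → perform b (lookup ts i)) (lookup∘updateAt i {const a}
            (Vec.map keep (Vec.map Tape.head ts))))
               (sym (lookup∘updateAt i ts)))
    ... | no i≢j = trans (lookup-zipWith perform j (Vec.map keep (Vec.map Tape.head ts) [ i ]≔ a) ts)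
        (trans (cong (λ b → perform b (lookup ts j))
                 (trans (lookup∘updateAt′ j i {const a} (i≢j ∘ sym) (Vec.map keep (Vec.map Tape.head ts)))
                 (trans (lookup-map j keep (Vec.map Tape.head ts)) (cong keep (lookup-map j Tape.head ts)))))
               (sym (lookup∘updateAt′ j i (i≢j ∘ sym) ts)))

    represents-update : ∀ {ts s} → Represents ts s → ∀ i a (f : Stack X → Stack X) →
      Holds (perform a (lookup ts i)) (f (lookup s i)) →
      Represents (Vec.zipWith perform (Vec.map keep (Vec.map Tape.head ts) [ i ]≔ a) ts) (updateAt s i f)
    represents-update {ts} {s} R i a f h j
      rewrite lookup-perform ts i a j with i ≟ j
    ... | yes refl rewrite lookup∘updateAt i {perform a} ts | lookup∘updateAt i {f} s = h
    ... | no i≢j rewrite lookup∘updateAt′ j i {perform a} (i≢j ∘ sym) ts | lookup∘updateAt′ j i {f} (i≢j ∘ sym) s = R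
        j

    module _ (O : Oracle κ) where

      Conf : Set
      Conf = Config machine O

      at : Maybe (St P) → Tapes → Conf
      at σ ts = config (encode states σ) ts

      infix 4 _⟶⟨_⟩_
      _⟶⟨_⟩_ : Conf → ℕ → Conf → Set
      c ⟶⟨ b ⟩ c′ = ∃[ t ] t ≤ b × run machine O t c ≡ c′

      chain : ∀ {a b c c′ c″} → c ⟶⟨ a ⟩ c′ → c′ ⟶⟨ b ⟩ c″ → c ⟶⟨ a + b ⟩ c″
      chain {c = c} (t , t≤ , e) (u , u≤ , e′) = t + u , +-mono-≤ t≤ u≤ ,
        trans (run-+ machine O t u c) (trans (cong (run machine O u) e) e′)

      single : ∀ σ ts → at σ ts ⟶⟨ 1 ⟩ execute machine O O (instruction machine O (at σ ts)) (at σ ts)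
      single σ ts = 1 , ≤-refl , refl

      once : ∀ σ ts {e τ} → control σ (Vec.map letter (Vec.map Tape.head ts)) ≡ just (e , τ) →
             at σ ts ⟶⟨ 1 ⟩ execute machine O O (realise e (encode states τ) (Vec.map Tape.head ts)) (at σ ts)
      once σ ts eq = subst (λ v → at σ ts ⟶⟨ 1 ⟩ execute machine O O (react v (Vec.map Tape.head ts)) (at σ ts)) eq
        (subst (λ v → at σ ts ⟶⟨ 1 ⟩ execute machine O O
            (react (control v (Vec.map letter (Vec.map Tape.head ts))) (Vec.map Tape.head ts)) (at σ ts))
          (decode-encode states σ) (single σ ts))

      -- `ctx` places the states and the exit of `p` among those of `P`.
      Inside : (p : Prog X κ (3 + w)) → (Maybe (St p) → Maybe (St P)) → Set
      Inside p ctx = ∀ σ hs → control (ctx (just σ)) hs ≡ just (map₂ ctx (step p σ hs))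

      -- The states of a subprogram reach those of `P` through an embedding `h` into the states of
      -- the enclosing construct. All that has to match is `step`, and for each construct it does by
      -- `refl`.
      inside-context : ∀ {q} {ctx : Maybe (St q) → Maybe (St P)} {p} (ctx′ : Maybe (St p) → Maybe (St P))
          (inj : St p → St q) →
        (h : Maybe (St p) → Maybe (St q)) → (∀ σ → h (just σ) ≡ just (inj σ)) → (∀ τ → ctx′ τ ≡ ctx (h τ)) →
        (∀ σ hs → step q (inj σ) hs ≡ map₂ h (step p σ hs)) →
        Inside q ctx → Inside p ctx′
      inside-context {p = p} ctx′ inj h hj e stp I σ hs
        rewrite e (just σ) | hj σ | I (inj σ) hs | stp σ hs
        = cong (λ τ → just (proj₁ (step p σ hs) , τ)) (sym (e _))

      Result : Prog X κ (3 + w) → Store X (3 + w) → ℕ → Conf → Maybe (St P) → Set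
      Result p s b c σ = ∃[ ts ] (c ⟶⟨ b ⟩ at σ ts) × Represents ts s

      goStay : ∀ {ts s} i → Represents ts s → Represents
        (Vec.zipWith perform (Vec.map keep (Vec.map Tape.head ts) [ i ]≔ (lookup (Vec.map Tape.head ts) i , stay)) ts)
            s
      goStay {ts} {s} i R j
        rewrite lookup-perform ts i (lookup (Vec.map Tape.head ts) i , stay) j with i ≟ j
      ... | yes refl rewrite lookup∘updateAt i {perform (lookup (Vec.map Tape.head ts) i , stay)} ts
                           | lookup-map i Tape.head ts = R i
      ... | no i≢j rewrite lookup∘updateAt′ j i {perform (lookup (Vec.map Tape.head ts) i , stay)} (i≢j ∘ sym) ts = R
          j

      holds-push : ∀ t xs c → Holds t xs → Holds (write (symbol c) (perform (Tape.head t , left) t)) (c ∷ xs)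
      holds-push (tape [] h rs)       xs c H = cell H
      holds-push (tape (l ∷ ls) h rs) xs c H = cell H

      holds-pop : ∀ t xs v → List.head xs ≡ v → Holds t xs →
                  Holds (perform (Tape.head t , Maybe.maybe (const right) stay v) t) (drop 1 xs)
      holds-pop (tape ls _ rs)       []       _ refl end         = end
      holds-pop (tape ls _ [])       (c ∷ []) _ refl (cell void) = end
      holds-pop (tape ls _ (r ∷ rs)) (c ∷ xs) _ refl (cell C)    = C

      lookup-step : ∀ (ts : Tapes) i a → lookup (Vec.zipWith perform (Vec.map keep (Vec.map Tape.head ts) [ i ]≔ a)
          ts) i
                      ≡ perform a (lookup ts i)
      lookup-step ts i a = trans (lookup-perform ts i a i) (lookup∘updateAt i ts)

      holds-prefix : ∀ t xs → Holds t xs → contents t ≡ prefix xs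
      holds-prefix (tape _ h rs) xs H = go-cells (h ∷ rs) xs H
        where
        go-cells : ∀ cs xs → Cells cs xs → glyphs cs ≡ prefix xs
        go-cells _ _ void = refl
        go-cells _ _ end  = refl
        go-cells _ _ (cell {c = gl c} C) = cong (c ∷_) (go-cells _ _ C)
        go-cells _ _ (cell {c = mark x} C) = refl

      holds-loaded : ∀ w → Holds (loaded w) (word w)
      holds-loaded []      = end
      holds-loaded (c ∷ w) = cell (cells w)
        where
        cells : ∀ w → Cells (List.map glyph w) (word w)
        cells []      = void
        cells (c ∷ w) = cell (cells w)

      -- Induction on the derivation rather than on `p`, because a loop unfolds to itself. The
      -- position of `p` inside `P` is generalised to `ctx`, so that the exit of one part can be the
      -- entry of the next, or the test of the loop.
      exec : ∀ {p s s′ b} → Run O p s s′ b → (ctx : Maybe (St p) → Maybe (St P)) → Inside p ctx →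
             ∀ ts → Represents ts s → Result p s′ b (at (ctx (entry p)) ts) (ctx nothing)
      exec skip ctx I ts R = ts , (0 , z≤n , refl) , R
      exec (push {s = s} {i = i} {c = c}) ctx I ts R =
        _ , chain (once _ ts (I false _)) (once _ ts₁ (I true _)) , final
        where
        ts₁ : Tapes
        ts₁ = Vec.zipWith perform (Vec.map keep (Vec.map Tape.head ts) [ i ]≔
            (lookup (Vec.map Tape.head ts) i , left)) ts
        final : Represents (Vec.zipWith perform (Vec.map keep (Vec.map Tape.head ts₁) [ i ]≔ (symbol c , stay)) ts₁)
            (updateAt s i (c ∷_))
        final j rewrite lookup-perform ts₁ i (symbol c , stay) j with i ≟ j
        ... | yes refl rewrite lookup∘updateAt i {perform (symbol c , stay)} ts₁ | lookup∘updateAt i {c ∷_} s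
                       | lookup-step ts i (lookup (Vec.map Tape.head ts) i , left) | lookup-map i Tape.head ts
                       = holds-push (lookup ts i) (lookup s i) c (R i)
        ... | no i≢j rewrite lookup∘updateAt′ j i {perform (symbol c , stay)} (i≢j ∘ sym) ts₁ | lookup∘updateAt′ j i
            {c ∷_} (i≢j ∘ sym) s
                       | lookup-perform ts i (lookup (Vec.map Tape.head ts) i , left) j
                       | lookup∘updateAt′ j i {perform (lookup (Vec.map Tape.head ts) i , left)} (i≢j ∘ sym) ts = R j
      exec (pop {s = s} {i = i}) ctx I ts R = popped (lookup (Vec.map letter (Vec.map Tape.head ts)) i) refl
        where
        hs : Vec (Maybe (Letter X)) (3 + w)
        hs = Vec.map letter (Vec.map Tape.head ts)
        step-pop : ∀ v → lookup hs i ≡ v → proj₂ (step (pop {X} {κ} i) tt hs) ≡ nothing × proj₁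
            (step (pop {X} {κ} i) tt hs) ≡ go i (Maybe.maybe (const right) stay v)
        step-pop v eq with lookup hs i
        step-pop nothing refl | .nothing = refl , refl
        step-pop (just _) refl | .(just _) = refl , refl
        popped : ∀ v → lookup hs i ≡ v → Result (pop i) (updateAt s i (drop 1)) 1 (at (ctx (just tt)) ts)
            (ctx nothing)
        popped v eq = _ , once _ ts (trans (I tt hs) (cong₂ (λ e σ → just (e , ctx σ)) (proj₂ (step-pop v eq))
            (proj₁ (step-pop v eq))))
          , represents-update {ts} {s} R i _ (drop 1)
              (subst (λ h → Holds (perform (h , Maybe.maybe (const right) stay v) (lookup ts i))
                  (drop 1 (lookup s i)))
                (sym (lookup-map i Tape.head ts))
                (holds-pop (lookup ts i) (lookup s i) v (trans (sym (represents-peek {ts} {s} R i)) eq) (R i)))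
      exec (case {s = s} {i = i} {f = f} d) ctx I ts R =
        let ts′ , r , R′ = exec d ctx′ I′ ts₁ (goStay {ts} {s} i R)
        in ts′ , chain (subst (λ σ → at (ctx (just nothing)) ts ⟶⟨ 1 ⟩ at σ ts₁) enter (once _ ts (I nothing hs))) r , R′
        where
        ts₁ : Tapes
        ts₁ = Vec.zipWith perform (Vec.map keep (Vec.map Tape.head ts) [ i ]≔
            (lookup (Vec.map Tape.head ts) i , stay)) ts
        hs : Vec (Maybe (Letter X)) (3 + w)
        hs = Vec.map letter (Vec.map Tape.head ts)
        h : ∀ c → Maybe (St (f c)) → Maybe (St (case i f))
        h c = link (λ σ → just (c , σ)) nothing
        ctx′ : Maybe (St (f (peek s i))) → Maybe (St P)
        ctx′ σ = ctx (h (peek s i) σ)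
        I′ : Inside (f (peek s i)) ctx′
        I′ = inside-context {case i f} {ctx} ctx′ (λ σ → just (peek s i , σ)) (h (peek s i)) (λ _ → refl) (λ _ → refl)
            (λ _ _ → refl) I
        enter : ctx (h (lookup hs i) (entry (f (lookup hs i)))) ≡ ctx (h (peek s i) (entry (f (peek s i))))
        enter = cong (λ c → ctx (h c (entry (f c)))) (represents-peek {ts} {s} R i)
      exec (_⨾_ {p = p} {q = q} d d′) ctx I ts R =
        let ts₁ , r₁ , R₁ = exec d (ctx ∘ link inj₁ (Maybe.map inj₂ (entry q))) (inside-context {p ⨾ q} {ctx} _ inj₁ (link inj₁ (Maybe.map inj₂ (entry q))) (λ _ → refl) (λ _ → refl) (λ _ _ → refl) I) ts R
            ts₂ , r₂ , R₂ = exec d′ (ctx ∘ Maybe.map inj₂)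
                (inside-context {p ⨾ q} {ctx} _ inj₂ (Maybe.map inj₂) (λ _ → refl) (λ _ → refl) (λ _ _ → refl) I) ts₁
                R₁
        in ts₂ , chain r₁ r₂ , R₂
      exec (done {s = s} {i = i} {g = g} {f = f} eq) ctx I ts R =
        _ , once _ ts (trans (I nothing hs) (cong (λ v → just (map₂ ctx v)) leave)) , goStay {ts} {s} i R
        where
        hs : Vec (Maybe (Letter X)) (3 + w)
        hs = Vec.map letter (Vec.map Tape.head ts)
        leave : step (while {κ = κ} i g f) nothing hs ≡ (go i stay , nothing)
        leave rewrite represents-peek {ts} {s} R i | eq = refl
      exec (loop {s = s} {i = i} {g = g} {f = f} eq d d′) ctx I ts R =
        let ts₁ , r₁ , R₁ = exec d ctx′ I′ _ (goStay {ts} {s} i R)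
            ts₂ , r₂ , R₂ = exec d′ ctx I ts₁ R₁
        in ts₂ , chain {a = 1} (once _ ts (trans (I nothing hs) (cong (λ v → just (map₂ ctx v)) enter))) (chain r₁ r₂) , R₂
        where
        hs : Vec (Maybe (Letter X)) (3 + w)
        hs = Vec.map letter (Vec.map Tape.head ts)
        h : ∀ c → Maybe (St (f c)) → Maybe (St (while i g f))
        h c = link (λ σ → just (c , σ)) (just nothing)
        ctx′ : Maybe (St (f (peek s i))) → Maybe (St P)
        ctx′ σ = ctx (h (peek s i) σ)
        I′ : Inside (f (peek s i)) ctx′
        I′ = inside-context {while i g f} {ctx} ctx′ (λ σ → just (peek s i , σ)) (h (peek s i)) (λ _ → refl)
            (λ _ → refl) (λ _ _ → refl) I
        enter : step (while {κ = κ} i g f) nothing hs ≡ (go i stay , h (peek s i) (entry (f (peek s i))))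
        enter rewrite represents-peek {ts} {s} R i | eq = refl
      exec (ask {a = a} {b = b} {q = q} {s = s}) ctx I (t₀ ∷ t₁ ∷ t ∷ ts) R =
        _ , once _ (t₀ ∷ t₁ ∷ t ∷ ts) (I tt _) , answered
        where
        answered : Represents (t₀ ∷ t₁ ∷ loaded (O (leading𝟏s (contents t))) ∷ ts)
            (a ∷ b ∷ word (O (leading𝟏s (prefix q))) ∷ s)
        answered zero                = R zero
        answered (suc zero)          = R (suc zero)
        answered (suc (suc zero))    = subst (λ v → Holds (loaded (O (leading𝟏s v)))
            (word (O (leading𝟏s (prefix q)))))
          (sym (holds-prefix t q (R (suc (suc zero))))) (holds-loaded _)
        answered (suc (suc (suc i))) = R (suc (suc (suc i)))
      exec (weaken b≤ d) ctx I ts R =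
        let ts′ , (t , t≤ , e) , R′ = exec d ctx I ts R in ts′ , (t , ≤-trans t≤ b≤ , e) , R′

      initially : ∀ v → Represents (loaded v ∷ Vec.replicate (2 + w) (loaded [])) (word v ∷ Vec.replicate (2 + w) [])
      initially v zero    = holds-loaded v
      initially v (suc i) = subst₂ Holds (sym (lookup-replicate i (loaded [])))
          (sym (lookup-replicate {n = 2 + w} i [])) end

      halt-nothing : ∀ ts → instruction machine O (at nothing ts) ≡ halt
      halt-nothing ts rewrite decode-encode states nothing = refl

      -- The exit state halts, so one derivation yields the output together with every time bound
      -- from `b` on.
      compiled : ∀ {v s b} → Run O P (word v ∷ Vec.replicate (2 + w) []) s b →
        (∀ b′ → b ≤ b′ → HaltsWithin machine O v b′) × Outputs machine O v (prefix (lookup s (suc zero)))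
      compiled {v} {s} {b} d =
        (λ b′ b≤ → trans (cong (instruction machine O) (final b′ (≤-trans t≤ b≤))) (halt-nothing ts))
        , b , trans (cong (instruction machine O) (final b t≤)) (halt-nothing ts)
        , trans (cong (output machine O) (final b t≤)) (out ts R)
        where
        result = exec d id (λ _ _ → refl) (loaded v ∷ Vec.replicate (2 + w) (loaded [])) (initially v)
        ts = proj₁ result
        t = proj₁ (proj₁ (proj₂ result))
        t≤ = proj₁ (proj₂ (proj₁ (proj₂ result)))
        e = proj₂ (proj₂ (proj₁ (proj₂ result)))
        R = proj₂ (proj₂ result)
        final : ∀ b′ → t ≤ b′ → run machine O b′ (initial machine O v) ≡ at nothing ts
        final b′ t≤b′ = trans (run-halted machine O t≤b′ (trans (cong (instruction machine O) e) (halt-nothing ts))) e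
        out : ∀ ts → Represents ts s → output machine O (at nothing ts) ≡ prefix (lookup s (suc zero))
        out (_ ∷ t₁ ∷ _ ∷ _) R = holds-prefix t₁ (lookup s (suc zero)) (R (suc zero))

-- Running a program on chosen registers of a larger store.

module Renaming where

  open import Defs using (Kind; plain; Oracle)
  open StackPrograms
  open import Data.Bool.Base using (Bool; true; T; _∧_; not)
  open import Data.Bool.Properties using (T-∧)
  open import Data.Empty using (⊥-elim)
  open import Data.Fin.Base using (Fin; zero; suc)
  open import Data.Fin.Properties using (_≟_; suc-injective; any?)
  open import Data.List.Base as List using (List; []; _∷_; drop)
  open import Data.Nat.Base using (ℕ; zero; suc; _+_)
  open import Data.Product.Base using (∃-syntax; _×_; _,_; proj₁; proj₂)
  open import Data.Unit.Base using (tt)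
  open import Data.Vec.Base as Vec using (Vec; []; _∷_; lookup; updateAt; _[_]≔_)
  open import Data.Vec.Properties using (lookup∘updateAt; lookup∘updateAt′; tabulate∘lookup; tabulate-cong; lookup-map)
  open import Function.Base using (_∘_)
  open import Function.Bundles using (Equivalence)
  open import Relation.Binary.PropositionalEquality
  open import Relation.Nullary.Decidable using (yes; no; isYes; toWitnessFalse)
  open import Relation.Nullary.Negation using (¬_)

  -- Restricted to plain programs because `ask` is tied to the first three stacks; the renamed code
  -- fits into programs of either kind.
  rename : ∀ {X κ k n} → (Fin k → Fin n) → Prog X plain k → Prog X κ n
  rename ρ skip          = skip
  rename ρ (push i c)    = push (ρ i) c
  rename ρ (pop i)       = pop (ρ i)
  rename ρ (case i f)    = case (ρ i) (λ c → rename ρ (f c))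
  rename ρ (p ⨾ q)       = rename ρ p ⨾ rename ρ q
  rename ρ (while i g f) = while (ρ i) g (λ c → rename ρ (f c))

  run-shift : ∀ {X κ n} {O : Oracle κ} {p : Prog X plain n} {s s′ b} {x : Stack X} →
              Run tt p s s′ b → Run O (rename suc p) (x ∷ s) (x ∷ s′) b
  run-shift skip           = skip
  run-shift push           = push
  run-shift pop            = pop
  run-shift (case d)       = case (run-shift d)
  run-shift (d ⨾ d′)       = run-shift d ⨾ run-shift d′
  run-shift (done e)       = done e
  run-shift (loop e d d′)  = loop e (run-shift d) (run-shift d′)
  run-shift (weaken b≤ d)  = weaken b≤ (run-shift d)

  -- Boolean, so that for a literal list of registers `T (distinct ρ)` computes to the unit type and
  -- the implicit argument is solved without a proof being written.
  absent : ∀ {n k} → Fin n → Vec (Fin n) k → Bool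
  absent i []      = true
  absent i (j ∷ ρ) = not (isYes (i ≟ j)) ∧ absent i ρ

  distinct : ∀ {n k} → Vec (Fin n) k → Bool
  distinct []      = true
  distinct (i ∷ ρ) = absent i ρ ∧ distinct ρ

  absent-lookup : ∀ {n k} (i : Fin n) (ρ : Vec (Fin n) k) → T (absent i ρ) → ∀ j → i ≢ lookup ρ j
  absent-lookup i (j ∷ ρ) t zero    = toWitnessFalse {a? = i ≟ j}
      (proj₁ (Equivalence.to (T-∧ {not (isYes (i ≟ j))}) t))
  absent-lookup i (j ∷ ρ) t (suc k) = absent-lookup i ρ (proj₂ (Equivalence.to (T-∧ {not (isYes (i ≟ j))}) t)) k

  distinct-injective : ∀ {n k} (ρ : Vec (Fin n) k) → T (distinct ρ) → ∀ i j → lookup ρ i ≡ lookup ρ j → i ≡ j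
  distinct-injective (r ∷ ρ) t zero    zero    e = refl
  distinct-injective (r ∷ ρ) t zero    (suc j) e = ⊥-elim
      (absent-lookup r ρ (proj₁ (Equivalence.to (T-∧ {absent r ρ}) t)) j e)
  distinct-injective (r ∷ ρ) t (suc i) zero    e = ⊥-elim
      (absent-lookup r ρ (proj₁ (Equivalence.to (T-∧ {absent r ρ}) t)) i (sym e))
  distinct-injective (r ∷ ρ) t (suc i) (suc j) e =
    cong suc (distinct-injective ρ (proj₂ (Equivalence.to (T-∧ {absent r ρ}) t)) i j e)

  -- On literal register lists and stores this computes to the literal resulting store, so
  -- consecutive runs compose with `⨾` without rewriting.
  scatter : ∀ {A : Set} {n k} → Vec (Fin n) k → Vec A k → Vec A n → Vec A n
  scatter []      []      s = s
  scatter (i ∷ ρ) (x ∷ u) s = scatter ρ u (s [ i ]≔ x)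

  scatter-outside : ∀ {A : Set} {n k} (ρ : Vec (Fin n) k) (u : Vec A k) (s : Vec A n) j →
                    (∀ i → lookup ρ i ≢ j) → lookup (scatter ρ u s) j ≡ lookup s j
  scatter-outside []      []      s j h = refl
  scatter-outside (i ∷ ρ) (x ∷ u) s j h = trans (scatter-outside ρ u (s [ i ]≔ x) j (h ∘ suc))
    (lookup∘updateAt′ j i (λ e → h zero (sym e)) s)

  scatter-inside : ∀ {A : Set} {n k} (ρ : Vec (Fin n) k) → (∀ i j → lookup ρ i ≡ lookup ρ j → i ≡ j) →
                   (u : Vec A k) (s : Vec A n) → ∀ i → lookup (scatter ρ u s) (lookup ρ i) ≡ lookup u i
  scatter-inside (r ∷ ρ) inj (x ∷ u) s zero    = trans
      (scatter-outside ρ u (s [ r ]≔ x) r (λ i e → absurd (inj (suc i) zero e))) (lookup∘updateAt r s)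
    where
    absurd : ∀ {k} {i : Fin k} {B : Set} → suc i ≡ zero → B
    absurd ()
  scatter-inside (r ∷ ρ) inj (x ∷ u) s (suc i) = scatter-inside ρ (λ i j e → suc-injective (inj (suc i) (suc j) e)) u
      (s [ r ]≔ x) i

  module _ {X : Set} {κ : Kind} {k n : ℕ} {O : Oracle κ} (ρ : Vec (Fin n) k) (inj : ∀ i j → lookup ρ i ≡ lookup ρ j → i ≡ j) where

    Agrees : Store X n → Store X k → Set
    Agrees s u = ∀ i → lookup s (lookup ρ i) ≡ lookup u i

    Framed : Store X n → Store X n → Set
    Framed s s′ = ∀ j → (∀ i → lookup ρ i ≢ j) → lookup s′ j ≡ lookup s j

    updated : ∀ {s u} → Agrees s u → ∀ i f → Agrees (updateAt s (lookup ρ i) f) (updateAt u i f) × Framed s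
        (updateAt s (lookup ρ i) f)
    updated {s} {u} A i f = agrees , λ j h → lookup∘updateAt′ j (lookup ρ i) (λ e → h i (sym e)) s
      where
      agrees : Agrees (updateAt s (lookup ρ i) f) (updateAt u i f)
      agrees j with i ≟ j
      ... | yes refl = trans (lookup∘updateAt (lookup ρ i) s) (trans (cong f (A i)) (sym (lookup∘updateAt i u)))
      ... | no i≢j   = trans (lookup∘updateAt′ (lookup ρ j) (lookup ρ i) (λ e → i≢j (sym (inj j i e))) s)
                         (trans (A j) (sym (lookup∘updateAt′ j i (i≢j ∘ sym) u)))

    run-rename : ∀ {p u u′ b} → Run tt p u u′ b → ∀ s → Agrees s u →
                 ∃[ s′ ] Run O (rename (lookup ρ) p) s s′ b × Agrees s′ u′ × Framed s s′
    run-rename skip s A = s , skip , A , λ _ _ → refl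
    run-rename (push {s = u} {i = i} {c = c}) s A = _ , push , updated {s} {u} A i (c ∷_)
    run-rename (pop {s = u} {i = i}) s A = _ , pop , updated {s} {u} A i (drop 1)
    run-rename (case {s = u} {i = i} {f = f} {t = t} d) s A =
      let s′ , r , A′ , F = run-rename d s A
      in s′ , case (subst (λ c → Run O (rename (lookup ρ) (f c)) s s′ t) (cong List.head (sym (A i))) r) , A′ , F
    run-rename (d ⨾ d′) s A =
      let s₁ , r₁ , A₁ , F₁ = run-rename d s A
          s₂ , r₂ , A₂ , F₂ = run-rename d′ s₁ A₁
      in s₂ , r₁ ⨾ r₂ , A₂ , λ j h → trans (F₂ j h) (F₁ j h)
    run-rename (done {i = i} {g = g} e) s A = s , done (trans (cong (g ∘ List.head) (A i)) e) , A , λ _ _ → refl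
    run-rename (loop {s = u} {i = i} {g = g} {f = f} {t = t} e d d′) s A =
      let s₁ , r₁ , A₁ , F₁ = run-rename d s A
          s₂ , r₂ , A₂ , F₂ = run-rename d′ s₁ A₁
      in s₂ , loop (trans (cong (g ∘ List.head) (A i)) e)
                (subst (λ c → Run O (rename (lookup ρ) (f c)) s s₁ t) (cong List.head (sym (A i))) r₁) r₂
         , A₂ , λ j h → trans (F₂ j h) (F₁ j h)
    run-rename (weaken b≤ d) s A = let s′ , r , A′ , F = run-rename d s A in s′ , weaken b≤ r , A′ , F

    -- Along a derivation only agreement and frame are tracked, which make sense for abstract `ρ`;
    -- together they pin down the final store.
    framed-scatter : ∀ {s s′ u′} → Agrees s′ u′ → Framed s s′ → s′ ≡ scatter ρ u′ s
    framed-scatter {s} {s′} {u′} A F =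
      trans (sym (tabulate∘lookup s′)) (trans (tabulate-cong same) (tabulate∘lookup (scatter ρ u′ s)))
      where
      same : ∀ j → lookup s′ j ≡ lookup (scatter ρ u′ s) j
      same j with any? (λ i → lookup ρ i ≟ j)
      ... | yes (i , refl) = trans (A i) (sym (scatter-inside ρ inj u′ s i))
      ... | no ¬p          = trans (F j (λ i e → ¬p (i , e))) (sym (scatter-outside ρ u′ s j (λ i e → ¬p (i , e))))

  use : ∀ {X κ k n} → Vec (Fin n) k → Prog X plain k → Prog X κ n
  use ρ = rename (lookup ρ)

  using-registers : ∀ {X κ k n} {O : Oracle κ} (ρ : Vec (Fin n) k) {_ : T (distinct ρ)} {p : Prog X plain k}
      {s : Store X n} {u′ b} →
    Run tt p (Vec.map (lookup s) ρ) u′ b → Run O (use ρ p) s (scatter ρ u′ s) b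
  using-registers {O = O} ρ {t} {p} {s} {u′} {b} d =
    let s′ , r , A , F = run-rename {O = O} ρ inj d s (λ i → sym (lookup-map i (lookup s) ρ))
    in subst (λ s′ → Run O (use ρ p) s s′ b) (framed-scatter {O = O} ρ inj {s} A F) r
    where
    inj : ∀ i j → lookup ρ i ≡ lookup ρ j → i ≡ j
    inj = distinct-injective ρ t

  -- For stores whose tail is not literal, such as the tapes of a simulated machine, where no list
  -- of registers could be written down.
  shiftBy : ∀ {X κ n} k → Prog X plain n → Prog X κ (suc k + n)
  shiftBy zero    p = rename suc p
  shiftBy (suc k) p = rename suc (shiftBy {κ = plain} k p)

  run-shiftBy : ∀ {X κ n k} {O : Oracle κ} {p : Prog X plain n} {s s′ b} (pre : Vec (Stack X) (suc k)) →
                Run tt p s s′ b → Run O (shiftBy k p) (pre Vec.++ s) (pre Vec.++ s′) b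
  run-shiftBy (x ∷ [])        d = run-shift d
  run-shiftBy (x ∷ pre@(_ ∷ _)) d = run-shift (run-shiftBy pre d)

-- Binary expansions of integers and dyadic numbers as lists of bits.

module BinaryDigits where

  open import Defs using (Glyph; 𝟎; 𝟏; minus; point; comma; binary; sign; wordℤ; dropTrailing𝟎; word𝔻; _/2^_)
  open import Data.Bool.Base using (Bool; true; false)
  open import Data.Digit using (toDigits; fromDigits; Expansion)
  open import Data.Fin.Base using (Fin; zero; suc; toℕ)
  open import Data.Integer.Base as ℤ using (ℤ; -[1+_])
  open import Data.List.Base as List using (List; []; _∷_; _++_; length; drop; foldr; foldl; reverse)
  open import Data.List.Properties
  open import Data.Nat.Base
  open import Data.Nat.DivMod
  open import Data.Nat.Properties
  open import Data.Nat.Tactic.RingSolver using (solve-∀)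
  open import Data.Nat.Induction using (<′-Rec; <′-wellFounded′; Acc; acc)
  open import Induction.WellFounded as WF using (module Some)
  open import Data.Product.Base using (∃-syntax; _×_; _,_; proj₁; proj₂)
  open import Function.Base using (_∘_)
  open import Relation.Binary.PropositionalEquality

  data Canonical : List Bool → Set where
    []  : Canonical []
    1∷_ : ∀ {w} → Canonical w → Canonical (true ∷ w)
    0∷_ : ∀ {b w} → Canonical (b ∷ w) → Canonical (false ∷ b ∷ w)

  -- One function serves two purposes: it prevents leading zeros in numbers listed least significant
  -- bit first, and trailing zeros in fractions listed first place first.
  scons : Bool → List Bool → List Bool
  scons false []      = []
  scons b     w       = b ∷ w

  b2n : Bool → ℕ
  b2n false = 0
  b2n true  = 1

  -- least significant bit first
  value : List Bool → ℕ
  value []      = 0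
  value (b ∷ w) = b2n b + 2 * value w

  bits : Expansion 2 → List Bool
  bits = List.map (λ { zero → false ; (suc _) → true })

  -- Zero is written with one digit and is the only expansion that is not canonical; `show` restores
  -- that digit.
  data Shape : List Bool → Set where
    0ᵇ  : Shape (false ∷ [])
    pos : ∀ {b w} → Canonical (b ∷ w) → Shape (b ∷ w)

  shape-[] : ∀ (r : Fin 2) → Shape (bits (r ∷ []))
  shape-[] zero       = 0ᵇ
  shape-[] (suc zero) = pos (1∷ [])

  shape-∷ : ∀ (r : Fin 2) ds m → fromDigits ds ≡ suc m → Shape (bits ds) → Shape (bits (r ∷ ds))
  shape-∷ r (zero ∷ []) m () s
  shape-∷ zero       (d ∷ ds) m _ (pos c) = pos (0∷ c)
  shape-∷ (suc zero) (d ∷ ds) m _ (pos c) = pos (1∷ c)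

  shape-∷∷ : ∀ (r r′ : Fin 2) y (p : ∃[ ds ] fromDigits {2} ds ≡ suc y) →
             Shape (bits (proj₁ p)) → Shape (bits (r ∷ r′ ∷ proj₁ p))
  shape-∷∷ r zero       y (ds , eq) s = shape-∷ r (zero ∷ ds) _ (cong (_* 2) eq) (shape-∷ zero ds y eq s)
  shape-∷∷ r (suc zero) y (ds , eq) s = shape-∷ r (suc zero ∷ ds) _ (cong (λ z → suc (z * 2)) eq)
      (shape-∷ (suc zero) ds y eq s)

  Expands : ℕ → Set
  Expands n = ∃[ ds ] fromDigits {2} ds ≡ n

  ShapeRec : (∀ m → <′-Rec Expands m → Expands m) → Set
  ShapeRec f = ∀ m (rec : <′-Rec Expands m) → (∀ {l} (l<m : l <′ m) → Shape (bits (proj₁ (rec l<m)))) →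
               Shape (bits (proj₁ (f m rec)))

  -- The recursor is built from applications of the functional `f`, so whatever `f` passes on from
  -- its recursive results holds of everything it builds.
  shape-builder : ∀ {f} → ShapeRec f → ∀ {x} (q : Acc _<′_ x) {y} (y<x : y <′ x) →
                  Shape (bits (proj₁ (Some.wfRecBuilder Expands f x q y<x)))
  shape-builder pres (acc rs) y<x = pres _ _ (shape-builder pres (rs y<x))

  -- The function by which toDigits recurs is local to its definition; here it
  -- is recovered by unification from the second unfolding of toDigits, where
  -- it occurs as an argument of a stuck recursor.
  mutual
    recursion : Fin 2 → Fin 2 → ℕ → ∀ m → <′-Rec Expands m → Expands m
    recursion r zero       x = _
    recursion r (suc zero) x = _

    toDigits-shape : ∀ n → Shape (bits (proj₁ (toDigits 2 n)))
    toDigits-shape n with n divMod 2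
    ... | result zero r eq      = shape-[] r
    ... | result (suc x) r refl with suc x divMod 2 | <′-wellFounded′ (toℕ r + suc x * 2)
    ...   | result zero r′ eq | _ = shape-∷ r (r′ ∷ []) x (trans (+-comm _ 0) (trans (+-comm 0 _) (sym eq)))
        (shape-[] r′)
    ...   | result (suc y) zero refl | wf = shape-∷∷ r zero y
        (Some.wfRecBuilder Expands (recursion r zero y) (suc y * 2) (wf _) _)
        (shape-builder {recursion r zero y} (recursion-shape r zero y) (wf _) _)
    ...   | result (suc y) (suc zero) refl | wf = shape-∷∷ r (suc zero) y
        (Some.wfRecBuilder Expands (recursion r (suc zero) y) (suc (suc y * 2)) (wf _) _)
        (shape-builder {recursion r (suc zero) y} (recursion-shape r (suc zero) y) (wf _) _)

    recursion-shape : ∀ r r′ x → ShapeRec (recursion r r′ x)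
    recursion-shape r zero x m rec ih with m divMod 2
    ... | result zero r eq      = shape-[] r
    ... | result (suc x) r refl = shape-∷ r (proj₁ (rec _)) x (proj₂ (rec _)) (ih _)
    recursion-shape r (suc zero) x m rec ih with m divMod 2
    ... | result zero r eq      = shape-[] r
    ... | result (suc x) r refl = shape-∷ r (proj₁ (rec _)) x (proj₂ (rec _)) (ih _)

  value-bits : ∀ ds → value (bits ds) ≡ fromDigits ds
  value-bits []              = refl
  value-bits (zero ∷ ds)     = trans (cong (2 *_) (value-bits ds)) (*-comm 2 (fromDigits ds))
  value-bits (suc zero ∷ ds) = cong suc (trans (cong (2 *_) (value-bits ds)) (*-comm 2 (fromDigits ds)))

  trim-canonical : ∀ {w} → Canonical w → foldr scons [] w ≡ w
  trim-canonical []     = refl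
  trim-canonical (1∷ c) = cong (true ∷_) (trim-canonical c)
  trim-canonical (0∷ c) = cong (scons false) (trim-canonical c)

  scons-canonical : ∀ b {w} → Canonical w → Canonical (scons b w)
  scons-canonical true  c      = 1∷ c
  scons-canonical false []     = []
  scons-canonical false (1∷ c) = 0∷ (1∷ c)
  scons-canonical false (0∷ c) = 0∷ (0∷ c)

  value-scons : ∀ b w → value (scons b w) ≡ b2n b + 2 * value w
  value-scons true  w       = refl
  value-scons false []      = refl
  value-scons false (_ ∷ _) = refl

  value-trim : ∀ w → value (foldr scons [] w) ≡ value w
  value-trim []      = refl
  value-trim (b ∷ w) = trans (value-scons b (foldr scons [] w)) (cong (λ v → b2n b + 2 * v) (value-trim w))

  trim-is-canonical : ∀ w → Canonical (foldr scons [] w)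
  trim-is-canonical []      = []
  trim-is-canonical (b ∷ w) = scons-canonical b (trim-is-canonical w)

  show : List Bool → List Bool
  show []        = false ∷ []
  show w@(_ ∷ _) = reverse w

  bitGlyph : Bool → Glyph
  bitGlyph false = 𝟎
  bitGlyph true  = 𝟏

  bitGlyphs : List Bool → List Glyph
  bitGlyphs = List.map bitGlyph

  shape-show : ∀ {w} → Shape w → reverse w ≡ show (foldr scons [] w)
  shape-show 0ᵇ                    = refl
  shape-show {b ∷ w} (pos c)       = cong show (sym (trim-canonical c))

  abstract
    -- least significant bit first, and empty for zero
    digits : ℕ → List Bool
    digits n = foldr scons [] (bits (proj₁ (toDigits 2 n)))

    canonical-digits : ∀ n → Canonical (digits n)
    canonical-digits n = trim-is-canonical (bits (proj₁ (toDigits 2 n)))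

    value-digits : ∀ n → value (digits n) ≡ n
    value-digits n = trans (value-trim (bits (proj₁ (toDigits 2 n))))
        (trans (value-bits (proj₁ (toDigits 2 n))) (proj₂ (toDigits 2 n)))

    -- The last use of the inner workings of `toDigits`: outside this block `digits` is known only
    -- through canonicity, value and this equation.
    binary-digits : ∀ n → binary n ≡ bitGlyphs (show (digits n))
    binary-digits n = trans
      (map-cong (λ { zero → refl ; (suc zero) → refl }) (reverse (proj₁ (toDigits 2 n))))
      (trans (map-∘ (reverse (proj₁ (toDigits 2 n))))
      (trans (cong bitGlyphs (reverse-map _ (proj₁ (toDigits 2 n))))
      (cong bitGlyphs (shape-show (toDigits-shape n)))))

  value>0 : ∀ {b w} → Canonical (b ∷ w) → 0 < value (b ∷ w)
  value>0 (1∷ c) = s≤s z≤n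
  value>0 (0∷ c) = ≤-trans (value>0 c) (m≤m+n _ _)

  parity-injective : ∀ b c m n → b2n b + 2 * m ≡ b2n c + 2 * n → b ≡ c × m ≡ n
  parity-injective false false m n e = refl , *-cancelˡ-≡ m n 2 e
  parity-injective true  true  m n e = refl , *-cancelˡ-≡ m n 2 (suc-injective e)
  parity-injective false true  m n e with () ← even≢odd m n e
  parity-injective true  false m n e with () ← even≢odd n m (sym e)

  canonical-tail : ∀ {b w} → Canonical (b ∷ w) → Canonical w
  canonical-tail (1∷ c) = c
  canonical-tail (0∷ c) = c

  -- The first bit is the parity of the value and the rest its half; the empty list stands alone
  -- because a nonempty canonical list has positive value. Hence `digits n` can be found by
  -- exhibiting any canonical list of value `n`.
  canonical-unique : ∀ {w w′} → Canonical w → Canonical w′ → value w ≡ value w′ → w ≡ w′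
  canonical-unique {[]}    {[]}      _ _  _ = refl
  canonical-unique {[]}    {_ ∷ _}   _ c′ e with () ← subst (0 <_) (sym e) (value>0 c′)
  canonical-unique {_ ∷ _} {[]}      c _  e with () ← subst (0 <_) e (value>0 c)
  canonical-unique {b ∷ w} {b′ ∷ w′} c c′ e with parity-injective b b′ (value w) (value w′) e
  ... | refl , e′ = cong (b ∷_) (canonical-unique (canonical-tail c) (canonical-tail c′) e′)

  digits-value : ∀ {w n} → Canonical w → value w ≡ n → digits n ≡ w
  digits-value {w} {n} c e = canonical-unique (canonical-digits n) c (trans (value-digits n) (sym e))

  digits-scons : ∀ b n → digits (b2n b + 2 * n) ≡ scons b (digits n)
  digits-scons b n = digits-value (scons-canonical b (canonical-digits n))
    (trans (value-scons b (digits n)) (cong (λ v → b2n b + 2 * v) (value-digits n)))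

  odd : ℕ → Bool
  odd n with n % 2
  ... | zero  = false
  ... | suc _ = true

  n≡odd+2half : ∀ n → n ≡ b2n (odd n) + 2 * (n / 2)
  n≡odd+2half n with n % 2 | m≡m%n+[m/n]*n n 2 | m%n<n n 2
  ... | zero        | e | _ = trans e (*-comm (n / 2) 2)
  ... | suc zero    | e | _ = trans e (cong suc (*-comm (n / 2) 2))
  ... | suc (suc _) | _ | s≤s (s≤s ())

  digits-unfold : ∀ n → digits n ≡ scons (odd n) (digits (n / 2))
  digits-unfold n = trans (cong digits (n≡odd+2half n)) (digits-scons (odd n) (n / 2))

  headBit : List Bool → Bool
  headBit []      = false
  headBit (b ∷ _) = b

  scons-head : ∀ b w → headBit (scons b w) ≡ b
  scons-head true  w       = refl
  scons-head false []      = refl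
  scons-head false (_ ∷ _) = refl

  scons-tail : ∀ b w → drop 1 (scons b w) ≡ w
  scons-tail true  w       = refl
  scons-tail false []      = refl
  scons-tail false (_ ∷ _) = refl

  digits-head : ∀ n → headBit (digits n) ≡ odd n
  digits-head n = trans (cong headBit (digits-unfold n)) (scons-head (odd n) (digits (n / 2)))

  digits-tail : ∀ n → drop 1 (digits n) ≡ digits (n / 2)
  digits-tail n = trans (cong (drop 1) (digits-unfold n)) (scons-tail (odd n) (digits (n / 2)))

  digits-0 : digits 0 ≡ []
  digits-0 = digits-value [] refl

  digits-lower : ∀ n b w → digits n ≡ b ∷ w → 2 ^ length w ≤ n
  digits-lower n b w e = subst (2 ^ length w ≤_) (trans (cong value (sym e)) (value-digits n))
    (lower (subst Canonical e (canonical-digits n)))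
    where
    lower : ∀ {b w} → Canonical (b ∷ w) → 2 ^ length w ≤ value (b ∷ w)
    lower {w = []}    (1∷ c) = s≤s z≤n
    lower {w = _ ∷ _} (1∷ c) = ≤-trans (*-monoʳ-≤ 2 (lower c)) (n≤1+n _)
    lower             (0∷ c) = *-monoʳ-≤ 2 (lower c)

  value-upper : ∀ w → value w < 2 ^ length w
  value-upper []          = s≤s z≤n
  value-upper (false ∷ w) = *-monoʳ-< 2 (value-upper w)
  value-upper (true ∷ w)  = begin
    2 + 2 * value w       ≡⟨ solve-∀′ (value w) ⟩
    2 * suc (value w)     ≤⟨ *-monoʳ-≤ 2 (value-upper w) ⟩
    2 * 2 ^ length w      ∎
    where
    open ≤-Reasoning
    solve-∀′ : ∀ v → 2 + 2 * v ≡ 2 * suc v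
    solve-∀′ = solve-∀

  digits-upper : ∀ n → n < 2 ^ length (digits n)
  digits-upper n = subst (_< 2 ^ length (digits n)) (value-digits n) (value-upper (digits n))

  -- most significant bit first
  horner : ℕ → List Bool → ℕ
  horner = List.foldl (λ a b → b2n b + 2 * a)

  horner-reverse : ∀ w → horner 0 (reverse w) ≡ value w
  horner-reverse w = trans (reverse-foldl (λ a b → b2n b + 2 * a) 0 w) (fold w)
    where
    fold : ∀ w → foldr (λ b a → b2n b + 2 * a) 0 w ≡ value w
    fold []      = refl
    fold (b ∷ w) = cong (λ v → b2n b + 2 * v) (fold w)

  horner-show : ∀ w → horner 0 (show w) ≡ value w
  horner-show []        = refl
  horner-show w@(_ ∷ _) = horner-reverse w

  -- The first j binary places after the point of n / 2^j, without trailing zeros.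
  frac : ℕ → ℕ → List Bool
  frac zero    n = []
  frac (suc j) n = scons (odd ((n / 2 ^ j) {{m^n≢0 2 j}})) (frac j n)

  stripZeros : List Glyph → List Glyph
  stripZeros (𝟎 ∷ w) = stripZeros w
  stripZeros w       = w

  dropTrailing-reverse : ∀ w → dropTrailing𝟎 (reverse w) ≡ reverse (stripZeros w)
  dropTrailing-reverse (𝟎 ∷ w) = trans step (dropTrailing-reverse w)
    where
    step : dropTrailing𝟎 (reverse (𝟎 ∷ w)) ≡ dropTrailing𝟎 (reverse w)
    step rewrite reverse-involutive (𝟎 ∷ w) | reverse-involutive w = refl
  dropTrailing-reverse []            = refl
  dropTrailing-reverse w@(𝟏 ∷ _)     rewrite reverse-involutive w = refl
  dropTrailing-reverse w@(minus ∷ _) rewrite reverse-involutive w = refl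
  dropTrailing-reverse w@(point ∷ _) rewrite reverse-involutive w = refl
  dropTrailing-reverse w@(comma ∷ _) rewrite reverse-involutive w = refl

  dropTrailing-strip : ∀ w → dropTrailing𝟎 w ≡ reverse (stripZeros (reverse w))
  dropTrailing-strip w = trans (cong dropTrailing𝟎 (sym (reverse-involutive w))) (dropTrailing-reverse (reverse w))

  strip-[] : ∀ u c → stripZeros u ≡ [] → stripZeros (u ++ c ∷ []) ≡ stripZeros (c ∷ [])
  strip-[] []      c e = refl
  strip-[] (𝟎 ∷ u) c e = strip-[] u c e

  strip-∷ : ∀ u c {d v} → stripZeros u ≡ d ∷ v → stripZeros (u ++ c ∷ []) ≡ (d ∷ v) ++ c ∷ []
  strip-∷ (𝟎 ∷ u)     c e = strip-∷ u c e
  strip-∷ (𝟏 ∷ u)     c refl = refl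
  strip-∷ (minus ∷ u) c refl = refl
  strip-∷ (point ∷ u) c refl = refl
  strip-∷ (comma ∷ u) c refl = refl

  strip-bit : ∀ b → reverse (stripZeros (bitGlyph b ∷ [])) ≡ bitGlyphs (scons b [])
  strip-bit false = refl
  strip-bit true  = refl

  scons-∷ : ∀ b x w → scons b (x ∷ w) ≡ b ∷ x ∷ w
  scons-∷ false x w = refl
  scons-∷ true  x w = refl

  -- A zero survives exactly if something to its right survives, which is what the right fold with
  -- `scons` tests.
  dropTrailing-bits : ∀ w → dropTrailing𝟎 (bitGlyphs w) ≡ bitGlyphs (foldr scons [] w)
  dropTrailing-bits []      = refl
  dropTrailing-bits (b ∷ w) = trans (dropTrailing-strip (bitGlyphs (b ∷ w)))
      (trans (cong (reverse ∘ stripZeros) (unfold-reverse (bitGlyph b) (bitGlyphs w)))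
    (split (stripZeros (reverse (bitGlyphs w))) refl (foldr scons [] w)
        (trans (sym (dropTrailing-strip (bitGlyphs w))) (dropTrailing-bits w))))
    where
    split : ∀ v → stripZeros (reverse (bitGlyphs w)) ≡ v → ∀ t → reverse (stripZeros (reverse (bitGlyphs w))) ≡
        bitGlyphs t →
            reverse (stripZeros (reverse (bitGlyphs w) ++ bitGlyph b ∷ [])) ≡ bitGlyphs (scons b t)
    split [] e [] ih rewrite strip-[] (reverse (bitGlyphs w)) (bitGlyph b) e = strip-bit b
    split [] e (_ ∷ _) ih rewrite e with () ← ih
    split (d ∷ v) e [] ih rewrite e with () ← trans (sym (length-reverse (d ∷ v))) (cong length ih)
    split (d ∷ v) e (x ∷ t) ih rewrite strip-∷ (reverse (bitGlyphs w)) (bitGlyph b) e | e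
      | reverse-++ (d ∷ v) (bitGlyph b ∷ []) = trans (cong (bitGlyph b ∷_) ih) (cong bitGlyphs (sym (scons-∷ b x t)))

  -- Stated for any `f` with the right values, because the digit function of `word𝔻` is local to it
  -- and cannot be named.
  frac-down : ∀ (f : ℕ → Glyph) n → (∀ i → f i ≡ bitGlyph (odd ((n / 2 ^ i) {{m^n≢0 2 i}}))) →
              ∀ j → dropTrailing𝟎 (List.applyDownFrom f j) ≡ bitGlyphs (frac j n)
  frac-down f n h j = trans (cong dropTrailing𝟎 (down j))
      (trans (dropTrailing-bits (places j)) (cong bitGlyphs (trim j)))
    where
    places : ℕ → List Bool
    places = List.applyDownFrom (λ i → odd ((n / 2 ^ i) {{m^n≢0 2 i}}))
    down : ∀ j → List.applyDownFrom f j ≡ bitGlyphs (places j)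
    down zero    = refl
    down (suc j) = cong₂ _∷_ (h j) (down j)
    trim : ∀ j → foldr scons [] (places j) ≡ frac j n
    trim zero    = refl
    trim (suc j) = cong (scons _) (trim j)

  wordℤ-digits : ∀ i → wordℤ i ≡ sign i ++ bitGlyphs (show (digits ℤ.∣ i ∣))
  wordℤ-digits i = cong (sign i ++_) (binary-digits ℤ.∣ i ∣)

  -- The digits written by word𝔻, recovered by unification from its definition.
  mutual
    placeGlyph : ℤ → ℕ → ℕ → Glyph
    placeGlyph a b = _

    word𝔻-digits : ∀ a b → word𝔻 (a /2^ b) ≡
      sign a ++ bitGlyphs (show (digits ((ℤ.∣ a ∣ / 2 ^ b) {{m^n≢0 2 b}}))) ++ point ∷ bitGlyphs (frac b ℤ.∣ a ∣)
    word𝔻-digits a b = cong₂ (λ u v → sign a ++ u ++ point ∷ v)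
      (binary-digits ((ℤ.∣ a ∣ / 2 ^ b) {{m^n≢0 2 b}})) (frac-down (placeGlyph a b) ℤ.∣ a ∣ (placeGlyph-odd a b) b)

    placeGlyph-odd : ∀ a b i → placeGlyph a b i ≡ bitGlyph (odd ((ℤ.∣ a ∣ / 2 ^ i) {{m^n≢0 2 i}}))
    placeGlyph-odd a b i with (ℤ.∣ a ∣ / 2 ^ i) {{m^n≢0 2 i}} % 2
    ... | zero  = refl
    ... | suc _ = refl

-- Moving, counting, unary arithmetic, and conversion between words and numbers.

module Subroutines where

  open import Defs using (plain; Oracle; Glyph; 𝟎; 𝟏; minus; point; unary; wordℤ)
  open StackPrograms
  open Renaming
  open BinaryDigits
  open import Data.Bool.Base using (Bool; true; false; if_then_else_)
  open import Data.Fin.Base using (Fin; zero; suc)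
  open import Data.List.Base as List using (List; []; _∷_; _++_; length; drop; reverse; _ʳ++_; replicate)
  open import Data.List.Properties
  open import Data.Integer.Base as ℤ using (ℤ; -[1+_])
  open import Data.Maybe.Base using (Maybe; just; nothing; is-just)
  open import Data.Nat.Base
  open import Data.Nat.DivMod
  open import Data.Nat.Properties
  open import Data.Nat.Tactic.RingSolver using (solve-∀)
  open import Data.Product.Base using (∃-syntax; _,_)
  open import Data.Unit.Base using (tt)
  open import Data.Vec.Base as Vec using ([]; _∷_)
  open import Relation.Binary.PropositionalEquality

  private variable
    X : Set
    n : ℕ

  r0 : Fin (1 + n)
  r0 = zero
  r1 : Fin (2 + n)
  r1 = suc r0
  r2 : Fin (3 + n)
  r2 = suc r1
  r3 : Fin (4 + n)
  r3 = suc r2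
  r4 : Fin (5 + n)
  r4 = suc r3
  r5 : Fin (6 + n)
  r5 = suc r4
  r6 : Fin (7 + n)
  r6 = suc r5
  r7 : Fin (8 + n)
  r7 = suc r6
  r8 : Fin (9 + n)
  r8 = suc r7
  r9 : Fin (10 + n)
  r9 = suc r8
  r10 : Fin (11 + n)
  r10 = suc r9
  r11 : Fin (12 + n)
  r11 = suc r10
  r12 : Fin (13 + n)
  r12 = suc r11
  r13 : Fin (14 + n)
  r13 = suc r12
  r14 : Fin (15 + n)
  r14 = suc r13
  r15 : Fin (16 + n)
  r15 = suc r14
  r16 : Fin (17 + n)
  r16 = suc r15
  r17 : Fin (18 + n)
  r17 = suc r16
  r18 : Fin (19 + n)
  r18 = suc r17
  r19 : Fin (20 + n)
  r19 = suc r18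
  r20 : Fin (21 + n)
  r20 = suc r19
  r21 : Fin (22 + n)
  r21 = suc r20
  r22 : Fin (23 + n)
  r22 = suc r21
  r23 : Fin (24 + n)
  r23 = suc r22
  r24 : Fin (25 + n)
  r24 = suc r23

  ones : ℕ → Stack X
  ones n = word (unary n)

  bitsˢ : List Bool → Stack X
  bitsˢ w = word (bitGlyphs w)

  num : ℕ → Stack X
  num n = bitsˢ (digits n)

  weaken-≡ : ∀ {κ} {O : Oracle κ} {s s′ : Store X n} {p t t′} → Run O p s s′ t → t ≡ t′ → Run O p s s′ t′
  weaken-≡ d refl = d

  to : ∀ {κ} {O : Oracle κ} {s s′ s″ : Store X n} {p t} → s′ ≡ s″ → Run O p s s′ t → Run O p s s″ t
  to refl d = d

  by-program : ∀ {κ} {O : Oracle κ} {s s′ : Store X n} {p q t} → p ≡ q → Run O p s s′ t → Run O q s s′ t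
  by-program refl d = d

  pushTop : Fin n → Maybe (Letter X) → Prog X plain n
  pushTop i nothing  = skip
  pushTop i (just c) = push i c

  move : Prog X plain 2
  move = while r0 is-just (λ c → pop r0 ⨾ pushTop r1 c)

  move-run : ∀ (xs ys : Stack X) → Run tt move (xs ∷ ys ∷ []) ([] ∷ (xs ʳ++ ys) ∷ []) (suc (length xs * 4))
  move-run []       ys = done refl
  move-run (x ∷ xs) ys = loop refl (pop ⨾ push) (move-run xs (x ∷ ys))

  clear : Prog X plain 1
  clear = while r0 is-just (λ _ → pop r0)

  clear-run : ∀ (xs : Stack X) → Run tt clear (xs ∷ []) ([] ∷ []) (suc (length xs * 2))
  clear-run []       = done refl
  clear-run (x ∷ xs) = loop refl pop (clear-run xs)

  tally : Letter X → Prog X plain 3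
  tally c = while r0 is-just (λ d → pop r0 ⨾ pushTop r1 d ⨾ push r2 c)

  replicate-∷ : ∀ {A : Set} n (c : A) zs → replicate n c ++ c ∷ zs ≡ c ∷ replicate n c ++ zs
  replicate-∷ zero    c zs = refl
  replicate-∷ (suc n) c zs = cong (c ∷_) (replicate-∷ n c zs)

  tally-run : ∀ (c : Letter X) xs ys zs → Run tt (tally c) (xs ∷ ys ∷ zs ∷ [])
                ([] ∷ (xs ʳ++ ys) ∷ (replicate (length xs) c ++ zs) ∷ []) (suc (length xs * 6))
  tally-run c []       ys zs = done refl
  tally-run c (x ∷ xs) ys zs = to (cong (λ v → _ ∷ _ ∷ v ∷ []) (replicate-∷ (length xs) c zs))
    (loop refl (pop ⨾ push ⨾ push) (tally-run c xs (x ∷ ys) (c ∷ zs)))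

  -- Pushes one `c` on the last register for each entry of the first, which is
  -- preserved; the second register must be empty.
  measure : Letter X → Prog X plain 3
  measure c = tally c ⨾ use (r1 ∷ r0 ∷ []) move

  measureCost : ℕ → ℕ
  measureCost n = suc (n * 6) + suc (n * 4)

  -- `move` reverses; two moves through an empty scratch stack restore the order.
  ʳ++-[] : ∀ {A : Set} (xs : List A) → (xs ʳ++ []) ʳ++ [] ≡ xs
  ʳ++-[] xs = trans (ʳ++-ʳ++ xs) (++-identityʳ xs)

  measure-run : ∀ (c : Letter X) xs zs → Run tt (measure c) (xs ∷ [] ∷ zs ∷ [])
                  (xs ∷ [] ∷ (replicate (length xs) c ++ zs) ∷ []) (measureCost (length xs))
  measure-run c xs zs = weaken-≡ (to (cong (λ v → v ∷ [] ∷ (replicate (length xs) c ++ zs) ∷ []) (ʳ++-[] xs))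
    (tally-run c xs [] zs ⨾ using-registers (r1 ∷ r0 ∷ []) (move-run (xs ʳ++ []) [])))
    (cong (λ l → suc (length xs * 6) + suc (l * 4)) (trans (length-ʳ++ xs) (+-identityʳ (length xs))))

  replicate-word : ∀ n (c : Glyph) → replicate n (gl {X} c) ≡ word (replicate n c)
  replicate-word n c = sym (map-replicate gl n c)

  length-ones : ∀ n → length (ones {X} n) ≡ n
  length-ones n = trans (length-map gl (unary n)) (length-replicate n)

  ones-+ : ∀ m n → replicate m (gl {X} 𝟏) ++ ones n ≡ ones (m + n)
  ones-+ zero    n = refl
  ones-+ (suc m) n = cong (gl 𝟏 ∷_) (ones-+ m n)

  ones-ʳ++ : ∀ m n → ones {X} m ʳ++ ones n ≡ ones (m + n)
  ones-ʳ++ zero    n = refl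
  ones-ʳ++ (suc m) n = trans (ones-ʳ++ m (suc n)) (cong ones (+-suc m n))

  measure-ones : ∀ m n → Run tt (measure (gl {X} 𝟏)) (ones m ∷ [] ∷ ones n ∷ []) (ones m ∷ [] ∷ ones (m + n) ∷ [])
      (measureCost m)
  measure-ones {X} m n = subst (λ l → Run tt (measure (gl 𝟏)) (ones m ∷ [] ∷ ones n ∷ [])
      (ones m ∷ [] ∷ ones (l + n) ∷ []) (measureCost l))
    (length-ones {X} m)
    (to (cong (λ v → _ ∷ _ ∷ v ∷ []) (ones-+ (length (ones {X} m)) n)) (measure-run (gl 𝟏) (ones m) (ones n)))

  move-ones : ∀ m n → Run tt move (ones {X} m ∷ ones n ∷ []) ([] ∷ ones (m + n) ∷ []) (suc (m * 4))
  move-ones {X} m n = weaken-≡ (to (cong (λ v → _ ∷ v ∷ []) (ones-ʳ++ m n)) (move-run (ones m) (ones n)))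
    (cong (λ l → suc (l * 4)) (length-ones {X} m))

  -- registers: u, scratch, v, scratch
  times : Prog X plain 4
  times = use (r2 ∷ r3 ∷ []) move ⨾ while r3 is-just (λ _ → pop r3 ⨾ use (r0 ∷ r1 ∷ r2 ∷ []) (measure (gl 𝟏)))

  timesCost : ℕ → ℕ → ℕ
  timesCost u v = suc (v * 4) + suc (v * (2 + measureCost u))

  times-run : ∀ u v → Run tt times (ones {X} u ∷ [] ∷ ones v ∷ [] ∷ []) (ones u ∷ [] ∷ ones (v * u) ∷ [] ∷ [])
      (timesCost u v)
  times-run {X} u v = using-registers (r2 ∷ r3 ∷ []) (move-ones v 0) ⨾
    subst (λ k → Run tt (while r3 is-just (λ _ → pop r3 ⨾ use (r0 ∷ r1 ∷ r2 ∷ []) (measure (gl 𝟏))))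
        (ones u ∷ [] ∷ [] ∷ ones k ∷ []) (ones u ∷ [] ∷ ones (v * u) ∷ [] ∷ []) (suc (v * (2 + measureCost u))))
        (sym (+-identityʳ v))
      (to (cong (λ k → ones u ∷ [] ∷ ones k ∷ [] ∷ []) (+-identityʳ (v * u))) (iterate v 0))
    where
    iterate : ∀ v k → Run tt (while r3 is-just (λ _ → pop r3 ⨾ use (r0 ∷ r1 ∷ r2 ∷ []) (measure (gl 𝟏))))
      (ones {X} u ∷ [] ∷ ones k ∷ ones v ∷ []) (ones u ∷ [] ∷ ones (v * u + k) ∷ [] ∷ [])
          (suc (v * (2 + measureCost u)))
    iterate zero    k = done refl
    iterate (suc v) k = weaken-≡ (to (cong (λ k → ones u ∷ [] ∷ ones k ∷ [] ∷ []) (solve₁ u v k))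
      (loop refl (pop ⨾ using-registers (r0 ∷ r1 ∷ r2 ∷ []) (measure-ones u k)) (iterate v (u + k))))
      (cong (λ t → suc (suc t)) (+-suc (measureCost u) (v * (2 + measureCost u))))
      where
      solve₁ : ∀ u v k → v * u + (u + k) ≡ u + v * u + k
      solve₁ = solve-∀

  power : ℕ → Prog X plain 4
  power zero    = push r2 (gl 𝟏)
  power (suc e) = power e ⨾ times

  powerCost : ℕ → ℕ → ℕ
  powerCost zero    u = 2
  powerCost (suc e) u = powerCost e u + timesCost u (u ^ e)

  power-run : ∀ e u → Run tt (power e) (ones {X} u ∷ [] ∷ [] ∷ [] ∷ []) (ones u ∷ [] ∷ ones (u ^ e) ∷ [] ∷ [])
      (powerCost e u)
  power-run zero    u = push
  power-run (suc e) u = to (cong (λ k → ones u ∷ [] ∷ ones k ∷ [] ∷ []) (*-comm (u ^ e) u))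
      (power-run e u ⨾ times-run u (u ^ e))

  bit : Bool → Letter X
  bit b = gl (bitGlyph b)

  -- An exhausted stack reads as an endless supply of zeros, which is right both for numbers with
  -- the least significant bit on top and for finite binary fractions.
  bitOf : Maybe (Letter X) → Bool
  bitOf (just (gl 𝟏)) = true
  bitOf _             = false

  isBit : Maybe (Letter X) → Bool
  isBit (just (gl 𝟎)) = true
  isBit (just (gl 𝟏)) = true
  isBit _             = false

  bitOf-bit : ∀ b → bitOf {X} (just (bit b)) ≡ b
  bitOf-bit false = refl
  bitOf-bit true  = refl

  isBit-bit : ∀ b → isBit {X} (just (bit b)) ≡ true
  isBit-bit false = refl
  isBit-bit true  = refl

  bitOf-bitsˢ : ∀ w → bitOf {X} (List.head (bitsˢ w)) ≡ headBit w
  bitOf-bitsˢ []      = refl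
  bitOf-bitsˢ (b ∷ w) = bitOf-bit b

  drop-bitsˢ : ∀ w → drop 1 (bitsˢ {X} w) ≡ bitsˢ (drop 1 w)
  drop-bitsˢ []      = refl
  drop-bitsˢ (b ∷ w) = refl

  -- `scons` as a program: the emptiness test keeps every stored number canonical, so that the store
  -- is determined by the number.
  spush : Bool → Prog X plain 1
  spush true  = push r0 (gl 𝟏)
  spush false = case r0 (λ { nothing → skip ; (just _) → push r0 (gl 𝟎) })

  spush-run : ∀ b w → Run tt (spush b) (bitsˢ {X} w ∷ []) (bitsˢ (scons b w) ∷ []) 3
  spush-run true  w       = weaken (s≤s (s≤s z≤n)) push
  spush-run false []      = weaken (s≤s z≤n) (case skip)
  spush-run false (b ∷ w) = case push

  -- registers: source, number
  parse : Prog X plain 2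
  parse = while r0 isBit (λ c → pop r0 ⨾ use (r1 ∷ []) (spush (bitOf c)))

  -- Pushing a bit on a number kept least significant bit first is a Horner step, so reading a word
  -- from its leading bit accumulates its value.
  parse-run : ∀ w rest a → isBit (List.head rest) ≡ false →
    Run tt parse ((bitsˢ {X} w ++ rest) ∷ num a ∷ []) (rest ∷ num (horner a w) ∷ []) (suc (length w * 5))
  parse-run []      rest a e = done e
  parse-run {X} (b ∷ w) rest a e = loop (isBit-bit b)
    (pop ⨾ subst (λ v → Run tt (use (r1 ∷ []) (spush v)) ((bitsˢ w ++ rest) ∷ num a ∷ [])
        ((bitsˢ w ++ rest) ∷ num (b2n b + 2 * a) ∷ []) 3)
      (sym (bitOf-bit b))
      (to (cong (λ v → _ ∷ bitsˢ v ∷ []) (sym (digits-scons b a)))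
          (using-registers (r1 ∷ []) (spush-run b (digits a)))))
    (parse-run w rest (b2n b + 2 * a) e)

  -- registers: number, output
  emit : Prog X plain 2
  emit = case r0 (λ { nothing → push r1 (gl 𝟎) ; (just _) → move })

  bits-ʳ++ : ∀ w (o : Stack X) → bitsˢ w ʳ++ o ≡ bitsˢ (reverse w) ++ o
  bits-ʳ++ w o = trans (ʳ++-defn (bitsˢ w)) (cong (_++ o)
    (trans (sym (reverse-map gl (bitGlyphs w))) (cong word (sym (reverse-map bitGlyph w)))))

  length-bitsˢ : ∀ w → length (bitsˢ {X} w) ≡ length w
  length-bitsˢ w = trans (length-map gl (bitGlyphs w)) (length-map bitGlyph w)

  emit-run : ∀ w (o : Stack X) → Run tt emit (bitsˢ w ∷ o ∷ []) ([] ∷ (bitsˢ (show w) ++ o) ∷ []) (3 + length w * 4)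
  emit-run []          o = case push
  emit-run {X} w@(b ∷ v) o = weaken (s≤s (s≤s (≤-trans (≤-reflexive (cong (_* 4) (length-bitsˢ {X} w))) (n≤1+n _))))
    (to (cong (λ v → [] ∷ v ∷ []) (bits-ʳ++ w o)) (case (move-run (bitsˢ w) o)))

  signed : Bool → ℕ → ℤ
  signed false n = ℤ.+ n
  signed true  n = ℤ.- (ℤ.+ n)

  signGlyph : Bool → List Glyph
  signGlyph false = []
  signGlyph true  = minus ∷ []

  moveSign-run : ∀ g (o : Stack X) → Run tt move (word (signGlyph g) ∷ o ∷ []) ([] ∷ (word (signGlyph g) ++ o) ∷ []) 5
  moveSign-run false o = weaken (s≤s z≤n) (move-run [] o)
  moveSign-run true  o = move-run (gl minus ∷ []) o

  -- registers: sign, absolute value, output; zero is written without sign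
  emitℤ : Prog X plain 3
  emitℤ = case r1 (λ { nothing  → push r2 (gl 𝟎) ⨾ use (r0 ∷ []) clear
                     ; (just _) → use (r1 ∷ r2 ∷ []) move ⨾ use (r0 ∷ r2 ∷ []) move })

  clearSign-run : ∀ g → Run tt clear (word {X} (signGlyph g) ∷ []) ([] ∷ []) 3
  clearSign-run false = weaken (s≤s z≤n) (clear-run [])
  clearSign-run true  = clear-run (gl minus ∷ [])

  wordℤ-signed : ∀ g n → wordℤ (signed g n) ≡ (if 1 ≤ᵇ n then signGlyph g else []) ++ bitGlyphs (show (digits n))
  wordℤ-signed false zero    = wordℤ-digits (ℤ.+ zero)
  wordℤ-signed false (suc n) = wordℤ-digits (ℤ.+ suc n)
  wordℤ-signed true  zero    = wordℤ-digits (ℤ.+ zero)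
  wordℤ-signed true  (suc n) = wordℤ-digits (ℤ.- (ℤ.+ suc n))

  emitℤ-run : ∀ g n (o : Stack X) → Run tt emitℤ (word (signGlyph g) ∷ num n ∷ o ∷ [])
                ([] ∷ [] ∷ (word (wordℤ (signed g n)) ++ o) ∷ []) (7 + length (digits n) * 4)
  emitℤ-run {X} g zero o rewrite wordℤ-signed g 0 | digits-0 = weaken (≤-trans (≤-reflexive refl) (n≤1+n _))
    (case (push ⨾ using-registers (r0 ∷ []) (clearSign-run g)))
  emitℤ-run {X} g (suc n) o rewrite wordℤ-signed g (suc n) with digits (suc n) in eq
  ... | [] with () ← trans (sym (value-digits (suc n))) (cong value eq)
  ... | w@(b ∷ v) = weaken-≡ (to (cong (λ v → [] ∷ [] ∷ v ∷ []) split)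
        (case (using-registers (r1 ∷ r2 ∷ []) (move-run (bitsˢ w) o) ⨾ using-registers (r0 ∷ r2 ∷ [])
            (moveSign-run g (bitsˢ w ʳ++ o)))))
        (trans (cong (λ l → suc (suc (l * 4) + 5)) (length-bitsˢ {X} w))
            (cong (λ t → suc (suc t)) (+-comm (length w * 4) 5)))
    where
    split : word {X} (signGlyph g) ++ (bitsˢ w ʳ++ o) ≡ word (signGlyph g ++ bitGlyphs (reverse w)) ++ o
    split = trans (cong (word (signGlyph g) ++_) (bits-ʳ++ w o))
      (trans (sym (++-assoc (word (signGlyph g)) (bitsˢ (reverse w)) o))
          (cong (_++ o) (sym (map-++ gl (signGlyph g) (bitGlyphs (reverse w))))))

  -- registers: source, sign
  parseSign : Prog X plain 2
  parseSign = case r0 (λ { (just (gl minus)) → pop r0 ⨾ push r1 (gl minus) ; _ → skip })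

  parseSign-run : ∀ g w (rest : Stack X) → Run tt parseSign ((word (signGlyph g) ++ bitsˢ (show w) ++ rest) ∷ [] ∷ [])
    ((bitsˢ (show w) ++ rest) ∷ word (signGlyph g) ∷ []) 4
  parseSign-run true  w  rest = case (pop ⨾ push)
  parseSign-run {X} false w rest = weaken (s≤s z≤n) (unsigned (show w) (show-∷ w))
    where
    show-∷ : ∀ w → ∃[ b ] ∃[ v ] show w ≡ b ∷ v
    show-∷ []      = false , [] , refl
    show-∷ (b ∷ w) with show (b ∷ w) in eq
    ... | c ∷ v = c , v , refl
    ... | [] with () ← trans (sym (length-reverse (b ∷ w))) (cong length eq)
    unsigned : ∀ v → (∃[ b ] ∃[ u ] v ≡ b ∷ u) → Run tt parseSign ((bitsˢ v ++ rest) ∷ [] ∷ [])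
        ((bitsˢ v ++ rest) ∷ [] ∷ []) 1
    unsigned _ (false , _ , refl) = case skip
    unsigned _ (true  , _ , refl) = case skip

  _>>_ : ℕ → ℕ → ℕ
  m >> n = (m / 2 ^ n) {{m^n≢0 2 n}}

  >>-suc : ∀ m j → (m >> j) / 2 ≡ m >> suc j
  >>-suc m j = trans (m/n/o≡m/[n*o] m (2 ^ j) 2 {{m^n≢0 2 j}} {{_}} {{m*n≢0 (2 ^ j) 2 {{m^n≢0 2 j}}}})
    (/-congʳ {{m*n≢0 (2 ^ j) 2 {{m^n≢0 2 j}}}} {{m^n≢0 2 (suc j)}} (*-comm (2 ^ j) 2))

  >>-zero : ∀ m → m >> 0 ≡ m
  >>-zero m = n/1≡n m

  popBit-run : ∀ n → drop 1 (num {X} n) ≡ num (n / 2)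
  popBit-run n = trans (drop-bitsˢ (digits n)) (cong bitsˢ (digits-tail n))

  -- registers: number, count, output
  splitFrac : Prog X plain 3
  splitFrac = while r1 is-just (λ _ → pop r1 ⨾ case r0 (λ c → use (r2 ∷ []) (spush (bitOf c))) ⨾ pop r0)

  -- Bits leave the number from its low end, that is from the last binary place, so the fraction is
  -- built from right to left and `spush` drops its trailing zeros on the way. `j` counts the places
  -- already moved.
  splitFrac-run : ∀ n r j → Run tt splitFrac (num {X} (n >> j) ∷ ones r ∷ bitsˢ (frac j n) ∷ [])
    (num (n >> (r + j)) ∷ [] ∷ bitsˢ (frac (r + j) n) ∷ []) (suc (r * 7))
  splitFrac-run n zero    j = done refl
  splitFrac-run {X} n (suc r) j = to (cong (λ k → num (n >> k) ∷ [] ∷ bitsˢ (frac k n) ∷ []) (+-suc r j))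
    (loop refl
      (pop ⨾ case (subst (λ b → Run tt (use (r2 ∷ []) (spush b)) (num (n >> j) ∷ ones r ∷ bitsˢ (frac j n) ∷ [])
          (num (n >> j) ∷ ones r ∷ bitsˢ (frac (suc j) n) ∷ []) 3)
          (sym (trans (bitOf-bitsˢ {X} (digits (n >> j))) (digits-head (n >> j))))
          (using-registers (r2 ∷ []) (spush-run (odd (n >> j)) (frac j n))))
        ⨾ to (cong (λ v → v ∷ ones r ∷ bitsˢ (frac (suc j) n) ∷ [])
            (trans (popBit-run (n >> j)) (cong num (>>-suc n j)))) pop)
      (splitFrac-run n r (suc j)))

  -- registers: number, count, output
  format : Prog X plain 3
  format = splitFrac ⨾ push r2 (gl point) ⨾ use (r0 ∷ r2 ∷ []) emit

  formatCost : ℕ → ℕ → ℕ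
  formatCost n b = suc (b * 7) + (2 + (3 + length (digits (n >> b)) * 4))

  format-run : ∀ n b → Run tt format (num {X} n ∷ ones b ∷ [] ∷ [])
    ([] ∷ [] ∷ word (bitGlyphs (show (digits (n >> b))) ++ point ∷ bitGlyphs (frac b n)) ∷ []) (formatCost n b)
  format-run {X} n b = subst₂ (λ m k → Run tt splitFrac (num m ∷ ones b ∷ [] ∷ [])
      (num (n >> k) ∷ [] ∷ bitsˢ (frac k n) ∷ []) (suc (b * 7)))
      (>>-zero n) (+-identityʳ b) (splitFrac-run n b 0)
    ⨾ push
    ⨾ to (cong (λ v → [] ∷ [] ∷ v ∷ []) (sym (map-++ gl (bitGlyphs (show (digits (n >> b))))
        (point ∷ bitGlyphs (frac b n)))))
        (using-registers (r0 ∷ r2 ∷ []) (emit-run (digits (n >> b)) (gl point ∷ bitsˢ (frac b n))))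

  -- registers: count, number
  shiftRight : Prog X plain 2
  shiftRight = while r0 is-just (λ _ → pop r0 ⨾ pop r1)

  shiftRight-run : ∀ r n j → Run tt shiftRight (ones {X} r ∷ num (n >> j) ∷ []) ([] ∷ num (n >> (r + j)) ∷ [])
      (suc (r * 3))
  shiftRight-run zero    n j = done refl
  shiftRight-run (suc r) n j = to (cong (λ k → [] ∷ num (n >> k) ∷ []) (+-suc r j))
    (loop refl (pop ⨾ to (cong (λ v → ones r ∷ v ∷ []) (trans (popBit-run (n >> j)) (cong num (>>-suc n j)))) pop)
        (shiftRight-run r n (suc j)))

  -- registers: source, count
  drain : Prog X plain 2
  drain = while r0 is-just (λ _ → pop r0 ⨾ push r1 (gl 𝟏))

  drain-run : ∀ (xs : Stack X) n → Run tt drain (xs ∷ ones n ∷ []) ([] ∷ ones (length xs + n) ∷ [])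
      (suc (length xs * 4))
  drain-run []       n = done refl
  drain-run (x ∷ xs) n = to (cong (λ k → [] ∷ ones k ∷ []) (+-suc (length xs) n))
      (loop refl (pop ⨾ push) (drain-run xs (suc n)))

  -- The first r bits of w, continued by zeros, appended to a.
  extend : ℕ → ℕ → List Bool → ℕ
  extend zero    a w = a
  extend (suc r) a w = extend r (b2n (headBit w) + 2 * a) (drop 1 w)

  -- registers: count, source, number
  parseBits : Prog X plain 3
  parseBits = while r0 is-just (λ _ → pop r0 ⨾ case r1 (λ c → pop r1 ⨾ use (r2 ∷ []) (spush (bitOf c))))

  parseBits-run : ∀ r w a → ∃[ w′ ] Run tt parseBits (ones {X} r ∷ bitsˢ w ∷ num a ∷ [])
      ([] ∷ bitsˢ w′ ∷ num (extend r a w) ∷ []) (suc (r * 7))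
  parseBits-run zero    w a = w , done refl
  parseBits-run {X} (suc r) w a =
    let w′ , d = parseBits-run r (drop 1 w) (b2n (headBit w) + 2 * a) in
    w′ , loop refl (pop ⨾ case (subst (λ b → Run tt (pop r1 ⨾ use (r2 ∷ []) (spush b)) (ones r ∷ bitsˢ w ∷ num a ∷ [])
        (ones r ∷ bitsˢ (drop 1 w) ∷ num (b2n (headBit w) + 2 * a) ∷ []) 4)
        (sym (bitOf-bitsˢ {X} w))
        (to (cong (λ v → ones r ∷ v ∷ num a ∷ []) (drop-bitsˢ w)) pop
         ⨾ to (cong (λ v → ones r ∷ bitsˢ (drop 1 w) ∷ bitsˢ v ∷ []) (sym (digits-scons (headBit w) a)))
             (using-registers (r2 ∷ []) (spush-run (headBit w) (digits a))))))
      d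

-- Binary addition under a unary clock, and multiplication by shifting and adding.

module Multiplication where

  open import Defs using (plain; 𝟏)
  open StackPrograms
  open Renaming
  open BinaryDigits
  open Subroutines
  open import Data.Bool.Base using (Bool; true; false)
  open import Data.Fin.Base using (zero; suc)
  open import Data.List.Base as List using (List; []; _∷_; _++_; length; drop)
  open import Data.List.Properties
  open import Data.Maybe.Base using (is-just)
  open import Data.Nat.Base
  open import Data.Nat.DivMod
  open import Data.Nat.Properties
  open import Data.Nat.Tactic.RingSolver using (solve-∀)
  open import Data.Product.Base using (∃-syntax)
  open import Data.Unit.Base using (tt)
  open import Data.Vec.Base as Vec using ([]; _∷_)
  open import Relation.Binary.PropositionalEquality

  private variable
    X : Set

  sumBit carryBit : Bool → Bool → Bool → Bool
  sumBit   false false k     = k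
  sumBit   false true  false = true
  sumBit   false true  true  = false
  sumBit   true  false false = true
  sumBit   true  false true  = false
  sumBit   true  true  k     = k
  carryBit false false k     = false
  carryBit false true  k     = k
  carryBit true  false k     = k
  carryBit true  true  k     = true

  b2n≤1 : ∀ b → b2n b ≤ 1
  b2n≤1 false = z≤n
  b2n≤1 true  = s≤s z≤n

  full-adder : ∀ x y k → b2n x + b2n y + b2n k ≡ b2n (sumBit x y k) + 2 * b2n (carryBit x y k)
  full-adder false false false = refl
  full-adder false false true  = refl
  full-adder false true  false = refl
  full-adder false true  true  = refl
  full-adder true  false false = refl
  full-adder true  false true  = refl
  full-adder true  true  false = refl
  full-adder true  true  true  = refl

  carry : Bool → Stack X
  carry false = []
  carry true  = gl 𝟏 ∷ []

  bitOf-carry : ∀ k → bitOf {X} (List.head (carry k)) ≡ k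
  bitOf-carry false = refl
  bitOf-carry true  = refl

  drop-carry : ∀ k → drop 1 (carry {X} k) ≡ []
  drop-carry false = refl
  drop-carry true  = refl

  setCarry : Bool → Prog X plain 1
  setCarry false = skip
  setCarry true  = push r0 (gl 𝟏)

  setCarry-run : ∀ k → Run tt (setCarry k) ([] ∷ []) (carry {X} k ∷ []) 2
  setCarry-run false = weaken z≤n skip
  setCarry-run true  = push

  -- registers: summand, its read bits, accumulator, sum bits, carry
  addBit : Bool → Bool → Bool → Prog X plain 5
  addBit x y k = pop r0 ⨾ push r1 (bit x) ⨾ pop r2 ⨾ push r3 (bit (sumBit x y k)) ⨾ pop r4 ⨾ use (r4 ∷ [])
      (setCarry (carryBit x y k))

  addStep : Prog X plain 5
  addStep = case r0 (λ x → case r2 (λ y → case r4 (λ k → addBit (bitOf x) (bitOf y) (bitOf k))))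

  addStep-run : ∀ a c k α β → Run tt addStep (num {X} a ∷ bitsˢ α ∷ num c ∷ bitsˢ β ∷ carry k ∷ [])
    (num (a / 2) ∷ bitsˢ (odd a ∷ α) ∷ num (c / 2) ∷ bitsˢ (sumBit (odd a) (odd c) k ∷ β) ∷ carry
        (carryBit (odd a) (odd c) k) ∷ []) 12
  addStep-run {X} a c k α β = case (case (case
    (subst₂ (λ x y → Run tt (addBit x y (bitOf (List.head (carry {X} k)))) s₀ s₁ 9)
      (sym (trans (bitOf-bitsˢ {X} (digits a)) (digits-head a)))
          (sym (trans (bitOf-bitsˢ {X} (digits c)) (digits-head c)))
      (subst (λ z → Run tt (addBit (odd a) (odd c) z) s₀ s₁ 9) (sym (bitOf-carry {X} k))
        (to (cong (λ v → v ∷ bitsˢ α ∷ num c ∷ bitsˢ β ∷ carry k ∷ []) (popBit-run a)) pop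
         ⨾ push
         ⨾ to (cong (λ v → num (a / 2) ∷ bitsˢ (odd a ∷ α) ∷ v ∷ bitsˢ β ∷ carry k ∷ []) (popBit-run c)) pop
         ⨾ push
         ⨾ to (cong (λ v → num (a / 2) ∷ bitsˢ (odd a ∷ α) ∷ num (c / 2) ∷ bitsˢ (sumBit (odd a) (odd c) k ∷ β) ∷ v ∷
             []) (drop-carry k)) pop
         ⨾ using-registers (r4 ∷ []) (setCarry-run (carryBit (odd a) (odd c) k)))))))
    where
    s₀ s₁ : Store X 5
    s₀ = num a ∷ bitsˢ α ∷ num c ∷ bitsˢ β ∷ carry k ∷ []
    s₁ = num (a / 2) ∷ bitsˢ (odd a ∷ α) ∷ num (c / 2) ∷ bitsˢ (sumBit (odd a) (odd c) k ∷ β) ∷ carry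
        (carryBit (odd a) (odd c) k) ∷ []

  halves : ℕ → ℕ → ℕ
  halves zero    a = a
  halves (suc n) a = halves n (a / 2)

  spill : ℕ → ℕ → List Bool → List Bool
  spill zero    a α = α
  spill (suc n) a α = spill n (a / 2) (odd a ∷ α)

  sums : ℕ → ℕ → ℕ → Bool → List Bool → List Bool
  sums zero    a c k β = β
  sums (suc n) a c k β = sums n (a / 2) (c / 2) (carryBit (odd a) (odd c) k) (sumBit (odd a) (odd c) k ∷ β)

  carries : ℕ → ℕ → ℕ → Bool → Bool
  carries zero    a c k = k
  carries (suc n) a c k = carries n (a / 2) (c / 2) (carryBit (odd a) (odd c) k)

  -- registers: summand, scratch, accumulator, scratch, carry, clock, scratch
  addLoop : Prog X plain 7
  addLoop = while r5 is-just (λ _ → pop r5 ⨾ push r6 (gl 𝟏) ⨾ use (r0 ∷ r1 ∷ r2 ∷ r3 ∷ r4 ∷ []) addStep)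

  addLoop-run : ∀ n m a c k α β → Run tt addLoop
    (num {X} a ∷ bitsˢ α ∷ num c ∷ bitsˢ β ∷ carry k ∷ ones n ∷ ones m ∷ [])
    (num (halves n a) ∷ bitsˢ (spill n a α) ∷ num (halves n c) ∷ bitsˢ (sums n a c k β) ∷ carry (carries n a c k) ∷ []
        ∷ ones (n + m) ∷ [])
    (suc (n * 16))
  addLoop-run zero    m a c k α β = done refl
  addLoop-run (suc n) m a c k α β = to (cong (λ l → num (halves (suc n) a) ∷ bitsˢ (spill (suc n) a α) ∷ num
      (halves (suc n) c) ∷ bitsˢ (sums (suc n) a c k β) ∷ carry (carries (suc n) a c k) ∷ [] ∷ ones l ∷ [])
      (+-suc n m))
    (loop refl (pop ⨾ push ⨾ using-registers (r0 ∷ r1 ∷ r2 ∷ r3 ∷ r4 ∷ []) (addStep-run a c k α β))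
      (addLoop-run n (suc m) (a / 2) (c / 2) (carryBit (odd a) (odd c) k) (odd a ∷ α) (sumBit (odd a) (odd c) k ∷ β)))

  half-< : ∀ a n → a < 2 ^ suc n → a / 2 < 2 ^ n
  half-< a n h = *-cancelˡ-< 2 (a / 2) (2 ^ n) (≤-<-trans
      (≤-trans (m≤n+m (2 * (a / 2)) (b2n (odd a))) (≤-reflexive (sym (n≡odd+2half a)))) h)

  halves-0 : ∀ n a → a < 2 ^ n → halves n a ≡ 0
  halves-0 zero    zero    h = refl
  halves-0 zero    (suc a) (s≤s ())
  halves-0 (suc n) a       h = halves-0 n (a / 2) (half-< a n h)

  horner-acc : ∀ a w → horner a w ≡ a * 2 ^ length w + horner 0 w
  horner-acc a []      = trans (sym (*-identityʳ a)) (sym (+-identityʳ (a * 1)))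
  horner-acc a (b ∷ w) = trans (horner-acc (b2n b + 2 * a) w) (trans (rearrange (b2n b) a (2 ^ length w) (horner 0 w))
    (cong (a * (2 * 2 ^ length w) +_) (sym (horner-acc (b2n b + 2 * 0) w))))
    where
    rearrange : ∀ b a p h → (b + 2 * a) * p + h ≡ a * (2 * p) + ((b + 2 * 0) * p + h)
    rearrange = solve-∀

  horner-∷ : ∀ b w → horner 0 (b ∷ w) ≡ b2n b * 2 ^ length w + horner 0 w
  horner-∷ b w = trans (horner-acc (b2n b + 2 * 0) w)
      (cong (λ v → v * 2 ^ length w + horner 0 w) (+-identityʳ (b2n b)))

  -- Addition consumes its summand. The bits read, stacked with the latest on top, spell it most
  -- significant bit first, so that `parse` can restore it.
  spill-value : ∀ n a α → a < 2 ^ n → horner 0 (spill n a α) ≡ a * 2 ^ length α + horner 0 α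
  spill-value zero    zero    α h = refl
  spill-value zero    (suc a) α (s≤s ())
  spill-value (suc n) a       α h = begin
    horner 0 (spill n (a / 2) (odd a ∷ α))                              ≡⟨ spill-value n (a / 2) (odd a ∷ α)
        (half-< a n h) ⟩
    a / 2 * (2 * 2 ^ length α) + horner 0 (odd a ∷ α)                   ≡⟨ cong (a / 2 * (2 * 2 ^ length α) +_)
        (horner-∷ (odd a) α) ⟩
    a / 2 * (2 * 2 ^ length α) + (b2n (odd a) * 2 ^ length α + horner 0 α) ≡⟨ rearrange (a / 2) (b2n (odd a))
        (2 ^ length α) (horner 0 α) ⟩
    (b2n (odd a) + 2 * (a / 2)) * 2 ^ length α + horner 0 α             ≡⟨ cong (λ v → v * 2 ^ length α + horner 0 α)
        (n≡odd+2half a) ⟨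
    a * 2 ^ length α + horner 0 α                                       ∎
    where
    open ≡-Reasoning
    rearrange : ∀ q o p h → q * (2 * p) + (o * p + h) ≡ (o + 2 * q) * p + h
    rearrange = solve-∀

  add-halves : ∀ a c k → a + c + b2n k ≡ b2n (sumBit (odd a) (odd c) k) + 2 *
      (a / 2 + c / 2 + b2n (carryBit (odd a) (odd c) k))
  add-halves a c k = begin
    a + c + b2n k                                                   ≡⟨ cong₂ (λ u v → u + v + b2n k) (n≡odd+2half a)
        (n≡odd+2half c) ⟩
    b2n (odd a) + 2 * (a / 2) + (b2n (odd c) + 2 * (c / 2)) + b2n k ≡⟨ rearrange (b2n (odd a)) (a / 2) (b2n (odd c))
        (c / 2) (b2n k) ⟩
    b2n (odd a) + b2n (odd c) + b2n k + 2 * (a / 2 + c / 2)         ≡⟨ cong (_+ 2 * (a / 2 + c / 2))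
        (full-adder (odd a) (odd c) k) ⟩
    s + 2 * r + 2 * (a / 2 + c / 2)                                 ≡⟨ rearrange′ s r (a / 2 + c / 2) ⟩
    s + 2 * (a / 2 + c / 2 + r)                                     ∎
    where
    open ≡-Reasoning
    s r : ℕ
    s = b2n (sumBit (odd a) (odd c) k)
    r = b2n (carryBit (odd a) (odd c) k)
    rearrange : ∀ o q o′ q′ k → o + 2 * q + (o′ + 2 * q′) + k ≡ o + o′ + k + 2 * (q + q′)
    rearrange = solve-∀
    rearrange′ : ∀ s r q → s + 2 * r + 2 * q ≡ s + 2 * (q + r)
    rearrange′ = solve-∀

  add-halves-< : ∀ n a c k → a + c + b2n k < 2 ^ suc n → a / 2 + c / 2 + b2n (carryBit (odd a) (odd c) k) < 2 ^ n
  add-halves-< n a c k h = *-cancelˡ-< 2 _ (2 ^ n)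
    (≤-<-trans (≤-trans (m≤n+m _ (b2n (sumBit (odd a) (odd c) k))) (≤-reflexive (sym (add-halves a c k)))) h)

  -- A full adder handles the lowest bits, and the halves with the new carry form the same problem
  -- one size smaller. The bound says that `n` places hold the whole sum, so no carry is lost.
  sums-value : ∀ n a c k β → a + c + b2n k < 2 ^ n → horner 0 (sums n a c k β) ≡ (a + c + b2n k) * 2 ^ length β +
      horner 0 β
  sums-value zero    zero    zero    false β h = refl
  sums-value zero    zero    zero    true  β (s≤s ())
  sums-value zero    zero    (suc c) k     β (s≤s ())
  sums-value zero    (suc a) c       k     β (s≤s ())
  sums-value (suc n) a       c       k     β h = begin
    horner 0 (sums n (a / 2) (c / 2) k′ (s ∷ β))             ≡⟨ sums-value n (a / 2) (c / 2) k′ (s ∷ β)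
        (add-halves-< n a c k h) ⟩
    q * (2 * 2 ^ length β) + horner 0 (s ∷ β)                ≡⟨ cong (q * (2 * 2 ^ length β) +_) (horner-∷ s β) ⟩
    q * (2 * 2 ^ length β) + (b2n s * 2 ^ length β + horner 0 β) ≡⟨ rearrange q (b2n s) (2 ^ length β) (horner 0 β) ⟩
    (b2n s + 2 * q) * 2 ^ length β + horner 0 β              ≡⟨ cong (λ v → v * 2 ^ length β + horner 0 β)
        (add-halves a c k) ⟨
    (a + c + b2n k) * 2 ^ length β + horner 0 β              ∎
    where
    open ≡-Reasoning
    s k′ : Bool
    s  = sumBit (odd a) (odd c) k
    k′ = carryBit (odd a) (odd c) k
    q : ℕ
    q = a / 2 + c / 2 + b2n k′
    rearrange : ∀ q o p h → q * (2 * p) + (o * p + h) ≡ (o + 2 * q) * p + h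
    rearrange = solve-∀

  carries-false : ∀ n a c k → a + c + b2n k < 2 ^ n → carries n a c k ≡ false
  carries-false zero    a c false h = refl
  carries-false zero    a c true  (s≤s h) with () ← subst (_≤ 0) (+-comm (a + c) 1) h
  carries-false (suc n) a c k     h = carries-false n (a / 2) (c / 2) _ (add-halves-< n a c k h)

  length-spill : ∀ n a α → length (spill n a α) ≡ n + length α
  length-spill zero    a α = refl
  length-spill (suc n) a α = trans (length-spill n (a / 2) (odd a ∷ α)) (+-suc n (length α))

  length-sums : ∀ n a c k β → length (sums n a c k β) ≡ n + length β
  length-sums zero    a c k β = refl
  length-sums (suc n) a c k β = trans (length-sums n (a / 2) (c / 2) _ (_ ∷ β)) (+-suc n (length β))

  -- Parsing the two scratch stacks restores the summand and puts the sum in canonical form; moving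
  -- the clock back makes the routine repeatable.
  add : Prog X plain 7
  add = addLoop ⨾ use (r1 ∷ r0 ∷ []) parse ⨾ use (r3 ∷ r2 ∷ []) parse ⨾ use (r6 ∷ r5 ∷ []) move

  addCost : ℕ → ℕ
  addCost n = suc (n * 16) + (suc (n * 5) + (suc (n * 5) + suc (n * 4)))

  reload-run : ∀ w n m l → horner 0 w ≡ n → m ≡ 0 → length w ≡ l → Run tt parse (bitsˢ {X} w ∷ num m ∷ [])
      ([] ∷ num n ∷ []) (suc (l * 5))
  reload-run {X} w n m l refl refl refl = subst (λ v → Run tt parse (v ∷ num 0 ∷ []) ([] ∷ num (horner 0 w) ∷ [])
      (suc (length w * 5)))
    (++-identityʳ (bitsˢ w)) (parse-run w [] 0 refl)

  add-run : ∀ n a c → a + c < 2 ^ n → Run tt add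
    (num {X} a ∷ [] ∷ num c ∷ [] ∷ [] ∷ ones n ∷ [] ∷ []) (num a ∷ [] ∷ num (a + c) ∷ [] ∷ [] ∷ ones n ∷ [] ∷ [])
        (addCost n)
  add-run {X} n a c h = to (cong (λ k → num (halves n a) ∷ bitsˢ (spill n a []) ∷ num (halves n c) ∷ bitsˢ
      (sums n a c false []) ∷ carry k ∷ [] ∷ ones (n + 0) ∷ []) (carries-false n a c false h′))
      (addLoop-run n 0 a c false [] [])
    ⨾ using-registers (r1 ∷ r0 ∷ []) (reload-run (spill n a []) a (halves n a) n
        (trans (spill-value n a [] a<) (trans (+-identityʳ (a * 1)) (*-identityʳ a))) (halves-0 n a a<)
            (trans (length-spill n a []) (+-identityʳ n)))
    ⨾ using-registers (r3 ∷ r2 ∷ []) (reload-run (sums n a c false []) (a + c) (halves n c) n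
        (trans (sums-value n a c false [] h′) (trans (+-identityʳ ((a + c + 0) * 1))
            (trans (*-identityʳ (a + c + 0)) (+-identityʳ (a + c)))))
        (halves-0 n c (≤-<-trans (m≤n+m c a) h)) (trans (length-sums n a c false []) (+-identityʳ n)))
    ⨾ to (cong (λ k → num a ∷ [] ∷ num (a + c) ∷ [] ∷ [] ∷ ones k ∷ [] ∷ [])
        (trans (+-identityʳ (n + 0)) (+-identityʳ n)))
        (subst (λ k → Run tt (use (r6 ∷ r5 ∷ []) move) (num a ∷ [] ∷ num (a + c) ∷ [] ∷ [] ∷ [] ∷ ones (n + 0) ∷ [])
            (num a ∷ [] ∷ num (a + c) ∷ [] ∷ [] ∷ ones (n + 0 + 0) ∷ [] ∷ []) (suc (k * 4))) (+-identityʳ n)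
          (using-registers (r6 ∷ r5 ∷ []) (move-ones (n + 0) 0)))
    where
    h′ : a + c + 0 < 2 ^ n
    h′ = subst (_< 2 ^ n) (sym (+-identityʳ (a + c))) h
    a< : a < 2 ^ n
    a< = ≤-<-trans (m≤m+n a c) h

  -- registers: source, factor, scratch, accumulator, scratch, carry, clock, scratch, number of bits read
  mulBit : Bool → Prog X plain 9
  mulBit b = pop r0 ⨾ push r8 (gl 𝟏) ⨾ use (r3 ∷ []) (spush false) ⨾ addIf b
    where
    addIf : Bool → Prog X plain 9
    addIf false = skip
    addIf true  = use (r1 ∷ r2 ∷ r3 ∷ r4 ∷ r5 ∷ r6 ∷ r7 ∷ []) add

  mulParse : Prog X plain 9
  mulParse = while r0 isBit (λ c → mulBit (bitOf c))

  mulCost : ℕ → ℕ → ℕ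
  mulCost n l = suc (l * (7 + addCost n))

  mulBit-run : ∀ b n a h j (src : Stack X) → a + 2 * (a * h) < 2 ^ n → Run tt (mulBit b)
    ((bit b ∷ src) ∷ num a ∷ [] ∷ num (a * h) ∷ [] ∷ [] ∷ ones n ∷ [] ∷ ones j ∷ [])
    (src ∷ num a ∷ [] ∷ num (a * (b2n b + 2 * h)) ∷ [] ∷ [] ∷ ones n ∷ [] ∷ ones (suc j) ∷ []) (6 + addCost n)
  mulBit-run false n a h j src lt = weaken (s≤s (s≤s (s≤s (s≤s (s≤s (s≤s z≤n))))))
    (pop ⨾ push ⨾ to (cong (λ v → src ∷ num a ∷ [] ∷ v ∷ [] ∷ [] ∷ ones n ∷ [] ∷ ones (suc j) ∷ [])
        (cong bitsˢ (trans (sym (digits-scons false (a * h))) (cong digits (rearrange a h)))))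
      (using-registers (r3 ∷ []) (spush-run false (digits (a * h)))) ⨾ skip)
    where
    rearrange : ∀ a h → 2 * (a * h) ≡ a * (2 * h)
    rearrange = solve-∀
  mulBit-run true n a h j src lt =
    pop ⨾ push ⨾ to (cong (λ v → src ∷ num a ∷ [] ∷ v ∷ [] ∷ [] ∷ ones n ∷ [] ∷ ones (suc j) ∷ [])
        (cong bitsˢ (sym (digits-scons false (a * h)))))
      (using-registers (r3 ∷ []) (spush-run false (digits (a * h))))
    ⨾ to (cong (λ v → src ∷ num a ∷ [] ∷ num v ∷ [] ∷ [] ∷ ones n ∷ [] ∷ ones (suc j) ∷ []) (rearrange a h))
        (using-registers (r1 ∷ r2 ∷ r3 ∷ r4 ∷ r5 ∷ r6 ∷ r7 ∷ []) (add-run n a (2 * (a * h)) lt))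
    where
    rearrange : ∀ a h → a + 2 * (a * h) ≡ a * (1 + 2 * h)
    rearrange = solve-∀

  -- The accumulator is `a * h` for the value `h` of the bits read so far. The finished value of the
  -- word is below `suc h * 2 ^ length w`, so the hypothesis keeps all partial products within `n`
  -- places. A general `h` lets a second call continue where a first one stopped.
  mulParse-run : ∀ w n a h j (rest : Stack X) → isBit (List.head rest) ≡ false → suc h * 2 ^ length w * a < 2 ^ n →
      Run tt mulParse
    ((bitsˢ w ++ rest) ∷ num a ∷ [] ∷ num (a * h) ∷ [] ∷ [] ∷ ones n ∷ [] ∷ ones j ∷ [])
    (rest ∷ num a ∷ [] ∷ num (a * horner h w) ∷ [] ∷ [] ∷ ones n ∷ [] ∷ ones (length w + j) ∷ [])
        (mulCost n (length w))
  mulParse-run []      n a h j rest e lt = done e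
  mulParse-run {X} (b ∷ w) n a h j rest e lt = weaken-≡
      (to (cong (λ k → rest ∷ num a ∷ [] ∷ num (a * horner h (b ∷ w)) ∷ [] ∷ [] ∷ ones n ∷ [] ∷ ones k ∷ [])
      (+-suc (length w) j))
    (loop (isBit-bit b)
      (by-program (cong mulBit (sym (bitOf-bit {X} b))) (mulBit-run b n a h j (bitsˢ w ++ rest) lt₁))
      (mulParse-run w n a (b2n b + 2 * h) (suc j) rest e lt₂)))
    (cong (λ t → suc (suc (suc (suc (suc (suc (suc t))))))) (+-suc (addCost n) (length w * (7 + addCost n))))
    where
    open ≤-Reasoning
    instance
      p≢0 : NonZero (2 ^ length w)
      p≢0 = m^n≢0 2 (length w)
    rearrange₁ : ∀ a h → a + 2 * (a * h) + a ≡ suc h * 2 * a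
    rearrange₁ = solve-∀
    rearrange₂ : ∀ h p → suc (1 + 2 * h) * p ≡ suc h * (2 * p)
    rearrange₂ = solve-∀
    lt₁ : a + 2 * (a * h) < 2 ^ n
    lt₁ = begin-strict
      a + 2 * (a * h)               ≤⟨ m≤m+n _ a ⟩
      a + 2 * (a * h) + a           ≡⟨ rearrange₁ a h ⟩
      suc h * 2 * a                 ≤⟨ *-monoˡ-≤ a (*-monoʳ-≤ (suc h) (m≤m*n 2 (2 ^ length w))) ⟩
      suc h * 2 ^ length (b ∷ w) * a <⟨ lt ⟩
      2 ^ n                         ∎
    lt₂ : suc (b2n b + 2 * h) * 2 ^ length w * a < 2 ^ n
    lt₂ = begin-strict
      suc (b2n b + 2 * h) * 2 ^ length w * a ≤⟨ *-monoˡ-≤ a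
          (*-monoˡ-≤ (2 ^ length w) (s≤s (+-monoˡ-≤ (2 * h) (b2n≤1 b)))) ⟩
      suc (1 + 2 * h) * 2 ^ length w * a     ≡⟨ cong (_* a) (rearrange₂ h (2 ^ length w)) ⟩
      suc h * 2 ^ length (b ∷ w) * a         <⟨ lt ⟩
      2 ^ n                                  ∎

-- How fast the tapes of a machine can grow.

module TapeGrowth where

  open import Defs using (Kind; Oracle; Move; left; stay; right; Symbol; glyph; Instruction; halt; act; query; Machine; Tape; tape; write; move; loaded; glyphs; contents; leading𝟏s; Config; config; initial; instruction; execute; run; output)
  import Defs
  open import Data.List.Base as List using ([]; _∷_; length)
  open import Data.List.Properties using (length-map)
  open import Data.Nat.Base
  open import Data.Nat.Properties
  open import Data.Product.Base using (_×_; _,_; proj₁; proj₂)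
  open import Data.Vec.Base using (_∷_)
  open import Relation.Binary.PropositionalEquality

  leading𝟏s≤length : ∀ w → leading𝟏s w ≤ length w
  leading𝟏s≤length []              = z≤n
  leading𝟏s≤length (Defs.𝟎 ∷ w)     = z≤n
  leading𝟏s≤length (Defs.𝟏 ∷ w)     = s≤s (leading𝟏s≤length w)
  leading𝟏s≤length (Defs.minus ∷ w) = z≤n
  leading𝟏s≤length (Defs.point ∷ w) = z≤n
  leading𝟏s≤length (Defs.comma ∷ w) = z≤n

  module TapeSizes {κ : Kind} (M : Machine κ) where
    open Machine M

    perform : Symbol aux × Move → Tape aux → Tape aux
    perform a t = move (proj₂ a) (write (proj₁ a) t)

    tapeSize : Tape aux → ℕ
    tapeSize t = length (Tape.before t) + length (Tape.after t)

    perform-size : ∀ a t → tapeSize (perform a t) ≤ suc (tapeSize t)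
    perform-size (s , left)  (tape [] h rs)       = ≤-refl
    perform-size (s , left)  (tape (l ∷ ls) h rs) = ≤-trans (≤-reflexive (+-suc (length ls) (length rs))) (n≤1+n _)
    perform-size (s , stay)  t                    = n≤1+n _
    perform-size (s , right) (tape ls h [])       = ≤-refl
    perform-size (s , right) (tape ls h (r ∷ rs)) = ≤-trans (≤-reflexive (sym (+-suc (length ls) (length rs))))
        (n≤1+n _)

    loaded-size : ∀ w → tapeSize (loaded w) ≤ length w
    loaded-size []      = z≤n
    loaded-size (c ∷ w) = ≤-trans (≤-reflexive (length-map glyph w)) (n≤1+n _)

    contents-size : ∀ t → length (contents t) ≤ suc (tapeSize t)
    contents-size (tape ls h rs) = ≤-trans (glyphs-length (h ∷ rs)) (s≤s (m≤n+m (length rs) (length ls)))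
      where
      glyphs-length : ∀ cs → length (glyphs {aux} cs) ≤ length cs
      glyphs-length []                    = z≤n
      glyphs-length (Symbol.blank ∷ cs)     = z≤n
      glyphs-length (Symbol.glyph c ∷ cs)   = s≤s (glyphs-length cs)
      glyphs-length (Symbol.special i ∷ cs) = z≤n

    module _ (O : Oracle κ) where

      next : Config M O → Config M O
      next c = execute M O O (instruction M O c) c

      querySize outputSize : Config M O → ℕ
      querySize (config _ (_ ∷ _ ∷ t ∷ _)) = tapeSize t
      outputSize (config _ (_ ∷ t ∷ _))    = tapeSize t

      execute-outputSize : ∀ {κ′} (A : Oracle κ′) (i : Instruction aux states (3 + work) κ′) → ∀ c →
        outputSize (execute M O A i c) ≤ suc (outputSize c)
      execute-outputSize A halt       c = n≤1+n _
      execute-outputSize A (act q (_ ∷ a ∷ _)) (config _ (_ ∷ t ∷ _)) = perform-size a t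
      execute-outputSize A (query q)  (config _ (_ ∷ t ∷ _ ∷ _)) = n≤1+n _

      run-outputSize : ∀ k c → outputSize (run M O k c) ≤ k + outputSize c
      run-outputSize zero    c = ≤-refl
      run-outputSize (suc k) c = ≤-trans (run-outputSize k (next c))
        (≤-trans (+-monoʳ-≤ k (execute-outputSize O (instruction M O c) c)) (≤-reflexive (+-suc k _)))

      -- The output tape starts as a single cell and grows by at most one per step; this bounds the
      -- answer of a simulated machine by its clock.
      output-length : ∀ k w → length (output M O (run M O k (initial M O w))) ≤ suc k
      output-length k w with run M O k (initial M O w) | run-outputSize k (initial M O w)
      ... | config _ (_ ∷ t ∷ _) | le = ≤-trans (contents-size t) (s≤s (≤-trans le (≤-reflexive (+-identityʳ k))))

-- Simulation of a Turing machine by a stack program.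

module Simulating where

  open import Defs using (Kind; plain; oracle; Oracle; Glyph; Move; left; stay; right; Symbol; blank; glyph; special; Instruction; halt; act; query; Machine; Tape; tape; loaded; glyphs; contents; leading𝟏s; Config; config; instruction; execute; run)
  import Defs
  open StackPrograms
  open Renaming
  open Subroutines
  open TapeGrowth
  open import Data.Bool.Base using (false)
  open import Data.Fin.Base using (Fin; zero; suc)
  open import Data.List.Base as List using (List; []; _∷_; _++_; length; _ʳ++_)
  open import Data.List.Membership.Propositional.Properties using (∈-++⁺ˡ; ∈-++⁺ʳ; ∈-map⁺)
  open import Data.List.Properties using (map-∘; length-ʳ++; length-map)
  open import Data.List.Relation.Unary.Any using (here; there)
  open import Data.Maybe.Base using (Maybe; just; nothing; is-just)
  open import Data.Nat.Base
  open import Data.Nat.Properties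
  open import Data.Product.Base using (∃-syntax; _×_; _,_)
  open import Data.Unit.Base using (⊤; tt)
  open import Data.Vec.Base as Vec using (Vec; []; _∷_; tabulate)
  open import Function.Base using (_∘_)
  open import Relation.Binary.PropositionalEquality

  data Extra (aux states : ℕ) : Set where
    blankˣ : Extra aux states
    auxˣ   : Fin aux → Extra aux states
    stateˣ : Fin states → Extra aux states

  finite-Extra : ∀ {aux states} → Finite (Extra aux states)
  finite-Extra {aux} {states} = record
    { elements = blankˣ ∷ List.map auxˣ (List.allFin aux) ++ List.map stateˣ (List.allFin states)
    ; complete = λ { blankˣ     → here refl
                   ; (auxˣ i)   → there (∈-++⁺ˡ (∈-map⁺ auxˣ (Finite.complete (finite-Fin aux) i)))
                   ; (stateˣ q) → there (∈-++⁺ʳ (List.map auxˣ (List.allFin aux))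
                       (∈-map⁺ stateˣ (Finite.complete (finite-Fin states) q))) } }

  copyBack : ∀ {X} → Prog X plain 3
  copyBack = while r0 is-just (λ c → pop r0 ⨾ pushTop r1 c ⨾ pushTop r2 c)

  copyBack-run : ∀ {X} (xs ys zs : Stack X) →
    Run tt copyBack (xs ∷ ys ∷ zs ∷ []) ([] ∷ (xs ʳ++ ys) ∷ (xs ʳ++ zs) ∷ []) (suc (length xs * 6))
  copyBack-run []       ys zs = done refl
  copyBack-run (x ∷ xs) ys zs = loop refl (pop ⨾ push ⨾ push) (copyBack-run xs (x ∷ ys) (x ∷ zs))

  -- registers: word, scratch, copy
  copy : ∀ {X} → Prog X plain 3
  copy = use (r0 ∷ r1 ∷ []) move ⨾ use (r1 ∷ r0 ∷ r2 ∷ []) copyBack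

  copyCost : ℕ → ℕ
  copyCost l = suc (l * 4) + suc (l * 6)

  copy-run : ∀ {X} (xs : Stack X) → Run tt copy (xs ∷ [] ∷ [] ∷ []) (xs ∷ [] ∷ xs ∷ []) (copyCost (length xs))
  copy-run xs = weaken-≡ (to (cong (λ v → v ∷ [] ∷ v ∷ []) (ʳ++-[] xs))
    (using-registers (r0 ∷ r1 ∷ []) (move-run xs []) ⨾ using-registers (r1 ∷ r0 ∷ r2 ∷ [])
        (copyBack-run (xs ʳ++ []) [] [])))
    (cong (λ l → suc (length xs * 4) + suc (l * 6)) (trans (length-ʳ++ xs) (+-identityʳ (length xs))))

  -- The simulating program keeps the answer ready on a stack, so the answer must not depend on the
  -- query. A dyadic point meets this: its exact word is correct at every precision.
  Constant : ∀ {κ} → Oracle κ → List Glyph → Set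
  Constant {plain}  _ _ = ⊤
  Constant {oracle} A w = ∀ m → A m ≡ w

  module Simulation {κ : Kind} (M : Machine κ) where
    open Machine M
    open TapeSizes M

    X : Set
    X = Extra aux states

    enc : Symbol aux → Letter X
    enc blank       = mark blankˣ
    enc (glyph c)   = gl c
    enc (special i) = mark (auxˣ i)

    dec : Maybe (Letter X) → Symbol aux
    dec (just (gl c))          = glyph c
    dec (just (mark (auxˣ i))) = special i
    dec _                      = blank

    dec-enc : ∀ s → dec (just (enc s)) ≡ s
    dec-enc blank       = refl
    dec-enc (glyph c)   = refl
    dec-enc (special i) = refl

    -- A tape as two stacks facing each other, the scanned symbol on top of the second. Blanks are
    -- stored as marks, so the first stack is empty only at the end of the listed cells.
    before after : Tape aux → Stack X
    before t = List.map enc (Tape.before t)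
    after  t = List.map enc (Tape.head t ∷ Tape.after t)

    tapesˢ : ∀ {k} → Vec (Tape aux) k → Store X (k * 2)
    tapesˢ []       = []
    tapesˢ (t ∷ ts) = before t ∷ after t ∷ tapesˢ ts

    actTape : Symbol aux × Move → Prog X plain 2
    actTape (s , stay)  = pop r1 ⨾ push r1 (enc s)
    actTape (s , left)  = pop r1 ⨾ push r1 (enc s) ⨾
      case r0 (λ { nothing → push r1 (mark blankˣ) ; (just c) → pop r0 ⨾ push r1 c })
    actTape (s , right) = pop r1 ⨾ push r0 (enc s) ⨾
      case r1 (λ { nothing → push r1 (mark blankˣ) ; (just _) → skip })

    actTape-run : ∀ a t → Run tt (actTape a) (before t ∷ after t ∷ [])
        (before (perform a t) ∷ after (perform a t) ∷ []) 7
    actTape-run (s , stay)  t                    = weaken (s≤s (s≤s (s≤s z≤n))) (pop ⨾ push)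
    actTape-run (s , left)  (tape [] h rs)       = weaken (n≤1+n _) (pop ⨾ push ⨾ case push)
    actTape-run (s , left)  (tape (l ∷ ls) h rs) = pop ⨾ push ⨾ case (pop ⨾ push)
    actTape-run (s , right) (tape ls h [])       = weaken (n≤1+n _) (pop ⨾ push ⨾ case push)
    actTape-run (s , right) (tape ls h (r ∷ rs)) = weaken (s≤s (s≤s (s≤s (s≤s z≤n)))) (pop ⨾ push ⨾ case skip)

    actAll : ∀ {k} → Vec (Symbol aux × Move) k → Prog X plain (k * 2)
    actAll []       = skip
    actAll (a ∷ as) = use (r0 ∷ r1 ∷ []) (actTape a) ⨾ rename suc (rename suc (actAll as))

    actAll-run : ∀ {k} (as : Vec (Symbol aux × Move) k) ts → Run tt (actAll as) (tapesˢ ts)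
        (tapesˢ (Vec.zipWith perform as ts)) (k * 7)
    actAll-run []       []       = skip
    actAll-run (a ∷ as) (t ∷ ts) = using-registers (r0 ∷ r1 ∷ []) (actTape-run a t) ⨾ run-shift
        (run-shift (actAll-run as ts))

    headReg : ∀ {k} → Fin k → Fin (k * 2)
    headReg zero    = suc zero
    headReg (suc j) = suc (suc (headReg j))

    -- Since `case` branches over every symbol, nesting it over all heads turns the transition
    -- function into program text, with one leaf for each vector of scanned symbols.
    readAll : ∀ {n} k → (Fin k → Fin n) → (Vec (Symbol aux) k → Prog X plain n) → Prog X plain n
    readAll zero    ι f = f []
    readAll (suc k) ι f = case (ι zero) (λ c → readAll k (ι ∘ suc) (λ v → f (dec c ∷ v)))

    readAll-run : ∀ {n} k (ι : Fin k → Fin n) f {s s′ t} →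
      Run tt (f (tabulate (λ j → dec (peek s (ι j))))) s s′ t → Run tt (readAll k ι f) s s′ (k + t)
    readAll-run zero    ι f d = d
    readAll-run (suc k) ι f d = case (readAll-run k (ι ∘ suc) _ d)

    peek-heads : ∀ {k} (ts : Vec (Tape aux) k) → tabulate (λ j → dec (peek (tapesˢ ts) (headReg j))) ≡ Vec.map
        Tape.head ts
    peek-heads []       = refl
    peek-heads (t ∷ ts) = cong₂ _∷_ (dec-enc (Tape.head t)) (peek-heads ts)

    -- registers: state, oracle answer, scratch, tapes
    setState : Fin states → Prog X plain (3 + (3 + work) * 2)
    setState q = pop r0 ⨾ push r0 (mark (stateˣ q))

    perform-instruction : ∀ {κ} → Instruction aux states (3 + work) κ → Prog X plain (3 + (3 + work) * 2)
    perform-instruction halt       = skip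
    perform-instruction (act q as) = setState q ⨾ rename suc (rename suc (rename suc (actAll as)))
    -- `r7` and `r8` are the two halves of the query tape. Its contents are discarded, since every
    -- query has the same answer.
    perform-instruction (query q)  = setState q ⨾ use (r7 ∷ []) clear ⨾ use (r8 ∷ []) clear ⨾ use (r1 ∷ r2 ∷ r8 ∷ [])
        copy

    stateOf : Maybe (Letter X) → Maybe (Fin states)
    stateOf (just (mark (stateˣ q))) = just q
    stateOf _                        = nothing

    stepProg : Prog X plain (3 + (3 + work) * 2)
    stepProg = case r0 (λ c → dispatch (stateOf c))
      where
      dispatch : Maybe (Fin states) → Prog X plain (3 + (3 + work) * 2)
      dispatch nothing  = skip
      dispatch (just q) = readAll (3 + work) (λ j → suc (suc (suc (headReg j)))) (λ v → perform-instruction (δ q v))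

    module _ (O : Oracle κ) (w : List Glyph) (O≡w : Constant O w) (nonempty : 0 < length w) where

      store : Config M O → Store X (3 + (3 + work) * 2)
      store (config q ts) = (mark (stateˣ q) ∷ []) ∷ word w ∷ [] ∷ tapesˢ ts

      T : ℕ
      T = 3 + work

      stepCost : ℕ → ℕ
      stepCost S = suc (T + (3 + (T * 7 + (suc (S * 2) + (suc (S * 2) + copyCost (length w))))))

      -- Loading the empty word would put a blank mark under the head; for a nonempty answer the
      -- copied word is exactly the second half of the tape.
      after-loaded : ∀ w → 0 < length w → after (loaded w) ≡ word w
      after-loaded (c ∷ w) _ = cong (gl c ∷_) (sym (map-∘ w))

      before-loaded : ∀ w → before (loaded w) ≡ []
      before-loaded []      = refl
      before-loaded (c ∷ w) = refl

      instruction-run : ∀ {κ′} (A : Oracle κ′) → Constant A w → (i : Instruction aux states T κ′) → ∀ c S → querySize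
          O c < S →
        Run tt (perform-instruction i) (store c) (store (execute M O A i c))
            (3 + (T * 7 + (suc (S * 2) + (suc (S * 2) + copyCost (length w)))))
      instruction-run A A≡w halt       c S lt = weaken z≤n skip
      instruction-run A A≡w (act q as) (config p ts) S lt =
        weaken (+-monoʳ-≤ 3 (m≤m+n (T * 7) _)) ((pop ⨾ push) ⨾ run-shift (run-shift (run-shift (actAll-run as ts))))
      instruction-run A A≡w (query q)  (config p (t₀ ∷ t₁ ∷ t ∷ ts)) S lt =
        weaken (+-monoʳ-≤ 3 (≤-trans (+-mono-≤ (s≤s (*-monoˡ-≤ 2 l≤))
            (+-monoˡ-≤ (copyCost (length w)) (s≤s (*-monoˡ-≤ 2 r≤)))) (m≤n+m _ (T * 7))))
          (to (cong₂ (λ u v → (mark (stateˣ q) ∷ []) ∷ word w ∷ [] ∷ before t₀ ∷ after t₀ ∷ before t₁ ∷ after t₁ ∷ u ∷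
              v ∷ tapesˢ ts) (answer₁) (answer₂))
            ((pop ⨾ push) ⨾ using-registers (r7 ∷ []) (clear-run (before t)) ⨾ using-registers (r8 ∷ [])
                (clear-run (after t))
              ⨾ weaken-≡ (using-registers (r1 ∷ r2 ∷ r8 ∷ []) (copy-run (word w))) (cong copyCost (length-map gl w))))
        where
        l≤ : length (before t) ≤ S
        l≤ = ≤-trans (≤-reflexive (length-map enc (Tape.before t))) (≤-trans (m≤m+n _ _) (<⇒≤ lt))
        r≤ : length (after t) ≤ S
        r≤ = ≤-trans (s≤s (≤-reflexive (length-map enc (Tape.after t)))) (≤-trans (s≤s (m≤n+m _ _)) lt)
        answer₁ : [] ≡ before (loaded (A (leading𝟏s (contents t))))
        answer₁ = sym (before-loaded (A (leading𝟏s (contents t))))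
        answer₂ : word w ≡ after (loaded (A (leading𝟏s (contents t))))
        answer₂ = sym (trans (cong (after ∘ loaded) (A≡w _)) (after-loaded w nonempty))

      step-run : ∀ c S → querySize O c < S → Run tt stepProg (store c) (store (next O c)) (stepCost S)
      step-run c@(config q ts) S lt = case (readAll-run T (λ j → suc (suc (suc (headReg j))))
          (λ v → perform-instruction (δ q v))
        (by-program (cong (λ v → perform-instruction (δ q v)) (sym (peek-heads ts)))
            (instruction-run O O≡w (instruction M O c) c S lt)))

      -- A query resets the tape to the fixed answer `w`, and any other step adds at most one cell.
      -- So the size stays within `length w` plus the number of steps, and clearing the tape costs
      -- time linear in that.
      execute-querySize : ∀ {κ′} (A : Oracle κ′) → Constant A w → (i : Instruction aux states T κ′) → ∀ c {k} →
          querySize O c ≤ length w + k →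
        querySize O (execute M O A i c) ≤ length w + suc k
      execute-querySize A A≡w halt       c le = ≤-trans le (+-monoʳ-≤ (length w) (n≤1+n _))
      execute-querySize A A≡w (act q (_ ∷ _ ∷ a ∷ _)) (config _ (_ ∷ _ ∷ t ∷ _)) {k} le =
        ≤-trans (perform-size a t) (≤-trans (s≤s le) (≤-reflexive (sym (+-suc (length w) k))))
      execute-querySize A A≡w (query q)  (config _ (_ ∷ _ ∷ t ∷ _)) {k} le =
        ≤-trans (loaded-size (A (leading𝟏s (contents t))))
            (≤-trans (≤-reflexive (cong length (A≡w (leading𝟏s (contents t))))) (m≤m+n (length w) (suc k)))

      -- registers: clock, state, oracle answer, scratch, tapes
      simulate-run : ∀ k c i B → querySize O c ≤ length w + i → length w + i + k < B →
        Run tt (while {κ = plain} r0 is-just (λ _ → pop r0 ⨾ rename suc stepProg)) (ones k ∷ store c)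
            ([] ∷ store (run M O k c)) (suc (k * (2 + stepCost B)))
      simulate-run zero    c i B le lt = done refl
      simulate-run (suc k) c i B le lt = weaken-≡
        (loop refl (pop ⨾ run-shift (step-run c B (≤-<-trans le (≤-<-trans (m≤m+n _ _) lt))))
          (simulate-run k (next O c) (suc i) B (execute-querySize O O≡w (instruction M O c) c le)
            (≤-<-trans (≤-reflexive (trans (cong (_+ k) (+-suc (length w) i)) (sym (+-suc (length w + i) k)))) lt)))
        (cong (λ t → suc (suc t)) (+-suc (stepCost B) (k * (2 + stepCost B))))

    simulate : Prog X plain (4 + (3 + work) * 2)
    simulate = while r0 is-just (λ _ → pop r0 ⨾ rename suc stepProg)

    -- What follows the output word is empty or begins with a mark, so a parser that stops at the
    -- first symbol other than a bit does not run past the word.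
    after-contents : ∀ t → ∃[ rest ] after t ≡ word (contents t) ++ rest × isBit (List.head rest) ≡ false
    after-contents (tape _ h rs) = split (h ∷ rs)
      where
      split : ∀ cs → ∃[ rest ] List.map enc cs ≡ word (glyphs cs) ++ rest × isBit (List.head rest) ≡ false
      split []               = [] , refl , refl
      split (blank ∷ cs)     = _ , refl , refl
      split (special i ∷ cs) = _ , refl , refl
      split (glyph c ∷ cs)   = let rest , e , b = split cs in rest , cong (gl c ∷_) e , b

-- Monotonicity, composition and a normal bound for polynomials.

module Polynomials where

  open import Defs using (Poly; con; var; _:+_; _:*_; ⟦_⟧)
  open import Data.Fin.Base using (zero; suc)
  open import Data.Nat.Base
  open import Data.Nat.Properties
  open import Data.Product.Base using (∃-syntax; _×_; _,_)
  open import Data.Vec.Base as Vec using (Vec; lookup)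
  open import Data.Vec.Properties using (lookup-map)
  open import Data.Vec.Relation.Binary.Pointwise.Inductive using (Pointwise)
  import Data.Vec.Relation.Binary.Pointwise.Inductive as Pointwise
  open import Relation.Binary.PropositionalEquality

  poly-mono : ∀ {d} (p : Poly d) {ρ σ} → Pointwise _≤_ ρ σ → ⟦ p ⟧ ρ ≤ ⟦ p ⟧ σ
  poly-mono (con c)  le = ≤-refl
  poly-mono (var i)  le = Pointwise.lookup le i
  poly-mono (p :+ q) le = +-mono-≤ (poly-mono p le) (poly-mono q le)
  poly-mono (p :* q) le = *-mono-≤ (poly-mono p le) (poly-mono q le)

  compose : ∀ {d e} → Poly d → Vec (Poly e) d → Poly e
  compose (con c)  σ = con c
  compose (var i)  σ = lookup σ i
  compose (p :+ q) σ = compose p σ :+ compose q σ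
  compose (p :* q) σ = compose p σ :* compose q σ

  compose-eval : ∀ {d e} (p : Poly d) (σ : Vec (Poly e) d) ρ → ⟦ compose p σ ⟧ ρ ≡ ⟦ p ⟧ (Vec.map (λ q → ⟦ q ⟧ ρ) σ)
  compose-eval (con c)  σ ρ = refl
  compose-eval (var i)  σ ρ = sym (lookup-map i (λ q → ⟦ q ⟧ ρ) σ)
  compose-eval (p :+ q) σ ρ = cong₂ _+_ (compose-eval p σ ρ) (compose-eval q σ ρ)
  compose-eval (p :* q) σ ρ = cong₂ _*_ (compose-eval p σ ρ) (compose-eval q σ ρ)

  ≤-compose : ∀ {d e} (p : Poly d) (σ : Vec (Poly e) d) ρ {τ} → Pointwise _≤_ τ (Vec.map (λ q → ⟦ q ⟧ ρ) σ) → ⟦ p ⟧ τ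
      ≤ ⟦ compose p σ ⟧ ρ
  ≤-compose p σ ρ le = ≤-trans (poly-mono p le) (≤-reflexive (sym (compose-eval p σ ρ)))

  infixr 8 _:^_
  _:^_ : ∀ {d} → Poly d → ℕ → Poly d
  p :^ zero  = con 1
  p :^ suc e = p :* (p :^ e)

  eval-^ : ∀ {d} (p : Poly d) e ρ → ⟦ p :^ e ⟧ ρ ≡ ⟦ p ⟧ ρ ^ e
  eval-^ p zero    ρ = refl
  eval-^ p (suc e) ρ = cong (⟦ p ⟧ ρ *_) (eval-^ p e ρ)

  sum≤2product : ∀ {x y} → 1 ≤ x → 1 ≤ y → x + y ≤ 2 * (x * y)
  sum≤2product {x} {y} 1≤x 1≤y = +-mono-≤ (subst (_≤ x * y) (*-identityʳ x) (*-monoʳ-≤ x 1≤y))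
    (≤-trans (subst (_≤ x * y) (*-identityˡ y) (*-monoˡ-≤ y 1≤x)) (m≤m+n (x * y) 0))

  abstract
    -- `(c + N) ^ e` is a form that programs can compute in unary. Keeping `2 ≤ c` lets a sum be
    -- absorbed by one more factor of the base, because x + y ≤ 2xy for positive x and y.
    poly-bound : ∀ {d} (p : Poly d) → ∃[ c ] ∃[ e ] 2 ≤ c × (∀ ρ N → (∀ i → lookup ρ i ≤ N) → ⟦ p ⟧ ρ ≤ (c + N) ^ e)
    poly-bound (con a) = 2 + a , 1 , s≤s (s≤s z≤n) , λ ρ N _ → ≤-trans (≤-trans (m≤n+m a 2) (m≤m+n (2 + a) N))
        (≤-reflexive (sym (*-identityʳ (2 + a + N))))
    poly-bound (var i) = 2 , 1 , ≤-refl , λ ρ N h → ≤-trans (h i)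
        (≤-trans (m≤n+m N 2) (≤-reflexive (sym (*-identityʳ (2 + N)))))
    poly-bound (p :+ q) with poly-bound p | poly-bound q
    ... | c , e , 2≤c , P | c′ , e′ , 2≤c′ , Q = c + c′ , suc (e + e′) , ≤-trans 2≤c (m≤m+n c c′) , bound
      where
      open ≤-Reasoning
      bound : ∀ ρ N → (∀ i → lookup ρ i ≤ N) → ⟦ p ⟧ ρ + ⟦ q ⟧ ρ ≤ (c + c′ + N) ^ suc (e + e′)
      bound ρ N h = begin
        ⟦ p ⟧ ρ + ⟦ q ⟧ ρ      ≤⟨ +-mono-≤ (≤-trans (P ρ N h) (^-monoˡ-≤ e (+-monoˡ-≤ N (m≤m+n c c′))))
            (≤-trans (Q ρ N h) (^-monoˡ-≤ e′ (+-monoˡ-≤ N (m≤n+m c′ c)))) ⟩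
        B ^ e + B ^ e′         ≤⟨ sum≤2product (m^n>0 B e) (m^n>0 B e′) ⟩
        2 * (B ^ e * B ^ e′)   ≤⟨ *-mono-≤ 2≤B (≤-reflexive (sym (^-distribˡ-+-* B e e′))) ⟩
        B * B ^ (e + e′)       ∎
        where
        B : ℕ
        B = c + c′ + N
        2≤B : 2 ≤ B
        2≤B = ≤-trans 2≤c (≤-trans (m≤m+n c c′) (m≤m+n (c + c′) N))
        instance
          B≢0 : NonZero B
          B≢0 = >-nonZero (≤-trans (s≤s z≤n) 2≤B)
    poly-bound (p :* q) with poly-bound p | poly-bound q
    ... | c , e , 2≤c , P | c′ , e′ , 2≤c′ , Q = c + c′ , e + e′ , ≤-trans 2≤c (m≤m+n c c′) , λ ρ N h →
      ≤-trans (*-mono-≤ (≤-trans (P ρ N h) (^-monoˡ-≤ e (+-monoˡ-≤ N (m≤m+n c c′))))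
          (≤-trans (Q ρ N h) (^-monoˡ-≤ e′ (+-monoˡ-≤ N (m≤n+m c′ c)))))
        (≤-reflexive (sym (^-distribˡ-+-* (c + c′ + N) e e′)))

-- Words of integers and dyadic numbers as stack contents.

module Words where

  open import Defs using (Kind; plain; Oracle; 𝟎; 𝟏; point; wordℤ; word𝔻; 𝔻; _/2^_; sign; Machine; loaded)
  open StackPrograms
  open Renaming
  open BinaryDigits
  open Subroutines
  open Simulating
  open import Data.Bool.Base using (Bool; true; false)
  open import Data.Fin.Base using (zero; suc)
  open import Data.Integer.Base as ℤ using (ℤ; -[1+_])
  open import Data.List.Base as List using (List; []; _∷_; _++_; length; reverse; replicate)
  open import Data.List.Properties
  open import Data.Nat.Base
  open import Data.Nat.Properties
  open import Data.Product.Base using (∃-syntax)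
  open import Data.Unit.Base using (tt)
  open import Data.Vec.Base as Vec using (Vec; []; _∷_)
  open import Relation.Binary.PropositionalEquality

  private variable
    X : Set

  num-0 : num {X} 0 ≡ []
  num-0 = cong bitsˢ digits-0

  from : ∀ {κ n} {O : Oracle κ} {s s′ s″ : Store X n} {p t} → s ≡ s″ → Run O p s s′ t → Run O p s″ s′ t
  from refl d = d

  parse₀-run : ∀ w rest → isBit (List.head rest) ≡ false →
    Run tt parse ((bitsˢ {X} w ++ rest) ∷ [] ∷ []) (rest ∷ num (horner 0 w) ∷ []) (suc (length w * 5))
  parse₀-run w rest e = from (cong (λ v → (bitsˢ w ++ rest) ∷ v ∷ []) num-0) (parse-run w rest 0 e)

  parseNum-run : ∀ n rest → isBit (List.head rest) ≡ false →
    Run tt parse ((bitsˢ {X} (show (digits n)) ++ rest) ∷ [] ∷ []) (rest ∷ num n ∷ [])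
        (suc (length (show (digits n)) * 5))
  parseNum-run n rest e = to (cong (λ m → rest ∷ num m ∷ []) (trans (horner-show (digits n)) (value-digits n)))
      (parse₀-run (show (digits n)) rest e)

  pushes : ℕ → Prog X plain 1
  pushes zero    = skip
  pushes (suc c) = pushes c ⨾ push r0 (gl 𝟏)

  pushes-run : ∀ c n → Run tt (pushes c) (ones {X} n ∷ []) (ones (c + n) ∷ []) (c * 2)
  pushes-run zero    n = skip
  pushes-run (suc c) n = weaken-≡ (pushes-run c n ⨾ push) (+-comm (c * 2) 2)

  neg : ℤ → Bool
  neg (ℤ.+ _)  = false
  neg -[1+ _ ] = true

  sign-neg : ∀ i → sign i ≡ signGlyph (neg i)
  sign-neg (ℤ.+ _)  = refl
  sign-neg -[1+ _ ] = refl

  signed-neg : ∀ i → signed (neg i) ℤ.∣ i ∣ ≡ i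
  signed-neg (ℤ.+ _)  = refl
  signed-neg -[1+ _ ] = refl

  wholePart : 𝔻 → ℕ
  wholePart (a /2^ b) = ℤ.∣ a ∣ >> b

  fracPart : 𝔻 → List Bool
  fracPart (a /2^ b) = frac b ℤ.∣ a ∣

  negative : 𝔻 → Bool
  negative (a /2^ b) = neg a

  wholeBits : 𝔻 → List Bool
  wholeBits d = show (digits (wholePart d))

  word𝔻-split : ∀ d → word {X} (word𝔻 d) ≡ word (signGlyph (negative d)) ++ bitsˢ (wholeBits d) ++ gl point ∷ bitsˢ
      (fracPart d)
  word𝔻-split {X} d@(a /2^ b) = trans (cong word
      (trans (word𝔻-digits a b) (cong (_++ (bitGlyphs (wholeBits d) ++ point ∷ bitGlyphs (fracPart d)))
      (sign-neg a))))
    (trans (map-++ gl (signGlyph (neg a)) _) (cong (word (signGlyph (neg a)) ++_)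
        (map-++ gl (bitGlyphs (wholeBits d)) _)))

  wordℤ-split : ∀ i → word {X} (wordℤ i) ≡ word (signGlyph (neg i)) ++ bitsˢ (show (digits ℤ.∣ i ∣))
  wordℤ-split i = trans (cong word (trans (wordℤ-digits i)
      (cong (_++ bitGlyphs (show (digits ℤ.∣ i ∣))) (sign-neg i))))
    (map-++ gl (signGlyph (neg i)) _)

  digits-2^ : ∀ b → digits (2 ^ b) ≡ replicate b false ++ true ∷ []
  digits-2^ zero    = digits-value (1∷ []) refl
  digits-2^ (suc b) = trans (digits-scons false (2 ^ b)) (trans (cong (scons false) (digits-2^ b)) (nonempty b))
    where
    nonempty : ∀ b → scons false (replicate b false ++ true ∷ []) ≡ false ∷ replicate b false ++ true ∷ []
    nonempty zero    = refl
    nonempty (suc b) = refl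

  show-2^ : ∀ b → show (digits (2 ^ b)) ≡ true ∷ replicate b false
  show-2^ b = trans (cong show (digits-2^ b)) (trans (nonempty b)
      (trans (reverse-++ (replicate b false) (true ∷ [])) (cong (true ∷_) (reverse-replicate b))))
    where
    nonempty : ∀ b → show (replicate b false ++ true ∷ []) ≡ reverse (replicate b false ++ true ∷ [])
    nonempty zero    = refl
    nonempty (suc b) = refl
    reverse-replicate : ∀ b → reverse (replicate b false) ≡ replicate b false
    reverse-replicate zero    = refl
    reverse-replicate (suc b) = trans (unfold-reverse false (replicate b false))
      (trans (cong (_++ false ∷ []) (reverse-replicate b))
          (trans (replicate-∷ b false []) (cong (false ∷_) (++-identityʳ _))))

  -- With `y` and `z` powers of two, the machine writes them from their unary exponents by copying
  -- zeros.
  wordℤ-2^ : ∀ b → wordℤ (ℤ.+ (2 ^ b)) ≡ 𝟏 ∷ replicate b 𝟎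
  wordℤ-2^ b = trans (wordℤ-digits (ℤ.+ (2 ^ b)))
      (trans (cong bitGlyphs (show-2^ b)) (cong (𝟏 ∷_) (map-replicate bitGlyph b false)))

  measure-zeros : ∀ m (zs : Stack X) → Run tt (measure (gl 𝟎)) (ones m ∷ [] ∷ zs ∷ [])
      (ones m ∷ [] ∷ (word (replicate m 𝟎) ++ zs) ∷ []) (measureCost m)
  measure-zeros {X} m zs = weaken-≡ (to (cong (λ v → ones m ∷ [] ∷ (v ++ zs) ∷ [])
      (trans (cong (λ l → replicate l (gl 𝟎)) (length-ones {X} m)) (replicate-word m 𝟎)))
    (measure-run (gl 𝟎) (ones m) zs)) (cong measureCost (length-ones {X} m))

  measure-length : ∀ (xs : Stack X) n → Run tt (measure (gl 𝟏)) (xs ∷ [] ∷ ones n ∷ [])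
      (xs ∷ [] ∷ ones (length xs + n) ∷ []) (measureCost (length xs))
  measure-length xs n = to (cong (λ v → xs ∷ [] ∷ v ∷ []) (ones-+ (length xs) n)) (measure-run (gl 𝟏) xs (ones n))

  module Tapes {κ : Kind} (M : Machine κ) where
    open Machine M
    open Simulation M using (tapesˢ)

    -- Even an empty tape scans a blank, so its second stack holds one blank mark.
    initTapes : ∀ k → Prog (Extra aux states) plain (k * 2)
    initTapes zero    = skip
    initTapes (suc k) = push r1 (mark blankˣ) ⨾ rename suc (rename suc (initTapes k))

    initTapes-run : ∀ k → Run tt (initTapes k) (Vec.replicate (k * 2) []) (tapesˢ (Vec.replicate k (loaded [])))
        (k * 2)
    initTapes-run zero    = skip
    initTapes-run (suc k) = push ⨾ run-shift (run-shift (initTapes-run k))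

-- The oracle program that computes f from an integer approximation.

module RealAlgorithm where

  open import Defs using (plain; oracle; Glyph; 𝟎; 𝟏; point; comma; unary; wordℤ; wordsℤ; word𝔻; 𝔻; _/2^_; Machine; loaded; leading𝟏s; Config; config; initial; run; output)
  open StackPrograms
  open Renaming
  open BinaryDigits
  open Subroutines
  open Words
  open Simulating
  open import Data.Bool.Base using (Bool; false)
  open import Data.Fin.Base using (Fin; zero; suc)
  open import Data.Fin.Patterns
  open import Data.Integer.Base as ℤ using (ℤ; -[1+_])
  open import Data.List.Base as List using (List; []; _∷_; _++_; length; replicate)
  open import Data.List.Properties
  open import Data.Nat.Base
  open import Data.Nat.Properties
  open import Data.Product.Base using (∃-syntax; _×_; _,_; proj₁; proj₂)
  open import Data.Unit.Base using (tt)
  open import Data.Vec.Base as Vec using (Vec; []; _∷_; lookup)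
  open import Relation.Binary.PropositionalEquality

  private variable
    X : Set

  -- registers: oracle answer, sign, whole part, magnitude
  readWhole : Prog X plain 4
  readWhole = use (r0 ∷ r1 ∷ []) parseSign ⨾ use (r1 ∷ []) clear ⨾ use (r0 ∷ r2 ∷ []) parse
    ⨾ use (r2 ∷ r3 ∷ []) drain ⨾ use (r3 ∷ []) (pushes 4)

  magnitude : 𝔻 → ℕ
  magnitude d = length (digits (wholePart d))

  readWhole-run : ∀ d → Run tt readWhole (word {X} (word𝔻 d) ∷ [] ∷ [] ∷ [] ∷ [])
    ((gl point ∷ bitsˢ (fracPart d)) ∷ [] ∷ [] ∷ ones (4 + magnitude d) ∷ [])
    (4 + (3 + (suc (length (wholeBits d) * 5) + (suc (magnitude d * 4) + 8))))
  readWhole-run {X} d = from (cong (λ v → v ∷ [] ∷ [] ∷ [] ∷ []) (sym (word𝔻-split d)))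
    (using-registers (r0 ∷ r1 ∷ []) (parseSign-run (negative d) (digits (wholePart d))
        (gl point ∷ bitsˢ (fracPart d)))
     ⨾ using-registers (r1 ∷ []) (clearSign-run (negative d))
     ⨾ using-registers (r0 ∷ r2 ∷ []) (parseNum-run (wholePart d) (gl point ∷ bitsˢ (fracPart d)) refl)
     ⨾ using-registers (r2 ∷ r3 ∷ []) drained
     ⨾ using-registers (r3 ∷ []) (pushes-run 4 (magnitude d)))
    where
    drained : Run tt drain (num {X} (wholePart d) ∷ [] ∷ []) ([] ∷ ones (magnitude d) ∷ []) (suc (magnitude d * 4))
    drained = subst (λ l → Run tt drain (num {X} (wholePart d) ∷ [] ∷ []) ([] ∷ ones l ∷ []) (suc (l * 4)))
        (length-bitsˢ {X} (digits (wholePart d)))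
      (to (cong (λ l → [] ∷ ones l ∷ []) (+-identityʳ _)) (drain-run (num (wholePart d)) 0))

  -- registers: oracle answer, sign, number, count
  truncate : Prog X plain 4
  truncate = use (r0 ∷ r1 ∷ []) parseSign ⨾ use (r0 ∷ r2 ∷ []) parse ⨾ pop r0 ⨾ use (r3 ∷ r0 ∷ r2 ∷ []) parseBits

  truncated : 𝔻 → ℕ → ℕ
  truncated d r = extend r (wholePart d) (fracPart d)

  truncate-run : ∀ d r → ∃[ w ] Run tt truncate (word {X} (word𝔻 d) ∷ [] ∷ [] ∷ ones r ∷ [])
    (w ∷ word (signGlyph (negative d)) ∷ num (truncated d r) ∷ [] ∷ [])
    (4 + (suc (length (wholeBits d) * 5) + (1 + suc (r * 7))))
  truncate-run {X} d r =
    let w , last = parseBits-run {X} r (fracPart d) (wholePart d) in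
    _ , from (cong (λ v → v ∷ [] ∷ [] ∷ ones r ∷ []) (sym (word𝔻-split d)))
      (using-registers (r0 ∷ r1 ∷ []) (parseSign-run (negative d) (digits (wholePart d))
          (gl point ∷ bitsˢ (fracPart d)))
       ⨾ using-registers (r0 ∷ r2 ∷ []) (parseNum-run (wholePart d) (gl point ∷ bitsˢ (fracPart d)) refl)
       ⨾ pop ⨾ using-registers (r3 ∷ r0 ∷ r2 ∷ []) last)

  -- registers: a, scratch, b, sign, number, output
  writeInput : Prog X plain 6
  writeInput = push r5 (gl comma) ⨾ use (r0 ∷ r1 ∷ r5 ∷ []) (measure (gl 𝟎)) ⨾ push r5 (gl 𝟏)
    ⨾ push r5 (gl comma) ⨾ use (r2 ∷ r1 ∷ r5 ∷ []) (measure (gl 𝟎)) ⨾ push r5 (gl 𝟏)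
    ⨾ push r5 (gl comma) ⨾ use (r3 ∷ r4 ∷ r5 ∷ []) emitℤ

  inputs : Bool → ℕ → ℕ → ℕ → Vec ℤ 3
  inputs g x a b = signed g x ∷ (ℤ.+ (2 ^ b)) ∷ (ℤ.+ (2 ^ a)) ∷ []

  writeInput-run : ∀ g x a b → Run tt writeInput (ones {X} a ∷ [] ∷ ones b ∷ word (signGlyph g) ∷ num x ∷ [] ∷ [])
    (ones a ∷ [] ∷ ones b ∷ [] ∷ [] ∷ word (wordsℤ (inputs g x a b)) ∷ [])
    (2 + (measureCost a + (2 + (2 + (measureCost b + (2 + (2 + (7 + length (digits x) * 4))))))))
  writeInput-run {X} g x a b = to (cong (λ v → ones a ∷ [] ∷ ones b ∷ [] ∷ [] ∷ v ∷ []) assemble)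
    (push ⨾ using-registers (r0 ∷ r1 ∷ r5 ∷ []) (measure-zeros a _) ⨾ push ⨾ push ⨾ using-registers
        (r2 ∷ r1 ∷ r5 ∷ []) (measure-zeros b _)
     ⨾ push ⨾ push ⨾ using-registers (r3 ∷ r4 ∷ r5 ∷ []) (emitℤ-run g x _))
    where
    zeros : ℕ → List Glyph
    zeros m = replicate m 𝟎
    assemble : word {X} (wordℤ (signed g x)) ++ gl comma ∷ gl 𝟏 ∷ word (zeros b) ++ gl comma ∷ gl 𝟏 ∷ word (zeros a)
        ++ gl comma ∷ []
             ≡ word (wordsℤ (inputs g x a b))
    assemble = sym (trans (map-++ gl (wordℤ (signed g x)) _) (cong (λ v → word (wordℤ (signed g x)) ++ gl comma ∷ v)
      (trans (cong (λ v → word (v ++ comma ∷ wordℤ (ℤ.+ (2 ^ a)) ++ comma ∷ [])) (wordℤ-2^ b))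
      (cong (gl 𝟏 ∷_) (trans (map-++ gl (zeros b) _) (cong (λ v → word (zeros b) ++ gl comma ∷ v)
      (trans (cong (λ v → word (v ++ comma ∷ [])) (wordℤ-2^ a)) (cong (gl 𝟏 ∷_) (map-++ gl (zeros a) _)))))))))

  -- registers: word, scratch, base, scratch, scratch, clock
  setClock : ℕ → ℕ → Prog X plain 6
  setClock c e = use (r2 ∷ []) clear ⨾ use (r0 ∷ r1 ∷ r2 ∷ []) (measure (gl 𝟏)) ⨾ use (r2 ∷ []) (pushes c)
    ⨾ use (r2 ∷ r1 ∷ r3 ∷ r4 ∷ []) (power e) ⨾ use (r3 ∷ r5 ∷ []) move

  setClock-run : ∀ c e (xs : Stack X) u → Run tt (setClock c e) (xs ∷ [] ∷ ones u ∷ [] ∷ [] ∷ [] ∷ [])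
    (xs ∷ [] ∷ ones (c + length xs) ∷ [] ∷ [] ∷ ones ((c + length xs) ^ e) ∷ [])
    (suc (u * 2) + (measureCost (length xs) + (c * 2 +
        (powerCost e (c + length xs) + suc ((c + length xs) ^ e * 4)))))
  setClock-run {X} c e xs u = weaken-≡ (using-registers (r2 ∷ []) (clear-run (ones u)))
      (cong (λ l → suc (l * 2)) (length-ones {X} u))
    ⨾ to (cong (λ l → xs ∷ [] ∷ ones l ∷ [] ∷ [] ∷ [] ∷ []) (+-identityʳ (length xs)))
        (using-registers (r0 ∷ r1 ∷ r2 ∷ []) (measure-length xs 0))
    ⨾ using-registers (r2 ∷ []) (pushes-run c (length xs))
    ⨾ using-registers (r2 ∷ r1 ∷ r3 ∷ r4 ∷ []) (power-run e (c + length xs))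
    ⨾ to (cong (λ l → xs ∷ [] ∷ ones (c + length xs) ∷ [] ∷ [] ∷ ones l ∷ []) (+-identityʳ ((c + length xs) ^ e)))
        (using-registers (r3 ∷ r5 ∷ []) (move-ones ((c + length xs) ^ e) 0))

  prefix-word : ∀ w → prefix {X} (word w) ≡ w
  prefix-word []      = refl
  prefix-word (c ∷ w) = cong (c ∷_) (prefix-word w)

  -- The query is written on top of what remains of the previous answer; the `point` below the ones
  -- ends the count.
  leading-ones : ∀ r (xs : Stack X) → leading𝟏s (prefix (replicate r (gl 𝟏) ++ gl point ∷ xs)) ≡ r
  leading-ones zero    xs = refl
  leading-ones (suc r) xs = cong suc (leading-ones r xs)

  module RealProgram (M : Machine plain) (k c c₂ e₂ : ℕ) where
    open Machine M
    open Simulation M hiding (X)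
    open Tapes M

    Y : Set
    Y = Extra aux states

    -- registers: input, output, query; 3 scratch; 4 b; 5 a; 6–8 unary powers; 9 sign;
    -- 10 number; 11 clock; 12 state; 13, 14 unused answer of the simulated machine;
    -- 15 onwards its tapes
    registers : ℕ
    registers = 15 + (3 + work) * 2

    prepare₁ : Prog Y oracle registers
    prepare₁ = use (r2 ∷ r9 ∷ r10 ∷ r5 ∷ []) readWhole ⨾ use (r0 ∷ r4 ∷ []) move ⨾ use (r4 ∷ []) (pushes c)
      ⨾ use (r5 ∷ r3 ∷ r6 ∷ []) (measure (gl 𝟏)) ⨾ use (r4 ∷ r3 ∷ r6 ∷ []) (measure (gl 𝟏)) ⨾ use
          (r6 ∷ r3 ∷ r7 ∷ r8 ∷ []) (power k)
      ⨾ push r2 (gl point) ⨾ use (r7 ∷ r3 ∷ r2 ∷ []) (measure (gl 𝟏))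

    prepare₂ : Prog Y oracle registers
    -- `r16` is the right half of the simulated input tape, so the input is written in place.
    prepare₂ = use (r2 ∷ r9 ∷ r10 ∷ r7 ∷ []) truncate ⨾ use (r5 ∷ r3 ∷ r4 ∷ r9 ∷ r10 ∷ r16 ∷ []) writeInput
      ⨾ use (r16 ∷ r3 ∷ r6 ∷ r7 ∷ r8 ∷ r11 ∷ []) (setClock c₂ e₂)
      -- The simulated machine asks nothing; `𝟎` stands in for the nonempty answer that the
      -- simulation carries along.
      ⨾ push r12 (mark (stateˣ start)) ⨾ push r13 (gl 𝟎) ⨾ shiftBy 16 (initTapes (2 + work))

    finish : Prog Y oracle registers
    finish = use (r18 ∷ r9 ∷ []) parseSign ⨾ use (r18 ∷ r10 ∷ []) parse ⨾ use (r10 ∷ r4 ∷ r1 ∷ []) format ⨾ use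
        (r9 ∷ r1 ∷ []) move

    -- The first `ask` finds an empty query tape and so requests precision 2^0. Only its whole part
    -- is used, to fix `a`; the second `ask` requests the precision `m ^ k` that this choice
    -- entails.
    program : Prog Y oracle registers
    program = ask ⨾ prepare₁ ⨾ ask ⨾ prepare₂ ⨾ shiftBy 10 simulate ⨾ finish

    module _ (φ : ℕ → 𝔻) (n : ℕ) where

      O : ℕ → List Glyph
      O i = word𝔻 (φ i)

      a b m E : ℕ
      -- The first answer is below 2^j for j its `magnitude`, the second differs from it by at most
      -- 2, and 4(2^j + 2) ≤ 2^(4+j). So z = 2^a satisfies the side condition on z.
      a = 4 + magnitude (φ 0)
      b = c + n
      m = b + a
      E = m ^ k

      d₀ d₁ : 𝔻
      d₀ = φ 0
      d₁ = φ E

      args : Vec ℤ 3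
      args = inputs (negative d₁) (truncated d₁ E) a b

      input : List Glyph
      input = wordsℤ args

      N clock : ℕ
      N = length (word {Y} input)
      clock = (c₂ + N) ^ e₂

      blanks : Store Y ((3 + work) * 2)
      blanks = Vec.replicate ((3 + work) * 2) []

      prepare₁Cost : ℕ
      prepare₁Cost = (4 + (3 + (suc (length (wholeBits d₀) * 5) + (suc (magnitude d₀ * 4) + 8))))
        + (suc (n * 4) + (c * 2 + (measureCost a + (measureCost b + (powerCost k m + (2 + measureCost E))))))

      prepare₁-run : Run {κ = oracle} O prepare₁
        (ones n ∷ [] ∷ word (word𝔻 d₀) ∷ [] ∷ [] ∷ [] ∷ [] ∷ [] ∷ [] ∷ [] ∷ [] ∷ [] ∷ [] ∷ [] ∷ [] ∷ blanks)
        ([] ∷ [] ∷ (replicate E (gl 𝟏) ++ gl point ∷ gl point ∷ bitsˢ (fracPart d₀)) ∷ [] ∷ ones b ∷ ones a ∷ ones m ∷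
            ones E ∷ [] ∷ [] ∷ [] ∷ [] ∷ [] ∷ [] ∷ [] ∷ blanks)
        prepare₁Cost
      prepare₁-run = using-registers (r2 ∷ r9 ∷ r10 ∷ r5 ∷ []) (readWhole-run d₀)
        ⨾ using-registers (r0 ∷ r4 ∷ []) moved
        ⨾ using-registers (r4 ∷ []) (pushes-run c n)
        ⨾ using-registers (r5 ∷ r3 ∷ r6 ∷ []) first
        ⨾ using-registers (r4 ∷ r3 ∷ r6 ∷ []) (measure-ones b a)
        ⨾ using-registers (r6 ∷ r3 ∷ r7 ∷ r8 ∷ []) (power-run k m)
        ⨾ push ⨾ using-registers (r7 ∷ r3 ∷ r2 ∷ []) spelled
        where
        moved : Run tt move (ones {Y} n ∷ [] ∷ []) ([] ∷ ones n ∷ []) (suc (n * 4))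
        moved = to (cong (λ l → [] ∷ ones l ∷ []) (+-identityʳ n)) (move-ones n 0)
        first : Run tt (measure (gl {Y} 𝟏)) (ones a ∷ [] ∷ [] ∷ []) (ones a ∷ [] ∷ ones a ∷ []) (measureCost a)
        first = to (cong (λ l → ones a ∷ [] ∷ ones l ∷ []) (+-identityʳ a)) (measure-ones a 0)
        spelled : ∀ {zs} → Run tt (measure (gl {Y} 𝟏)) (ones E ∷ [] ∷ zs ∷ [])
            (ones E ∷ [] ∷ (replicate E (gl 𝟏) ++ zs) ∷ []) (measureCost E)
        spelled {zs} = subst (λ l → Run tt (measure (gl 𝟏)) (ones E ∷ [] ∷ zs ∷ [])
            (ones E ∷ [] ∷ (replicate l (gl 𝟏) ++ zs) ∷ []) (measureCost l)) (length-ones {Y} E)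
          (measure-run (gl 𝟏) (ones E) zs)

      prepare₂Cost : ℕ
      prepare₂Cost = (4 + (suc (length (wholeBits d₁) * 5) + (1 + suc (E * 7))))
        + ((2 + (measureCost a + (2 + (2 + (measureCost b +
            (2 + (2 + (7 + length (digits (truncated d₁ E)) * 4))))))))
        + ((suc (m * 2) + (measureCost N + (c₂ * 2 + (powerCost e₂ (c₂ + N) + suc (clock * 4)))))
        + (2 + (2 + (2 + work) * 2))))

      prepare₂-run : ∃[ q ] Run {κ = oracle} O prepare₂
        ([] ∷ [] ∷ word (word𝔻 d₁) ∷ [] ∷ ones b ∷ ones a ∷ ones m ∷ ones E ∷ [] ∷ [] ∷ [] ∷ [] ∷ [] ∷ [] ∷ [] ∷
            blanks)
        ([] ∷ [] ∷ q ∷ [] ∷ ones b ∷ ones a ∷ ones (c₂ + N) ∷ [] ∷ [] ∷ [] ∷ [] ∷ ones clock ∷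
            (mark (stateˣ start) ∷ []) ∷ (gl 𝟎 ∷ []) ∷ [] ∷ [] ∷ word input ∷ tapesˢ
            (Vec.replicate (2 + work) (loaded [])))
        prepare₂Cost
      prepare₂-run = let q , d = truncate-run d₁ E in q ,
        using-registers (r2 ∷ r9 ∷ r10 ∷ r7 ∷ []) d
        ⨾ using-registers (r5 ∷ r3 ∷ r4 ∷ r9 ∷ r10 ∷ r16 ∷ []) (writeInput-run (negative d₁) (truncated d₁ E) a b)
        ⨾ using-registers (r16 ∷ r3 ∷ r6 ∷ r7 ∷ r8 ∷ r11 ∷ []) (setClock-run c₂ e₂ (word input) m)
        ⨾ push ⨾ push
        ⨾ run-shiftBy ([] ∷ [] ∷ q ∷ [] ∷ ones b ∷ ones a ∷ ones (c₂ + N) ∷ [] ∷ [] ∷ [] ∷ [] ∷ ones clock ∷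
            (mark (stateˣ start) ∷ []) ∷ (gl 𝟎 ∷ []) ∷ [] ∷ [] ∷ word input ∷ []) (initTapes-run (2 + work))

      final : Config M tt
      final = run M tt clock (initial M tt input)

      simulateCost : ℕ
      simulateCost = suc (clock * (2 + stepCost tt (𝟎 ∷ []) tt (s≤s z≤n) (2 + clock)))

      simulate-input : Run tt simulate
        (ones clock ∷ (mark (stateˣ start) ∷ []) ∷ (gl 𝟎 ∷ []) ∷ [] ∷ [] ∷ word input ∷ tapesˢ
            (Vec.replicate (2 + work) (loaded [])))
        ([] ∷ store tt (𝟎 ∷ []) tt (s≤s z≤n) final) simulateCost
      simulate-input = from (cong₂ (λ u v → ones clock ∷ (mark (stateˣ start) ∷ []) ∷ (gl 𝟎 ∷ []) ∷ [] ∷ u ∷ v ∷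
          tapesˢ (Vec.replicate (2 + work) (loaded [])))
          (before-loaded tt (𝟎 ∷ []) tt (s≤s z≤n) input) (after-loaded tt (𝟎 ∷ []) tt (s≤s z≤n) input nonempty))
        (simulate-run tt (𝟎 ∷ []) tt (s≤s z≤n) clock (initial M tt input) 0 (2 + clock) z≤n ≤-refl)
        where
        nonempty : 0 < length input
        nonempty = ≤-trans (s≤s z≤n) (≤-trans (m≤n+m _ (length (wordℤ (signed (negative d₁) (truncated d₁ E)))))
            (≤-reflexive (sym (length-++ (wordℤ (signed (negative d₁) (truncated d₁ E)))))))

      finishCost : ℤ → ℕ
      finishCost h = 4 + (suc (length (show (digits ℤ.∣ h ∣)) * 5) + (formatCost ℤ.∣ h ∣ b + 5))

      finish-run : ∀ h q₂ u (cfg : Config M tt) → output M tt cfg ≡ wordℤ h → ∃[ s ] Run {κ = oracle} O finish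
        ([] ∷ [] ∷ q₂ ∷ [] ∷ ones b ∷ ones a ∷ u ∷ [] ∷ [] ∷ [] ∷ [] ∷ [] ∷ store tt (𝟎 ∷ []) tt (s≤s z≤n) cfg) s
            (finishCost h)
        × lookup s r1 ≡ word (word𝔻 (h /2^ b))
      finish-run h q₂ u (config q (t₀ ∷ t ∷ t₂ ∷ ts)) out = _ ,
        (from (cong (λ v → [] ∷ [] ∷ q₂ ∷ [] ∷ ones b ∷ ones a ∷ u ∷ [] ∷ [] ∷ [] ∷ [] ∷ [] ∷ (mark (stateˣ q) ∷ []) ∷
            (gl 𝟎 ∷ []) ∷ [] ∷ before t₀ ∷ after t₀ ∷ before t ∷ v ∷ tapesˢ (t₂ ∷ ts)) (sym content))
          (using-registers (r18 ∷ r9 ∷ []) (parseSign-run (neg h) (digits ℤ.∣ h ∣) rest)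
          ⨾ using-registers (r18 ∷ r10 ∷ []) (parseNum-run ℤ.∣ h ∣ rest stop)
          ⨾ using-registers (r10 ∷ r4 ∷ r1 ∷ []) (format-run ℤ.∣ h ∣ b)
          ⨾ using-registers (r9 ∷ r1 ∷ []) (moveSign-run (neg h) _))) ,
        trans (sym (map-++ gl (signGlyph (neg h)) _)) (cong word
            (sym (trans (word𝔻-digits h b) (cong (_++ (bitGlyphs (show (digits (ℤ.∣ h ∣ >> b))) ++ point ∷ bitGlyphs
            (frac b ℤ.∣ h ∣))) (sign-neg h)))))
        where
        rest : Stack Y
        rest = proj₁ (after-contents t)
        stop : isBit (List.head rest) ≡ false
        stop = proj₂ (proj₂ (after-contents t))
        content : after t ≡ word (signGlyph (neg h)) ++ bitsˢ (show (digits ℤ.∣ h ∣)) ++ rest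
        content = trans (proj₁ (proj₂ (after-contents t))) (trans (cong (λ v → word v ++ rest) out)
          (trans (cong (_++ rest) (wordℤ-split h)) (++-assoc (word (signGlyph (neg h))) _ rest)))

      programCost : ℤ → ℕ
      programCost h = 1 + (prepare₁Cost + (1 + (prepare₂Cost + (simulateCost + finishCost h))))

      program-run : ∀ h → output M tt final ≡ wordℤ h → ∃[ s ] Run {κ = oracle} O program
        (word (unary n) ∷ Vec.replicate (14 + (3 + work) * 2) []) s (programCost h) × lookup s r1 ≡ word
            (word𝔻 (h /2^ b))
      program-run h out =
        let q , d₂ = prepare₂-run
            s , d₃ , e = finish-run h q (ones (c₂ + N)) final out
        in s , ask ⨾ prepare₁-run
             ⨾ to (cong (λ r → [] ∷ [] ∷ word (O r) ∷ [] ∷ ones b ∷ ones a ∷ ones m ∷ ones E ∷ [] ∷ [] ∷ [] ∷ [] ∷ []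
                 ∷ [] ∷ [] ∷ blanks) (leading-ones E _)) ask
             ⨾ d₂
             ⨾ run-shiftBy ([] ∷ [] ∷ q ∷ [] ∷ ones b ∷ ones a ∷ ones (c₂ + N) ∷ [] ∷ [] ∷ [] ∷ [] ∷ [])
                 simulate-input ⨾ d₃ , e

-- The program that computes the integer function approximating y f(x / 2^(m^K)).

module IntegerAlgorithm where

  open import Defs using (plain; oracle; Glyph; 𝟏; point; comma; unary; wordℤ; wordsℤ; word𝔻; 𝔻; _/2^_; sign; Machine; loaded; Config; config; initial; run; output)
  import Defs
  open StackPrograms
  open Renaming
  open BinaryDigits
  open Subroutines
  open Words
  open Multiplication
  open Simulating
  open RealAlgorithm
  open import Data.Bool.Base using (false)
  open import Data.Fin.Base using (Fin; zero; suc)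
  open import Data.Integer.Base as ℤ using (ℤ; -[1+_])
  open import Data.List.Base as List using (List; []; _∷_; _++_; length; drop; replicate)
  open import Data.List.Properties
  open import Data.Nat.Base
  open import Data.Nat.Properties
  open import Data.Nat.Tactic.RingSolver using (solve-∀)
  open import Data.Product.Base using (∃-syntax; _×_; _,_; proj₁; proj₂)
  open import Data.Unit.Base using (tt)
  open import Data.Vec.Base as Vec using (Vec; []; _∷_; lookup)
  open import Relation.Binary.PropositionalEquality

  private variable
    X : Set

  clear-ones : ∀ l → Run tt clear (ones {X} l ∷ []) ([] ∷ []) (suc (l * 2))
  clear-ones {X} l = weaken-≡ (clear-run (ones l)) (cong (λ l → suc (l * 2)) (length-ones {X} l))

  mulParse₀-run : ∀ w n a j (rest : Stack X) → isBit (List.head rest) ≡ false → 2 ^ length w * a < 2 ^ n → Run tt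
      mulParse
    ((bitsˢ w ++ rest) ∷ num a ∷ [] ∷ [] ∷ [] ∷ [] ∷ ones n ∷ [] ∷ ones j ∷ [])
    (rest ∷ num a ∷ [] ∷ num (a * horner 0 w) ∷ [] ∷ [] ∷ ones n ∷ [] ∷ ones (length w + j) ∷ [])
        (mulCost n (length w))
  mulParse₀-run w n a j rest e lt = from (cong (λ v → (bitsˢ w ++ rest) ∷ num a ∷ [] ∷ v ∷ [] ∷ [] ∷ ones n ∷ [] ∷
      ones j ∷ []) (trans (cong num (*-zeroʳ a)) num-0))
    (mulParse-run w n a 0 j rest e (subst (λ v → v * a < 2 ^ n) (sym (*-identityˡ (2 ^ length w))) lt))

  wordℤ-parts : ∀ i (rest : Stack X) → word (wordℤ i) ++ rest ≡ word (signGlyph (neg i)) ++ bitsˢ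
      (show (digits ℤ.∣ i ∣)) ++ rest
  wordℤ-parts i rest = trans (cong (_++ rest) (wordℤ-split i)) (++-assoc (word (signGlyph (neg i))) _ rest)

  shown : ℤ → ℕ
  shown i = length (show (digits ℤ.∣ i ∣))

  length-wordℤ : ∀ i → length (wordℤ i) ≡ length (sign i) + shown i
  length-wordℤ i = trans (cong length (wordℤ-digits i))
    (trans (length-++ (sign i)) (cong (length (sign i) +_) (length-map bitGlyph (show (digits ℤ.∣ i ∣)))))

  shown≤word : ∀ i → shown i ≤ length (wordℤ i)
  shown≤word i = ≤-trans (m≤n+m (shown i) (length (sign i))) (≤-reflexive (sym (length-wordℤ i)))

  -- registers: source, sign, number
  readℤ : Prog X plain 3
  readℤ = use (r0 ∷ r1 ∷ []) parseSign ⨾ use (r0 ∷ r2 ∷ []) parse ⨾ pop r0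

  readℤ-run : ∀ i (rest : Stack X) → Run tt readℤ ((word (wordℤ i) ++ gl comma ∷ rest) ∷ [] ∷ [] ∷ [])
    (rest ∷ word (signGlyph (neg i)) ∷ num ℤ.∣ i ∣ ∷ []) (4 + (suc (shown i * 5) + 1))
  readℤ-run i rest = from (cong (λ v → v ∷ [] ∷ [] ∷ []) (sym (wordℤ-parts i (gl comma ∷ rest))))
    (using-registers (r0 ∷ r1 ∷ []) (parseSign-run (neg i) (digits ℤ.∣ i ∣) (gl comma ∷ rest))
     ⨾ using-registers (r0 ∷ r2 ∷ []) (parseNum-run ℤ.∣ i ∣ (gl comma ∷ rest) refl) ⨾ pop)

  -- registers: source, sign, factor, scratch, product, scratch, carry, clock, scratch, count
  readProduct : Prog X plain 10
  readProduct = use (r0 ∷ r1 ∷ []) parseSign ⨾ use (r1 ∷ []) clear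
    ⨾ use (r0 ∷ r2 ∷ r3 ∷ r4 ∷ r5 ∷ r6 ∷ r7 ∷ r8 ∷ r9 ∷ []) mulParse ⨾ use (r9 ∷ []) clear

  readProduct-run : ∀ i y n (rest : Stack X) → 2 ^ shown i * y < 2 ^ n → Run tt readProduct
    ((word (wordℤ i) ++ gl comma ∷ rest) ∷ [] ∷ num y ∷ [] ∷ [] ∷ [] ∷ [] ∷ ones n ∷ [] ∷ [] ∷ [])
    ((gl comma ∷ rest) ∷ [] ∷ num y ∷ [] ∷ num (y * ℤ.∣ i ∣) ∷ [] ∷ [] ∷ ones n ∷ [] ∷ [] ∷ [])
    (4 + (3 + (mulCost n (shown i) + suc (shown i * 2))))
  readProduct-run i y n rest lt = from (cong (λ v → v ∷ [] ∷ num y ∷ [] ∷ [] ∷ [] ∷ [] ∷ ones n ∷ [] ∷ [] ∷ [])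
      (sym (wordℤ-parts i (gl comma ∷ rest))))
    (using-registers (r0 ∷ r1 ∷ []) (parseSign-run (neg i) (digits ℤ.∣ i ∣) (gl comma ∷ rest))
     ⨾ using-registers (r1 ∷ []) (clearSign-run (neg i))
     ⨾ to (cong₂ (λ v l → (gl comma ∷ rest) ∷ [] ∷ num y ∷ [] ∷ num (y * v) ∷ [] ∷ [] ∷ ones n ∷ [] ∷ ones l ∷ [])
          (trans (horner-show (digits ℤ.∣ i ∣)) (value-digits ℤ.∣ i ∣)) (+-identityʳ (shown i)))
        (using-registers (r0 ∷ r2 ∷ r3 ∷ r4 ∷ r5 ∷ r6 ∷ r7 ∷ r8 ∷ r9 ∷ [])
            (mulParse₀-run (show (digits ℤ.∣ i ∣)) n y 0 (gl comma ∷ rest) refl lt))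
     ⨾ using-registers (r9 ∷ []) (clear-ones (shown i)))

  -- registers: number, logarithm
  logarithm : Prog X plain 2
  logarithm = drain ⨾ pop r1

  ⌊log₂_⌋ : ℕ → ℕ
  ⌊log₂ n ⌋ = pred (length (digits n))

  logarithm-run : ∀ n → Run tt logarithm (num {X} n ∷ [] ∷ []) ([] ∷ ones ⌊log₂ n ⌋ ∷ [])
      (suc (length (digits n) * 4) + 1)
  logarithm-run {X} n = subst (λ l → Run tt drain (num n ∷ [] ∷ []) ([] ∷ ones l ∷ []) (suc (l * 4)))
      (length-bitsˢ {X} (digits n))
      (to (cong (λ l → [] ∷ ones l ∷ []) (+-identityʳ _)) (drain-run (num n) 0))
    ⨾ to (cong (λ v → [] ∷ v ∷ []) (drop-ones (length (digits n)))) pop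
    where
    drop-ones : ∀ l → drop 1 (ones {X} l) ≡ ones (pred l)
    drop-ones zero    = refl
    drop-ones (suc l) = refl

  significand : 𝔻 → ℕ
  significand d = horner (wholePart d) (fracPart d)

  -- `y` times `d`, rounded towards zero: the machine multiplies by the significand and then drops
  -- as many bits as `d` has binary places.
  scaledFloor : 𝔻 → ℕ → ℤ
  scaledFloor d y = signed (negative d) ((y * significand d) >> length (fracPart d))

  -- registers: source, scratch, clock, sign, factor, scratch, product, scratch, carry, scratch, count, output
  writeProduct : Prog X plain 12
  writeProduct = use (r0 ∷ r1 ∷ r2 ∷ []) (measure (gl 𝟏)) ⨾ use (r0 ∷ r3 ∷ []) parseSign
    ⨾ use (r0 ∷ r4 ∷ r5 ∷ r6 ∷ r7 ∷ r8 ∷ r2 ∷ r9 ∷ r10 ∷ []) mulParse ⨾ use (r10 ∷ []) clear ⨾ pop r0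
    -- The product continues across the point, whereas the counter was cleared there and thus ends
    -- as the number of binary places.
    ⨾ use (r0 ∷ r4 ∷ r5 ∷ r6 ∷ r7 ∷ r8 ∷ r2 ∷ r9 ∷ r10 ∷ []) mulParse
    ⨾ use (r10 ∷ r6 ∷ []) shiftRight ⨾ use (r3 ∷ r6 ∷ r11 ∷ []) emitℤ

  writeProductCost : ℕ → ℕ → 𝔻 → ℕ → ℕ
  writeProductCost l n d y = measureCost l + (4 +
      (mulCost (l + n) (length (wholeBits d)) + (suc (length (wholeBits d) * 2) +
      (1 + (mulCost (l + n) (length (fracPart d))
    + (suc (length (fracPart d) * 3) + (7 + length (digits ((y * significand d) >> length (fracPart d))) * 4)))))))

  length-show : ∀ w → length w ≤ length (show w)
  length-show []        = z≤n
  length-show w@(_ ∷ _) = ≤-reflexive (sym (length-reverse w))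

  suc≤2^shown : ∀ n → suc n ≤ 2 ^ length (show (digits n))
  suc≤2^shown n = ≤-trans (digits-upper n) (^-monoʳ-≤ 2 (length-show (digits n)))

  writeProduct-run : ∀ d y n src (rest : Stack X) → src ≡ word (word𝔻 d) ++ rest → isBit (List.head rest) ≡ false →
      length (digits y) ≤ n →
    ∃[ s ] Run tt writeProduct
      (src ∷ [] ∷ ones n ∷ [] ∷ num y ∷ [] ∷ [] ∷ [] ∷ [] ∷ [] ∷ [] ∷ [] ∷ []) s (writeProductCost (length src) n d y)
      × lookup s r11 ≡ word (wordℤ (scaledFloor d y))
  writeProduct-run {X} d y n src rest refl stop y≤n = _ ,
    (using-registers (r0 ∷ r1 ∷ r2 ∷ []) (measure-length src n)
     ⨾ from (cong (λ v → v ∷ [] ∷ ones n′ ∷ [] ∷ num y ∷ [] ∷ [] ∷ [] ∷ [] ∷ [] ∷ [] ∷ [] ∷ []) (sym parts))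
       (using-registers (r0 ∷ r3 ∷ []) (parseSign-run (negative d) (digits (wholePart d)) tail))
     ⨾ to (cong₂ (λ v l → tail ∷ [] ∷ ones n′ ∷ word (signGlyph (negative d)) ∷ num y ∷ [] ∷ num (y * v) ∷ [] ∷ [] ∷
         [] ∷ ones l ∷ [] ∷ [])
          (trans (horner-show (digits (wholePart d))) (value-digits (wholePart d)))
              (+-identityʳ (length (wholeBits d))))
        (using-registers (r0 ∷ r4 ∷ r5 ∷ r6 ∷ r7 ∷ r8 ∷ r2 ∷ r9 ∷ r10 ∷ [])
            (mulParse₀-run (wholeBits d) n′ y 0 tail refl lt₁))
     ⨾ using-registers (r10 ∷ []) (clear-ones (length (wholeBits d))) ⨾ pop
     ⨾ using-registers (r0 ∷ r4 ∷ r5 ∷ r6 ∷ r7 ∷ r8 ∷ r2 ∷ r9 ∷ r10 ∷ [])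
         (mulParse-run (fracPart d) n′ y (wholePart d) 0 rest stop lt₂)
     ⨾ from (cong₂ (λ v l → rest ∷ [] ∷ ones n′ ∷ word (signGlyph (negative d)) ∷ num y ∷ [] ∷ num v ∷ [] ∷ [] ∷ [] ∷
         ones l ∷ [] ∷ [])
          (>>-zero (y * significand d)) (sym (+-identityʳ (length (fracPart d)))))
        (to (cong (λ l → rest ∷ [] ∷ ones n′ ∷ word (signGlyph (negative d)) ∷ num y ∷ [] ∷ num
            ((y * significand d) >> l) ∷ [] ∷ [] ∷ [] ∷ [] ∷ [] ∷ []) (+-identityʳ (length (fracPart d))))
          (using-registers (r10 ∷ r6 ∷ []) (shiftRight-run (length (fracPart d)) (y * significand d) 0)))
     ⨾ using-registers (r3 ∷ r6 ∷ r11 ∷ []) (emitℤ-run (negative d) ((y * significand d) >> length (fracPart d)) []))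
         ,
    ++-identityʳ _
    where
    tail : Stack X
    tail = gl point ∷ bitsˢ (fracPart d) ++ rest
    n′ : ℕ
    -- Enough places for the adder: the written number fits into `length src` bits and `y` into `n`,
    -- and both lengths are at hand in unary.
    n′ = length src + n
    parts : src ≡ word (signGlyph (negative d)) ++ bitsˢ (wholeBits d) ++ tail
    parts = trans (cong (_++ rest) (word𝔻-split d)) (trans (++-assoc (word (signGlyph (negative d))) _ rest)
      (cong (word (signGlyph (negative d)) ++_) (++-assoc (bitsˢ (wholeBits d)) _ rest)))
    W F L : ℕ
    W = length (wholeBits d)
    F = length (fracPart d)
    L = length (digits y)
    W+F≤ : W + F ≤ length src
    W+F≤ = begin
      W + F                                     ≤⟨ +-monoʳ-≤ W (≤-trans (m≤m+n F (length rest)) (n≤1+n _)) ⟩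
      W + suc (F + length rest)                 ≡⟨ cong₂ (λ u v → u + suc (v + length rest))
          (length-bitsˢ {X} (wholeBits d)) (length-bitsˢ {X} (fracPart d)) ⟨
      length (bitsˢ {X} (wholeBits d)) + suc (length (bitsˢ {X} (fracPart d)) + length rest) ≡⟨ cong
          (λ u → length (bitsˢ {X} (wholeBits d)) + suc u) (length-++ (bitsˢ (fracPart d))) ⟨
      length (bitsˢ {X} (wholeBits d)) + length tail ≡⟨ length-++ (bitsˢ (wholeBits d)) ⟨
      length (bitsˢ {X} (wholeBits d) ++ tail)  ≤⟨ m≤n+m _ (length (word {X} (signGlyph (negative d)))) ⟩
      length (word {X} (signGlyph (negative d))) + length (bitsˢ {X} (wholeBits d) ++ tail) ≡⟨ length-++
          (word (signGlyph (negative d))) ⟨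
      length (word {X} (signGlyph (negative d)) ++ bitsˢ (wholeBits d) ++ tail) ≡⟨ cong length parts ⟨
      length src                                ∎
      where open ≤-Reasoning
    bound : ∀ l → l ≤ W + F → 2 ^ l * y < 2 ^ n′
    bound l l≤ = begin-strict
      2 ^ l * y       <⟨ *-monoʳ-< (2 ^ l) {{m^n≢0 2 l}} (digits-upper y) ⟩
      2 ^ l * 2 ^ L   ≡⟨ ^-distribˡ-+-* 2 l L ⟨
      2 ^ (l + L)     ≤⟨ ^-monoʳ-≤ 2 (+-mono-≤ (≤-trans l≤ W+F≤) y≤n) ⟩
      2 ^ n′          ∎
      where open ≤-Reasoning
    lt₁ : 2 ^ W * y < 2 ^ n′
    lt₁ = bound W (m≤m+n W F)
    lt₂ : suc (wholePart d) * 2 ^ F * y < 2 ^ n′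
    lt₂ = ≤-<-trans (*-monoˡ-≤ y (≤-trans (*-monoˡ-≤ (2 ^ F) (suc≤2^shown (wholePart d)))
        (≤-reflexive (sym (^-distribˡ-+-* 2 W F))))) (bound (W + F) ≤-refl)

  module IntegerProgram (M : Machine oracle) (K c₂ e₂ : ℕ) where
    open Machine M
    open Simulation M hiding (X)
    open Tapes M

    Y : Set
    Y = Extra aux states

    -- registers: input, output, unused; 3 scratch; 4, 5 length of the input; 6–8 unary powers;
    -- 9 sign; 10 |x|; 11 |y|; 12–16 multiplication; 17 clock; 18 state; 19 oracle answer;
    -- 20 scratch; 21 onwards the tapes of the simulated machine
    registers : ℕ
    registers = 21 + (3 + work) * 2

    read : Prog Y plain registers
    read = use (r0 ∷ r3 ∷ r4 ∷ []) (measure (gl 𝟏)) ⨾ use (r0 ∷ r9 ∷ r10 ∷ []) readℤ ⨾ use (r0 ∷ r3 ∷ r11 ∷ []) readℤ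
        ⨾ use (r3 ∷ []) clear
      ⨾ use (r0 ∷ r3 ∷ r11 ∷ r12 ∷ r13 ∷ r14 ∷ r15 ∷ r4 ∷ r5 ∷ r16 ∷ []) readProduct

    prepare : Prog Y plain registers
    prepare = use (r13 ∷ r6 ∷ []) logarithm ⨾ use (r6 ∷ r3 ∷ r7 ∷ r8 ∷ []) (power K) ⨾ use (r10 ∷ r7 ∷ r19 ∷ [])
        format ⨾ use (r9 ∷ r19 ∷ []) move
      -- The length of the input, in unary, becomes the precision requested of `M`; `r22` is the
      -- right half of its input tape.
      ⨾ use (r4 ∷ r3 ∷ r22 ∷ []) (measure (gl 𝟏)) ⨾ use (r4 ∷ r3 ∷ r6 ∷ r7 ∷ r8 ∷ r17 ∷ []) (setClock c₂ e₂)
      ⨾ push r18 (mark (stateˣ start)) ⨾ shiftBy 22 (initTapes (2 + work))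

    finish : Prog Y plain registers
    finish = use (r24 ∷ r3 ∷ r4 ∷ r9 ∷ r11 ∷ r12 ∷ r13 ∷ r14 ∷ r15 ∷ r5 ∷ r16 ∷ r1 ∷ []) writeProduct

    program : Prog Y plain registers
    program = read ⨾ prepare ⨾ shiftBy 16 simulate ⨾ finish

    module _ (x y z : ℤ) where

      input : List Glyph
      input = wordsℤ (x ∷ y ∷ z ∷ [])

      N m E clock : ℕ
      N = length input
      m = ⌊log₂ ℤ.∣ y ∣ * ℤ.∣ z ∣ ⌋
      E = m ^ K
      clock = (c₂ + N) ^ e₂

      point-x : 𝔻
      point-x = x /2^ E

      answer : List Glyph
      answer = word𝔻 point-x

      O : ℕ → List Glyph
      O _ = answer

      blanks : Store Y ((3 + work) * 2)
      blanks = Vec.replicate ((3 + work) * 2) []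

      readCost : ℕ
      readCost = measureCost N + ((4 + (suc (shown x * 5) + 1)) + ((4 + (suc (shown y * 5) + 1)) + (3
        + (4 + (3 + (mulCost N (shown z) + suc (shown z * 2)))))))

      length-input : N ≡ length (wordℤ x) + suc (length (wordℤ y) + suc (length (wordℤ z) + 1))
      length-input = trans (length-++ (wordℤ x)) (cong (λ l → length (wordℤ x) + suc l)
        (trans (length-++ (wordℤ y)) (cong (λ l → length (wordℤ y) + suc l) (length-++ (wordℤ z)))))

      product-fits : 2 ^ shown z * ℤ.∣ y ∣ < 2 ^ N
      product-fits = begin-strict
        2 ^ shown z * ℤ.∣ y ∣                <⟨ *-monoʳ-< (2 ^ shown z) {{m^n≢0 2 (shown z)}} (digits-upper ℤ.∣ y ∣) ⟩
        2 ^ shown z * 2 ^ length (digits ℤ.∣ y ∣) ≡⟨ ^-distribˡ-+-* 2 (shown z) (length (digits ℤ.∣ y ∣)) ⟨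
        2 ^ (shown z + length (digits ℤ.∣ y ∣)) ≤⟨ ^-monoʳ-≤ 2 enough ⟩
        2 ^ N                                ∎
        where
        open ≤-Reasoning
        rearrange : ∀ a b c → c + b + (a + 3) ≡ a + suc (b + suc (c + 1))
        rearrange = solve-∀
        enough : shown z + length (digits ℤ.∣ y ∣) ≤ N
        enough = begin
          shown z + length (digits ℤ.∣ y ∣)              ≤⟨ +-mono-≤ (shown≤word z)
              (≤-trans (length-show (digits ℤ.∣ y ∣)) (shown≤word y)) ⟩
          length (wordℤ z) + length (wordℤ y)            ≤⟨ m≤m+n _ (length (wordℤ x) + 3) ⟩
          length (wordℤ z) + length (wordℤ y) + (length (wordℤ x) + 3) ≡⟨ rearrange (length (wordℤ x))
              (length (wordℤ y)) (length (wordℤ z)) ⟩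
          length (wordℤ x) + suc (length (wordℤ y) + suc (length (wordℤ z) + 1)) ≡⟨ length-input ⟨
          N                                              ∎

      read-run : Run tt read
        (word input ∷ [] ∷ [] ∷ [] ∷ [] ∷ [] ∷ [] ∷ [] ∷ [] ∷ [] ∷ [] ∷ [] ∷ [] ∷ [] ∷ [] ∷ [] ∷ [] ∷ [] ∷ [] ∷ [] ∷
            [] ∷ blanks)
        ((gl comma ∷ []) ∷ [] ∷ [] ∷ [] ∷ ones N ∷ [] ∷ [] ∷ [] ∷ [] ∷ word (signGlyph (neg x)) ∷ num ℤ.∣ x ∣ ∷ num
            ℤ.∣ y ∣ ∷ [] ∷ num (ℤ.∣ y ∣ * ℤ.∣ z ∣) ∷ [] ∷ [] ∷ [] ∷ [] ∷ [] ∷ [] ∷ [] ∷ blanks)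
        readCost
      read-run = using-registers (r0 ∷ r3 ∷ r4 ∷ []) measured
        ⨾ from (cong (λ v → v ∷ [] ∷ [] ∷ [] ∷ ones N ∷ [] ∷ [] ∷ [] ∷ [] ∷ [] ∷ [] ∷ [] ∷ [] ∷ [] ∷ [] ∷ [] ∷ [] ∷ []
            ∷ [] ∷ [] ∷ [] ∷ blanks) (sym parts))
          (using-registers (r0 ∷ r9 ∷ r10 ∷ []) (readℤ-run x _))
        ⨾ using-registers (r0 ∷ r3 ∷ r11 ∷ []) (readℤ-run y _)
        ⨾ using-registers (r3 ∷ []) (clearSign-run (neg y))
        ⨾ using-registers (r0 ∷ r3 ∷ r11 ∷ r12 ∷ r13 ∷ r14 ∷ r15 ∷ r4 ∷ r5 ∷ r16 ∷ [])
            (readProduct-run z ℤ.∣ y ∣ N [] product-fits)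
        where
        measured : Run tt (measure (gl {Y} 𝟏)) (word input ∷ [] ∷ [] ∷ []) (word input ∷ [] ∷ ones N ∷ [])
            (measureCost N)
        measured = subst (λ l → Run tt (measure (gl {Y} 𝟏)) (word input ∷ [] ∷ [] ∷ [])
            (word input ∷ [] ∷ ones l ∷ []) (measureCost l)) (length-map gl input)
          (to (cong (λ l → word input ∷ [] ∷ ones l ∷ []) (+-identityʳ _)) (measure-length (word input) 0))
        parts : word {Y} input ≡ word (wordℤ x) ++ gl comma ∷ word (wordℤ y) ++ gl comma ∷ word (wordℤ z) ++ gl comma
            ∷ []
        parts = trans (map-++ gl (wordℤ x) _) (cong (λ v → word (wordℤ x) ++ gl comma ∷ v)
          (trans (map-++ gl (wordℤ y) _) (cong (λ v → word (wordℤ y) ++ gl comma ∷ v) (map-++ gl (wordℤ z) _))))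

      prepareCost : ℕ
      prepareCost = (suc (length (digits (ℤ.∣ y ∣ * ℤ.∣ z ∣)) * 4) + 1) +
          (powerCost K m + (formatCost ℤ.∣ x ∣ E + (5 + (measureCost N
        + ((suc (m * 2) + (measureCost N + (c₂ * 2 + (powerCost e₂ (c₂ + N) + suc (clock * 4))))) +
            (2 + (2 + work) * 2))))))

      prepare-run : Run tt prepare
        ((gl comma ∷ []) ∷ [] ∷ [] ∷ [] ∷ ones N ∷ [] ∷ [] ∷ [] ∷ [] ∷ word (signGlyph (neg x)) ∷ num ℤ.∣ x ∣ ∷ num
            ℤ.∣ y ∣ ∷ [] ∷ num (ℤ.∣ y ∣ * ℤ.∣ z ∣) ∷ [] ∷ [] ∷ [] ∷ [] ∷ [] ∷ [] ∷ [] ∷ blanks)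
        ((gl comma ∷ []) ∷ [] ∷ [] ∷ [] ∷ ones N ∷ [] ∷ ones (c₂ + N) ∷ [] ∷ [] ∷ [] ∷ [] ∷ num ℤ.∣ y ∣ ∷ [] ∷ [] ∷ []
            ∷ [] ∷ [] ∷ ones clock ∷ (mark (stateˣ start) ∷ []) ∷ word answer ∷ [] ∷ [] ∷ ones N ∷ tapesˢ
            (Vec.replicate (2 + work) (loaded [])))
        prepareCost
      prepare-run = using-registers (r13 ∷ r6 ∷ []) (logarithm-run (ℤ.∣ y ∣ * ℤ.∣ z ∣))
        ⨾ using-registers (r6 ∷ r3 ∷ r7 ∷ r8 ∷ []) (power-run K m)
        ⨾ using-registers (r10 ∷ r7 ∷ r19 ∷ []) (format-run ℤ.∣ x ∣ E)
        ⨾ to (cong (λ v → (gl comma ∷ []) ∷ [] ∷ [] ∷ [] ∷ ones N ∷ [] ∷ ones m ∷ [] ∷ [] ∷ [] ∷ [] ∷ num ℤ.∣ y ∣ ∷ []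
            ∷ [] ∷ [] ∷ [] ∷ [] ∷ [] ∷ [] ∷ v ∷ [] ∷ blanks) spelled)
            (using-registers (r9 ∷ r19 ∷ []) (moveSign-run (neg x) _))
        ⨾ using-registers (r4 ∷ r3 ∷ r22 ∷ []) measured
        ⨾ using-registers (r4 ∷ r3 ∷ r6 ∷ r7 ∷ r8 ∷ r17 ∷ []) clocked
        ⨾ push
        ⨾ run-shiftBy ((gl comma ∷ []) ∷ [] ∷ [] ∷ [] ∷ ones N ∷ [] ∷ ones (c₂ + N) ∷ [] ∷ [] ∷ [] ∷ [] ∷ num ℤ.∣ y ∣
            ∷ [] ∷ [] ∷ [] ∷ [] ∷ [] ∷ ones clock ∷ (mark (stateˣ start) ∷ []) ∷ word answer ∷ [] ∷ [] ∷ ones N ∷ [])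
            (initTapes-run (2 + work))
        where
        spelled : word {Y} (signGlyph (neg x)) ++ word
            (bitGlyphs (show (digits (ℤ.∣ x ∣ >> E))) ++ point ∷ bitGlyphs (frac E ℤ.∣ x ∣)) ≡ word answer
        spelled = trans (sym (map-++ gl (signGlyph (neg x)) _))
          (cong word (sym (trans (word𝔻-digits x E) (cong
              (_++ (bitGlyphs (show (digits (ℤ.∣ x ∣ >> E))) ++ point ∷ bitGlyphs (frac E ℤ.∣ x ∣))) (sign-neg x)))))
        measured : Run tt (measure (gl {Y} 𝟏)) (ones N ∷ [] ∷ [] ∷ []) (ones N ∷ [] ∷ ones N ∷ []) (measureCost N)
        measured = to (cong (λ l → ones N ∷ [] ∷ ones l ∷ []) (+-identityʳ N)) (measure-ones N 0)
        clocked : Run tt (setClock {Y} c₂ e₂) (ones N ∷ [] ∷ ones m ∷ [] ∷ [] ∷ [] ∷ [])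
            (ones N ∷ [] ∷ ones (c₂ + N) ∷ [] ∷ [] ∷ ones clock ∷ [])
          (suc (m * 2) + (measureCost N + (c₂ * 2 + (powerCost e₂ (c₂ + N) + suc (clock * 4)))))
        clocked = subst (λ l → Run tt (setClock {Y} c₂ e₂) (ones N ∷ [] ∷ ones m ∷ [] ∷ [] ∷ [] ∷ [])
            (ones N ∷ [] ∷ ones (c₂ + l) ∷ [] ∷ [] ∷ ones ((c₂ + l) ^ e₂) ∷ [])
          (suc (m * 2) + (measureCost l + (c₂ * 2 + (powerCost e₂ (c₂ + l) + suc ((c₂ + l) ^ e₂ * 4))))))
              (length-ones {Y} N) (setClock-run c₂ e₂ (ones N) m)

      answer-nonempty : 0 < length answer
      answer-nonempty = subst (0 <_) (sym (trans (length-++ (sign x))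
          (cong (length (sign x) +_) (length-++ (Defs.binary (ℤ.∣ x ∣ >> E))))))
        (≤-trans (s≤s z≤n) (≤-trans (m≤n+m _ (length (Defs.binary (ℤ.∣ x ∣ >> E)))) (m≤n+m _ (length (sign x)))))

      constant : Constant {oracle} O answer
      constant _ = refl

      final : Config M O
      final = run M O clock (initial M O (unary N))

      simulateCost : ℕ
      simulateCost = suc (clock * (2 + stepCost O answer constant answer-nonempty (suc (length answer + clock))))

      0<N : 0 < N
      0<N = subst (0 <_) (sym length-input) (≤-trans (s≤s z≤n) (m≤n+m _ (length (wordℤ x))))

      simulate-input : Run tt simulate
        (ones clock ∷ (mark (stateˣ start) ∷ []) ∷ word answer ∷ [] ∷ [] ∷ ones N ∷ tapesˢ
            (Vec.replicate (2 + work) (loaded [])))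
        ([] ∷ store O answer constant answer-nonempty final) simulateCost
      simulate-input = from (cong₂ (λ u v → ones clock ∷ (mark (stateˣ start) ∷ []) ∷ word answer ∷ [] ∷ u ∷ v ∷
          tapesˢ (Vec.replicate (2 + work) (loaded [])))
          (before-loaded O answer constant answer-nonempty (unary N))
          (after-loaded O answer constant answer-nonempty (unary N)
              (≤-trans 0<N (≤-reflexive (sym (length-replicate N))))))
        (simulate-run O answer constant answer-nonempty clock (initial M O (unary N)) 0 (suc (length answer + clock))
            (z≤n)
          (s≤s (≤-reflexive (cong (_+ clock) (+-identityʳ (length answer))))))

      written : Config M O → ℕ
      written (config _ (_ ∷ t ∷ _)) = length (after t)

      y≤N : length (digits ℤ.∣ y ∣) ≤ N
      y≤N = ≤-trans (length-show (digits ℤ.∣ y ∣)) (≤-trans (shown≤word y)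
          (≤-trans (≤-trans (m≤m+n _ _) (≤-trans (n≤1+n _) (m≤n+m _ (length (wordℤ x)))))
          (≤-reflexive (sym length-input))))

      finish-run : ∀ d u v (cfg : Config M O) → output M O cfg ≡ word𝔻 d → ∃[ s ] Run tt finish
        (u ∷ [] ∷ [] ∷ [] ∷ ones N ∷ [] ∷ v ∷ [] ∷ [] ∷ [] ∷ [] ∷ num ℤ.∣ y ∣ ∷ [] ∷ [] ∷ [] ∷ [] ∷ [] ∷ [] ∷ store O
            answer constant answer-nonempty cfg)
        s (writeProductCost (written cfg) N d ℤ.∣ y ∣)
        × lookup s r1 ≡ word (wordℤ (scaledFloor d ℤ.∣ y ∣))
      finish-run d u v (config q (t₀ ∷ t ∷ t₂ ∷ ts)) out
        with writeProduct-run {Y} d ℤ.∣ y ∣ N (after t) (proj₁ (after-contents t))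
               (trans (proj₁ (proj₂ (after-contents t))) (cong (λ v → word v ++ proj₁ (after-contents t)) out))
                   (proj₂ (proj₂ (after-contents t))) y≤N
      ... | (_ ∷ _ ∷ _ ∷ _ ∷ _ ∷ _ ∷ _ ∷ _ ∷ _ ∷ _ ∷ _ ∷ _ ∷ []) , r , e =
        _ , using-registers (r24 ∷ r3 ∷ r4 ∷ r9 ∷ r11 ∷ r12 ∷ r13 ∷ r14 ∷ r15 ∷ r5 ∷ r16 ∷ r1 ∷ []) r , e

      programCost : 𝔻 → ℕ
      programCost d = readCost + (prepareCost + (simulateCost + writeProductCost (written final) N d ℤ.∣ y ∣))

      program-run : ∀ d → output M O final ≡ word𝔻 d → ∃[ s ] Run tt program
          (word input ∷ Vec.replicate (20 + (3 + work) * 2) []) s (programCost d)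
        × lookup s r1 ≡ word (wordℤ (scaledFloor d ℤ.∣ y ∣))
      program-run d out =
        let s , r , e = finish-run d (gl comma ∷ []) (ones (c₂ + N)) final out
        in s , read-run ⨾ prepare-run
           ⨾ run-shiftBy ((gl comma ∷ []) ∷ [] ∷ [] ∷ [] ∷ ones N ∷ [] ∷ ones (c₂ + N) ∷ [] ∷ [] ∷ [] ∷ [] ∷ num ℤ.∣ y
               ∣ ∷ [] ∷ [] ∷ [] ∷ [] ∷ [] ∷ []) simulate-input ⨾ r , e

-- Rational values of words, truncations and scaled products.

module DyadicValues where

  open import Defs using (𝔻; _/2^_; ½^_; word𝔻)
  import Defs
  open BinaryDigits
  open Subroutines using (signed; signGlyph; _>>_; >>-suc; >>-zero; extend)
  open Words using (wholePart; fracPart; negative; neg; signed-neg; sign-neg)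
  open RealAlgorithm using (truncated; magnitude)
  open IntegerAlgorithm using (significand; scaledFloor)
  open import Data.Bool.Base using (Bool; true; false)
  open import Data.Integer.Base as ℤ using (ℤ; +_; -[1+_])
  import Data.Integer.Properties as ℤ
  open import Data.List.Base as List using (List; []; _∷_; length; drop)
  open import Data.Nat.Base as ℕ using (ℕ; zero; suc)
  import Data.Nat.Properties as ℕ
  open import Data.Product.Base using (∃-syntax)
  open import Data.Rational.Base as ℚ using (ℚ; 0ℚ; 1ℚ; ½; _+_; _*_; -_; _-_; _≤_; _<_; ∣_∣)
  open import Data.Rational.Properties as ℚ
  open import Data.Rational.Solver using (module +-*-Solver)
  open import Data.Rational.Unnormalised.Base as ℚᵘ using (mkℚᵘ; *≡*; *≤*; *<*)
  import Data.Rational.Unnormalised.Properties as ℚᵘ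
  open import Relation.Binary.PropositionalEquality

  ι : ℤ → ℚ
  ι i = i ℚ./ 1

  private
    toᵘ : ∀ i → ℚ.toℚᵘ (ι i) ℚᵘ.≃ mkℚᵘ i 0
    toᵘ i = toℚᵘ-fromℚᵘ (mkℚᵘ i 0)

  abstract
    ι-+ : ∀ i j → ι (i ℤ.+ j) ≡ ι i + ι j
    ι-+ i j = toℚᵘ-injective (ℚᵘ.≃-trans (toᵘ (i ℤ.+ j)) (ℚᵘ.≃-trans
      (*≡* (cong (ℤ._* + 1) (cong₂ ℤ._+_ (sym (ℤ.*-identityʳ i)) (sym (ℤ.*-identityʳ j)))))
      (ℚᵘ.≃-sym (ℚᵘ.≃-trans (toℚᵘ-homo-+ (ι i) (ι j)) (ℚᵘ.+-cong (toᵘ i) (toᵘ j))))))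

    ι-* : ∀ i j → ι (i ℤ.* j) ≡ ι i * ι j
    ι-* i j = toℚᵘ-injective (ℚᵘ.≃-trans (toᵘ (i ℤ.* j)) (ℚᵘ.≃-trans (*≡* refl)
      (ℚᵘ.≃-sym (ℚᵘ.≃-trans (toℚᵘ-homo-* (ι i) (ι j)) (ℚᵘ.*-cong (toᵘ i) (toᵘ j))))))

    ι-neg : ∀ i → ι (ℤ.- i) ≡ - ι i
    ι-neg i = toℚᵘ-injective (ℚᵘ.≃-trans (toᵘ (ℤ.- i))
        (ℚᵘ.≃-sym (ℚᵘ.≃-trans (toℚᵘ-homo‿- (ι i)) (ℚᵘ.-‿cong (toᵘ i)))))

    ι-≤ : ∀ {i j} → i ℤ.≤ j → ι i ≤ ι j
    ι-≤ {i} {j} le = toℚᵘ-cancel-≤ (ℚᵘ.≤-respˡ-≃ (ℚᵘ.≃-sym (toᵘ i)) (ℚᵘ.≤-respʳ-≃ (ℚᵘ.≃-sym (toᵘ j))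
      (*≤* (ℤ.*-monoʳ-≤-nonNeg (+ 1) le))))

    ι-< : ∀ {i j} → i ℤ.< j → ι i < ι j
    ι-< {i} {j} lt = toℚᵘ-cancel-< (ℚᵘ.<-respˡ-≃ (ℚᵘ.≃-sym (toᵘ i)) (ℚᵘ.<-respʳ-≃ (ℚᵘ.≃-sym (toᵘ j))
      (*<* (ℤ.*-monoʳ-<-pos (+ 1) lt))))

  ι-<⁻¹ : ∀ {i j} → ι i < ι j → i ℤ.< j
  ι-<⁻¹ lt = ℤ.≰⇒> (λ le → <-irrefl refl (<-≤-trans lt (ι-≤ le)))

  ι-≤⁻¹ : ∀ {i j} → ι i ≤ ι j → i ℤ.≤ j
  ι-≤⁻¹ le = ℤ.≮⇒≥ (λ lt → <-irrefl refl (<-≤-trans (ι-< lt) le))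

  nat : ℕ → ℚ
  nat n = ι (+ n)

  nat-+ : ∀ m n → nat (m ℕ.+ n) ≡ nat m + nat n
  nat-+ m n = ι-+ (+ m) (+ n)

  nat-* : ∀ m n → nat (m ℕ.* n) ≡ nat m * nat n
  nat-* m n = trans (cong ι (ℤ.pos-* m n)) (ι-* (+ m) (+ n))

  nat-≤ : ∀ {m n} → m ℕ.≤ n → nat m ≤ nat n
  nat-≤ le = ι-≤ (ℤ.+≤+ le)

  nat-< : ∀ {m n} → m ℕ.< n → nat m < nat n
  nat-< lt = ι-< (ℤ.+<+ lt)

  nat-<⁻¹ : ∀ {m n} → nat m < nat n → m ℕ.< n
  nat-<⁻¹ lt = ℤ.drop‿+<+ (ι-<⁻¹ lt)

  nat-≤⁻¹ : ∀ {m n} → nat m ≤ nat n → m ℕ.≤ n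
  nat-≤⁻¹ le = ℤ.drop‿+≤+ (ι-≤⁻¹ le)

  0≤nat : ∀ n → 0ℚ ≤ nat n
  0≤nat n = nat-≤ {0} {n} ℕ.z≤n

  𝟚^_ : ℕ → ℚ
  𝟚^ n = nat (2 ℕ.^ n)

  ½^-pos : ∀ n → ℚ.Positive (½^ n)
  ½^-pos zero    = _
  ½^-pos (suc n) = pos*pos⇒pos ½ (½^ n) {{½^-pos n}}

  ½^-nonNeg : ∀ n → ℚ.NonNegative (½^ n)
  ½^-nonNeg n = pos⇒nonNeg (½^ n) {{½^-pos n}}

  ½^-+ : ∀ m n → ½^ (m ℕ.+ n) ≡ ½^ m * ½^ n
  ½^-+ zero    n = sym (*-identityˡ (½^ n))
  ½^-+ (suc m) n = trans (cong (½ *_) (½^-+ m n)) (sym (*-assoc ½ (½^ m) (½^ n)))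

  𝟚^-suc : ∀ n → 𝟚^ (suc n) ≡ nat 2 * 𝟚^ n
  𝟚^-suc n = nat-* 2 (2 ℕ.^ n)

  𝟚^*½^ : ∀ n → 𝟚^ n * ½^ n ≡ 1ℚ
  𝟚^*½^ zero    = refl
  𝟚^*½^ (suc n) = trans (cong (_* (½ * ½^ n)) (𝟚^-suc n)) (trans
    (solve 4 (λ t p h q → (t :* p) :* (h :* q) := (t :* h) :* (p :* q)) refl (nat 2) (𝟚^ n) ½ (½^ n))
    (trans (*-identityˡ (𝟚^ n * ½^ n)) (𝟚^*½^ n)))
    where open +-*-Solver

  ½^*𝟚^ : ∀ n → ½^ n * 𝟚^ n ≡ 1ℚ
  ½^*𝟚^ n = trans (*-comm (½^ n) (𝟚^ n)) (𝟚^*½^ n)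

  ½^≤1 : ∀ n → ½^ n ≤ 1ℚ
  ½^≤1 n = subst (½^ n ≤_) (½^*𝟚^ n) (subst (_≤ ½^ n * 𝟚^ n) (*-identityʳ (½^ n))
    (*-monoˡ-≤-nonNeg (½^ n) {{½^-nonNeg n}} (nat-≤ (ℕ.m^n>0 2 n))))

  ½^-anti : ∀ {m n} → m ℕ.≤ n → ½^ n ≤ ½^ m
  ½^-anti {m} {n} m≤n = subst (λ k → ½^ k ≤ ½^ m) (ℕ.m+[n∸m]≡n m≤n)
    (subst₂ _≤_ (sym (½^-+ m (n ℕ.∸ m))) (*-identityʳ (½^ m))
        (*-monoˡ-≤-nonNeg (½^ m) {{½^-nonNeg m}} (½^≤1 (n ℕ.∸ m))))

  value𝔻 : 𝔻 → ℚ
  value𝔻 (a /2^ b) = ι a * ½^ b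

  -- value of 0.b₁b₂…
  fraction : List Bool → ℚ
  fraction []      = 0ℚ
  fraction (b ∷ w) = ½ * (nat (b2n b) + fraction w)

  0≤fraction : ∀ w → 0ℚ ≤ fraction w
  0≤fraction []      = ≤-refl
  0≤fraction (b ∷ w) = subst (_≤ fraction (b ∷ w)) (*-zeroʳ ½)
      (*-monoˡ-≤-nonNeg ½ (+-mono-≤ (0≤nat (b2n b)) (0≤fraction w)))

  fraction<1 : ∀ w → fraction w < 1ℚ
  fraction<1 []      = positive⁻¹ 1ℚ
  fraction<1 (b ∷ w) = *-monoʳ-<-pos ½ (+-mono-≤-< (nat-≤ (b≤1 b)) (fraction<1 w))
    where
    b≤1 : ∀ b → b2n b ℕ.≤ 1
    b≤1 false = ℕ.z≤n
    b≤1 true  = ℕ.≤-refl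

  fraction-scons : ∀ b w → fraction (scons b w) ≡ ½ * (nat (b2n b) + fraction w)
  fraction-scons true  w       = refl
  fraction-scons false (_ ∷ _) = refl
  fraction-scons false []      = refl

  nat-parity : ∀ b m → nat (b2n b ℕ.+ 2 ℕ.* m) ≡ nat (b2n b) + nat 2 * nat m
  nat-parity b m = trans (nat-+ (b2n b) (2 ℕ.* m)) (cong (λ v → nat (b2n b) + v) (nat-* 2 m))

  half-double : ∀ p q → ½ * (p + nat 2 * q) ≡ ½ * p + q
  half-double p q = trans (solve 4 (λ h p t q → h :* (p :+ t :* q) := h :* p :+ (h :* t) :* q) refl ½ p (nat 2) q)
    (cong (λ v → ½ * p + v) (*-identityˡ q))
    where open +-*-Solver

  double-half : ∀ p → nat 2 * (½ * p) ≡ p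
  double-half p = trans (sym (*-assoc (nat 2) ½ p)) (*-identityˡ p)

  -- Each further halving moves the parity bit of the integer part across the point, to the front of
  -- the fraction.
  >>-fraction : ∀ n j → nat n * ½^ j ≡ nat (n >> j) + fraction (frac j n)
  >>-fraction n zero    = trans (*-identityʳ (nat n))
      (trans (cong nat (sym (>>-zero n))) (sym (+-identityʳ (nat (n >> 0)))))
  >>-fraction n (suc j) = begin
    nat n * (½ * ½^ j)                                          ≡⟨ solve 3 (λ n h p → n :* (h :* p) := h :* (n :* p))
        refl (nat n) ½ (½^ j) ⟩
    ½ * (nat n * ½^ j)                                          ≡⟨ cong (½ *_) (>>-fraction n j) ⟩
    ½ * (nat (n >> j) + fraction (frac j n))                    ≡⟨ cong (λ v → ½ * (v + fraction (frac j n)))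
        (trans (cong nat (trans (n≡odd+2half (n >> j)) (cong (λ q → b2n o ℕ.+ 2 ℕ.* q) (>>-suc n j))))
        (nat-parity o (n >> suc j))) ⟩
    ½ * (nat (b2n o) + nat 2 * nat (n >> suc j) + fraction (frac j n)) ≡⟨ cong (½ *_)
        (solve 3 (λ b q f → b :+ q :+ f := (b :+ f) :+ q) refl (nat (b2n o)) (nat 2 * nat (n >> suc j))
        (fraction (frac j n))) ⟩
    ½ * (nat (b2n o) + fraction (frac j n) + nat 2 * nat (n >> suc j)) ≡⟨ half-double
        (nat (b2n o) + fraction (frac j n)) (nat (n >> suc j)) ⟩
    ½ * (nat (b2n o) + fraction (frac j n)) + nat (n >> suc j)  ≡⟨ +-comm _ (nat (n >> suc j)) ⟩
    nat (n >> suc j) + ½ * (nat (b2n o) + fraction (frac j n))  ≡⟨ cong (λ v → nat (n >> suc j) + v)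
        (fraction-scons o (frac j n)) ⟨
    nat (n >> suc j) + fraction (frac (suc j) n)                ∎
    where
    open ≡-Reasoning
    open +-*-Solver
    o : Bool
    o = odd (n >> j)

  horner-fraction : ∀ a w → nat (horner a w) ≡ (nat a + fraction w) * 𝟚^ length w
  horner-fraction a []      = sym (trans (*-identityʳ (nat a + 0ℚ)) (+-identityʳ (nat a)))
  horner-fraction a (b ∷ w) = begin
    nat (horner (b2n b ℕ.+ 2 ℕ.* a) w)                    ≡⟨ horner-fraction (b2n b ℕ.+ 2 ℕ.* a) w ⟩
    (nat (b2n b ℕ.+ 2 ℕ.* a) + fraction w) * 𝟚^ length w  ≡⟨ cong (λ v → (v + fraction w) * 𝟚^ length w)
        (nat-parity b a) ⟩
    (nat (b2n b) + nat 2 * nat a + fraction w) * 𝟚^ length w ≡⟨ cong (_* 𝟚^ length w) regroup ⟩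
    nat 2 * (nat a + fraction (b ∷ w)) * 𝟚^ length w      ≡⟨ solve 3 (λ t p q → t :* p :* q := p :* (t :* q)) refl
        (nat 2) (nat a + fraction (b ∷ w)) (𝟚^ length w) ⟩
    (nat a + fraction (b ∷ w)) * (nat 2 * 𝟚^ length w)    ≡⟨ cong ((nat a + fraction (b ∷ w)) *_) (𝟚^-suc (length w))
        ⟨
    (nat a + fraction (b ∷ w)) * 𝟚^ suc (length w)        ∎
    where
    open ≡-Reasoning
    open +-*-Solver
    regroup : nat (b2n b) + nat 2 * nat a + fraction w ≡ nat 2 * (nat a + fraction (b ∷ w))
    regroup = trans (solve 3 (λ b a f → b :+ a :+ f := a :+ (b :+ f)) refl (nat (b2n b)) (nat 2 * nat a) (fraction w))
      (trans (cong (λ v → nat 2 * nat a + v) (sym (double-half (nat (b2n b) + fraction w))))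
          (sym (*-distribˡ-+ (nat 2) (nat a) (fraction (b ∷ w)))))

  -- Each doubling moves one bit of the fraction across the point; past the end of `w` the moved bit
  -- is 0, in accordance with `headBit`.
  extend-fraction : ∀ r a w → (nat a + fraction w) * 𝟚^ r ≡ nat (extend r a w) + fraction (drop r w)
  extend-fraction zero    a w = *-identityʳ (nat a + fraction w)
  extend-fraction (suc r) a w = begin
    (nat a + fraction w) * 𝟚^ suc r                    ≡⟨ cong ((nat a + fraction w) *_) (𝟚^-suc r) ⟩
    (nat a + fraction w) * (nat 2 * 𝟚^ r)              ≡⟨ solve 4
        (λ a f t p → (a :+ f) :* (t :* p) := (t :* a :+ t :* f) :* p) refl (nat a) (fraction w) (nat 2) (𝟚^ r) ⟩
    (nat 2 * nat a + nat 2 * fraction w) * 𝟚^ r        ≡⟨ cong (λ v → (nat 2 * nat a + v) * 𝟚^ r) (doubled w) ⟩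
    (nat 2 * nat a + (nat (b2n (headBit w)) + fraction (drop 1 w))) * 𝟚^ r ≡⟨ cong (_* 𝟚^ r)
        (solve 3 (λ b a f → a :+ (b :+ f) := b :+ a :+ f) refl (nat (b2n (headBit w))) (nat 2 * nat a)
        (fraction (drop 1 w))) ⟩
    (nat (b2n (headBit w)) + nat 2 * nat a + fraction (drop 1 w)) * 𝟚^ r ≡⟨ cong
        (λ v → (v + fraction (drop 1 w)) * 𝟚^ r) (nat-parity (headBit w) a) ⟨
    (nat (b2n (headBit w) ℕ.+ 2 ℕ.* a) + fraction (drop 1 w)) * 𝟚^ r ≡⟨ extend-fraction r _ (drop 1 w) ⟩
    nat (extend r _ (drop 1 w)) + fraction (drop r (drop 1 w)) ≡⟨ cong
        (λ v → nat (extend r _ (drop 1 w)) + fraction v) (drop-suc r w) ⟩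
    nat (extend (suc r) a w) + fraction (drop (suc r) w) ∎
    where
    open ≡-Reasoning
    open +-*-Solver
    doubled : ∀ w → nat 2 * fraction w ≡ nat (b2n (headBit w)) + fraction (drop 1 w)
    doubled []      = refl
    doubled (b ∷ w) = double-half (nat (b2n b) + fraction w)
    drop-suc : ∀ r (w : List Bool) → drop r (drop 1 w) ≡ drop (suc r) w
    drop-suc zero    []      = refl
    drop-suc (suc r) []      = refl
    drop-suc r       (b ∷ w) = refl

  signedℚ : Bool → ℚ → ℚ
  signedℚ false p = p
  signedℚ true  p = - p

  ι-signed : ∀ g n → ι (signed g n) ≡ signedℚ g (nat n)
  ι-signed false n = refl
  ι-signed true  n = ι-neg (+ n)

  signedℚ-* : ∀ g p q → signedℚ g p * q ≡ signedℚ g (p * q)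
  signedℚ-* false p q = refl
  signedℚ-* true  p q = sym (neg-distribˡ-* p q)

  signedℚ-*ʳ : ∀ g p q → p * signedℚ g q ≡ signedℚ g (p * q)
  signedℚ-*ʳ false p q = refl
  signedℚ-*ʳ true  p q = sym (neg-distribʳ-* p q)

  ∣signedℚ∣ : ∀ g {p} → 0ℚ ≤ p → ∣ signedℚ g p ∣ ≡ p
  ∣signedℚ∣ false 0≤p = 0≤p⇒∣p∣≡p 0≤p
  ∣signedℚ∣ true  {p} 0≤p = trans (∣-p∣≡∣p∣ p) (0≤p⇒∣p∣≡p 0≤p)

  signedℚ-minus : ∀ g p q → signedℚ g p - signedℚ g q ≡ signedℚ g (p - q)
  signedℚ-minus false p q = refl
  signedℚ-minus true  p q = solve 2 (λ p q → (:- p) :- (:- q) := :- (p :- q)) refl p q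
    where open +-*-Solver

  ∣signedℚ∣′ : ∀ g p → ∣ signedℚ g p ∣ ≡ ∣ p ∣
  ∣signedℚ∣′ false p = refl
  ∣signedℚ∣′ true  p = ∣-p∣≡∣p∣ p

  size : 𝔻 → ℚ
  size d = nat (wholePart d) + fraction (fracPart d)

  0≤size : ∀ d → 0ℚ ≤ size d
  0≤size d = +-mono-≤ (0≤nat (wholePart d)) (0≤fraction (fracPart d))

  value-size : ∀ d → value𝔻 d ≡ signedℚ (negative d) (size d)
  value-size (a /2^ b) = trans (cong (_* ½^ b) (trans (cong ι (sym (signed-neg a))) (ι-signed (neg a) ℤ.∣ a ∣)))
    (trans (signedℚ-* (neg a) (nat ℤ.∣ a ∣) (½^ b)) (cong (signedℚ (neg a)) (>>-fraction ℤ.∣ a ∣ b)))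

  ∣value∣ : ∀ d → ∣ value𝔻 d ∣ ≡ size d
  ∣value∣ d = trans (cong ∣_∣ (value-size d)) (∣signedℚ∣ (negative d) (0≤size d))

  size<𝟚^ : ∀ d → size d < 𝟚^ magnitude d
  size<𝟚^ d = <-≤-trans (+-monoʳ-< (nat (wholePart d)) (fraction<1 (fracPart d)))
    (subst (_≤ 𝟚^ magnitude d) (trans (cong nat (ℕ.+-comm 1 (wholePart d))) (nat-+ (wholePart d) 1))
        (nat-≤ (digits-upper (wholePart d))))

  whole≤size : ∀ d → nat (wholePart d) ≤ size d
  whole≤size d = subst (_≤ size d) (+-identityʳ (nat (wholePart d)))
      (+-monoʳ-≤ (nat (wholePart d)) (0≤fraction (fracPart d)))

  ∣-fraction∣≤1 : ∀ p w → ∣ p - (p + fraction w) ∣ ≤ 1ℚ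
  ∣-fraction∣≤1 p w = subst (_≤ 1ℚ) (sym (trans (cong ∣_∣
      (solve 2 (λ p f → p :- (p :+ f) := :- f) refl p (fraction w)))
    (trans (∣-p∣≡∣p∣ (fraction w)) (0≤p⇒∣p∣≡p (0≤fraction w))))) (<⇒≤ (fraction<1 w))
    where open +-*-Solver

  significand-size : ∀ d → nat (significand d) * ½^ length (fracPart d) ≡ size d
  significand-size d = trans (cong (_* ½^ length (fracPart d)) (horner-fraction (wholePart d) (fracPart d)))
    (trans (*-assoc (size d) (𝟚^ length (fracPart d)) (½^ length (fracPart d)))
    (trans (cong (size d *_) (𝟚^*½^ (length (fracPart d)))) (*-identityʳ (size d))))

  -- Both sides carry the sign of `d`, which can be factored out; what is left is the fraction
  -- dropped by the shift.
  scaledFloor-close : ∀ d y → ∣ ι (scaledFloor d y) - nat y * value𝔻 d ∣ ≤ 1ℚ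
  scaledFloor-close d y = subst (_≤ 1ℚ) (sym rewritten) (∣-fraction∣≤1 (nat (p >> F)) (frac F p))
    where
    F p : ℕ
    F = length (fracPart d)
    p = y ℕ.* significand d
    product : nat y * size d ≡ nat (p >> F) + fraction (frac F p)
    product = trans (cong (nat y *_) (sym (significand-size d)))
        (trans (sym (*-assoc (nat y) (nat (significand d)) (½^ F)))
      (trans (cong (_* ½^ F) (sym (nat-* y (significand d)))) (>>-fraction p F)))
    rewritten : ∣ ι (scaledFloor d y) - nat y * value𝔻 d ∣ ≡ ∣ nat (p >> F) - (nat (p >> F) + fraction (frac F p)) ∣
    rewritten = trans (cong₂ (λ u v → ∣ u - v ∣) (ι-signed (negative d) (p >> F))
        (trans (cong (nat y *_) (value-size d)) (trans (signedℚ-*ʳ (negative d) (nat y) (size d))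
            (cong (signedℚ (negative d)) product))))
      (trans (cong ∣_∣ (signedℚ-minus (negative d) _ _)) (∣signedℚ∣′ (negative d) _))

  truncated-close : ∀ d r → ∣ ι (signed (negative d) (truncated d r)) - value𝔻 d * 𝟚^ r ∣ ≤ 1ℚ
  truncated-close d r = subst (_≤ 1ℚ) (sym rewritten) (∣-fraction∣≤1 (nat (truncated d r)) (drop r (fracPart d)))
    where
    rewritten : ∣ ι (signed (negative d) (truncated d r)) - value𝔻 d * 𝟚^ r ∣ ≡ ∣ nat (truncated d r) -
        (nat (truncated d r) + fraction (drop r (fracPart d))) ∣
    rewritten = trans (cong₂ (λ u v → ∣ u - v ∣) (ι-signed (negative d) (truncated d r))
        (trans (cong (_* 𝟚^ r) (value-size d)) (trans (signedℚ-* (negative d) (size d) (𝟚^ r))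
            (cong (signedℚ (negative d)) (extend-fraction r (wholePart d) (fracPart d))))))
      (trans (cong ∣_∣ (signedℚ-minus (negative d) _ _)) (∣signedℚ∣′ (negative d) _))

  truncated≤ : ∀ d r → nat (truncated d r) ≤ size d * 𝟚^ r
  truncated≤ d r = subst₂ _≤_ (+-identityʳ (nat (truncated d r))) (sym (extend-fraction r (wholePart d) (fracPart d)))
    (+-monoʳ-≤ (nat (truncated d r)) (0≤fraction (drop r (fracPart d))))

  fractionᴳ : List Defs.Glyph → ℚ
  fractionᴳ (Defs.𝟎 ∷ w) = ½ * (nat 0 + fractionᴳ w)
  fractionᴳ (Defs.𝟏 ∷ w) = ½ * (nat 1 + fractionᴳ w)
  fractionᴳ _            = 0ℚ

  -- Reads a word back into the number it denotes, with a default for malformed words. Such an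
  -- inverse shows that a word determines its value.
  decode : Bool → ℕ → List Defs.Glyph → ℚ
  decode g a (Defs.𝟎 ∷ w)     = decode g (2 ℕ.* a) w
  decode g a (Defs.𝟏 ∷ w)     = decode g (1 ℕ.+ 2 ℕ.* a) w
  decode g a (Defs.minus ∷ w) = decode true a w
  decode g a (Defs.point ∷ w) = signedℚ g (nat a + fractionᴳ w)
  decode g a _                = 0ℚ

  fractionᴳ-bits : ∀ w → fractionᴳ (bitGlyphs w) ≡ fraction w
  fractionᴳ-bits []          = refl
  fractionᴳ-bits (false ∷ w) = cong (λ v → ½ * (nat 0 + v)) (fractionᴳ-bits w)
  fractionᴳ-bits (true ∷ w)  = cong (λ v → ½ * (nat 1 + v)) (fractionᴳ-bits w)

  decode-bits : ∀ g a w v → decode g a (bitGlyphs w List.++ v) ≡ decode g (horner a w) v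
  decode-bits g a []          v = refl
  decode-bits g a (false ∷ w) v = decode-bits g (2 ℕ.* a) w v
  decode-bits g a (true ∷ w)  v = decode-bits g (1 ℕ.+ 2 ℕ.* a) w v

  decode-word : ∀ d → decode false 0 (word𝔻 d) ≡ value𝔻 d
  decode-word d@(a /2^ b) = trans (cong (decode false 0)
      (trans (word𝔻-digits a b) (cong (List._++ rest) (sign-neg a))))
    (trans (signs (neg a)) (trans (decode-bits (neg a) 0 (show (digits (wholePart d)))
        (Defs.point ∷ bitGlyphs (fracPart d)))
    (trans (cong₂ (λ u v → signedℚ (neg a) (nat u + v))
        (trans (horner-show (digits (wholePart d))) (value-digits (wholePart d))) (fractionᴳ-bits (fracPart d)))
      (sym (value-size d)))))
    where
    rest : List Defs.Glyph
    rest = bitGlyphs (show (digits (wholePart d))) List.++ Defs.point ∷ bitGlyphs (fracPart d)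
    signs : ∀ g → decode false 0 (signGlyph g List.++ rest) ≡ decode g 0 rest
    signs false = refl
    signs true  = refl

  -- Continuity compares two runs through the words they write; this passes from the words back to
  -- the numbers.
  word-value : ∀ d e → word𝔻 d ≡ word𝔻 e → value𝔻 d ≡ value𝔻 e
  word-value d e eq = trans (sym (decode-word d)) (trans (cong (decode false 0) eq) (decode-word e))

-- Order and distance of reals with explicit rational bounds.

module RealDistance where

  open import Defs hiding (Poly; con; var; _:+_; _:*_; ⟦_⟧)
  open import Data.Integer.Base as ℤ using (+_)
  open import Data.Nat.Base as ℕ using (ℕ)
  import Data.Nat.Properties as ℕ
  open import Data.Product.Base using (∃-syntax; _×_; _,_)
  open import Data.Rational.Base as ℚ using (ℚ; 0ℚ; 1ℚ; ½)
  import Data.Rational.Properties as ℚ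
  open import Data.Rational.Solver using (module +-*-Solver)
  open import Data.Sum.Base using (inj₁; inj₂)
  open import Relation.Binary.PropositionalEquality using (_≡_; refl; sym; trans; cong; subst)
  open import Relation.Nullary.Decidable using (yes; no)
  open import Relation.Nullary.Negation using (contradiction)

  half>0 : ∀ {ε} → 0ℚ ℚ.< ε → 0ℚ ℚ.< ½ ℚ.* ε
  half>0 {ε} 0<ε = subst (ℚ._< ½ ℚ.* ε) (ℚ.*-zeroʳ ½) (ℚ.*-monoʳ-<-pos ½ 0<ε)

  halves : ∀ ε → ½ ℚ.* ε ℚ.+ ½ ℚ.* ε ≡ ε
  halves ε = trans (sym (ℚ.*-distribʳ-+ ε ½ ½)) (ℚ.*-identityˡ ε)

  ≤+ : ∀ {p q ε} → p ℚ.≤ q → 0ℚ ℚ.< ε → p ℚ.≤ q ℚ.+ ε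
  ≤+ {p} {q} {ε} p≤q 0<ε = subst (ℚ._≤ q ℚ.+ ε) (ℚ.+-identityʳ p) (ℚ.+-mono-≤ p≤q (ℚ.<⇒≤ 0<ε))

  p≤∣p∣ : ∀ p → p ℚ.≤ ℚ.∣ p ∣
  p≤∣p∣ p with ℚ.∣p∣≡p∨∣p∣≡-p p
  ... | inj₁ e = ℚ.≤-reflexive (sym e)
  ... | inj₂ e = ℚ.≤-trans p≤0 (ℚ.0≤∣p∣ p)
    where
    p≤0 : p ℚ.≤ 0ℚ
    p≤0 = subst (ℚ._≤ 0ℚ) (solve 1 (λ p → :- (:- p) := p) refl p) (ℚ.neg-antimono-≤ (subst (0ℚ ℚ.≤_) e (ℚ.0≤∣p∣ p)))
      where open +-*-Solver

  ∣-∣-comm : ∀ p q → ℚ.∣ p ℚ.- q ∣ ≡ ℚ.∣ q ℚ.- p ∣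
  ∣-∣-comm p q = trans (cong ℚ.∣_∣ (solve 2 (λ a b → a :- b := :- (b :- a)) refl p q)) (ℚ.∣-p∣≡∣p∣ (q ℚ.- p))
    where open +-*-Solver

  ∣-∣-triangle : ∀ p q r → ℚ.∣ p ℚ.- r ∣ ℚ.≤ ℚ.∣ p ℚ.- q ∣ ℚ.+ ℚ.∣ q ℚ.- r ∣
  ∣-∣-triangle p q r = subst (λ s → ℚ.∣ s ∣ ℚ.≤ ℚ.∣ p ℚ.- q ∣ ℚ.+ ℚ.∣ q ℚ.- r ∣)
    (solve 3 (λ a b c → (a :- b) :+ (b :- c) := a :- c) refl p q r)
    (ℚ.∣p+q∣≤∣p∣+∣q∣ (p ℚ.- q) (q ℚ.- r))
    where open +-*-Solver


  -- The order and distance as records, so that their arguments can be inferred.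
  record _≼_ (x y : ℝ) : Set where
    constructor le
    field
      holds : x ≤ y
  open _≼_ public

  infix 4 _≼_ _≈[_]_

  record _≈[_]_ (x : ℝ) (p : ℚ) (y : ℝ) : Set where
    constructor near
    field
      close : ∣ x - y ∣ ≤ fromℚ p
  open _≈[_]_ public

  record _≅_ (x y : ℝ) : Set where
    constructor same
    field
      equal : x ≃ y
  open _≅_ public

  ≼-pointwise : ∀ {x y} → (∀ n → seq x n ℚ.≤ seq y n) → x ≼ y
  ≼-pointwise h = le λ ε 0<ε → 0 , λ n _ → ≤+ (h n) 0<ε

  ≅-pointwise : ∀ {x y} → (∀ n → seq x n ≡ seq y n) → x ≅ y
  ≅-pointwise {x} {y} h = same λ ε 0<ε → 0 , λ n _ → ℚ.≤-trans
    (ℚ.≤-reflexive (trans (cong (λ v → ℚ.∣ v ℚ.- seq y n ∣) (h n)) (cong ℚ.∣_∣ (ℚ.+-inverseʳ (seq y n))))) (ℚ.<⇒≤ 0<ε)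

  ≼-trans : ∀ {x y z} → x ≼ y → y ≼ z → x ≼ z
  ≼-trans {x} {y} {z} x≤y y≤z = le λ ε 0<ε →
    let N₁ , h₁ = holds x≤y (½ ℚ.* ε) (half>0 0<ε)
        N₂ , h₂ = holds y≤z (½ ℚ.* ε) (half>0 0<ε)
    in N₁ ℕ.⊔ N₂ , λ n N≤n → ℚ.≤-trans (h₁ n (ℕ.m⊔n≤o⇒m≤o N₁ N₂ N≤n))
         (ℚ.≤-trans (ℚ.+-monoˡ-≤ (½ ℚ.* ε) (h₂ n (ℕ.m⊔n≤o⇒n≤o N₁ N₂ N≤n)))
           (ℚ.≤-reflexive (trans (ℚ.+-assoc (seq z n) (½ ℚ.* ε) (½ ℚ.* ε)) (cong (λ v → seq z n ℚ.+ v) (halves ε)))))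

  +-mono-≼ : ∀ {x y u v} → x ≼ y → u ≼ v → x + u ≼ y + v
  +-mono-≼ {x} {y} {u} {v} x≤y u≤v = le λ ε 0<ε →
    let N₁ , h₁ = holds x≤y (½ ℚ.* ε) (half>0 0<ε)
        N₂ , h₂ = holds u≤v (½ ℚ.* ε) (half>0 0<ε)
    in N₁ ℕ.⊔ N₂ , λ n N≤n → ℚ.≤-trans (ℚ.+-mono-≤ (h₁ n (ℕ.m⊔n≤o⇒m≤o N₁ N₂ N≤n)) (h₂ n (ℕ.m⊔n≤o⇒n≤o N₁ N₂ N≤n)))
         (ℚ.≤-reflexive (trans (solve 3 (λ y v e → (y :+ e) :+ (v :+ e) := (y :+ v) :+ (e :+ e)) refl (seq y n)
             (seq v n) (½ ℚ.* ε))
           (cong (λ w → seq y n ℚ.+ seq v n ℚ.+ w) (halves ε))))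
    where open +-*-Solver

  fromℚ-≼ : ∀ {p q} → p ℚ.≤ q → fromℚ p ≼ fromℚ q
  fromℚ-≼ p≤q = ≼-pointwise (λ _ → p≤q)

  -- Otherwise half the gap between `q` and `p` would be an ε violating the assumption; the case
  -- distinction is decidable on rationals.
  ≤-archimedean : ∀ {p q} → (∀ ε → 0ℚ ℚ.< ε → p ℚ.≤ q ℚ.+ ε) → p ℚ.≤ q
  ≤-archimedean {p} {q} h with p ℚ.≤? q
  ... | yes p≤q = p≤q
  ... | no p≰q = contradiction (ℚ.≤-<-trans (h ε 0<ε) q+ε<p) (ℚ.<-irrefl refl)
    where
    open +-*-Solver
    q<p : q ℚ.< p
    q<p = ℚ.≰⇒> p≰q
    0<p-q : 0ℚ ℚ.< p ℚ.- q
    0<p-q = subst (ℚ._< p ℚ.- q) (ℚ.+-inverseʳ q) (ℚ.+-monoˡ-< (ℚ.- q) q<p)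
    ε : ℚ
    ε = ½ ℚ.* (p ℚ.- q)
    0<ε : 0ℚ ℚ.< ε
    0<ε = half>0 0<p-q
    q+ε<p : q ℚ.+ ε ℚ.< p
    q+ε<p = subst (q ℚ.+ ε ℚ.<_) (trans (ℚ.+-assoc q ε ε)
        (trans (cong (λ v → q ℚ.+ v) (halves (p ℚ.- q))) (solve 2 (λ p q → q :+ (p :- q) := p) refl p q)))
      (subst (ℚ._< q ℚ.+ ε ℚ.+ ε) (ℚ.+-identityʳ (q ℚ.+ ε)) (ℚ.+-monoʳ-< (q ℚ.+ ε) 0<ε))

  fromℚ-≼⁻¹ : ∀ {p q} → fromℚ p ≼ fromℚ q → p ℚ.≤ q
  fromℚ-≼⁻¹ h = ≤-archimedean (λ ε 0<ε → let N , h′ = holds h ε 0<ε in h′ N ℕ.≤-refl)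

  <⇒≼ : ∀ {x y} → x < y → x ≼ y
  <⇒≼ {x} {y} (ε , 0<ε , N , h) = le λ δ 0<δ → N , λ n N≤n →
    ≤+ (ℚ.≤-trans (subst (ℚ._≤ seq x n ℚ.+ ε) (ℚ.+-identityʳ (seq x n)) (ℚ.+-monoʳ-≤ (seq x n) (ℚ.<⇒≤ 0<ε)))
        (h n N≤n)) 0<δ

  fromℚ-+ : ∀ p q → fromℚ p + fromℚ q ≼ fromℚ (p ℚ.+ q)
  fromℚ-+ p q = ≼-pointwise {fromℚ p + fromℚ q} {fromℚ (p ℚ.+ q)} (λ _ → ℚ.≤-refl {p ℚ.+ q})

  ≈-trans : ∀ {x y z p q} → x ≈[ p ] y → y ≈[ q ] z → x ≈[ p ℚ.+ q ] z
  ≈-trans {x} {y} {z} {p} {q} h h′ = near (holds (≼-trans {∣ x - z ∣} {∣ x - y ∣ + ∣ y - z ∣} {fromℚ (p ℚ.+ q)}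
    (≼-pointwise {∣ x - z ∣} {∣ x - y ∣ + ∣ y - z ∣} (λ n → ∣-∣-triangle (seq x n) (seq y n) (seq z n)))
    (≼-trans {∣ x - y ∣ + ∣ y - z ∣} {fromℚ p + fromℚ q} {fromℚ (p ℚ.+ q)}
        (+-mono-≼ {∣ x - y ∣} {fromℚ p} {∣ y - z ∣} {fromℚ q} (le (close h)) (le (close h′))) (fromℚ-+ p q))))

  ≈-sym : ∀ {x y p} → x ≈[ p ] y → y ≈[ p ] x
  ≈-sym {x} {y} {p} h = near (holds (≼-trans {∣ y - x ∣} {∣ x - y ∣} {fromℚ p}
      (≼-pointwise {∣ y - x ∣} {∣ x - y ∣} (λ n → ℚ.≤-reflexive (∣-∣-comm (seq y n) (seq x n)))) (le (close h))))

  ≈-weaken : ∀ {x y p q} → p ℚ.≤ q → x ≈[ p ] y → x ≈[ q ] y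
  ≈-weaken {x} {y} {p} {q} p≤q h = near (holds (≼-trans {∣ x - y ∣} {fromℚ p} {fromℚ q} (le (close h)) (fromℚ-≼ p≤q)))

  ≅⇒≈ : ∀ {x y} → x ≅ y → x ≈[ 0ℚ ] y
  ≅⇒≈ {x} {y} x≃y = near λ ε 0<ε → let N , h = equal x≃y ε 0<ε in N , λ n N≤n → subst (ℚ.∣ seq x n ℚ.- seq y n ∣ ℚ.≤_) (sym (ℚ.+-identityˡ ε)) (h n N≤n)

  ≈-respʳ : ∀ {x y z p} → y ≅ z → x ≈[ p ] y → x ≈[ p ] z
  ≈-respʳ {p = p} y≃z h = ≈-weaken (ℚ.≤-reflexive (ℚ.+-identityʳ p)) (≈-trans h (≅⇒≈ y≃z))

  ≈-respˡ : ∀ {x y z p} → x ≅ y → x ≈[ p ] z → y ≈[ p ] z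
  ≈-respˡ x≃y h = ≈-sym (≈-respʳ x≃y (≈-sym h))

  ≈-fromℚ : ∀ {p q r} → ℚ.∣ p ℚ.- q ∣ ℚ.≤ r → fromℚ p ≈[ r ] fromℚ q
  ≈-fromℚ h = near (holds (fromℚ-≼ h))

  ≈-fromℚ⁻¹ : ∀ {p q r} → fromℚ p ≈[ r ] fromℚ q → ℚ.∣ p ℚ.- q ∣ ℚ.≤ r
  ≈-fromℚ⁻¹ {p} {q} {r} h = fromℚ-≼⁻¹ {ℚ.∣ p ℚ.- q ∣} {r} (le (close h))

  ∣q∣≤∣p∣+∣p-q∣ : ∀ p q → ℚ.∣ q ∣ ℚ.≤ ℚ.∣ p ∣ ℚ.+ ℚ.∣ p ℚ.- q ∣
  ∣q∣≤∣p∣+∣p-q∣ p q = subst (λ v → ℚ.∣ v ∣ ℚ.≤ ℚ.∣ p ∣ ℚ.+ ℚ.∣ p ℚ.- q ∣)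
    (solve 2 (λ x q → x :+ (:- (x :- q)) := q) refl p q)
    (ℚ.≤-trans (ℚ.∣p+q∣≤∣p∣+∣q∣ p (ℚ.- (p ℚ.- q)))
        (ℚ.≤-reflexive (cong (λ v → ℚ.∣ p ∣ ℚ.+ v) (ℚ.∣-p∣≡∣p∣ (p ℚ.- q)))))
    where open +-*-Solver

  ∣∣-shift : ∀ {x y p r} → ∣ x ∣ ≼ fromℚ p → x ≈[ r ] y → ∣ y ∣ ≼ fromℚ (p ℚ.+ r)
  ∣∣-shift {x} {y} {p} {r} hx h = ≼-trans {∣ y ∣} {∣ x ∣ + ∣ x - y ∣} {fromℚ (p ℚ.+ r)}
    (≼-pointwise {∣ y ∣} {∣ x ∣ + ∣ x - y ∣} (λ n → ∣q∣≤∣p∣+∣p-q∣ (seq x n) (seq y n)))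
    (≼-trans {∣ x ∣ + ∣ x - y ∣} {fromℚ p + fromℚ r} {fromℚ (p ℚ.+ r)}
        (+-mono-≼ {∣ x ∣} {fromℚ p} {∣ x - y ∣} {fromℚ r} hx (le (close h))) (fromℚ-+ p r))

  ∣∣-≈ : ∀ {x p q r} → ∣ x ∣ ≼ fromℚ p → x ≈[ r ] fromℚ q → ℚ.∣ q ∣ ℚ.≤ p ℚ.+ r
  ∣∣-≈ {x} {p} {q} {r} hx h = fromℚ-≼⁻¹ {ℚ.∣ q ∣} {p ℚ.+ r} (le (holds (∣∣-shift {x} {fromℚ q} {p} {r} hx h)))

  -- δ is the minimum of 1 and ε/(K + 1). The added 1 covers K = 0, and δ ≤ 1 later allows δ² to be
  -- bounded by δ.
  shrink : ∀ {K ε} → 0ℚ ℚ.≤ K → 0ℚ ℚ.< ε → ∃[ δ ] 0ℚ ℚ.< δ × δ ℚ.≤ 1ℚ × K ℚ.* δ ℚ.≤ ε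
  shrink {K} {ε} 0≤K 0<ε = δ ℚ.⊓ 1ℚ , pos , ℚ.p⊓q≤q δ 1ℚ , ℚ.≤-trans (ℚ.*-monoˡ-≤-nonNeg K (ℚ.p⊓q≤p δ 1ℚ))
      (ℚ.≤-trans (ℚ.*-monoʳ-≤-nonNeg δ {{ℚ.pos⇒nonNeg δ {{δ⁺}}}} K≤L) (ℚ.≤-reflexive Lδ))
    where
    L : ℚ
    L = K ℚ.+ 1ℚ
    K≤L : K ℚ.≤ L
    K≤L = ≤+ ℚ.≤-refl (ℚ.positive⁻¹ 1ℚ)
    instance
      K⁰ : ℚ.NonNegative K
      K⁰ = ℚ.nonNegative 0≤K
      ε⁺ : ℚ.Positive ε
      ε⁺ = ℚ.positive 0<ε
      L⁺ : ℚ.Positive L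
      L⁺ = ℚ.nonNeg+pos⇒pos K 1ℚ
      L≢0 : ℚ.NonZero L
      L≢0 = ℚ.pos⇒nonZero L
      1/L⁺ : ℚ.Positive (ℚ.1/ L)
      1/L⁺ = ℚ.1/pos⇒pos L
    δ : ℚ
    δ = ℚ.1/ L ℚ.* ε
    δ⁺ : ℚ.Positive δ
    δ⁺ = ℚ.pos*pos⇒pos (ℚ.1/ L) ε
    Lδ : L ℚ.* δ ≡ ε
    Lδ = trans (sym (ℚ.*-assoc L (ℚ.1/ L) ε)) (trans (cong (ℚ._* ε) (ℚ.*-inverseʳ L)) (ℚ.*-identityˡ ε))
    pos : 0ℚ ℚ.< δ ℚ.⊓ 1ℚ
    pos with ℚ.⊓-sel δ 1ℚ
    ... | inj₁ e = subst (0ℚ ℚ.<_) (sym e) (ℚ.positive⁻¹ δ {{δ⁺}})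
    ... | inj₂ e = subst (0ℚ ℚ.<_) (sym e) (ℚ.positive⁻¹ 1ℚ)

  -- With slack δ in both factors, (Y + δ)(r + δ) = Yr + (Y + r + δ)δ, and since δ ≤ 1 the last term
  -- is at most ε by `shrink` for Y + r + 1.
  *-mono-≼ : ∀ {y v Y r} → 0ℚ ℚ.≤ Y → 0ℚ ℚ.≤ r → y ≼ fromℚ Y → ∣ v ∣ ≼ fromℚ r → y * ∣ v ∣ ≼ fromℚ (Y ℚ.* r)
  *-mono-≼ {y} {v} {Y} {r} 0≤Y 0≤r hy hv = le λ ε 0<ε →
    let δ , 0<δ , δ≤1 , small = shrink (ℚ.+-mono-≤ (ℚ.+-mono-≤ 0≤Y 0≤r) (ℚ.<⇒≤ (ℚ.positive⁻¹ 1ℚ))) 0<ε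
        N₁ , h₁ = holds hy δ 0<δ
        N₂ , h₂ = holds hv δ 0<δ
    in N₁ ℕ.⊔ N₂ , λ n N≤n → bound n ε δ 0<δ δ≤1 small (h₁ n (ℕ.m⊔n≤o⇒m≤o N₁ N₂ N≤n)) (h₂ n (ℕ.m⊔n≤o⇒n≤o N₁ N₂ N≤n))
    where
    open +-*-Solver
    bound : ∀ n ε δ → 0ℚ ℚ.< δ → δ ℚ.≤ 1ℚ → (Y ℚ.+ r ℚ.+ 1ℚ) ℚ.* δ ℚ.≤ ε → seq y n ℚ.≤ Y ℚ.+ δ → ℚ.∣ seq v n ∣ ℚ.≤ r
        ℚ.+ δ →
            seq y n ℚ.* ℚ.∣ seq v n ∣ ℚ.≤ Y ℚ.* r ℚ.+ ε
    bound n ε δ 0<δ δ≤1 small a b = ℚ.≤-trans (ℚ.*-monoʳ-≤-nonNeg ℚ.∣ seq v n ∣ {{ℚ.∣-∣-nonNeg (seq v n)}} a)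
      (ℚ.≤-trans (ℚ.*-monoˡ-≤-nonNeg (Y ℚ.+ δ) {{ℚ.nonNegative (ℚ.+-mono-≤ 0≤Y (ℚ.<⇒≤ 0<δ))}} b)
      (ℚ.≤-trans (ℚ.≤-reflexive (solve 3 (λ Y r d → (Y :+ d) :* (r :+ d) := Y :* r :+ (Y :+ r :+ d) :* d) refl Y r δ))
      (ℚ.+-monoʳ-≤ (Y ℚ.* r) (ℚ.≤-trans (ℚ.*-monoʳ-≤-nonNeg δ {{ℚ.nonNegative (ℚ.<⇒≤ 0<δ)}}
          (ℚ.+-monoʳ-≤ (Y ℚ.+ r) δ≤1)) small))))

  scale-≼ : ∀ {x p} c → 0ℚ ℚ.≤ c → x ≼ fromℚ p → fromℚ c * x ≼ fromℚ (c ℚ.* p)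
  scale-≼ {x} {p} c 0≤c h = le λ ε 0<ε →
    let δ , 0<δ , _ , small = shrink 0≤c 0<ε
        N , h′ = holds h δ 0<δ
    in N , λ n N≤n → ℚ.≤-trans (ℚ.*-monoˡ-≤-nonNeg c {{ℚ.nonNegative 0≤c}} (h′ n N≤n))
         (ℚ.≤-trans (ℚ.≤-reflexive (ℚ.*-distribˡ-+ c p δ)) (ℚ.+-monoʳ-≤ (c ℚ.* p) small))

  ∣c*-c*∣ : ∀ c p q → 0ℚ ℚ.≤ c → ℚ.∣ c ℚ.* p ℚ.- c ℚ.* q ∣ ≡ c ℚ.* ℚ.∣ p ℚ.- q ∣
  ∣c*-c*∣ c p q 0≤c = trans (cong ℚ.∣_∣ (solve 3 (λ c p q → c :* p :- c :* q := c :* (p :- q)) refl c p q))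
    (trans (ℚ.∣p*q∣≡∣p∣*∣q∣ c (p ℚ.- q)) (cong (ℚ._* ℚ.∣ p ℚ.- q ∣) (ℚ.0≤p⇒∣p∣≡p 0≤c)))
    where open +-*-Solver

  scaled⇒≈ : ∀ {x y p} c → 0ℚ ℚ.≤ c → fromℚ c * ∣ x - y ∣ ≼ fromℚ p → fromℚ c * x ≈[ p ] fromℚ c * y
  scaled⇒≈ {x} {y} {p} c 0≤c h = near (holds (≼-trans {∣ fromℚ c * x - fromℚ c * y ∣} {fromℚ c * ∣ x - y ∣} {fromℚ p}
      (≼-pointwise {∣ fromℚ c * x - fromℚ c * y ∣} {fromℚ c * ∣ x - y ∣}
      (λ n → ℚ.≤-reflexive (∣c*-c*∣ c (seq x n) (seq y n) 0≤c))) h))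

  ≈-scale : ∀ {x y p} c → 0ℚ ℚ.≤ c → x ≈[ p ] y → fromℚ c * x ≈[ c ℚ.* p ] fromℚ c * y
  ≈-scale {x} {y} {p} c 0≤c h = scaled⇒≈ {x} {y} {c ℚ.* p} c 0≤c (scale-≼ {∣ x - y ∣} {p} c 0≤c (le (close h)))

  eventually-bounded : ∀ x → ∃[ K ] 0ℚ ℚ.≤ K × (∃[ N ] ∀ n → N ℕ.≤ n → ℚ.∣ seq x n ∣ ℚ.≤ K)
  eventually-bounded x =
    let N , h = cauchy x 1ℚ (ℚ.positive⁻¹ 1ℚ)
    in ℚ.∣ seq x N ∣ ℚ.+ 1ℚ , ℚ.+-mono-≤ (ℚ.0≤∣p∣ (seq x N)) (ℚ.<⇒≤ (ℚ.positive⁻¹ 1ℚ)) , N ,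
       λ n N≤n → ℚ.≤-trans (∣q∣≤∣p∣+∣p-q∣ (seq x N) (seq x n)) (ℚ.+-monoʳ-≤ ℚ.∣ seq x N ∣ (h N n ℕ.≤-refl N≤n))

  -- 1 ≤ y holds for the approximants only up to δ, giving x ≤ xy + xδ; an eventual bound on x makes
  -- the error small. In this way y and z inherit the bound 2^(m+1) on yz.
  x≼x*y : ∀ {x y} → fromℚ 1ℚ ≼ x → fromℚ 1ℚ ≼ y → x ≼ x * y
  x≼x*y {x} {y} 1≤x 1≤y = le λ ε 0<ε →
    let K , 0≤K , N , b = eventually-bounded x
        δ , 0<δ , _ , small = shrink 0≤K 0<ε
        N₁ , h₁ = holds 1≤x 1ℚ (ℚ.positive⁻¹ 1ℚ)
        N₂ , h₂ = holds 1≤y δ 0<δ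
        M = N₁ ℕ.⊔ N₂
        part : ∀ {n} → N ℕ.⊔ M ℕ.≤ n → M ℕ.≤ n
        part = ℕ.m⊔n≤o⇒n≤o N M
    in N ℕ.⊔ M , λ n N≤n → bound n ε δ 0<δ (ℚ.≤-trans (ℚ.*-monoʳ-≤-nonNeg δ {{ℚ.nonNegative (ℚ.<⇒≤ 0<δ)}} (ℚ.≤-trans (p≤∣p∣ (seq x n)) (b n (ℕ.m⊔n≤o⇒m≤o N M N≤n)))) small)
         (h₁ n (ℕ.m⊔n≤o⇒m≤o N₁ N₂ (part N≤n))) (h₂ n (ℕ.m⊔n≤o⇒n≤o N₁ N₂ (part N≤n)))
    where
    open +-*-Solver
    bound : ∀ n ε δ → 0ℚ ℚ.< δ → seq x n ℚ.* δ ℚ.≤ ε → 1ℚ ℚ.≤ seq x n ℚ.+ 1ℚ → 1ℚ ℚ.≤ seq y n ℚ.+ δ → seq x n ℚ.≤ seq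
        x n ℚ.* seq y n ℚ.+ ε
    bound n ε δ 0<δ small 0≤x 1≤y = ℚ.≤-trans (ℚ.≤-reflexive (sym (ℚ.*-identityʳ (seq x n))))
      (ℚ.≤-trans (ℚ.*-monoˡ-≤-nonNeg (seq x n) {{ℚ.nonNegative nonneg}} 1≤y)
      (ℚ.≤-trans (ℚ.≤-reflexive (ℚ.*-distribˡ-+ (seq x n) (seq y n) δ)) (ℚ.+-monoʳ-≤ (seq x n ℚ.* seq y n) small)))
      where
      nonneg : 0ℚ ℚ.≤ seq x n
      nonneg = subst (0ℚ ℚ.≤_) (solve 2 (λ p o → p :+ o :- o := p) refl (seq x n) 1ℚ) (ℚ.+-monoˡ-≤ (ℚ.- 1ℚ) 0≤x)

  ∣fromℚ∣-≼ : ∀ {p q} → ℚ.∣ q ∣ ℚ.≤ p → ∣ fromℚ q ∣ ≼ fromℚ p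
  ∣fromℚ∣-≼ h = ≼-pointwise (λ _ → h)

  ∣∣-difference : ∀ {x y p q} → ∣ x ∣ ≼ fromℚ p → ∣ y ∣ ≼ fromℚ q → x ≈[ p ℚ.+ q ] y
  ∣∣-difference {x} {y} {p} {q} hx hy = near (holds (≼-trans {∣ x - y ∣} {∣ x ∣ + ∣ y ∣} {fromℚ (p ℚ.+ q)}
    (≼-pointwise {∣ x - y ∣} {∣ x ∣ + ∣ y ∣} (λ n → ℚ.∣p-q∣≤∣p∣+∣q∣ (seq x n) (seq y n)))
    (≼-trans {∣ x ∣ + ∣ y ∣} {fromℚ p + fromℚ q} {fromℚ (p ℚ.+ q)}
        (+-mono-≼ {∣ x ∣} {fromℚ p} {∣ y ∣} {fromℚ q} hx hy) (fromℚ-+ p q))))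

-- Short dyadic names of a real number.

module Approximation where

  open import Defs hiding (Poly; con; var; _:+_; _:*_; ⟦_⟧)
  open BinaryDigits
  open Subroutines using (signGlyph; _>>_)
  open Words using (wholePart; fracPart; wholeBits; negative; sign-neg)
  open RealAlgorithm using (magnitude)
  open DyadicValues
  open RealDistance
  open import Data.Bool.Base using (true; false)
  open import Data.Integer.Base as ℤ using (ℤ; +_; -[1+_])
  import Data.Integer.Properties as ℤ
  import Data.Integer.DivMod as ℤ
  open import Data.List.Base as List using ([]; _∷_; _++_; length)
  open import Data.List.Properties using (length-++; length-map; length-reverse)
  open import Data.Nat.Base as ℕ using (ℕ; zero; suc)
  import Data.Nat.Properties as ℕ
  open import Data.Product.Base using (∃-syntax; _,_; proj₁; proj₂)
  open import Data.Rational.Base as ℚ using (ℚ; 0ℚ; 1ℚ; ↥_; ↧_)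
  import Data.Rational.Properties as ℚ
  open import Data.Rational.Solver using (module +-*-Solver)
  import Data.Rational.Unnormalised.Base as ℚᵘ
  import Data.Rational.Unnormalised.Properties as ℚᵘ
  open import Relation.Binary.PropositionalEquality using (_≡_; refl; sym; trans; cong; cong₂; subst; subst₂)

  numerator : ∀ p → p ℚ.* ι (↧ p) ≡ ι (↥ p)
  numerator p@(ℚ.mkℚ _ _ _) = ℚ.toℚᵘ-injective (ℚᵘ.≃-trans (ℚ.toℚᵘ-homo-* p (ι (↧ p)))
    (ℚᵘ.≃-trans (ℚᵘ.*-cong (ℚᵘ.≃-refl {ℚ.toℚᵘ p}) (ℚ.toℚᵘ-fromℚᵘ (ℚᵘ.mkℚᵘ (↧ p) 0)))
    (ℚᵘ.≃-trans (ℚᵘ.*≡* {ℚ.toℚᵘ p ℚᵘ.* ℚᵘ.mkℚᵘ (↧ p) 0} {ℚᵘ.mkℚᵘ (↥ p) 0} cross)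
        (ℚᵘ.≃-sym (ℚ.toℚᵘ-fromℚᵘ (ℚᵘ.mkℚᵘ (↥ p) 0))))))
    where
    cross : (↥ p ℤ.* ↧ p) ℤ.* + 1 ≡ ↥ p ℤ.* + (ℚ.↧ₙ p ℕ.* 1)
    cross = trans (ℤ.*-identityʳ (↥ p ℤ.* ↧ p)) (cong (λ d → ↥ p ℤ.* + d) (sym (ℕ.*-identityʳ (ℚ.↧ₙ p))))

  floor : ℚ → ℤ
  floor p = ↥ p ℤ./ ↧ p

  floor-close : ∀ p → ℚ.∣ p ℚ.- ι (floor p) ∣ ℚ.≤ 1ℚ
  floor-close p = subst (ℚ._≤ 1ℚ) (sym (ℚ.0≤p⇒∣p∣≡p (p≤q⇒0≤q-p lower))) (ℚ.≤-trans (ℚ.+-monoˡ-≤ (ℚ.- ι q) upper)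
      (ℚ.≤-reflexive (solve 2 (λ q o → q :+ o :- q := o) refl (ι q) 1ℚ)))
    where
    open +-*-Solver
    q : ℤ
    q = floor p
    r : ℕ
    r = ↥ p ℤ.% ↧ p
    split : ι (↥ p) ≡ nat r ℚ.+ ι q ℚ.* ι (↧ p)
    split = trans (cong ι (ℤ.a≡a%n+[a/n]*n (↥ p) (↧ p)))
        (trans (ι-+ (+ r) (q ℤ.* ↧ p)) (cong (λ v → nat r ℚ.+ v) (ι-* q (↧ p))))
    0<d : 0ℚ ℚ.< ι (↧ p)
    0<d = ι-< {+ 0} {↧ p} (ℤ.+<+ (ℕ.s≤s ℕ.z≤n))
    p≤q⇒0≤q-p : ∀ {p q} → p ℚ.≤ q → 0ℚ ℚ.≤ q ℚ.- p
    p≤q⇒0≤q-p {p} {q} h = subst (ℚ._≤ q ℚ.- p) (ℚ.+-inverseʳ p) (ℚ.+-monoˡ-≤ (ℚ.- p) h)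
    lower : ι q ℚ.≤ p
    lower = ℚ.*-cancelʳ-≤-pos (ι (↧ p)) {{ℚ.positive 0<d}}
        (subst (ι q ℚ.* ι (↧ p) ℚ.≤_) (sym (trans (numerator p) split))
      (subst (ℚ._≤ nat r ℚ.+ ι q ℚ.* ι (↧ p)) (ℚ.+-identityˡ (ι q ℚ.* ι (↧ p)))
          (ℚ.+-monoˡ-≤ (ι q ℚ.* ι (↧ p)) (0≤nat r))))
    upper : p ℚ.≤ ι q ℚ.+ 1ℚ
    upper = ℚ.*-cancelʳ-≤-pos (ι (↧ p)) {{ℚ.positive 0<d}} (subst₂ ℚ._≤_ (sym (trans (numerator p) split))
      (solve 2 (λ q d → d :+ q :* d := (q :+ con 1ℚ) :* d) refl (ι q) (ι (↧ p)))
      (ℚ.+-monoˡ-≤ (ι q ℚ.* ι (↧ p)) (ℚ.<⇒≤ (nat-< (ℤ.n%d<d (↥ p) (↧ p))))))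

  approximate : ℚ → ℕ → 𝔻
  approximate p e = floor (p ℚ.* 𝟚^ e) /2^ e

  approximate-close : ∀ p e → ℚ.∣ p ℚ.- value𝔻 (approximate p e) ∣ ℚ.≤ ½^ e
  approximate-close p e = subst₂ ℚ._≤_ rescaled (ℚ.*-identityʳ (½^ e))
      (ℚ.*-monoˡ-≤-nonNeg (½^ e) {{½^-nonNeg e}} (floor-close (p ℚ.* P)))
    where
    open +-*-Solver
    P : ℚ
    P = 𝟚^ e
    a : ℚ
    a = ι (floor (p ℚ.* P))
    rescaled : ½^ e ℚ.* ℚ.∣ p ℚ.* P ℚ.- a ∣ ≡ ℚ.∣ p ℚ.- a ℚ.* ½^ e ∣
    rescaled = trans (cong (ℚ._* ℚ.∣ p ℚ.* P ℚ.- a ∣) (sym (ℚ.0≤p⇒∣p∣≡p (ℚ.nonNegative⁻¹ (½^ e) {{½^-nonNeg e}}))))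
      (trans (sym (ℚ.∣p*q∣≡∣p∣*∣q∣ (½^ e) (p ℚ.* P ℚ.- a))) (cong ℚ.∣_∣
        (trans (solve 4 (λ h p P a → h :* (p :* P :- a) := p :* (P :* h) :- a :* h) refl (½^ e) p P a)
          (cong (ℚ._- a ℚ.* ½^ e) (trans (cong (p ℚ.*_) (𝟚^*½^ e)) (ℚ.*-identityʳ p))))))

  ½^>0 : ∀ n → 0ℚ ℚ.< ½^ n
  ½^>0 n = ℚ.positive⁻¹ (½^ n) {{½^-pos n}}

  ½^-double : ∀ n → ½^ (suc n) ℚ.+ ½^ (suc n) ≡ ½^ n
  ½^-double n = halves (½^ n)

  -- Half the error that `CF` permits: 2^-(j+2) for stopping the Cauchy sequence and as much for
  -- rounding to `2 + j` places. The other half pays for moving to a nearby point.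
  sample : ℝ → ℕ → 𝔻
  sample x j = approximate (seq x (proj₁ (cauchy x (½^ (2 ℕ.+ j)) (½^>0 (2 ℕ.+ j))))) (2 ℕ.+ j)

  sample-close : ∀ x j → x ≈[ ½^ (suc j) ] from𝔻 (sample x j)
  sample-close x j = ≈-weaken {x} {from𝔻 (sample x j)} {½^ (2 ℕ.+ j) ℚ.+ ½^ (2 ℕ.+ j)} {½^ (suc j)}
      (ℚ.≤-reflexive (½^-double (suc j)))
    (≈-trans {x} {fromℚ r} {from𝔻 (sample x j)} {½^ (2 ℕ.+ j)} {½^ (2 ℕ.+ j)} (near settled)
        (≈-fromℚ (approximate-close r (2 ℕ.+ j))))
    where
    N : ℕ
    N = proj₁ (cauchy x (½^ (2 ℕ.+ j)) (½^>0 (2 ℕ.+ j)))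
    r : ℚ
    r = seq x N
    settled : ∣ x - fromℚ r ∣ ≤ fromℚ (½^ (2 ℕ.+ j))
    settled ε 0<ε = N , λ n N≤n → ≤+ (proj₂ (cauchy x (½^ (2 ℕ.+ j)) (½^>0 (2 ℕ.+ j))) n N N≤n ℕ.≤-refl) 0<ε

  length-frac : ∀ j n → length (frac j n) ℕ.≤ j
  length-frac zero    n = ℕ.z≤n
  length-frac (suc j) n = ℕ.≤-trans (length-scons (odd (n >> j)) (frac j n)) (ℕ.s≤s (length-frac j n))
    where
    length-scons : ∀ b w → length (scons b w) ℕ.≤ suc (length w)
    length-scons true  w       = ℕ.≤-refl
    length-scons false []      = ℕ.z≤n
    length-scons false (_ ∷ _) = ℕ.≤-refl

  length-show≤ : ∀ w → length (show w) ℕ.≤ suc (length w)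
  length-show≤ []        = ℕ.≤-refl
  length-show≤ w@(_ ∷ _) = ℕ.≤-trans (ℕ.≤-reflexive (length-reverse w)) (ℕ.n≤1+n _)

  length-signGlyph : ∀ g → length (signGlyph g) ℕ.≤ 1
  length-signGlyph false = ℕ.z≤n
  length-signGlyph true  = ℕ.≤-refl

  word𝔻-length : ∀ d → length (word𝔻 d) ≡ length (signGlyph (negative d)) ℕ.+
      (length (wholeBits d) ℕ.+ suc (length (fracPart d)))
  word𝔻-length d@(a /2^ b) = trans (cong length (trans (word𝔻-digits a b)
      (cong (_++ (bitGlyphs (wholeBits d) ++ point ∷ bitGlyphs (fracPart d))) (sign-neg a))))
    (trans (length-++ (signGlyph (negative d))) (cong (length (signGlyph (negative d)) ℕ.+_)
    (trans (length-++ (bitGlyphs (wholeBits d))) (cong₂ (λ u v → u ℕ.+ suc v) (length-map bitGlyph (wholeBits d))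
        (length-map bitGlyph (fracPart d))))))

  wholeBits+frac≤word : ∀ d → length (wholeBits d) ℕ.+ length (fracPart d) ℕ.≤ length (word𝔻 d)
  wholeBits+frac≤word d = ℕ.≤-trans (ℕ.+-monoʳ-≤ (length (wholeBits d)) (ℕ.n≤1+n _))
    (ℕ.≤-trans (ℕ.m≤n+m _ (length (signGlyph (negative d)))) (ℕ.≤-reflexive (sym (word𝔻-length d))))

  digits-length : ∀ n k → n ℕ.< 2 ℕ.^ k → length (digits n) ℕ.≤ k
  digits-length n k lt with digits n in eq
  ... | []    = ℕ.z≤n
  ... | b ∷ w = ℕ.≰⇒> (λ k≤ → ℕ.<-irrefl refl (ℕ.≤-<-trans (ℕ.≤-trans (ℕ.^-monoʳ-≤ 2 k≤) (digits-lower n b w eq)) lt))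

  2^k+1<2^[2+k] : ∀ k → 2 ℕ.^ k ℕ.+ 1 ℕ.< 2 ℕ.^ (2 ℕ.+ k)
  2^k+1<2^[2+k] k = begin-strict
    P ℕ.+ 1         <⟨ ℕ.+-monoʳ-< P (ℕ.s≤s (ℕ.m^n>0 2 k)) ⟩
    P ℕ.+ suc P     ≤⟨ ℕ.+-monoʳ-≤ P (ℕ.≤-trans (ℕ.≤-reflexive (ℕ.+-comm 1 P)) (ℕ.+-monoʳ-≤ P (ℕ.m^n>0 2 k))) ⟩
    P ℕ.+ (P ℕ.+ P) ≤⟨ ℕ.m≤m+n _ P ⟩
    P ℕ.+ (P ℕ.+ P) ℕ.+ P ≡⟨ solve-∀ P ⟩
    2 ℕ.* (2 ℕ.* P) ∎
    where
    open ℕ.≤-Reasoning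
    open import Data.Nat.Tactic.RingSolver using () renaming (solve-∀ to ring)
    P : ℕ
    P = 2 ℕ.^ k
    solve-∀ : ∀ P → P ℕ.+ (P ℕ.+ P) ℕ.+ P ≡ 2 ℕ.* (2 ℕ.* P)
    solve-∀ = ring

  magnitude≤ : ∀ d k → size d ℚ.≤ 𝟚^ k ℚ.+ 1ℚ → magnitude d ℕ.≤ 2 ℕ.+ k
  magnitude≤ d k h = digits-length (wholePart d) (2 ℕ.+ k)
    (ℕ.≤-<-trans (nat-≤⁻¹ (ℚ.≤-trans (whole≤size d) (ℚ.≤-trans h (ℚ.≤-reflexive (sym (nat-+ (2 ℕ.^ k) 1))))))
        (2^k+1<2^[2+k] k))

  wholeBits≤ : ∀ d k → size d ℚ.≤ 𝟚^ k ℚ.+ 1ℚ → length (wholeBits d) ℕ.≤ 3 ℕ.+ k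
  wholeBits≤ d k h = ℕ.≤-trans (length-show≤ (digits (wholePart d))) (ℕ.s≤s (magnitude≤ d k h))

  size≤ : ∀ {x} d k {r} → ∣ x ∣ ≼ 2^ k → r ℚ.≤ 1ℚ → x ≈[ r ] from𝔻 d → size d ℚ.≤ 𝟚^ k ℚ.+ 1ℚ
  size≤ {x} d k {r} hx r≤1 h = subst (ℚ._≤ 𝟚^ k ℚ.+ 1ℚ) (∣value∣ d)
    (ℚ.≤-trans (∣∣-≈ {x} {𝟚^ k} {value𝔻 d} {r} hx h) (ℚ.+-monoʳ-≤ (𝟚^ k) r≤1))

  -- There are at most `2 + j` binary places and `3 + k` whole digits, besides sign and point. What
  -- matters is the form: j plus a constant.
  sample-length : ∀ {x} k j → ∣ x ∣ ≼ 2^ k → length (word𝔻 (sample x j)) ℕ.≤ j ℕ.+ (7 ℕ.+ k)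
  sample-length {x} k j hx = ℕ.≤-trans (ℕ.≤-reflexive (word𝔻-length d)) (ℕ.≤-trans
    (ℕ.+-mono-≤ (length-signGlyph (negative d)) (ℕ.+-mono-≤
        (wholeBits≤ d k (size≤ {x} d k hx (½^≤1 (suc j)) (sample-close x j)))
        (ℕ.s≤s (length-frac (2 ℕ.+ j) ℤ.∣ 𝔻.num d ∣))))
    (ℕ.≤-reflexive (rearrange k j)))
    where
    open import Data.Nat.Tactic.RingSolver using (solve-∀)
    d : 𝔻
    d = sample x j
    rearrange : ∀ k j → 1 ℕ.+ (3 ℕ.+ k ℕ.+ suc (2 ℕ.+ j)) ≡ j ℕ.+ (7 ℕ.+ k)
    rearrange = solve-∀

-- A run depends only on the oracle's answers to short queries.

module Locality where

  open import Defs using (oracle; Glyph; Instruction; halt; act; query; Machine; loaded; contents; leading𝟏s; Config; config; initial; instruction; execute; run; output)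
  import Defs
  open TapeGrowth
  open import Data.List.Base as List using (List; _∷_; length)
  open import Data.Nat.Base
  open import Data.Nat.Properties
  open import Data.Vec.Base using (_∷_)
  open import Relation.Binary.PropositionalEquality

  -- A run of t steps asks only short questions, because each step lengthens
  -- the query tape by at most a constant.
  module _ (M : Machine oracle) (A B : ℕ → List Glyph) (c L : ℕ)
           (short : ∀ j → length (A j) ≤ j + c) (agree : ∀ j → j < L → A j ≡ B j) where
    open Machine M
    open TapeSizes M

    transfer : Config M A → Config M B
    transfer (config q ts) = config q ts

    execute-agrees : ∀ (i : Instruction aux states (3 + work) oracle) d → suc (querySize A d) < L →
      transfer (execute M A A i d) ≡ execute M B B i (transfer d)
    execute-agrees halt       (config q ts) lt = refl
    execute-agrees (act q as) (config p ts) lt = refl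
    execute-agrees (query q)  (config p (t₀ ∷ t₁ ∷ t ∷ ts)) lt =
      cong (λ w → config q (t₀ ∷ t₁ ∷ loaded w ∷ ts))
          (agree _ (≤-<-trans (≤-trans (leading𝟏s≤length (contents t)) (contents-size t)) lt))

    -- A query of length j is replaced by an answer of length at most j + c, so it too lengthens the
    -- tape by a constant only. Answers of length 2j could double the tape at every query.
    execute-grows : ∀ (i : Instruction aux states (3 + work) oracle) d → querySize A (execute M A A i d) ≤ suc c +
        querySize A d
    execute-grows halt       d = m≤n+m _ (suc c)
    execute-grows (act q (_ ∷ _ ∷ a ∷ _)) (config p (_ ∷ _ ∷ t ∷ _)) = ≤-trans (perform-size a t)
        (+-monoˡ-≤ (tapeSize t) (s≤s (z≤n {c})))
    execute-grows (query q)  (config p (t₀ ∷ t₁ ∷ t ∷ ts)) = begin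
      tapeSize (loaded (A j)) ≤⟨ loaded-size (A j) ⟩
      length (A j)            ≤⟨ short j ⟩
      j + c                   ≤⟨ +-monoˡ-≤ c (≤-trans (leading𝟏s≤length (contents t)) (contents-size t)) ⟩
      suc (tapeSize t) + c    ≡⟨ cong suc (+-comm (tapeSize t) c) ⟩
      suc c + tapeSize t      ∎
      where
      open ≤-Reasoning
      j : ℕ
      j = leading𝟏s (contents t)

    run-agrees : ∀ t d s → querySize A d ≤ s → suc (t * suc c + s) < L → transfer (run M A t d) ≡ run M B t
        (transfer d)
    run-agrees zero    d s le lt = refl
    run-agrees (suc t) d s le lt = trans (run-agrees t (next A d) (suc c + s)
        (≤-trans (execute-grows (instruction M A d) d) (+-monoʳ-≤ (suc c) le)) lt′)
      (cong (run M B t) (execute-agrees (instruction M A d) d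
          (≤-<-trans (s≤s (≤-trans le (m≤n+m s (suc t * suc c)))) lt)))
      where
      lt′ : suc (t * suc c + (suc c + s)) < L
      lt′ = subst (λ v → suc v < L) (trans (cong (_+ s) (+-comm (suc c) (t * suc c))) (+-assoc (t * suc c) (suc c) s))
          lt

    output-transfer : ∀ d → output M B (transfer d) ≡ output M A d
    output-transfer (config _ (_ ∷ _ ∷ _ ∷ _)) = refl

    output-agrees : ∀ t w → suc (t * suc c + 0) < L → output M A (run M A t (initial M A w)) ≡ output M B
        (run M B t (initial M B w))
    output-agrees t w lt = trans (sym (output-transfer (run M A t (initial M A w))))
        (cong (output M B) (run-agrees t (initial M A w) 0 z≤n lt))

    halts-agree : ∀ t w → suc (t * suc c + 0) < L → Defs.HaltsWithin M A w t → Defs.HaltsWithin M B w t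
    halts-agree t w lt h = trans (cong (instruction M B) (sym (run-agrees t (initial M A w) 0 z≤n lt))) h

-- Modulus of continuity of a polytime computable function, and smoothness.

module Smoothness where

  open import Defs
  open BinaryDigits
  open Words using (wholePart)
  open RealAlgorithm using (magnitude)
  open IntegerAlgorithm using (length-show)
  open DyadicValues
  open RealDistance
  open Approximation
  open Polynomials using (poly-mono; poly-bound; compose; compose-eval)
  open Halting using (halts-later; halted-output)
  open TapeGrowth
  open Locality
  open import Data.Bool.Base using (if_then_else_)
  open import Data.Fin.Base using (zero; suc)
  open import Data.Integer.Base as ℤ using (+_)
  open import Data.List.Base as List using (length)
  open import Data.Nat.Base as ℕ using (ℕ; zero; suc)
  import Data.Nat.Properties as ℕ
  open import Data.Product.Base using (∃-syntax; _×_; _,_; proj₁; proj₂)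
  open import Data.Rational.Base as ℚ using (ℚ; 0ℚ; 1ℚ)
  import Data.Rational.Properties as ℚ
  open import Data.Vec.Base as Vec using ([]; _∷_)
  open import Data.Vec.Relation.Binary.Pointwise.Inductive using ([]; _∷_)
  open import Function.Base using (_∘_)
  open import Function.Bundles using (_⟨$⟩_)
  open import Relation.Binary.PropositionalEquality using (_≡_; refl; sym; trans; cong; cong₂; subst)
  open import Relation.Nullary.Decidable using (Dec; yes; no; decidable-stable)
  open import Relation.Nullary.Negation using (¬_; contradiction)

  halt? : ∀ {aux states tapes κ} (i : Instruction aux states tapes κ) → Dec (i ≡ halt)
  halt? halt      = yes refl
  halt? (act _ _) = no λ ()
  halt? (query _) = no λ ()

  -- Turns an additive constant into an exponent: for m ≥ 2 each further factor m at least doubles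
  -- the power, which is at least 1.
  k+m≤m^1+k : ∀ k m → 2 ℕ.≤ m → k ℕ.+ m ℕ.≤ m ℕ.^ suc k
  k+m≤m^1+k zero    m 2≤m = ℕ.≤-reflexive (sym (ℕ.*-identityʳ m))
  k+m≤m^1+k (suc k) m 2≤m = ℕ.≤-trans (ℕ.+-mono-≤ (ℕ.m^n>0 m {{ℕ.>-nonZero (ℕ.≤-trans (ℕ.s≤s ℕ.z≤n) 2≤m)}} (suc k))
      (k+m≤m^1+k k m 2≤m))
    (ℕ.≤-trans (ℕ.≤-reflexive (cong (P ℕ.+_) (sym (ℕ.+-identityʳ P)))) (ℕ.*-monoˡ-≤ P 2≤m))
    where
    P : ℕ
    P = m ℕ.^ suc k

  ¼ : ℚ
  ¼ = + 1 ℚ./ 4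

  quarter : ∀ p L → ℚ.∣ p ℚ.* ½^ L ∣ ≡ ¼ ℚ.* (nat 4 ℚ.* ℚ.∣ p ∣ ℚ.* ½^ L)
  quarter p L = trans (ℚ.∣p*q∣≡∣p∣*∣q∣ p (½^ L)) (trans (cong (ℚ.∣ p ∣ ℚ.*_) (ℚ.0≤p⇒∣p∣≡p (ℚ.<⇒≤ (½^>0 L))))
    (trans (sym (ℚ.*-identityˡ (ℚ.∣ p ∣ ℚ.* ½^ L)))
        (trans (ℚ.*-assoc ¼ (nat 4) (ℚ.∣ p ∣ ℚ.* ½^ L)) (cong (¼ ℚ.*_) (sym (ℚ.*-assoc (nat 4) ℚ.∣ p ∣ (½^ L)))))))

  quarter-𝟚^ : ∀ m → ¼ ℚ.* 𝟚^ (suc m) ℚ.≤ 𝟚^ m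
  quarter-𝟚^ m = ℚ.≤-trans (ℚ.≤-reflexive (trans (cong (¼ ℚ.*_) (𝟚^-suc m)) (sym (ℚ.*-assoc ¼ (nat 2) (𝟚^ m)))))
    (ℚ.≤-trans (ℚ.*-monoʳ-≤-nonNeg (𝟚^ m) {{ℚ.nonNegative (0≤nat (2 ℕ.^ m))}} (½^≤1 1))
        (ℚ.≤-reflexive (ℚ.*-identityˡ (𝟚^ m))))

  choose : ∀ {P A : Set} → Dec P → A → A → A
  choose (yes _) a b = a
  choose (no _)  a b = b

  choose-yes : ∀ {P A : Set} (P? : Dec P) {a b : A} → P → choose P? a b ≡ a
  choose-yes (yes _)  _ = refl
  choose-yes (no ¬p)  p = contradiction p ¬p

  choose-elim : ∀ {P A : Set} (Q : A → Set) (P? : Dec P) {a b : A} → (P → Q a) → Q b → Q (choose P? a b)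
  choose-elim Q (yes p) qa qb = qa p
  choose-elim Q (no _)  qa qb = qb

  module Continuity (f : ℝ→ℝ) (M : Machine oracle) (computes : Computes M f) (p : Poly 2) (runs : RunsInTime M p) where

    time : ℕ → ℕ → ℕ
    time B n = ⟦ p ⟧ (B ∷ n ∷ [])

    -- The magnitude of x exists only classically, but halting is decidable.
    halts : ∀ x φ → CF x φ → ∀ n B → ∣ x ∣ ≼ 2^ B → HaltsWithin M (word𝔻 ∘ φ) (unary n) (time B n)
    halts x φ cf n B hx = decidable-stable (halt? _) λ ¬h → none ¬h (suc B) B ℕ.≤-refl ℕ.≤-refl (holds hx)
      where
      none : ¬ HaltsWithin M (word𝔻 ∘ φ) (unary n) (time B n) → ∀ b j → j ℕ.< b → j ℕ.≤ B → ¬ (∣ x ∣ ≤ 2^ j)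
      -- If `j` bounds |x| and, by induction, no smaller `i` does, then `j` is the magnitude and the
      -- time bound applies. `b` is the fuel of this descent.
      none ¬h (suc b) j (ℕ.s≤s j≤b) j≤B h = ¬h (halts-later M (word𝔻 ∘ φ) (poly-mono p (j≤B ∷ ℕ.≤-refl ∷ []))
        (runs x φ cf n j (h , λ i hi → ℕ.≮⇒≥ λ i<j → none ¬h b i (ℕ.<-≤-trans i<j j≤b) (ℕ.≤-trans (ℕ.<⇒≤ i<j) j≤B)
            hi)))

    sample-CF : ∀ x → CF x (sample x)
    sample-CF x j = close (≈-weaken {x} {from𝔻 (sample x j)} (½^-anti (ℕ.n≤1+n j)) (sample-close x j))

    module _ (x₁ x₂ : ℝ) (B n L : ℕ) (bounded : ∣ x₁ ∣ ≼ 2^ B) (x₁≈x₂ : x₁ ≈[ ½^ L ] x₂)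
             (enough : suc (time B n ℕ.* suc (7 ℕ.+ B) ℕ.+ 0) ℕ.< L) where

      -- A name of x₂ that answers below `L` as the name of x₁ does, so that the run for x₁ cannot
      -- tell the two apart.
      φ : ℕ → 𝔻
      φ j = choose (j ℕ.<? L) (sample x₁ j) (sample x₂ j)

      -- For j < L the error is at most 2^-(j+1) from `sample` plus |x₁ - x₂| ≤ 2^-L ≤ 2^-(j+1).
      φ-CF : CF x₂ φ
      φ-CF j = choose-elim (λ d → ∣ x₂ - from𝔻 d ∣ ≤ 2^- j) (j ℕ.<? L)
        (λ j<L → close (≈-weaken {x₂} {from𝔻 (sample x₁ j)} {½^ (suc j) ℚ.+ ½^ (suc j)} {½^ j}
            (ℚ.≤-reflexive (½^-double j))
          (≈-trans {x₂} {x₁} {from𝔻 (sample x₁ j)} {½^ (suc j)} {½^ (suc j)}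
              (≈-weaken {x₂} {x₁} {½^ L} {½^ (suc j)} (½^-anti j<L) (≈-sym {x₁} {x₂} x₁≈x₂)) (sample-close x₁ j))))
        (sample-CF x₂ j)

      φ-agrees : ∀ j → j ℕ.< L → word𝔻 (sample x₁ j) ≡ word𝔻 (φ j)
      φ-agrees j j<L = cong word𝔻 (sym (choose-yes (j ℕ.<? L) j<L))

      d₁ d₂ : 𝔻
      d₁ = proj₁ (computes x₁ (sample x₁) (sample-CF x₁) n)
      d₂ = proj₁ (computes x₂ φ φ-CF n)

      same-word : word𝔻 d₁ ≡ word𝔻 d₂
      same-word = trans (sym (halted-output M (word𝔻 ∘ sample x₁) {t = time B n}
          (proj₁ (proj₂ (computes x₁ (sample x₁) (sample-CF x₁) n))) halted₁))
        (trans (output-agrees M (word𝔻 ∘ sample x₁) (word𝔻 ∘ φ) (7 ℕ.+ B) L (λ j → sample-length {x₁} B j bounded)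
            φ-agrees (time B n) (unary n) enough)
          (halted-output M (word𝔻 ∘ φ) {t = time B n} (proj₁ (proj₂ (computes x₂ φ φ-CF n))) halted₂))
        where
        halted₁ : HaltsWithin M (word𝔻 ∘ sample x₁) (unary n) (time B n)
        halted₁ = halts x₁ (sample x₁) (sample-CF x₁) n B bounded
        halted₂ : HaltsWithin M (word𝔻 ∘ φ) (unary n) (time B n)
        halted₂ = halts-agree M (word𝔻 ∘ sample x₁) (word𝔻 ∘ φ) (7 ℕ.+ B) L (λ j → sample-length {x₁} B j bounded)
            φ-agrees (time B n) (unary n) enough halted₁

      -- Both runs write the same word, and its value is within 2^-n of either value of f.
      continuity : (f ⟨$⟩ x₁) ≈[ ½^ n ℚ.+ ½^ n ] (f ⟨$⟩ x₂)
      continuity = ≈-trans {f ⟨$⟩ x₁} {from𝔻 d₁} {f ⟨$⟩ x₂} {½^ n} {½^ n}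
          (≈-sym {from𝔻 d₁} {f ⟨$⟩ x₁} (near (proj₂ (proj₂ (computes x₁ (sample x₁) (sample-CF x₁) n)))))
        (subst (λ v → fromℚ v ≈[ ½^ n ] (f ⟨$⟩ x₂)) (sym (word-value d₁ d₂ same-word))
            (near (proj₂ (proj₂ (computes x₂ φ φ-CF n)))))

    bound : ℕ → ℚ
    bound B = 𝟚^ (suc (time B 0)) ℚ.+ 1ℚ

    -- A run writes at most one glyph more than it makes steps, so the result at precision 2^0 is
    -- below 2^(1 + `time B 0`), and it is within 1 of f(x).
    f-bounded : ∀ x B → ∣ x ∣ ≼ 2^ B → ∣ f ⟨$⟩ x ∣ ≼ fromℚ (bound B)
    f-bounded x B hx = ∣∣-shift {from𝔻 d} {f ⟨$⟩ x} {𝟚^ (suc (time B 0))} {1ℚ}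
      (∣fromℚ∣-≼ {𝟚^ (suc (time B 0))} {value𝔻 d} (subst (ℚ._≤ 𝟚^ (suc (time B 0))) (sym (∣value∣ d))
          (ℚ.≤-trans (ℚ.<⇒≤ (size<𝟚^ d)) (nat-≤ (ℕ.^-monoʳ-≤ 2 short)))))
      (near (proj₂ (proj₂ (computes x (sample x) (sample-CF x) 0))))
      where
      d : 𝔻
      d = proj₁ (computes x (sample x) (sample-CF x) 0)
      out : output M (word𝔻 ∘ sample x) (run M (word𝔻 ∘ sample x) (time B 0) (initial M (word𝔻 ∘ sample x) (unary 0)))
          ≡ word𝔻 d
      out = halted-output M (word𝔻 ∘ sample x) {w = unary 0} {t = time B 0}
          (proj₁ (proj₂ (computes x (sample x) (sample-CF x) 0))) (halts x (sample x) (sample-CF x) 0 B hx)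
      short : magnitude d ℕ.≤ suc (time B 0)
      short = ℕ.≤-trans (length-show (digits (wholePart d)))
          (ℕ.≤-trans (ℕ.m≤m+n _ _) (ℕ.≤-trans (wholeBits+frac≤word d)
        (subst (λ w → length w ℕ.≤ suc (time B 0)) out
            (TapeSizes.output-length M (word𝔻 ∘ sample x) (time B 0) (unary 0)))))

    -- 3 + time (m, m + 1) · (m + 8) exceeds every query made in computing f with
    -- precision m + 1 at a point of magnitude m.
    queries : Poly 1
    queries = con 3 :+ (compose p (var zero ∷ (con 1 :+ var zero) ∷ []) :* (con 8 :+ var zero))

    base degree exponent : ℕ
    base     = proj₁ (poly-bound queries)
    degree   = proj₁ (proj₂ (poly-bound queries))
    -- The outer `suc` makes the exponent positive even when `degree` is 0.
    exponent = suc (suc base ℕ.* degree)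

    queries-bound : ∀ m → 2 ℕ.≤ m → ⟦ queries ⟧ (m ∷ []) ℕ.≤ m ℕ.^ exponent
    queries-bound m 2≤m = begin
      ⟦ queries ⟧ (m ∷ [])             ≤⟨ proj₂ (proj₂ (proj₂ (poly-bound queries))) (m ∷ []) m
          (λ { zero → ℕ.≤-refl }) ⟩
      (base ℕ.+ m) ℕ.^ degree          ≤⟨ ℕ.^-monoˡ-≤ degree (k+m≤m^1+k base m 2≤m) ⟩
      (m ℕ.^ suc base) ℕ.^ degree      ≡⟨ ℕ.^-*-assoc m (suc base) degree ⟩
      m ℕ.^ (suc base ℕ.* degree)      ≤⟨ ℕ.^-monoʳ-≤ m {{ℕ.>-nonZero (ℕ.≤-trans (ℕ.s≤s ℕ.z≤n) 2≤m)}}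
          (ℕ.n≤1+n (suc base ℕ.* degree)) ⟩
      m ℕ.^ exponent                   ∎
      where open ℕ.≤-Reasoning

    constant : ℕ
    -- From the case m ≤ 1: there y is at most 4, and both arguments of f are at most 2^m + 1 ≤ 4,
    -- so both values are bounded by `bound 2`. In the case m ≥ 2 the estimate is 2.
    constant = 4 ℕ.* (2 ℕ.* (2 ℕ.^ suc (time 2 0) ℕ.+ 1))

    smooth : Smooth (λ n → n ℕ.^ exponent) f
    smooth = + constant , λ x₁ x₂ y z 1≤y 1≤z m (_ , yz<) small x₁≈x₂ →
      let L  = m ℕ.^ exponent
          u₁ = x₁ * 2^- L
          u₂ = x₂ * 2^- L
          yz≼ = <⇒≼ {y * z} {2^ (suc m)} yz<
          y≼ = ≼-trans {y} {y * z} {2^ (suc m)} (x≼x*y {y} {z} (le 1≤y) (le 1≤z)) yz≼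
          z≼ = ≼-trans {z} {y * z} {2^ (suc m)} (≼-trans {z} {z * y} {y * z} (x≼x*y {z} {y} (le 1≤z) (le 1≤y))
                 (≼-pointwise {z * y} {y * z} (λ n → ℚ.≤-reflexive (ℚ.*-comm (seq z n) (seq y n))))) yz≼
          b₁ = product-bound x₁ L m (≼-trans {fromℤ (+ 4) * ∣ x₁ ∣ * 2^- L} {z} {2^ (suc m)}
              (<⇒≼ {fromℤ (+ 4) * ∣ x₁ ∣ * 2^- L} {z} small) z≼)
          u₁≈u₂ = scale-near x₁ x₂ L x₁≈x₂
      in holds (conclude y (f ⟨$⟩ u₁) (f ⟨$⟩ u₂) m y≼ (close-values u₁ u₂ m b₁ u₁≈u₂ (2 ℕ.≤? m)))
      where
      -- Applied with 4|x|/2^L < z ≤ yz < 2^(m+1): it makes m a bound for the magnitude of the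
      -- argument of f, so the running time there is polynomial in m.
      product-bound : ∀ x L m → fromℤ (+ 4) * ∣ x ∣ * 2^- L ≼ 2^ (suc m) → ∣ x * 2^- L ∣ ≼ 2^ m
      product-bound x L m h = ≼-trans {∣ x * 2^- L ∣} {fromℚ ¼ * (fromℤ (+ 4) * ∣ x ∣ * 2^- L)} {2^ m}
        (≼-pointwise {∣ x * 2^- L ∣} {fromℚ ¼ * (fromℤ (+ 4) * ∣ x ∣ * 2^- L)}
            (λ n → ℚ.≤-reflexive (quarter (seq x n) L)))
        (≼-trans {fromℚ ¼ * (fromℤ (+ 4) * ∣ x ∣ * 2^- L)} {fromℚ (¼ ℚ.* 𝟚^ (suc m))} {2^ m}
          (scale-≼ {fromℤ (+ 4) * ∣ x ∣ * 2^- L} {𝟚^ (suc m)} ¼ (ℚ.<⇒≤ (ℚ.positive⁻¹ ¼)) h)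
          (fromℚ-≼ {¼ ℚ.* 𝟚^ (suc m)} {𝟚^ m} (quarter-𝟚^ m)))

      scale-near : ∀ x₁ x₂ L → ∣ x₁ - x₂ ∣ ≤ fromℤ (+ 1) → x₁ * 2^- L ≈[ ½^ L ] x₂ * 2^- L
      scale-near x₁ x₂ L h = ≈-respˡ {fromℚ (½^ L) * x₁} {x₁ * 2^- L} {x₂ * 2^- L}
          (≅-pointwise {fromℚ (½^ L) * x₁} {x₁ * 2^- L} (λ n → ℚ.*-comm (½^ L) (seq x₁ n)))
        (≈-respʳ {fromℚ (½^ L) * x₁} {fromℚ (½^ L) * x₂} {x₂ * 2^- L}
            (≅-pointwise {fromℚ (½^ L) * x₂} {x₂ * 2^- L} (λ n → ℚ.*-comm (½^ L) (seq x₂ n)))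
          (≈-weaken {fromℚ (½^ L) * x₁} {fromℚ (½^ L) * x₂} {½^ L ℚ.* 1ℚ} {½^ L}
              (ℚ.≤-reflexive (ℚ.*-identityʳ (½^ L)))
            (≈-scale {x₁} {x₂} {1ℚ} (½^ L) (ℚ.<⇒≤ (½^>0 L)) (near h))))

      F : ℚ
      F = bound 2

      0≤F : 0ℚ ℚ.≤ F
      0≤F = ℚ.+-mono-≤ (0≤nat (2 ℕ.^ suc (time 2 0))) (ℚ.<⇒≤ (ℚ.positive⁻¹ 1ℚ))

      Close : ℝ → ℝ → ℕ → Set
      Close v w m = ∃[ r ] (0ℚ ℚ.≤ r) × (𝟚^ (suc m) ℚ.* r ℚ.≤ nat constant) × (v ≈[ r ] w)

      close-values : ∀ u₁ u₂ m → ∣ u₁ ∣ ≼ 2^ m → u₁ ≈[ ½^ (m ℕ.^ exponent) ] u₂ → Dec (2 ℕ.≤ m) → Close (f ⟨$⟩ u₁)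
          (f ⟨$⟩ u₂) m
      -- Precision m + 1 matches y ≤ 2^(m+1): two errors of 2^-(m+1), times y, make 2.
      close-values u₁ u₂ m b₁ u₁≈u₂ (yes 2≤m) = ½^ (suc m) ℚ.+ ½^ (suc m) , ℚ.+-mono-≤ (ℚ.<⇒≤ (½^>0 (suc m)))
          (ℚ.<⇒≤ (½^>0 (suc m))) , two ,
        continuity u₁ u₂ m (suc m) (m ℕ.^ exponent) b₁ u₁≈u₂
            (ℕ.<-≤-trans (ℕ.s≤s (ℕ.≤-trans (ℕ.≤-reflexive (cong suc (ℕ.+-identityʳ _))) (ℕ.n≤1+n _)))
          (subst (ℕ._≤ m ℕ.^ exponent) (cong (λ v → 3 ℕ.+ v ℕ.* (8 ℕ.+ m))
              (compose-eval p (var zero ∷ (con 1 :+ var zero) ∷ []) (m ∷ []))) (queries-bound m 2≤m)))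
        where
        two : 𝟚^ (suc m) ℚ.* (½^ (suc m) ℚ.+ ½^ (suc m)) ℚ.≤ nat constant
        two = ℚ.≤-trans (ℚ.≤-reflexive (trans (ℚ.*-distribˡ-+ (𝟚^ (suc m)) (½^ (suc m)) (½^ (suc m)))
            (cong₂ ℚ._+_ (𝟚^*½^ (suc m)) (𝟚^*½^ (suc m)))))
          (nat-≤ {2} {constant} (ℕ.*-mono-≤ {1} {4} {2} (ℕ.s≤s ℕ.z≤n)
              (ℕ.*-monoʳ-≤ 2 (ℕ.m≤n+m 1 (2 ℕ.^ suc (time 2 0))))))
      close-values u₁ u₂ m b₁ u₁≈u₂ (no 2≰m) = F ℚ.+ F , ℚ.+-mono-≤ 0≤F 0≤F , eight ,
        ∣∣-difference {f ⟨$⟩ u₁} {f ⟨$⟩ u₂} {F} {F} (f-bounded u₁ 2 b₁′) (f-bounded u₂ 2 b₂)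
        where
        m≤1 : m ℕ.≤ 1
        m≤1 = ℕ.≤-pred (ℕ.≰⇒> 2≰m)
        2^m≤2 : 2 ℕ.^ m ℕ.≤ 2
        2^m≤2 = ℕ.^-monoʳ-≤ 2 m≤1
        b₁′ : ∣ u₁ ∣ ≼ 2^ 2
        b₁′ = ≼-trans {∣ u₁ ∣} {2^ m} {2^ 2} b₁ (fromℚ-≼ {𝟚^ m} {𝟚^ 2}
            (nat-≤ {2 ℕ.^ m} {4} (ℕ.≤-trans 2^m≤2 (ℕ.s≤s (ℕ.s≤s ℕ.z≤n)))))
        b₂ : ∣ u₂ ∣ ≼ 2^ 2
        b₂ = ≼-trans {∣ u₂ ∣} {fromℚ (𝟚^ m ℚ.+ ½^ (m ℕ.^ exponent))} {2^ 2}
            (∣∣-shift {u₁} {u₂} {𝟚^ m} {½^ (m ℕ.^ exponent)} b₁ u₁≈u₂)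
          (fromℚ-≼ {𝟚^ m ℚ.+ ½^ (m ℕ.^ exponent)} {𝟚^ 2}
              (ℚ.≤-trans (ℚ.+-mono-≤ (nat-≤ {2 ℕ.^ m} {2} 2^m≤2) (½^≤1 (m ℕ.^ exponent)))
              (nat-≤ {3} {4} (ℕ.n≤1+n 3))))
        eight : 𝟚^ (suc m) ℚ.* (F ℚ.+ F) ℚ.≤ nat constant
        eight = ℚ.≤-trans (ℚ.*-monoʳ-≤-nonNeg (F ℚ.+ F) {{ℚ.nonNegative (ℚ.+-mono-≤ 0≤F 0≤F)}}
            (nat-≤ {2 ℕ.^ suc m} {4} (ℕ.*-monoʳ-≤ 2 2^m≤2)))
          (ℚ.≤-reflexive (trans (cong (nat 4 ℚ.*_) (sym (trans (cong nat (cong (s ℕ.+_) (ℕ.+-identityʳ s)))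
              (trans (nat-+ s s) (cong₂ ℚ._+_ F≡ F≡))))) (sym (nat-* 4 (2 ℕ.* s)))))
          where
          s : ℕ
          s = 2 ℕ.^ suc (time 2 0) ℕ.+ 1
          F≡ : nat s ≡ F
          F≡ = nat-+ (2 ℕ.^ suc (time 2 0)) 1

      conclude : ∀ y v w m → y ≼ 2^ (suc m) → Close v w m → y * ∣ v - w ∣ ≼ fromℤ (+ constant)
      conclude y v w m hy (r , 0≤r , small , v≈w) = ≼-trans {y * ∣ v - w ∣} {fromℚ (𝟚^ (suc m) ℚ.* r)}
          {fromℤ (+ constant)}
        (*-mono-≼ {y} {v - w} {𝟚^ (suc m)} {r} (0≤nat (2 ℕ.^ suc m)) 0≤r hy (le (close v≈w)))
            (fromℚ-≼ {𝟚^ (suc m) ℚ.* r} {nat constant} small)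

-- Polynomial expressions for the costs of the subroutines.

module CostPolynomials where

  open import Defs using (Poly; con; var; _:+_; _:*_; ⟦_⟧)
  open Polynomials
  open Subroutines
  open Multiplication
  open import Data.Fin.Base using (zero; suc)
  open import Data.Nat.Base
  open import Data.Nat.Properties
  open import Data.Vec.Base using ([]; _∷_)
  open import Data.Vec.Relation.Binary.Pointwise.Inductive using ([]; _∷_)
  open import Relation.Binary.PropositionalEquality

  private variable
    d : ℕ

  -- These terms copy the shape of the cost functions literally, so that evaluating a cost
  -- polynomial gives the cost by `refl`. Only powers require an inductive lemma.
  lin : ℕ → Poly d → Poly d
  lin c p = con 1 :+ (p :* con c)

  measureᵖ addᵖ copyᵖ : Poly d → Poly d
  measureᵖ p = lin 6 p :+ lin 4 p
  addᵖ p     = lin 16 p :+ (lin 5 p :+ (lin 5 p :+ lin 4 p))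
  copyᵖ p    = lin 4 p :+ lin 6 p

  mulᵖ timesᵖ formatᵖ : Poly d → Poly d → Poly d
  mulᵖ n l    = con 1 :+ (l :* (con 7 :+ addᵖ n))
  timesᵖ u v  = lin 4 v :+ (con 1 :+ (v :* (con 2 :+ measureᵖ u)))
  formatᵖ b l = lin 7 b :+ (con 2 :+ (con 3 :+ (l :* con 4)))

  stepᵖ : ℕ → Poly d → Poly d → Poly d
  stepᵖ T w S = con 1 :+ (con T :+ (con 3 :+ (con (T * 7) :+ (lin 2 S :+ (lin 2 S :+ copyᵖ w)))))

  powerᵖ : ℕ → Poly d → Poly d
  powerᵖ zero    u = con 2
  powerᵖ (suc e) u = powerᵖ e u :+ timesᵖ u (u :^ e)

  eval-power : ∀ e (u : Poly d) ρ → ⟦ powerᵖ e u ⟧ ρ ≡ powerCost e (⟦ u ⟧ ρ)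
  eval-power zero    u ρ = refl
  eval-power (suc e) u ρ = cong₂ (λ p v → p + timesCost (⟦ u ⟧ ρ) v) (eval-power e u ρ) (eval-^ u e ρ)

  powerCost-mono : ∀ e {u v} → u ≤ v → powerCost e u ≤ powerCost e v
  powerCost-mono e {u} {v} u≤v = subst₂ _≤_ (eval-power e (var zero) (u ∷ [])) (eval-power e (var zero) (v ∷ []))
    (poly-mono (powerᵖ e (var zero)) (u≤v ∷ []))

-- From polytime computability to definability.

module DefinabilityProof where

  open import Defs
  open BinaryDigits
  open Subroutines using (_>>_; powerCost; signGlyph)
  open Words using (wholePart; fracPart; wholeBits; neg)
  open Simulating using (finite-Extra)
  open RealAlgorithm using (magnitude; prefix-word)
  open IntegerAlgorithm
  open DyadicValues
  open RealDistance
  open Approximation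
  open Polynomials
  open CostPolynomials
  open Halting using (halts-later; halted-output)
  open TapeGrowth
  open Smoothness
  open import Data.Fin.Base using (zero; suc)
  open import Data.Fin.Patterns
  open import Data.Integer.Base as ℤ using (ℤ; +_)
  import Data.Integer.Properties as ℤ
  open import Data.List.Base as List using ([]; _∷_; length)
  open import Data.List.Properties using (length-map)
  open import Data.Nat.Base as ℕ using (ℕ; zero; suc)
  import Data.Nat.Properties as ℕ
  open import Data.Product.Base using (∃-syntax; _×_; _,_; proj₁; proj₂)
  open import Data.Rational.Base as ℚ using (ℚ; 1ℚ; ½)
  import Data.Rational.Properties as ℚ
  open import Data.Unit.Base using (tt)
  open import Data.Vec.Base as Vec using (Vec; []; _∷_)
  open import Data.Vec.Relation.Binary.Pointwise.Inductive using ([]; _∷_)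
  open import Function.Base using (_∘_)
  open import Function.Bundles using (Func; _⟨$⟩_)
  open import Relation.Nullary.Decidable using (toWitness)
  open import Relation.Nullary.Negation using (contradiction)
  open import Relation.Unary using (Pred)
  open import Relation.Binary.PropositionalEquality using (_≡_; refl; sym; trans; cong; subst)

  >>≤ : ∀ m j → m >> j ℕ.≤ m
  >>≤ m j = Data.Nat.DivMod.m/n≤m m (2 ℕ.^ j) {{ℕ.m^n≢0 2 j}}
    where import Data.Nat.DivMod

  digits-length-mono : ∀ {m n} → m ℕ.≤ n → length (digits m) ℕ.≤ length (digits n)
  digits-length-mono {m} {n} m≤n = digits-length m (length (digits n)) (ℕ.≤-<-trans m≤n (digits-upper n))

  scaled-length : ∀ d y → length (digits ((y ℕ.* significand d) >> length (fracPart d))) ℕ.≤ length (digits y) ℕ.+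
      magnitude d
  scaled-length d y = digits-length _ _ (ℕ.≤-<-trans (nat-≤⁻¹ below) (ℕ.<-≤-trans
      (ℕ.*-monoˡ-< (2 ℕ.^ magnitude d) {{ℕ.m^n≢0 2 (magnitude d)}} (digits-upper y))
          (ℕ.≤-reflexive (sym (ℕ.^-distribˡ-+-* 2 (length (digits y)) (magnitude d))))))
    where
    F p : ℕ
    F = length (fracPart d)
    p = y ℕ.* significand d
    below : nat (p >> F) ℚ.≤ nat (y ℕ.* 2 ℕ.^ magnitude d)
    below = ℚ.≤-trans (subst (ℚ._≤ nat (p >> F) ℚ.+ fraction (frac F p)) (ℚ.+-identityʳ (nat (p >> F)))
        (ℚ.+-monoʳ-≤ (nat (p >> F)) (0≤fraction (frac F p))))
      (ℚ.≤-trans (ℚ.≤-reflexive (trans (sym (>>-fraction p F)) (trans (cong (ℚ._* ½^ F) (nat-* y (significand d)))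
        (trans (ℚ.*-assoc (nat y) (nat (significand d)) (½^ F)) (cong (nat y ℚ.*_) (significand-size d))))))
      (ℚ.≤-trans (ℚ.*-monoˡ-≤-nonNeg (nat y) {{ℚ.nonNegative (0≤nat y)}} (ℚ.<⇒≤ (size<𝟚^ d)))
          (ℚ.≤-reflexive (sym (nat-* y (2 ℕ.^ magnitude d))))))

  log₂-unique : ∀ n m → 2 ℕ.^ m ℕ.≤ n → n ℕ.< 2 ℕ.^ suc m → m ≡ ⌊log₂ n ⌋
  log₂-unique n m lower upper with digits n in eq
  ... | []    = contradiction (ℕ.≤-trans lower (ℕ.≤-reflexive (trans (sym (value-digits n)) (cong value eq))))
      (ℕ.<⇒≱ (ℕ.m^n>0 2 m))
  ... | b ∷ w = ℕ.≤-antisym (ℕ.≤-pred (exponent-<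
      (ℕ.≤-<-trans lower (subst (λ v → n ℕ.< 2 ℕ.^ length v) eq (digits-upper n)))))
                            (ℕ.≤-pred (exponent-< (ℕ.≤-<-trans (digits-lower n b w eq) upper)))
    where
    exponent-< : ∀ {i j} → 2 ℕ.^ i ℕ.< 2 ℕ.^ j → i ℕ.< j
    exponent-< lt = ℕ.≰⇒> (λ j≤i → ℕ.<-irrefl refl (ℕ.<-≤-trans lt (ℕ.^-monoʳ-≤ 2 j≤i)))

  -- Both sides are constant sequences, so the inequalities descend to rationals: the weak one by
  -- `≤-archimedean`, the strict one because it comes with a gap.
  floorLog₂-ℕ : ∀ y z m → IsFloorLog₂ (fromℤ (+ y) * fromℤ (+ z)) m → m ≡ ⌊log₂ y ℕ.* z ⌋
  floorLog₂-ℕ y z m (lower , ε , 0<ε , j , upper) = log₂-unique (y ℕ.* z) m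
    (nat-≤⁻¹ (subst (𝟚^ m ℚ.≤_) (sym (nat-* y z)) (≤-archimedean {𝟚^ m} {nat y ℚ.* nat z} (λ δ 0<δ → let i , h = lower δ 0<δ in h i ℕ.≤-refl))))
    (nat-<⁻¹ (subst (ℚ._< 𝟚^ (suc m)) (sym (nat-* y z))
        (ℚ.<-≤-trans (subst (ℚ._< nat y ℚ.* nat z ℚ.+ ε) (ℚ.+-identityʳ (nat y ℚ.* nat z))
        (ℚ.+-monoʳ-< (nat y ℚ.* nat z) 0<ε)) (upper j ℕ.≤-refl))))

  -- 1/4 + 1 + 1/2 ≤ 2, for the approximation of g, its rounding, and the error of f.
  errors-add : ∀ {g̃ u v} (i : ℤ) (q : ℚ) (y : ℕ) {e} → g̃ ≈[ ¼ ] fromℚ (ι i) → ℚ.∣ ι i ℚ.- nat y ℚ.* q ∣ ℚ.≤ 1ℚ →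
    fromℚ q ≈[ e ] u → u ≅ v → nat y ℚ.* e ℚ.≤ ½ → g̃ ≈[ nat 2 ] fromℚ (nat y) * v
  errors-add {g̃} {u} {v} i q y {e} h₁ h₂ h₃ u≅v small = generic (fromℚ (nat y) * fromℚ q) (fromℚ (nat y) * v)
    (≅-pointwise {fromℚ (nat y ℚ.* q)} {fromℚ (nat y) * fromℚ q} (λ _ → refl))
    (≈-scale {fromℚ q} {v} {e} (nat y) (0≤nat y) (≈-respʳ {fromℚ q} {u} {v} u≅v h₃))
    where
    generic : ∀ a b → fromℚ (nat y ℚ.* q) ≅ a → a ≈[ nat y ℚ.* e ] b → g̃ ≈[ nat 2 ] b
    generic a b eq h = ≈-weaken {g̃} {b} {(¼ ℚ.+ 1ℚ) ℚ.+ nat y ℚ.* e} {nat 2}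
      (ℚ.≤-trans (ℚ.+-monoʳ-≤ (¼ ℚ.+ 1ℚ) small) (toWitness {a? = (¼ ℚ.+ 1ℚ) ℚ.+ ½ ℚ.≤? nat 2} tt))
      (≈-trans {g̃} {a} {b} {¼ ℚ.+ 1ℚ} {nat y ℚ.* e}
        (≈-respʳ {g̃} {fromℚ (nat y ℚ.* q)} {a} eq (≈-trans {g̃} {fromℚ (ι i)} {fromℚ (nat y ℚ.* q)} {¼} {1ℚ} h₁
            (≈-fromℚ {ι i} {nat y ℚ.* q} {1ℚ} h₂))) h)

  module Definability (f : ℝ→ℝ) (M : Machine oracle) (computes : Computes M f) (p : Poly 2) (runs : RunsInTime M p) (K : ℕ) where
    open Machine M using (work)
    open Continuity f M computes p runs using (time; halts)

    c₂ e₂ : ℕ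
    c₂ = proj₁ (poly-bound p)
    e₂ = proj₁ (proj₂ (poly-bound p))

    open IntegerProgram M K c₂ e₂
    open StackPrograms.Compile finite-Extra program using (machine; compiled)

    module _ (x y z : ℤ) where

      φ : ℕ → 𝔻
      φ _ = point-x x y z

      φ-CF : CF (from𝔻 (point-x x y z)) φ
      φ-CF n = close (≈-fromℚ {v} {v} {½^ n} (ℚ.≤-trans (ℚ.≤-reflexive (cong ℚ.∣_∣ (ℚ.+-inverseʳ v)))
          (ℚ.<⇒≤ (½^>0 n))))
        where
        v : ℚ
        v = value𝔻 (point-x x y z)

      n : ℕ
      -- The input length serves as precision and as magnitude bound at once: |x / 2^E| ≤ 2^n and y
      -- 2^-n ≤ 1/2.
      n = N x y z

      result : 𝔻
      result = proj₁ (computes (from𝔻 (point-x x y z)) φ φ-CF n)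

      shown≤N : shown x ℕ.≤ n × shown y ℕ.≤ n × shown z ℕ.≤ n
      shown≤N = subst (λ l → shown x ℕ.≤ l × shown y ℕ.≤ l × shown z ℕ.≤ l) (sym (length-input x y z))
        ( ℕ.≤-trans (shown≤word x) (ℕ.m≤m+n _ _)
        , ℕ.≤-trans (shown≤word y) (ℕ.≤-trans (ℕ.m≤m+n _ _) (ℕ.≤-trans (ℕ.n≤1+n _) (ℕ.m≤n+m _ (length (wordℤ x)))))
        , ℕ.≤-trans (shown≤word z) (ℕ.≤-trans (ℕ.m≤m+n _ 1)
            (ℕ.≤-trans (ℕ.n≤1+n _) (ℕ.≤-trans (ℕ.m≤n+m _ (length (wordℤ y)))
            (ℕ.≤-trans (ℕ.n≤1+n _) (ℕ.m≤n+m _ (length (wordℤ x))))))) )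

      x-length : length (digits ℤ.∣ x ∣) ℕ.≤ n
      x-length = ℕ.≤-trans (length-show (digits ℤ.∣ x ∣)) (proj₁ shown≤N)

      bounded : ∣ from𝔻 (point-x x y z) ∣ ≼ 2^ n
      bounded = ∣fromℚ∣-≼ {𝟚^ n} {value𝔻 (point-x x y z)} (subst (ℚ._≤ 𝟚^ n) (sym (∣value∣ (point-x x y z)))
        (ℚ.≤-trans (ℚ.<⇒≤ (size<𝟚^ (point-x x y z))) (nat-≤
            (ℕ.^-monoʳ-≤ 2 (ℕ.≤-trans (digits-length-mono (>>≤ ℤ.∣ x ∣ (E x y z))) x-length)))))

      halted : HaltsWithin M (O x y z) (unary n) (clock x y z)
      halted = halts-later M (O x y z) (proj₂ (proj₂ (proj₂ (poly-bound p))) (n ∷ n ∷ []) n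
          (λ { zero → ℕ.≤-refl ; (suc zero) → ℕ.≤-refl }))
        (halts (from𝔻 (point-x x y z)) φ φ-CF n n bounded)

      result-output : output M (O x y z) (final x y z) ≡ word𝔻 result
      result-output = halted-output M (O x y z) {w = unary n} {t = clock x y z}
          (proj₁ (proj₂ (computes (from𝔻 (point-x x y z)) φ φ-CF n))) halted

      result-length : length (word𝔻 result) ℕ.≤ suc (clock x y z)
      result-length = subst (λ w → length w ℕ.≤ suc (clock x y z)) result-output
          (TapeSizes.output-length M (O x y z) (clock x y z) (unary n))

      product-length : length (digits (ℤ.∣ y ∣ ℕ.* ℤ.∣ z ∣)) ℕ.≤ n
      product-length = digits-length _ n (ℕ.≤-<-trans
          (ℕ.≤-trans (ℕ.≤-reflexive (ℕ.*-comm ℤ.∣ y ∣ ℤ.∣ z ∣)) (ℕ.*-monoˡ-≤ ℤ.∣ y ∣ (ℕ.<⇒≤ (suc≤2^shown ℤ.∣ z ∣))))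
          (product-fits x y z))

      m≤n : m x y z ℕ.≤ n
      m≤n = ℕ.≤-trans ℕ.pred[n]≤n product-length

      answer-length : length (answer x y z) ℕ.≤ 3 ℕ.+ (n ℕ.+ n ℕ.^ K)
      answer-length = begin
        length (answer x y z)                                   ≡⟨ word𝔻-length (point-x x y z) ⟩
        length (signGlyph (neg x)) ℕ.+ (length (wholeBits (point-x x y z)) ℕ.+ suc
            (length (fracPart (point-x x y z)))) ≤⟨
          ℕ.+-mono-≤ (length-signGlyph (neg x)) (ℕ.+-mono-≤
              (ℕ.≤-trans (length-show≤ (digits (wholePart (point-x x y z))))
              (ℕ.s≤s (ℕ.≤-trans (digits-length-mono (>>≤ ℤ.∣ x ∣ (E x y z))) x-length)))
            (ℕ.s≤s (ℕ.≤-trans (length-frac (E x y z) ℤ.∣ x ∣) (ℕ.^-monoˡ-≤ K m≤n)))) ⟩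
        1 ℕ.+ (suc n ℕ.+ suc (n ℕ.^ K))                         ≡⟨ cong (λ v → suc (suc v)) (ℕ.+-suc n (n ℕ.^ K)) ⟩
        3 ℕ.+ (n ℕ.+ n ℕ.^ K)                                   ∎
        where
        open ℕ.≤-Reasoning

      written≤ : written x y z (final x y z) ℕ.≤ suc (clock x y z)
      written≤ = ℕ.≤-trans (written-size (final x y z))
          (ℕ.s≤s (ℕ.≤-trans (TapeSizes.run-outputSize M (O x y z) (clock x y z) (initial M (O x y z) (unary n)))
          (ℕ.≤-reflexive (ℕ.+-identityʳ _))))
        where
        written-size : ∀ cfg → written x y z cfg ℕ.≤ suc (TapeSizes.outputSize M (O x y z) cfg)
        written-size (config _ (_ ∷ t ∷ _)) = ℕ.s≤s (ℕ.≤-trans (ℕ.≤-reflexive (length-map _ (Tape.after t)))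
            (ℕ.m≤n+m _ _))

      -- All lengths, costs of powers and numbers on which the cost depends, as arguments of one
      -- polynomial; each is then bounded on its own by a polynomial in the input length.
      quantities : Vec ℕ 16
      quantities = n ∷ shown x ∷ shown y ∷ shown z ∷ length (digits (ℤ.∣ y ∣ ℕ.* ℤ.∣ z ∣)) ∷ powerCost K (m x y z) ∷ E
          x y z
        ∷ length (digits (ℤ.∣ x ∣ >> E x y z)) ∷ m x y z ∷ powerCost e₂ (c₂ ℕ.+ n) ∷ clock x y z ∷ length
            (answer x y z)
        ∷ written x y z (final x y z) ∷ length (wholeBits result) ∷ length (fracPart result)
        ∷ length (digits ((ℤ.∣ y ∣ ℕ.* significand result) >> length (fracPart result))) ∷ []

    readᵖ prepareᵖ simulateᵖ writeᵖ totalᵖ : Poly 16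
    readᵖ = measureᵖ (var 0F) :+ ((con 4 :+ (lin 5 (var 1F) :+ con 1)) :+
        ((con 4 :+ (lin 5 (var 2F) :+ con 1)) :+ (con 3
      :+ (con 4 :+ (con 3 :+ (mulᵖ (var 0F) (var 3F) :+ lin 2 (var 3F)))))))
    prepareᵖ = (lin 4 (var 4F) :+ con 1) :+ (var 5F :+ (formatᵖ (var 6F) (var 7F) :+ (con 5 :+ (measureᵖ (var 0F)
      :+ ((lin 2 (var 8F) :+ (measureᵖ (var 0F) :+ (con (c₂ ℕ.* 2) :+ (var 9F :+ lin 4 (var (suc 9F)))))) :+
          (con 2 :+ con ((2 ℕ.+ work) ℕ.* 2)))))))
    simulateᵖ = con 1 :+ (var (suc 9F) :* (con 2 :+ stepᵖ (3 ℕ.+ work) (var (suc (suc 9F)))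
        (con 1 :+ (var (suc (suc 9F)) :+ var (suc 9F)))))
    writeᵖ = measureᵖ wr :+ (con 4 :+ (mulᵖ (wr :+ var 0F) W :+
        (lin 2 W :+ (con 1 :+ (mulᵖ (wr :+ var 0F) F :+ (lin 3 F :+ (con 7 :+ (lp :* con 4))))))))
      where
      wr W F lp : Poly 16
      wr = var (suc (suc (suc 9F)))
      W  = var (suc (suc (suc (suc 9F))))
      F  = var (suc (suc (suc (suc (suc 9F)))))
      lp = var (suc (suc (suc (suc (suc (suc 9F))))))
    totalᵖ = readᵖ :+ (prepareᵖ :+ (simulateᵖ :+ writeᵖ))

    total-cost : ∀ x y z → programCost x y z (result x y z) ≡ ⟦ totalᵖ ⟧ (quantities x y z)
    total-cost x y z = refl

    clockᵖ : Poly 1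
    clockᵖ = (con c₂ :+ var 0F) :^ e₂

    bounds : Vec (Poly 1) 16
    bounds = v ∷ v ∷ v ∷ v ∷ v ∷ powerᵖ K v ∷ v :^ K ∷ v ∷ v ∷ powerᵖ e₂ (con c₂ :+ v) ∷ clockᵖ ∷
        (con 3 :+ (v :+ (v :^ K)))
      ∷ (con 1 :+ clockᵖ) ∷ (con 1 :+ clockᵖ) ∷ (con 1 :+ clockᵖ) ∷ (v :+ (con 1 :+ clockᵖ)) ∷ []
      where
      v : Poly 1
      v = var 0F

    inputᵖ : Poly 3
    inputᵖ = var 0F :+ (con 1 :+ (var 1F :+ (con 1 :+ (var 2F :+ con 1))))

    -- Composed of three layers: the cost in terms of the quantities, these in terms of the input
    -- length, and that in terms of the lengths of the three arguments.
    timeᵖ : Poly 3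
    timeᵖ = compose (compose totalᵖ bounds) (inputᵖ ∷ [])

    cost-bound : ∀ x y z → programCost x y z (result x y z) ℕ.≤ ⟦ timeᵖ ⟧ (Vec.map (length ∘ wordℤ) (x ∷ y ∷ z ∷ []))
    cost-bound x y z = ℕ.≤-trans (ℕ.≤-reflexive (total-cost x y z))
        (ℕ.≤-trans (≤-compose totalᵖ bounds (n x y z ∷ []) {quantities x y z}
        ( ℕ.≤-refl ∷ proj₁ sh ∷ proj₁ (proj₂ sh) ∷ proj₂ (proj₂ sh) ∷ product-length x y z
        ∷ subst (powerCost K (m x y z) ℕ.≤_) (sym (eval-power K (var 0F) (n x y z ∷ [])))
            (powerCost-mono K (m≤n x y z))
        ∷ subst (E x y z ℕ.≤_) (sym (eval-^ (var 0F) K (n x y z ∷ []))) (ℕ.^-monoˡ-≤ K (m≤n x y z))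
        ∷ ℕ.≤-trans (digits-length-mono (>>≤ ℤ.∣ x ∣ (E x y z))) (x-length x y z) ∷ m≤n x y z
        ∷ ℕ.≤-reflexive (sym (eval-power e₂ (con c₂ :+ var 0F) (n x y z ∷ []))) ∷ ℕ.≤-reflexive (sym clock≡)
        ∷ subst (λ v → length (answer x y z) ℕ.≤ 3 ℕ.+ (n x y z ℕ.+ v)) (sym (eval-^ (var 0F) K (n x y z ∷ [])))
            (answer-length x y z)
        ∷ clocked (written≤ x y z) ∷ clocked (ℕ.≤-trans (ℕ.≤-trans (ℕ.m≤m+n _ _) (wholeBits+frac≤word r))
            (result-length x y z))
        ∷ clocked (ℕ.≤-trans (ℕ.≤-trans (ℕ.m≤n+m _ (length (wholeBits r))) (wholeBits+frac≤word r))
            (result-length x y z))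
        ∷ ℕ.≤-trans (scaled-length r ℤ.∣ y ∣) (ℕ.+-mono-≤
            (ℕ.≤-trans (length-show (digits ℤ.∣ y ∣)) (proj₁ (proj₂ sh)))
            (clocked (ℕ.≤-trans (length-show (digits (wholePart r)))
                (ℕ.≤-trans (ℕ.≤-trans (ℕ.m≤m+n _ _) (wholeBits+frac≤word r)) (result-length x y z)))))
        ∷ []))
      (≤-compose (compose totalᵖ bounds) (inputᵖ ∷ []) (Vec.map (length ∘ wordℤ) (x ∷ y ∷ z ∷ [])) {n x y z ∷ []}
          (ℕ.≤-reflexive (length-input x y z) ∷ [])))
      where
      sh = shown≤N x y z
      r = result x y z
      clock≡ : ⟦ clockᵖ ⟧ (n x y z ∷ []) ≡ clock x y z
      clock≡ = eval-^ (con c₂ :+ var 0F) e₂ (n x y z ∷ [])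
      clocked : ∀ {l} → l ℕ.≤ suc (clock x y z) → l ℕ.≤ suc (⟦ clockᵖ ⟧ (n x y z ∷ []))
      clocked {l} = subst (λ v → l ℕ.≤ suc v) (sym clock≡)

    g : Vec ℤ 3 → ℤ
    g (x ∷ y ∷ z ∷ []) = scaledFloor (result x y z) ℤ.∣ y ∣

    g-polytime : PolytimeComputableℤ g
    g-polytime = machine , outputs , timeᵖ , halting
      where
      outputs : ∀ is → Outputs machine tt (wordsℤ is) (wordℤ (g is))
      outputs (x ∷ y ∷ z ∷ []) = let s , r , e = program-run x y z (result x y z) (result-output x y z) in
        subst (Outputs machine tt (wordsℤ (x ∷ y ∷ z ∷ [])))
            (trans (cong StackPrograms.prefix e) (prefix-word (wordℤ (g (x ∷ y ∷ z ∷ []))))) (proj₂ (compiled tt r))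
      halting : ∀ is → HaltsWithin machine tt (wordsℤ is) (⟦ timeᵖ ⟧ (Vec.map (length ∘ wordℤ) is))
      halting (x ∷ y ∷ z ∷ []) = let s , r , e = program-run x y z (result x y z) (result-output x y z) in
        proj₁ (compiled tt r) (⟦ timeᵖ ⟧ (Vec.map (length ∘ wordℤ) (x ∷ y ∷ z ∷ []))) (cost-bound x y z)

    -- The input contains y and at least one comma, so n exceeds the number of digits of y and 2y ≤
    -- 2^n.
    precise : ∀ x y z → nat ℤ.∣ y ∣ ℚ.* ½^ (n x y z) ℚ.≤ ½
    precise x y z = ℚ.≤-trans (ℚ.≤-reflexive (sym (double-half′ (nat v ℚ.* ½^ k))))
      (ℚ.≤-trans (ℚ.*-monoˡ-≤-nonNeg ½ (ℚ.≤-trans (ℚ.≤-reflexive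
          (trans (sym (ℚ.*-assoc (nat 2) (nat v) (½^ k))) (cong (ℚ._* ½^ k) (sym (nat-* 2 v)))))
        (ℚ.≤-trans (ℚ.*-monoʳ-≤-nonNeg (½^ k) {{½^-nonNeg k}} (nat-≤ {2 ℕ.* v} {2 ℕ.^ k} 2v≤2^k))
            (ℚ.≤-reflexive (𝟚^*½^ k)))))
        (ℚ.≤-reflexive (ℚ.*-identityʳ ½)))
      where
      v k : ℕ
      v = ℤ.∣ y ∣
      k = n x y z
      double-half′ : ∀ p → ½ ℚ.* (nat 2 ℚ.* p) ≡ p
      double-half′ p = trans (sym (ℚ.*-assoc ½ (nat 2) p)) (ℚ.*-identityˡ p)
      1+shown≤k : suc (shown y) ℕ.≤ k
      1+shown≤k = ℕ.≤-trans (ℕ.s≤s (shown≤word y)) (ℕ.≤-trans (ℕ.s≤s (ℕ.m≤m+n _ _))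
          (ℕ.≤-trans (ℕ.m≤n+m _ (length (wordℤ x))) (ℕ.≤-reflexive (sym (length-input x y z)))))
      2v≤2^k : 2 ℕ.* v ℕ.≤ 2 ℕ.^ k
      2v≤2^k = ℕ.≤-trans (ℕ.*-monoʳ-≤ 2 (ℕ.<⇒≤ (suc≤2^shown v))) (ℕ.^-monoʳ-≤ 2 1+shown≤k)

    definable : ∀ {ℓ} (C : Pred (ℝ^ 3 →ℝ) ℓ) → PeacefullyApproximates C PolytimeComputableℤ → Definable
        (λ n → n ℕ.^ K) C f
    definable C approximates = let g̃ , (Cg̃ , peaceful) , g̃≈g = approximates g g-polytime in g̃ , Cg̃ , peaceful , defines g̃ g̃≈g
      where
      defines : ∀ g̃ → (∀ is → ∣ (g̃ ⟨$⟩ Vec.map fromℤ is) - fromℤ (g is) ∣ ≤ fromℚ (+ 1 ℚ./ 4)) → ∀ (x y z : ℤ) →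
          ℤ.1ℤ ℤ.≤ y → ℤ.1ℤ ℤ.≤ z → ∀ m → IsFloorLog₂ (fromℤ y * fromℤ z) m →
        fromℤ (+ 4) * ∣ fromℤ x ∣ * 2^- (m ℕ.^ K) < fromℤ z →
        ∣ (g̃ ⟨$⟩ (fromℤ x ∷ fromℤ y ∷ fromℤ z ∷ [])) - fromℤ y * (f ⟨$⟩ (fromℤ x * 2^- (m ℕ.^ K))) ∣ ≤ fromℤ (+ 2)
      defines g̃ g̃≈g x (+ y) (+ z) _ _ m log _ = subst
          (λ m → ∣ (g̃ ⟨$⟩ (fromℤ x ∷ fromℤ (+ y) ∷ fromℤ (+ z) ∷ [])) - fromℤ (+ y) *
          (f ⟨$⟩ (fromℤ x * 2^- (m ℕ.^ K))) ∣ ≤ fromℤ (+ 2))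
          (sym (floorLog₂-ℕ y z m log)) (close total)
        where
        q d : 𝔻
        q = point-x x (+ y) (+ z)
        d = result x (+ y) (+ z)
        step₁ : (g̃ ⟨$⟩ (fromℤ x ∷ fromℤ (+ y) ∷ fromℤ (+ z) ∷ [])) ≈[ ¼ ] fromℚ (ι (scaledFloor d y))
        step₁ = near (g̃≈g (x ∷ + y ∷ + z ∷ []))
        step₂ : fromℚ (value𝔻 d) ≈[ ½^ (n x (+ y) (+ z)) ] (f ⟨$⟩ from𝔻 q)
        step₂ = near (proj₂ (proj₂ (computes (from𝔻 q) (φ x (+ y) (+ z)) (φ-CF x (+ y) (+ z)) (n x (+ y) (+ z)))))
        step₃ : (f ⟨$⟩ from𝔻 q) ≅ (f ⟨$⟩ (fromℤ x * 2^- (⌊log₂ y ℕ.* z ⌋ ℕ.^ K)))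
        step₃ = same (Func.cong f {from𝔻 q} {fromℤ x * 2^- (⌊log₂ y ℕ.* z ⌋ ℕ.^ K)}
            (equal (≅-pointwise {from𝔻 q} {fromℤ x * 2^- (⌊log₂ y ℕ.* z ⌋ ℕ.^ K)} (λ _ → refl))))
        total : (g̃ ⟨$⟩ (fromℤ x ∷ fromℤ (+ y) ∷ fromℤ (+ z) ∷ [])) ≈[ nat 2 ] fromℚ (nat y) *
            (f ⟨$⟩ (fromℤ x * 2^- (⌊log₂ y ℕ.* z ⌋ ℕ.^ K)))
        total = errors-add {g̃ ⟨$⟩ (fromℤ x ∷ fromℤ (+ y) ∷ fromℤ (+ z) ∷ [])} {f ⟨$⟩ from𝔻 q}
            {f ⟨$⟩ (fromℤ x * 2^- (⌊log₂ y ℕ.* z ⌋ ℕ.^ K))}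
          (scaledFloor d y) (value𝔻 d) y {½^ (n x (+ y) (+ z))} step₁ (scaledFloor-close d y) step₂ step₃
              (precise x (+ y) (+ z))

-- Error of the answer computed from definability and smoothness.

module ErrorEstimate where

  open import Defs hiding (Poly; con; var; _:+_; _:*_; ⟦_⟧)
  open BinaryDigits
  open Subroutines using (signed)
  open Words using (negative)
  open RealAlgorithm using (magnitude; truncated)
  open DyadicValues
  open RealDistance
  open Approximation
  open import Data.Integer.Base as ℤ using (ℤ; +_)
  import Data.Integer.Properties as ℤ
  open import Data.Nat.Base as ℕ using (ℕ; zero; suc)
  import Data.Nat.Properties as ℕ
  open import Data.Nat.Tactic.RingSolver using (solve-∀)
  open import Data.Product.Base using (∃-syntax; _,_)
  open import Data.Rational.Base as ℚ using (ℚ; 1ℚ)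
  import Data.Rational.Properties as ℚ
  open import Data.Rational.Solver using (module +-*-Solver)
  open import Data.Vec.Base as Vec using ([]; _∷_)
  open import Function.Bundles using (Func; _⟨$⟩_)
  open import Relation.Binary.PropositionalEquality using (_≡_; refl; sym; trans; cong; cong₂; subst; subst₂)

  constant-< : ∀ {x y p q} → (∀ n → seq x n ≡ p) → (∀ n → seq y n ≡ q) → p ℚ.< q → x < y
  constant-< {x} {y} {p} {q} hx hy p<q = q ℚ.- p , subst (ℚ._< q ℚ.- p) (ℚ.+-inverseʳ p) (ℚ.+-monoˡ-< (ℚ.- p) p<q) , 0
      ,
    λ n _ → ℚ.≤-reflexive (trans (cong (ℚ._+ (q ℚ.- p)) (hx n))
        (trans (solve 2 (λ p q → p :+ (q :- p) := q) refl p q) (sym (hy n))))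
    where open +-*-Solver

  -- Before division by y = 2^b the errors are 1 for the integer approximation of g, 2 for g against
  -- y f, and S for each of two uses of smoothness.
  combine : ∀ {G v₁ v₂ v₃ v : ℝ} (H : ℤ) b S → fromℚ (ι H) ≈[ 1ℚ ] G → G ≈[ nat 2 ] fromℚ (𝟚^ b) * v₁ →
    fromℚ (𝟚^ b) * ∣ v₁ - v₂ ∣ ≼ fromℚ S → fromℚ (𝟚^ b) * ∣ v₂ - v₃ ∣ ≼ fromℚ S → v₃ ≅ v →
    fromℚ (ι H ℚ.* ½^ b) ≈[ ½^ b ℚ.* (1ℚ ℚ.+ nat 2 ℚ.+ S ℚ.+ S) ] v
  combine {G} {v₁} {v₂} {v₃} {v} H b S h₁ h₂ s₁ s₂ v₃≅v =
    generic (fromℚ (½^ b) * fromℚ (ι H)) (fromℚ (½^ b) * (fromℚ (𝟚^ b) * v₃))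
      (≅-pointwise {fromℚ (½^ b) * fromℚ (ι H)} {fromℚ (ι H ℚ.* ½^ b)} (λ _ → ℚ.*-comm (½^ b) (ι H)))
      (≅-pointwise {fromℚ (½^ b) * (fromℚ (𝟚^ b) * v₃)} {v₃}
          (λ n → trans (sym (ℚ.*-assoc (½^ b) (𝟚^ b) (seq v₃ n)))
          (trans (cong (ℚ._* seq v₃ n) (½^*𝟚^ b)) (ℚ.*-identityˡ (seq v₃ n)))))
      (≈-scale {fromℚ (ι H)} {fromℚ (𝟚^ b) * v₃} {1ℚ ℚ.+ nat 2 ℚ.+ S ℚ.+ S} (½^ b) (ℚ.<⇒≤ (½^>0 b))
          (sum (fromℚ (𝟚^ b) * v₁) (fromℚ (𝟚^ b) * v₂) (fromℚ (𝟚^ b) * v₃) h₂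
          (scaled⇒≈ {v₁} {v₂} {S} (𝟚^ b) (0≤nat (2 ℕ.^ b)) s₁) (scaled⇒≈ {v₂} {v₃} {S} (𝟚^ b) (0≤nat (2 ℕ.^ b)) s₂)))
    where
    sum : ∀ w₁ w₂ w₃ → G ≈[ nat 2 ] w₁ → w₁ ≈[ S ] w₂ → w₂ ≈[ S ] w₃ → fromℚ (ι H) ≈[ 1ℚ ℚ.+ nat 2 ℚ.+ S ℚ.+ S ] w₃
    sum w₁ w₂ w₃ a₁ a₂ a₃ = ≈-trans {fromℚ (ι H)} {w₂} {w₃} {1ℚ ℚ.+ nat 2 ℚ.+ S} {S}
        (≈-trans {fromℚ (ι H)} {w₁} {w₂} {1ℚ ℚ.+ nat 2} {S} (≈-trans {fromℚ (ι H)} {G} {w₁} {1ℚ} {nat 2} h₁ a₁) a₂) a₃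
    generic : ∀ l r {e} → l ≅ fromℚ (ι H ℚ.* ½^ b) → r ≅ v₃ → l ≈[ e ] r → fromℚ (ι H ℚ.* ½^ b) ≈[ e ] v
    generic l r {e} l≅ r≅ h = ≈-respʳ {fromℚ (ι H ℚ.* ½^ b)} {v₃} {v} {e} v₃≅v
        (≈-respʳ {fromℚ (ι H ℚ.* ½^ b)} {r} {v₃} {e} r≅ (≈-respˡ {l} {fromℚ (ι H ℚ.* ½^ b)} {r} {e} l≅ h))

  module Estimate (T : ℕ → ℕ) (f : ℝ→ℝ) (g : ℝ^ 3 →ℝ)
    (defines : ∀ (x y z : ℤ) → ℤ.1ℤ ℤ.≤ y → ℤ.1ℤ ℤ.≤ z → ∀ m → IsFloorLog₂ (fromℤ y * fromℤ z) m →
       fromℤ (+ 4) * ∣ fromℤ x ∣ * 2^- (T m) < fromℤ z →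
       ∣ (g ⟨$⟩ (fromℤ x ∷ fromℤ y ∷ fromℤ z ∷ [])) - fromℤ y * (f ⟨$⟩ (fromℤ x * 2^- (T m))) ∣ ≤ fromℤ (+ 2))
    (S : ℤ)
    (smooth : ∀ x₁ x₂ y z → fromℤ (+ 1) ≤ y → fromℤ (+ 1) ≤ z → ∀ m → IsFloorLog₂ (y * z) m →
       fromℤ (+ 4) * ∣ x₁ ∣ * 2^- (T m) < z → ∣ x₁ - x₂ ∣ ≤ fromℤ (+ 1) →
       y * ∣ (f ⟨$⟩ (x₁ * 2^- (T m))) - (f ⟨$⟩ (x₂ * 2^- (T m))) ∣ ≤ fromℤ S)
    where

    module _ (x : ℝ) (φ : ℕ → 𝔻) (cf : CF x φ) (b : ℕ) where

      a m : ℕ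
      a = 4 ℕ.+ magnitude (φ 0)
      m = b ℕ.+ a

      d : 𝔻
      d = φ (T m)

      X : ℤ
      X = signed (negative d) (truncated d (T m))

      y z : ℤ
      y = + (2 ℕ.^ b)
      z = + (2 ℕ.^ a)

      -- For powers of two the logarithm is the sum of the exponents, so the machine has m as b + a
      -- without computing it from the product.
      logarithm : IsFloorLog₂ (fromℤ y * fromℤ z) m
      logarithm = holds (≼-pointwise {2^ m} {fromℤ y * fromℤ z} (λ _ → ℚ.≤-reflexive product))
        , constant-< {fromℤ y * fromℤ z} {2^ (suc m)} (λ _ → sym product) (λ _ → refl)
            (nat-< (ℕ.^-monoʳ-< 2 ℕ.≤-refl (ℕ.n<1+n m)))
        where
        product : 𝟚^ m ≡ 𝟚^ b ℚ.* 𝟚^ a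
        product = trans (cong nat (ℕ.^-distribˡ-+-* 2 b a)) (nat-* (2 ℕ.^ b) (2 ℕ.^ a))

      size-d : size d ℚ.≤ size (φ 0) ℚ.+ nat 2
      size-d = subst₂ (λ u v → u ℚ.≤ v ℚ.+ nat 2) (∣value∣ d) (∣value∣ (φ 0))
        (ℚ.≤-trans (∣q∣≤∣p∣+∣p-q∣ (value𝔻 (φ 0)) (value𝔻 d)) (ℚ.+-monoʳ-≤ ℚ.∣ value𝔻 (φ 0) ∣
          (ℚ.≤-trans (≈-fromℚ⁻¹ {value𝔻 (φ 0)} {value𝔻 d} {1ℚ ℚ.+ ½^ (T m)}
              (≈-trans {from𝔻 (φ 0)} {x} {from𝔻 d} {1ℚ} {½^ (T m)} (≈-sym {x} {from𝔻 (φ 0)} (near (cf 0)))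
              (near (cf (T m)))))
            (ℚ.+-monoʳ-≤ 1ℚ (½^≤1 (T m))))))

      4size<z : nat 4 ℚ.* size d ℚ.< 𝟚^ a
      4size<z = ℚ.<-≤-trans (ℚ.*-monoʳ-<-pos (nat 4) (ℚ.≤-<-trans size-d (ℚ.+-monoˡ-< (nat 2) (size<𝟚^ (φ 0)))))
        (ℚ.≤-trans (ℚ.≤-reflexive (trans (cong (nat 4 ℚ.*_) (sym (nat-+ P 2))) (sym (nat-* 4 (P ℕ.+ 2)))))
            (nat-≤ {4 ℕ.* (P ℕ.+ 2)} {2 ℕ.^ a} fits))
        where
        P : ℕ
        P = 2 ℕ.^ magnitude (φ 0)
        fits : 4 ℕ.* (P ℕ.+ 2) ℕ.≤ 2 ℕ.^ (4 ℕ.+ magnitude (φ 0))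
        fits = ℕ.≤-trans (ℕ.*-monoʳ-≤ 4 (ℕ.≤-trans (ℕ.+-monoʳ-≤ P (ℕ.*-monoʳ-≤ 2 (ℕ.m^n>0 2 (magnitude (φ 0)))))
            (ℕ.m≤m+n _ P)))
          (ℕ.≤-reflexive (rearrange P))
          where
          rearrange : ∀ P → 4 ℕ.* (P ℕ.+ 2 ℕ.* P ℕ.+ P) ≡ 2 ℕ.* (2 ℕ.* (2 ℕ.* (2 ℕ.* P)))
          rearrange = solve-∀

      small : ∀ p → ℚ.∣ p ∣ ℚ.≤ size d ℚ.* 𝟚^ (T m) → nat 4 ℚ.* ℚ.∣ p ∣ ℚ.* ½^ (T m) ℚ.< 𝟚^ a
      small p h = ℚ.≤-<-trans (ℚ.≤-trans (ℚ.≤-reflexive (ℚ.*-assoc (nat 4) ℚ.∣ p ∣ (½^ (T m))))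
        (ℚ.*-monoˡ-≤-nonNeg (nat 4) (ℚ.≤-trans (ℚ.*-monoʳ-≤-nonNeg (½^ (T m)) {{½^-nonNeg (T m)}} h)
          (ℚ.≤-reflexive (trans (ℚ.*-assoc (size d) (𝟚^ (T m)) (½^ (T m)))
              (trans (cong (size d ℚ.*_) (𝟚^*½^ (T m))) (ℚ.*-identityʳ (size d)))))))) 4size<z

      -- Smoothness compares points at distance at most 1, but from the truncation `X` to x 2^(T m)
      -- the distance may reach 2. The scaled answer before truncation is put in between.
      q : ℚ
      q = value𝔻 d ℚ.* 𝟚^ (T m)

      condition₁ : fromℤ (+ 4) * ∣ fromℤ X ∣ * 2^- (T m) < fromℤ z
      condition₁ = constant-< {fromℤ (+ 4) * ∣ fromℤ X ∣ * 2^- (T m)} {fromℤ z} (λ _ → refl) (λ _ → refl)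
        (small (ι X) (ℚ.≤-trans (ℚ.≤-reflexive (trans (cong ℚ.∣_∣ (ι-signed (negative d) (truncated d (T m))))
            (∣signedℚ∣ (negative d) (0≤nat (truncated d (T m)))))) (truncated≤ d (T m))))

      condition₂ : fromℤ (+ 4) * ∣ fromℚ q ∣ * 2^- (T m) < fromℤ z
      condition₂ = constant-< {fromℤ (+ 4) * ∣ fromℚ q ∣ * 2^- (T m)} {fromℤ z} (λ _ → refl) (λ _ → refl)
        (small q (ℚ.≤-reflexive (trans (ℚ.∣p*q∣≡∣p∣*∣q∣ (value𝔻 d) (𝟚^ (T m)))
            (cong₂ ℚ._*_ (∣value∣ d) (ℚ.0≤p⇒∣p∣≡p (0≤nat (2 ℕ.^ T m)))))))

      1≤y : fromℤ (+ 1) ≤ fromℤ y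
      1≤y = holds (fromℚ-≼ {nat 1} {𝟚^ b} (nat-≤ {1} {2 ℕ.^ b} (ℕ.m^n>0 2 b)))

      1≤z : fromℤ (+ 1) ≤ fromℤ z
      1≤z = holds (fromℚ-≼ {nat 1} {𝟚^ a} (nat-≤ {1} {2 ℕ.^ a} (ℕ.m^n>0 2 a)))

      near₁ : ∣ fromℤ X - fromℚ q ∣ ≤ fromℤ (+ 1)
      near₁ = close (≈-fromℚ {ι X} {q} {1ℚ} (truncated-close d (T m)))

      near₂ : ∣ fromℚ q - x * 2^ (T m) ∣ ≤ fromℤ (+ 1)
      near₂ = close (generic (fromℚ (𝟚^ (T m)) * x) (fromℚ (𝟚^ (T m)) * from𝔻 d) (x * 2^ (T m))
        (≈-scale {x} {from𝔻 d} {½^ (T m)} (𝟚^ (T m)) (0≤nat (2 ℕ.^ T m)) (near (cf (T m))))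
        (≅-pointwise {fromℚ (𝟚^ (T m)) * x} {x * 2^ (T m)} (λ n → ℚ.*-comm (𝟚^ (T m)) (seq x n)))
        (≅-pointwise {fromℚ (𝟚^ (T m)) * from𝔻 d} {fromℚ q} (λ n → ℚ.*-comm (𝟚^ (T m)) (value𝔻 d))))
        where
        generic : ∀ u v w → u ≈[ 𝟚^ (T m) ℚ.* ½^ (T m) ] v → u ≅ w → v ≅ fromℚ q → fromℚ q ≈[ 1ℚ ] w
        generic u v w h u≅w v≅q = ≈-sym {w} {fromℚ q} (≈-respˡ {u} {w} {fromℚ q} {1ℚ} u≅w
            (≈-respʳ {u} {v} {fromℚ q} {1ℚ} v≅q
          (≈-weaken {u} {v} {𝟚^ (T m) ℚ.* ½^ (T m)} {1ℚ} (ℚ.≤-reflexive (𝟚^*½^ (T m))) h)))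

      back : (f ⟨$⟩ (x * 2^ (T m) * 2^- (T m))) ≅ (f ⟨$⟩ x)
      back = same (Func.cong f {x * 2^ (T m) * 2^- (T m)} {x}
          (equal (≅-pointwise {x * 2^ (T m) * 2^- (T m)} {x} (λ n →
        trans (ℚ.*-assoc (seq x n) (𝟚^ (T m)) (½^ (T m)))
            (trans (cong (seq x n ℚ.*_) (𝟚^*½^ (T m))) (ℚ.*-identityʳ (seq x n)))))))

      estimate : ∀ H → ∣ fromℤ H - (g ⟨$⟩ (fromℤ X ∷ fromℤ y ∷ fromℤ z ∷ [])) ∣ ≤ fromℤ (+ 1) →
        fromℚ (ι H ℚ.* ½^ b) ≈[ ½^ b ℚ.* (1ℚ ℚ.+ nat 2 ℚ.+ ι S ℚ.+ ι S) ] (f ⟨$⟩ x)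
      estimate H h = combine {g ⟨$⟩ (fromℤ X ∷ fromℤ y ∷ fromℤ z ∷ [])} {f ⟨$⟩ (fromℤ X * 2^- (T m))}
          {f ⟨$⟩ (fromℚ q * 2^- (T m))} {f ⟨$⟩ (x * 2^ (T m) * 2^- (T m))} {f ⟨$⟩ x} H b (ι S)
        (near h)
        (near (defines X y z (ℤ.+≤+ (ℕ.m^n>0 2 b)) (ℤ.+≤+ (ℕ.m^n>0 2 a)) m logarithm condition₁))
        (le (smooth (fromℤ X) (fromℚ q) (fromℤ y) (fromℤ z) 1≤y 1≤z m logarithm condition₁ near₁))
        (le (smooth (fromℚ q) (x * 2^ (T m)) (fromℤ y) (fromℤ z) 1≤y 1≤z m logarithm condition₂ near₂))
        back

  n<2^n : ∀ n → n ℕ.< 2 ℕ.^ n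
  n<2^n zero    = ℕ.s≤s ℕ.z≤n
  n<2^n (suc n) = ℕ.≤-trans (ℕ.+-mono-≤ (ℕ.m^n>0 2 n) (n<2^n n))
      (ℕ.≤-reflexive (cong (2 ℕ.^ n ℕ.+_) (sym (ℕ.+-identityʳ (2 ℕ.^ n)))))

  -- 2^c absorbs the constant 3 + 2S.
  margin : ℤ → ℕ
  margin S = 3 ℕ.+ (ℤ.∣ S ∣ ℕ.+ ℤ.∣ S ∣)

  margin-enough : ∀ S n → ½^ (margin S ℕ.+ n) ℚ.* (1ℚ ℚ.+ nat 2 ℚ.+ ι S ℚ.+ ι S) ℚ.≤ ½^ n
  margin-enough S n = ℚ.≤-trans (ℚ.*-monoˡ-≤-nonNeg (½^ (c ℕ.+ n)) {{½^-nonNeg (c ℕ.+ n)}} sum≤)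
    (ℚ.≤-reflexive (trans (cong (ℚ._* 𝟚^ c) (trans (½^-+ c n) (ℚ.*-comm (½^ c) (½^ n))))
        (trans (ℚ.*-assoc (½^ n) (½^ c) (𝟚^ c)) (trans (cong (½^ n ℚ.*_) (½^*𝟚^ c)) (ℚ.*-identityʳ (½^ n))))))
    where
    c s : ℕ
    c = margin S
    s = ℤ.∣ S ∣
    S≤ : ι S ℚ.≤ nat s
    S≤ = ι-≤ {S} {+ s} (i≤+∣i∣ S)
      where
      i≤+∣i∣ : ∀ i → i ℤ.≤ + ℤ.∣ i ∣
      i≤+∣i∣ (+ _)        = ℤ.≤-refl
      i≤+∣i∣ ℤ.-[1+ _ ]   = ℤ.-≤+
    sum≤ : 1ℚ ℚ.+ nat 2 ℚ.+ ι S ℚ.+ ι S ℚ.≤ 𝟚^ c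
    sum≤ = ℚ.≤-trans (ℚ.+-mono-≤ (ℚ.+-monoʳ-≤ (1ℚ ℚ.+ nat 2) S≤) S≤)
      (ℚ.≤-trans (ℚ.≤-reflexive (trans (ℚ.+-assoc (nat 3) (nat s) (nat s))
          (trans (cong (λ v → nat 3 ℚ.+ v) (sym (nat-+ s s))) (sym (nat-+ 3 (s ℕ.+ s))))))
        (nat-≤ {c} {2 ℕ.^ c} (ℕ.<⇒≤ (n<2^n c))))

-- Running time of the machine for f.

module ComputabilityProof where

  open import Defs
  open BinaryDigits
  open Subroutines using (_>>_; powerCost; signed)
  open Words using (wholeBits; negative; wordℤ-2^)
  open Simulating using (finite-Extra)
  open RealAlgorithm
  open IntegerAlgorithm using (shown; length-show; length-wordℤ; shown≤word)
  open DyadicValues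
  open RealDistance
  open Approximation
  open Polynomials
  open CostPolynomials
  open Halting using (halts-later; halted-output)
  open TapeGrowth
  open DefinabilityProof using (>>≤; digits-length-mono)
  open ErrorEstimate
  open import Data.Bool.Base using (true; false)
  open import Data.Fin.Base using (zero; suc)
  open import Data.Fin.Patterns
  open import Data.Integer.Base as ℤ using (ℤ; +_; -[1+_])
  open import Data.List.Base as List using ([]; _∷_; length)
  open import Data.List.Properties using (length-map; length-++; length-replicate)
  open import Data.Nat.Base as ℕ using (ℕ; zero; suc)
  import Data.Nat.Properties as ℕ
  open import Data.Product.Base using (∃-syntax; _×_; _,_; proj₁; proj₂)
  open import Data.Rational.Base as ℚ using (ℚ; 1ℚ)
  import Data.Rational.Properties as ℚ
  open import Data.Unit.Base using (tt)
  open import Data.Vec.Base as Vec using (Vec; []; _∷_; lookup)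
  open import Data.Vec.Relation.Binary.Pointwise.Inductive using ([]; _∷_)
  open import Function.Base using (_∘_)
  open import Relation.Binary.PropositionalEquality using (_≡_; refl; sym; trans; cong; cong₂; subst)

  wordℤ-length : ∀ i → length (wordℤ i) ℕ.≤ 1 ℕ.+ shown i
  wordℤ-length i = ℕ.≤-trans (ℕ.≤-reflexive (length-wordℤ i)) (ℕ.+-monoˡ-≤ (shown i) (sign-length i))
    where
    sign-length : ∀ i → length (sign i) ℕ.≤ 1
    sign-length (+ _)    = ℕ.z≤n
    sign-length -[1+ _ ] = ℕ.≤-refl

  ∣signed∣ : ∀ g n → ℤ.∣ signed g n ∣ ≡ n
  ∣signed∣ false n       = refl
  ∣signed∣ true  zero    = refl
  ∣signed∣ true  (suc n) = refl

  truncated-length : ∀ d r → length (digits (truncated d r)) ℕ.≤ magnitude d ℕ.+ r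
  truncated-length d r = digits-length _ _ (nat-<⁻¹ (ℚ.≤-<-trans (truncated≤ d r)
    (subst (size d ℚ.* 𝟚^ r ℚ.<_) (sym (trans (cong nat (ℕ.^-distribˡ-+-* 2 (magnitude d) r))
        (nat-* (2 ℕ.^ magnitude d) (2 ℕ.^ r))))
      (ℚ.*-monoˡ-<-pos (𝟚^ r) {{ℚ.positive (nat-< (ℕ.m^n>0 2 r))}} (size<𝟚^ d)))))

  module Computation (M : Machine plain) (h : Vec ℤ 3 → ℤ)
    (outputs : ∀ is → Outputs {plain} M _ (wordsℤ is) (wordℤ (h is)))
    (p : Poly 3) (halting : ∀ (is : Vec ℤ 3) → HaltsWithin M _ (wordsℤ is) (⟦ p ⟧ (Vec.map (length ∘ wordℤ) is)))
    (k c : ℕ) where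
    open Machine M using (work)

    c₂ e₂ : ℕ
    c₂ = proj₁ (poly-bound p)
    e₂ = proj₁ (proj₂ (poly-bound p))

    open RealProgram M k c c₂ e₂
    open StackPrograms.Compile finite-Extra program using (machine; compiled) public

    module _ (φ : ℕ → 𝔻) (n : ℕ) where

      X : ℤ
      X = signed (negative (d₁ φ n)) (truncated (d₁ φ n) (E φ n))

      N-split : N φ n ≡ length (wordℤ X) ℕ.+ suc (suc (b φ n) ℕ.+ suc (suc (a φ n) ℕ.+ 1))
      N-split = trans (length-map StackPrograms.gl (input φ n))
          (trans (length-++ (wordℤ X)) (cong (λ l → length (wordℤ X) ℕ.+ suc l)
        (trans (length-++ (wordℤ (+ (2 ℕ.^ b φ n)))) (cong₂ (λ u v → u ℕ.+ suc v) (power-length (b φ n))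
          (trans (length-++ (wordℤ (+ (2 ℕ.^ a φ n)))) (cong (ℕ._+ 1) (power-length (a φ n))))))))
        where
        power-length : ∀ j → length (wordℤ (+ (2 ℕ.^ j))) ≡ suc j
        power-length j = trans (cong length (wordℤ-2^ j)) (cong suc (length-replicate j))

      word≤N : ∀ i → lookup (Vec.map (length ∘ wordℤ) (args φ n)) i ℕ.≤ N φ n
      word≤N i = ℕ.≤-trans (go i) (ℕ.≤-reflexive (sym
          (trans (length-map StackPrograms.gl (input φ n))
          (trans (length-++ (wordℤ X)) (cong (λ l → length (wordℤ X) ℕ.+ suc l)
        (trans (length-++ (wordℤ (+ (2 ℕ.^ b φ n)))) (cong (λ l → length (wordℤ (+ (2 ℕ.^ b φ n))) ℕ.+ suc l)
            (length-++ (wordℤ (+ (2 ℕ.^ a φ n)))))))))))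
        where
        lx ly lz : ℕ
        lx = length (wordℤ X)
        ly = length (wordℤ (+ (2 ℕ.^ b φ n)))
        lz = length (wordℤ (+ (2 ℕ.^ a φ n)))
        go : ∀ i → lookup (lx ∷ ly ∷ lz ∷ []) i ℕ.≤ lx ℕ.+ suc (ly ℕ.+ suc (lz ℕ.+ 1))
        go zero             = ℕ.m≤m+n _ _
        go (suc zero)       = ℕ.≤-trans (ℕ.m≤m+n _ _) (ℕ.≤-trans (ℕ.n≤1+n _) (ℕ.m≤n+m _ lx))
        go (suc (suc zero)) = ℕ.≤-trans (ℕ.m≤m+n _ _) (ℕ.≤-trans (ℕ.n≤1+n _)
            (ℕ.≤-trans (ℕ.m≤n+m _ ly) (ℕ.≤-trans (ℕ.n≤1+n _) (ℕ.m≤n+m _ lx))))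

      halted : HaltsWithin M tt (input φ n) (clock φ n)
      halted = halts-later M tt (proj₂ (proj₂ (proj₂ (poly-bound p))) (Vec.map (length ∘ wordℤ) (args φ n)) (N φ n)
          word≤N) (halting (args φ n))

      result : ℤ
      result = h (args φ n)

      result-output : output M tt (final φ n) ≡ wordℤ result
      result-output = halted-output M tt {w = input φ n} {t = clock φ n} (outputs (args φ n)) halted

      result-length : shown result ℕ.≤ suc (clock φ n)
      result-length = ℕ.≤-trans (shown≤word result) (subst (λ w → length w ℕ.≤ suc (clock φ n)) result-output
          (TapeSizes.output-length M tt (clock φ n) (input φ n)))

      quantities : Vec ℕ 15
      quantities = length (wholeBits (d₀ φ n)) ∷ magnitude (d₀ φ n) ∷ n ∷ a φ n ∷ b φ n ∷ powerCost k (m φ n) ∷ E φ n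
          ∷ length (wholeBits (d₁ φ n))
        ∷ length (digits (truncated (d₁ φ n) (E φ n))) ∷ m φ n ∷ N φ n ∷ powerCost e₂ (c₂ ℕ.+ N φ n) ∷ clock φ n ∷
            shown result ∷ length (digits (ℤ.∣ result ∣ >> b φ n)) ∷ []

    prepare₁ᵖ prepare₂ᵖ simulateᵖ finishᵖ totalᵖ : Poly 15
    prepare₁ᵖ = (con 4 :+ (con 3 :+ (lin 5 (var 0F) :+ (lin 4 (var 1F) :+ con 8)))) :+
        (lin 4 (var 2F) :+ (con (c ℕ.* 2) :+ (measureᵖ (var 3F)
      :+ (measureᵖ (var 4F) :+ (var 5F :+ (con 2 :+ measureᵖ (var 6F)))))))
    prepare₂ᵖ = (con 4 :+ (lin 5 (var 7F) :+ (con 1 :+ lin 7 (var 6F)))) :+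
        ((con 2 :+ (measureᵖ (var 3F) :+ (con 2 :+ (con 2 :+
        (measureᵖ (var 4F) :+ (con 2 :+ (con 2 :+ (con 7 :+ (var 8F :* con 4)))))))))
      :+ ((lin 2 (var 9F) :+ (measureᵖ (var (suc 9F)) :+
          (con (c₂ ℕ.* 2) :+ (var (suc (suc 9F)) :+ lin 4 (var (suc (suc (suc 9F)))))))) :+
          (con 2 :+ (con 2 :+ con ((2 ℕ.+ work) ℕ.* 2)))))
    simulateᵖ = con 1 :+ (var (suc (suc (suc 9F))) :*
        (con 2 :+ stepᵖ (3 ℕ.+ work) (con 1) (con 2 :+ var (suc (suc (suc 9F))))))
    finishᵖ = con 4 :+ (lin 5 (var (suc (suc (suc (suc 9F))))) :+
        (formatᵖ (var 4F) (var (suc (suc (suc (suc (suc 9F)))))) :+ con 5))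
    totalᵖ = con 1 :+ (prepare₁ᵖ :+ (con 1 :+ (prepare₂ᵖ :+ (simulateᵖ :+ finishᵖ))))

    total-cost : ∀ φ n → programCost φ n (result φ n) ≡ ⟦ totalᵖ ⟧ (quantities φ n)
    total-cost φ n = refl

    aᵖ bᵖ mᵖ Eᵖ xᵖ Nᵖ clockᵖ : Poly 2
    -- The first answer is at most 2^l + 1 in size, so its whole part has at most l + 2 bits, and
    -- `a` adds 4.
    aᵖ = con 6 :+ var 0F
    bᵖ = con c :+ var 1F
    mᵖ = bᵖ :+ aᵖ
    Eᵖ = mᵖ :^ k
    xᵖ = (con 2 :+ var 0F) :+ Eᵖ
    -- The first 2 is for a sign and for the digit of a possible zero; then follow the commas and
    -- the b + 1 and a + 1 digits of 2^b and 2^a.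
    Nᵖ = (con 2 :+ xᵖ) :+ (con 1 :+ ((con 1 :+ bᵖ) :+ (con 1 :+ ((con 1 :+ aᵖ) :+ con 1))))
    clockᵖ = (con c₂ :+ Nᵖ) :^ e₂

    bounds : Vec (Poly 2) 15
    bounds = (con 3 :+ var 0F) ∷ (con 2 :+ var 0F) ∷ var 1F ∷ aᵖ ∷ bᵖ ∷ powerᵖ k mᵖ ∷ Eᵖ ∷ (con 3 :+ var 0F) ∷ xᵖ ∷ mᵖ
        ∷ Nᵖ
      ∷ powerᵖ e₂ (con c₂ :+ Nᵖ) ∷ clockᵖ ∷ (con 1 :+ clockᵖ) ∷ (con 1 :+ clockᵖ) ∷ []

    -- If the time bound unfolded, comparing types would run the machine symbolically.
    abstract
      timeᵖ : Poly 2
      timeᵖ = compose totalᵖ bounds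

    module _ {x : ℝ} (φ : ℕ → 𝔻) (cf : CF x φ) (n l : ℕ) (bounded : ∣ x ∣ ≼ 2^ l) where

      -- Every answer has error at most 1, so a bound on x bounds all answers alike; this makes the
      -- time bound uniform in the oracle.
      sizes : ∀ i → size (φ i) ℚ.≤ 𝟚^ l ℚ.+ 1ℚ
      sizes i = size≤ {x} (φ i) l {½^ i} bounded (½^≤1 i) (near (cf i))

      a≤ : a φ n ℕ.≤ 6 ℕ.+ l
      a≤ = ℕ.+-monoʳ-≤ 4 (magnitude≤ (φ 0) l (sizes 0))

      m≤ : m φ n ℕ.≤ ⟦ mᵖ ⟧ (l ∷ n ∷ [])
      m≤ = ℕ.+-monoʳ-≤ (b φ n) a≤

      E≤ : E φ n ℕ.≤ ⟦ Eᵖ ⟧ (l ∷ n ∷ [])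
      E≤ = ℕ.≤-trans (ℕ.^-monoˡ-≤ k m≤) (ℕ.≤-reflexive (sym (eval-^ mᵖ k (l ∷ n ∷ []))))

      x≤ : length (digits (truncated (d₁ φ n) (E φ n))) ℕ.≤ ⟦ xᵖ ⟧ (l ∷ n ∷ [])
      x≤ = ℕ.≤-trans (truncated-length (d₁ φ n) (E φ n)) (ℕ.+-mono-≤ (magnitude≤ (d₁ φ n) l (sizes (E φ n))) E≤)

      N≤ : N φ n ℕ.≤ ⟦ Nᵖ ⟧ (l ∷ n ∷ [])
      N≤ = ℕ.≤-trans (ℕ.≤-reflexive (N-split φ n)) (ℕ.+-mono-≤
        (ℕ.≤-trans (wordℤ-length (X φ n)) (ℕ.s≤s (ℕ.≤-trans (length-show≤ (digits ℤ.∣ X φ n ∣))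
            (ℕ.s≤s (ℕ.≤-trans (ℕ.≤-reflexive (cong (length ∘ digits)
            (∣signed∣ (negative (d₁ φ n)) (truncated (d₁ φ n) (E φ n))))) x≤)))))
        (ℕ.s≤s (ℕ.s≤s (ℕ.+-monoʳ-≤ (b φ n) (ℕ.s≤s (ℕ.s≤s (ℕ.+-monoˡ-≤ 1 a≤)))))))

      clock≤ : clock φ n ℕ.≤ ⟦ clockᵖ ⟧ (l ∷ n ∷ [])
      clock≤ = ℕ.≤-trans (ℕ.^-monoˡ-≤ e₂ (ℕ.+-monoʳ-≤ c₂ N≤))
          (ℕ.≤-reflexive (sym (eval-^ (con c₂ :+ Nᵖ) e₂ (l ∷ n ∷ []))))

      abstract
        cost-bound : programCost φ n (result φ n) ℕ.≤ ⟦ timeᵖ ⟧ (l ∷ n ∷ [])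
        cost-bound = ℕ.≤-trans (ℕ.≤-reflexive (total-cost φ n)) (≤-compose totalᵖ bounds (l ∷ n ∷ []) {quantities φ n}
          ( wholeBits≤ (φ 0) l (sizes 0) ∷ magnitude≤ (φ 0) l (sizes 0) ∷ ℕ.≤-refl ∷ a≤ ∷ ℕ.≤-refl
          ∷ ℕ.≤-trans (powerCost-mono k m≤) (ℕ.≤-reflexive (sym (eval-power k mᵖ (l ∷ n ∷ [])))) ∷ E≤ ∷ wholeBits≤
              (d₁ φ n) l (sizes (E φ n)) ∷ x≤ ∷ m≤ ∷ N≤
          ∷ ℕ.≤-trans (powerCost-mono e₂ (ℕ.+-monoʳ-≤ c₂ N≤))
              (ℕ.≤-reflexive (sym (eval-power e₂ (con c₂ :+ Nᵖ) (l ∷ n ∷ [])))) ∷ clock≤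
          ∷ ℕ.≤-trans (result-length φ n) (ℕ.s≤s clock≤)
          ∷ ℕ.≤-trans (digits-length-mono (>>≤ ℤ.∣ result φ n ∣ (b φ n)))
              (ℕ.≤-trans (length-show (digits ℤ.∣ result φ n ∣)) (ℕ.≤-trans (result-length φ n) (ℕ.s≤s clock≤))) ∷
              []))

    compiled-run : ∀ φ n → (∀ t → programCost φ n (result φ n) ℕ.≤ t → HaltsWithin machine (word𝔻 ∘ φ) (unary n) t)
      × Outputs machine (word𝔻 ∘ φ) (unary n) (word𝔻 (result φ n /2^ b φ n))
    compiled-run φ n = let s , r , e = program-run φ n (result φ n) (result-output φ n)
                           halts , outs = compiled (word𝔻 ∘ φ) r
      in halts , subst (Outputs machine (word𝔻 ∘ φ) (unary n)) (trans (cong StackPrograms.prefix e) (prefix-word (word𝔻 (result φ n /2^ b φ n)))) outs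

    runs-in-time : RunsInTime machine timeᵖ
    runs-in-time x φ cf n l (bounded , _) = proj₁ (compiled-run φ n) (⟦ timeᵖ ⟧ (l ∷ n ∷ []))
        (cost-bound {x} φ cf n l (le bounded))

    polytime-computable : ∀ {f} → Computes machine f → PolytimeComputable f
    polytime-computable computes = machine , computes , timeᵖ , runs-in-time

-- The two implications.

module Equivalence where

  open import Defs
  open DyadicValues
  open RealDistance
  open Smoothness
  open DefinabilityProof
  open ErrorEstimate
  open ComputabilityProof
  open RealAlgorithm
  open import Data.Integer.Base as ℤ using (ℤ; +_)
  open import Data.Nat.Base as ℕ using (ℕ)
  open import Data.Product.Base using (∃-syntax; _×_; _,_; proj₂)
  open import Data.Rational.Base as ℚ using (ℚ; 1ℚ)
  open import Data.Vec.Base as Vec using ([]; _∷_)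
  open import Function.Base using (_∘_)
  open import Function.Bundles using (_⟨$⟩_)
  open import Relation.Binary.PropositionalEquality using (_≡_; refl; subst)
  open import Relation.Unary using (Pred)

  -- The exponent is dictated by smoothness; the construction for definability works with any `K`
  -- and is given the same one.
  definable∧smooth : ∀ {ℓ} (C : Pred (ℝ^ 3 →ℝ) ℓ) → PeacefullyApproximates C PolytimeComputableℤ → ∀ f →
      PolytimeComputable f →
    ∃[ k ] 1 ℕ.≤ k × Definable (λ n → n ℕ.^ k) C f × Smooth (λ n → n ℕ.^ k) f
  definable∧smooth C approximates f (M , computes , p , runs) =
    exponent , ℕ.s≤s ℕ.z≤n , Definability.definable f M computes p runs exponent C approximates , smooth
    where open Continuity f M computes p runs

  polytime : ∀ (k : ℕ) (f : ℝ→ℝ) (g : ℝ^ 3 →ℝ) →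
    (∀ (x y z : ℤ) → ℤ.1ℤ ℤ.≤ y → ℤ.1ℤ ℤ.≤ z → ∀ m → IsFloorLog₂ (fromℤ y * fromℤ z) m →
       fromℤ (+ 4) * ∣ fromℤ x ∣ * 2^- (m ℕ.^ k) < fromℤ z →
       ∣ (g ⟨$⟩ (fromℤ x ∷ fromℤ y ∷ fromℤ z ∷ [])) - fromℤ y * (f ⟨$⟩ (fromℤ x * 2^- (m ℕ.^ k))) ∣ ≤ fromℤ (+ 2)) →
    Smooth (λ n → n ℕ.^ k) f → HasPolytimeIntegerApproximation g → PolytimeComputable f
  polytime k f g defines (S , smooth) (h , (M , outputs , p , halting) , h≈g) = polytime-computable {f} computes
    where
    open Computation M h outputs p halting k (margin S)
    module Est = Estimate (λ n → n ℕ.^ k) f g defines S smooth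

    computes : Computes machine f
    computes x φ cf n = H /2^ b , subst (λ i → Outputs machine (word𝔻 ∘ φ) (unary n) (word𝔻 (i /2^ b))) result≡H
        (proj₂ (compiled-run φ n)) ,
      close (≈-weaken {fromℚ (ι H ℚ.* ½^ b)} {f ⟨$⟩ x} {½^ b ℚ.* (1ℚ ℚ.+ nat 2 ℚ.+ ι S ℚ.+ ι S)} {½^ n}
          (margin-enough S n)
        (Est.estimate x φ cf b H (h≈g (Est.X x φ cf b ∷ Est.y x φ cf b ∷ Est.z x φ cf b ∷ []))))
      where
      b : ℕ
      b = margin S ℕ.+ n
      H : ℤ
      H = h (Est.X x φ cf b ∷ Est.y x φ cf b ∷ Est.z x φ cf b ∷ [])
      -- The arguments that the machine writes are definitionally those of the estimate, with `E`
      -- for T m.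
      result≡H : result φ n ≡ H
      result≡H = refl

open import Defs
open import Level using (Level)
open import Data.Nat.Base using (ℕ; _^_) renaming (_≤_ to _≤ℕ_)
open import Data.Product.Base using (∃-syntax; _×_; _,_)
open import Function.Bundles using (_⇔_; mk⇔)
open import Relation.Unary using (Pred)

theorem20 : ∀ {ℓ : Level} (C : Pred (ℝ^ 3 →ℝ) ℓ) →
    PeacefullyApproximates C PolytimeComputableℤ →
    (∀ g → C g → HasPolytimeIntegerApproximation g) →
    (f : ℝ→ℝ) →
    PolytimeComputable f ⇔
      (∃[ k ] 1 ≤ℕ k × Definable (λ n → n ^ k) C f × Smooth (λ n → n ^ k) f)
theorem20 C approximates integer f = mk⇔ (Equivalence.definable∧smooth C approximates f)
  (λ { (k , _ , (g , Cg , _ , defines) , smooth) → Equivalence.polytime k f g defines smooth (integer g Cg) })
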